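{- There is a universal constant $\kappa>0$ such that for all finite sets $\mathcal X,\mathcal Y$, every $f:\mathcal X\times\mathcal Y\to\{0,1\}$, all integers $n,r\ge1$ and every $C>7(r\log r)/\kappa$: if $\mathsf{adv}^r(C,f)<\kappa$, then $$\mathsf{suc}^r\Big(\Big(\frac{\kappa C}{r}-\log r\Big)n,\,f^{n}\Big)<\exp(-\kappa n).$$
   Context: We write $xy$ for $(x,y)$; logs are base 2. $f^n:\mathcal X^n\times\mathcal Y^n\to\{0,1\}^n$ is $f^n(xy)=(f(x_1y_1),\dots,f(x_ny_n))$. A randomized two-party communication protocol $\pi$: Alice receives $x$, Bob receives $y$, they have public and private randomness and alternately send messages (Alice sends the odd-numbered ones, Bob the even-numbered ones); it is an $r$-round protocol if $r$ messages are exchanged. The output $\pi(xy)$ is determined by the transcript together with the public randomness. $\|\pi\|$ is the maximum total number of bits exchanged (public randomness not counted). Define $$\mathsf{adv}^r(C,g)=\sup_{\|\pi\|\le C}\inf_{xy}\mathbb E\big[(-1)^{\pi(xy)+g(xy)}\big]\ (g\text{ Boolean}),\qquad \mathsf{suc}^r(C,g)=\sup_{\|\pi\|\le C}\inf_{xy}\Pr[\pi(xy)=g(xy)],$$ where the suprema are over $r$-round protocols, the infima over all inputs, and expectation/probability is over the randomness of $\pi$. -}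

module Defs where

open import Data.Bool.Base using (Bool; true; false; if_then_else_; _xor_)
open import Data.Fin.Base using (Fin)
open import Data.Integer.Base as ℤ using (+_)
import Data.Integer.Properties as ℤ
open import Data.Nat.Base as ℕ using (ℕ; zero; suc; NonZero)
open import Data.Nat.Logarithm using (⌊log₂_⌋; ⌊log₂⌋-mono-≤; ⌊log₂⌊n/2⌋⌋≡⌊log₂n⌋∸1; ⌊log₂[2^n]⌋≡n)
import Data.Nat.Induction as ℕ
import Data.Nat.Properties as ℕ
open import Data.Product.Base using (Σ-syntax; ∃; _×_; _,_; proj₁; proj₂)
open import Data.Rational.Base as ℚ using (ℚ; 0ℚ; 1ℚ; _+_; _*_; -_; _-_; ∣_∣; _≤_; _<_; _/_; toℚᵘ)
open import Data.Rational.Properties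
open import Data.Rational.Solver using (module +-*-Solver)
import Data.Rational.Unnormalised.Base as ℚᵘ
import Data.Rational.Unnormalised.Properties as ℚᵘ
open import Data.Sum.Base using (inj₁; inj₂)
open import Data.Vec.Base using (Vec; zipWith)
open import Data.Vec.Functional using (foldr)
open import Relation.Binary.Definitions using (DecidableEquality)
open import Relation.Binary.PropositionalEquality
open import Relation.Nullary.Decidable using (does)
open import Relation.Nullary.Negation using (¬_)

open +-*-Solver using (solve; _:+_; _:*_; _:-_; :-_; _:=_; con)

------------------------------------------------------------------------
-- Rational estimates

≤-eq : ∀ {p q r} → p ≤ q → q ≡ r → p ≤ r
≤-eq p refl = p

eq-≤ : ∀ {p q r} → p ≡ q → q ≤ r → p ≤ r
eq-≤ refl p = p

*-monoˡ : ∀ {r p q} → 0ℚ ≤ r → p ≤ q → r * p ≤ r * q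
*-monoˡ {r} 0≤r = *-monoˡ-≤-nonNeg r {{ℚ.nonNegative 0≤r}}

*-monoʳ : ∀ {r p q} → 0ℚ ≤ r → p ≤ q → p * r ≤ q * r
*-monoʳ {r} 0≤r = *-monoʳ-≤-nonNeg r {{ℚ.nonNegative 0≤r}}

0≤* : ∀ {p q} → 0ℚ ≤ p → 0ℚ ≤ q → 0ℚ ≤ p * q
0≤* {p} 0≤p 0≤q = eq-≤ (sym (*-zeroʳ p)) (*-monoˡ 0≤p 0≤q)

*-mono : ∀ {p q r s} → 0ℚ ≤ r → 0ℚ ≤ q → p ≤ q → r ≤ s → p * r ≤ q * s
*-mono 0≤r 0≤q p≤q r≤s = ≤-trans (*-monoʳ 0≤r p≤q) (*-monoˡ 0≤q r≤s)

p≤p+q : ∀ p {q} → 0ℚ ≤ q → p ≤ p + q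
p≤p+q p 0≤q = eq-≤ (sym (+-identityʳ p)) (+-monoʳ-≤ p 0≤q)

p≤q+p : ∀ p {q} → 0ℚ ≤ q → p ≤ q + p
p≤q+p p {q} 0≤q = ≤-eq (p≤p+q p 0≤q) (+-comm p q)

p≤∣p∣ : ∀ p → p ≤ ∣ p ∣
p≤∣p∣ p with ≤-total 0ℚ p
... | inj₁ 0≤p = ≤-reflexive (sym (0≤p⇒∣p∣≡p 0≤p))
... | inj₂ p≤0 = ≤-trans p≤0 (0≤∣p∣ p)

∣∣-swap : ∀ p q → ∣ p - q ∣ ≡ ∣ q - p ∣
∣∣-swap p q = trans (sym (∣-p∣≡∣p∣ (p - q)))
  (cong ∣_∣ (solve 2 (λ p q → :- (p :- q) := q :- p) refl p q))

p≤q+r⇒p-q≤r : ∀ {p q r} → p ≤ q + r → p - q ≤ r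
p≤q+r⇒p-q≤r {p} {q} {r} h = ≤-eq (+-monoˡ-≤ (- q) h)
  (solve 2 (λ q r → q :+ r :- q := r) refl q r)

∣∣-intro : ∀ {p q r} → p ≤ q + r → q ≤ p + r → ∣ p - q ∣ ≤ r
∣∣-intro {p} {q} {r} h₁ h₂ with ∣p∣≡p∨∣p∣≡-p (p - q)
... | inj₁ e = eq-≤ e (p≤q+r⇒p-q≤r h₁)
... | inj₂ e = eq-≤ (trans e (solve 2 (λ p q → :- (p :- q) := q :- p) refl p q))
                 (p≤q+r⇒p-q≤r h₂)

∣∣-triangle : ∀ p q r → ∣ p - r ∣ ≤ ∣ p - q ∣ + ∣ q - r ∣
∣∣-triangle p q r =
  eq-≤ (cong ∣_∣ (solve 3 (λ p q r → p :- r := (p :- q) :+ (q :- r)) refl p q r))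
    (∣p+q∣≤∣p∣+∣q∣ (p - q) (q - r))

+-interchange : ∀ p q r s → (p + q) - (r + s) ≡ (p - r) + (q - s)
+-interchange = solve 4 (λ p q r s → (p :+ q) :- (r :+ s) := (p :- r) :+ (q :- s)) refl

∣∣-sum : ∀ p q r s → ∣ (p + q) - (r + s) ∣ ≤ ∣ p - r ∣ + ∣ q - s ∣
∣∣-sum p q r s = eq-≤ (cong ∣_∣ (+-interchange p q r s)) (∣p+q∣≤∣p∣+∣q∣ (p - r) (q - s))

neg-swap : ∀ p q → (- p) - (- q) ≡ q - p
neg-swap = solve 2 (λ p q → (:- p) :- (:- q) := q :- p) refl

factor : ∀ a b e → a * e + e * b ≡ (a + b) * e
factor = solve 3 (λ a b e → a :* e :+ e :* b := (a :+ b) :* e) refl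

double : ∀ p → p + p ≡ (1ℚ + 1ℚ) * p
double = solve 1 (λ p → p :+ p := (con 1ℚ :+ con 1ℚ) :* p) refl

∣∣-product : ∀ p q r s → ∣ p * q - r * s ∣ ≤ ∣ p ∣ * ∣ q - s ∣ + ∣ p - r ∣ * ∣ s ∣
∣∣-product p q r s = eq-≤
  (cong ∣_∣ (solve 4 (λ p q r s → p :* q :- r :* s := p :* (q :- s) :+ (p :- r) :* s) refl p q r s))
  (≤-eq (∣p+q∣≤∣p∣+∣q∣ (p * (q - s)) ((p - r) * s))
    (cong₂ _+_ (∣p*q∣≡∣p∣*∣q∣ p (q - s)) (∣p*q∣≡∣p∣*∣q∣ (p - r) s)))

frac-≤ : ∀ a b c d → a ℕ.* suc d ℕ.≤ c ℕ.* suc b → + a / suc b ≤ + c / suc d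
frac-≤ a b c d h = toℚᵘ-cancel-≤
  (ℚᵘ.≤-respˡ-≃ (ℚᵘ.≃-sym (toℚᵘ-fromℚᵘ (ℚᵘ.mkℚᵘ (+ a) b)))
  (ℚᵘ.≤-respʳ-≃ (ℚᵘ.≃-sym (toℚᵘ-fromℚᵘ (ℚᵘ.mkℚᵘ (+ c) d)))
  (ℚᵘ.*≤* (subst₂ ℤ._≤_ (ℤ.pos-* a (suc d)) (ℤ.pos-* c (suc b)) (ℤ.+≤+ h)))))

natℚ : ℕ → ℚ
natℚ n = + n / 1

1/suc : ℕ → ℚ
1/suc k = + 1 / suc k

frac-≡ : ∀ a b c d → a ℕ.* suc d ≡ c ℕ.* suc b → + a / suc b ≡ + c / suc d
frac-≡ a b c d e = ≤-antisym (frac-≤ a b c d (ℕ.≤-reflexive e)) (frac-≤ c d a b (ℕ.≤-reflexive (sym e)))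

frac-* : ∀ a b c d → (+ a / suc b) * (+ c / suc d) ≡ + (a ℕ.* c) / suc (d ℕ.+ b ℕ.* suc d)
frac-* a b c d = toℚᵘ-injective
  (ℚᵘ.≃-trans (toℚᵘ-homo-* (+ a / suc b) (+ c / suc d))
  (ℚᵘ.≃-trans (ℚᵘ.*-cong (toℚᵘ-fromℚᵘ (ℚᵘ.mkℚᵘ (+ a) b)) (toℚᵘ-fromℚᵘ (ℚᵘ.mkℚᵘ (+ c) d)))
  (ℚᵘ.≃-trans (ℚᵘ.≃-reflexive (cong (λ z → ℚᵘ.mkℚᵘ z (d ℕ.+ b ℕ.* suc d)) (sym (ℤ.pos-* a c))))
  (ℚᵘ.≃-sym (toℚᵘ-fromℚᵘ (ℚᵘ.mkℚᵘ (+ (a ℕ.* c)) (d ℕ.+ b ℕ.* suc d)))))))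

frac≡* : ∀ a k → + a / suc k ≡ natℚ a * 1/suc k
frac≡* a k = sym (trans (frac-* a 0 1 k)
  (frac-≡ (a ℕ.* 1) (k ℕ.+ 0) a k
    (cong₂ (λ u v → u ℕ.* suc v) (ℕ.*-identityʳ a) (sym (ℕ.+-identityʳ k)))))

natℚ-suc : ∀ a → natℚ (suc a) ≡ 1ℚ + natℚ a
natℚ-suc a = toℚᵘ-injective
  (ℚᵘ.≃-trans (toℚᵘ-fromℚᵘ (ℚᵘ.mkℚᵘ (+ suc a) 0))
  (ℚᵘ.≃-sym (ℚᵘ.≃-trans (toℚᵘ-homo-+ 1ℚ (natℚ a))
  (ℚᵘ.≃-trans (ℚᵘ.+-congʳ (toℚᵘ 1ℚ) (toℚᵘ-fromℚᵘ (ℚᵘ.mkℚᵘ (+ a) 0)))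
  (ℚᵘ.*≡* (cong (λ z → (+ 1 ℤ.+ z) ℤ.* + 1) (ℤ.*-identityʳ (+ a))))))))

suc*1/suc : ∀ k → natℚ (suc k) * 1/suc k ≡ 1ℚ
suc*1/suc k = trans (sym (frac≡* (suc k) k)) (frac-≡ (suc k) k 1 0 (ℕ.*-comm (suc k) 1))

0≤frac : ∀ a k → 0ℚ ≤ + a / suc k
0≤frac a k = frac-≤ 0 0 a k ℕ.z≤n

0≤natℚ : ∀ a → 0ℚ ≤ natℚ a
0≤natℚ a = 0≤frac a 0

archimedean : ∀ p → ∃ λ n → p ≤ natℚ n
archimedean (ℚ.mkℚ (+ a) d-1 c) = a , eq-≤ (sym (↥p/↧p≡p p)) (frac-≤ a d-1 a 0
  (ℕ.*-monoʳ-≤ a (ℕ.s≤s ℕ.z≤n)))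
  where p = ℚ.mkℚ (+ a) d-1 c
archimedean (ℚ.mkℚ (ℤ.-[1+ a ]) d-1 c) = 0 , ℚ.*≤* ℤ.-≤+

1/suc-small : ∀ ε → 0ℚ < ε → ∃ λ N → 1/suc N ≤ ε
1/suc-small ε 0<ε = N , *-cancelˡ-≤-pos (natℚ (suc N)) {{pos}}
    (eq-≤ (suc*1/suc N) (eq-≤ (sym (*-inverseˡ ε)) (*-monoʳ (<⇒≤ 0<ε)
      (≤-trans (proj₂ arch) (eq-≤ refl (≤-eq (p≤q+p (natℚ N) (0≤natℚ 1)) (sym (natℚ-suc N))))))))
  where
  instance
    ε-pos : ℚ.Positive ε
    ε-pos = ℚ.positive 0<ε
    ε-nz : ℚ.NonZero ε
    ε-nz = pos⇒nonZero ε
  arch = archimedean (ℚ.1/ ε)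
  N = proj₁ arch
  pos : ℚ.Positive (natℚ (suc N))
  pos = normalize-pos (suc N) 1

1/suc-mono : ∀ {m n} → m ℕ.≤ n → 1/suc n ≤ 1/suc m
1/suc-mono {m} {n} m≤n = frac-≤ 1 n 1 m (ℕ.*-monoʳ-≤ 1 (ℕ.s≤s m≤n))

------------------------------------------------------------------------
-- Cauchy sequences

Cauchy : (ℕ → ℚ) → Set
Cauchy x = ∀ ε → 0ℚ < ε → ∃ λ N → ∀ m n → N ℕ.≤ m → N ℕ.≤ n → ∣ x m - x n ∣ ≤ ε

cauchy-up-to : ∀ x K → 0ℚ ≤ K →
  (∀ ε → 0ℚ < ε → ∃ λ N → ∀ m n → N ℕ.≤ m → N ℕ.≤ n → ∣ x m - x n ∣ ≤ K * ε) → Cauchy x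
cauchy-up-to x K 0≤K h ε 0<ε = proj₁ (h δ 0<δ) , λ m n N≤m N≤n →
  ≤-trans (proj₂ (h δ 0<δ) m n N≤m N≤n) (≤-eq (*-monoʳ (<⇒≤ 0<δ) K≤K+1) L*δ≡ε)
  where
  L = K + 1ℚ
  K≤K+1 : K ≤ L
  K≤K+1 = p≤p+q K (0≤natℚ 1)
  instance
    L-pos : ℚ.Positive L
    L-pos = ℚ.positive (<-≤-trans (ℚ.*<* (ℤ.+<+ (ℕ.s≤s ℕ.z≤n))) (p≤q+p 1ℚ 0≤K))
    L-nz : ℚ.NonZero L
    L-nz = pos⇒nonZero L
    inv-pos : ℚ.Positive (ℚ.1/ L)
    inv-pos = 1/pos⇒pos L
  δ = ε * ℚ.1/ L
  0<δ : 0ℚ < δ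
  0<δ = positive⁻¹ δ {{pos*pos⇒pos ε {{ℚ.positive 0<ε}} (ℚ.1/ L)}}
  L*δ≡ε : L * δ ≡ ε
  L*δ≡ε = trans (solve 3 (λ l e i → l :* (e :* i) := e :* (l :* i)) refl L ε (ℚ.1/ L))
    (trans (cong (ε *_) (*-inverseʳ L)) (*-identityʳ ε))

-- The bound is a natural number because the tail estimate for exp needs one.
bounded : ∀ x → Cauchy x → ∃ λ B → ∃ λ N → ∀ n → N ℕ.≤ n → ∣ x n ∣ ≤ natℚ B
bounded x c = proj₁ arch , N , λ n N≤n → ≤-trans (step n N≤n) (proj₂ arch)
  where
  c₁ = c 1ℚ (ℚ.*<* (ℤ.+<+ (ℕ.s≤s ℕ.z≤n)))
  N = proj₁ c₁
  arch = archimedean (1ℚ + ∣ x N ∣)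
  step : ∀ n → N ℕ.≤ n → ∣ x n ∣ ≤ 1ℚ + ∣ x N ∣
  step n N≤n = ≤-trans
    (eq-≤ (cong ∣_∣ (solve 2 (λ p q → p := (p :- q) :+ q) refl (x n) (x N)))
      (∣p+q∣≤∣p∣+∣q∣ (x n - x N) (x N)))
    (+-monoˡ-≤ ∣ x N ∣ (proj₂ c₁ n N N≤n ℕ.≤-refl))

abstract
  const-cauchy : ∀ q → Cauchy (λ _ → q)
  const-cauchy q ε 0<ε = 0 , λ _ _ _ _ → eq-≤ (cong ∣_∣ (+-inverseʳ q)) (<⇒≤ 0<ε)

  +-cauchy : ∀ x y → Cauchy x → Cauchy y → Cauchy (λ n → x n + y n)
  +-cauchy x y cx cy = cauchy-up-to (λ n → x n + y n) (1ℚ + 1ℚ) (0≤natℚ 2) λ ε 0<ε →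
    let M , hx = cx ε 0<ε
        N , hy = cy ε 0<ε
    in M ℕ.⊔ N , λ m n h₁ h₂ → ≤-trans
      (∣∣-sum (x m) (y m) (x n) (y n))
      (≤-eq (+-mono-≤ (hx m n (ℕ.m⊔n≤o⇒m≤o M N h₁) (ℕ.m⊔n≤o⇒m≤o M N h₂))
                      (hy m n (ℕ.m⊔n≤o⇒n≤o M N h₁) (ℕ.m⊔n≤o⇒n≤o M N h₂)))
        (double ε))

  neg-cauchy : ∀ x → Cauchy x → Cauchy (λ n → - x n)
  neg-cauchy x cx ε 0<ε =
    let N , h = cx ε 0<ε
    in N , λ m n h₁ h₂ → eq-≤
      (cong ∣_∣ (neg-swap (x m) (x n)))
      (h n m h₂ h₁)

module Product (x y : ℕ → ℚ) (cx : Cauchy x) (cy : Cauchy y) where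
  A = proj₁ (bounded x cx)
  B = proj₁ (bounded y cy)
  M = proj₁ (proj₂ (bounded x cx))
  N = proj₁ (proj₂ (bounded y cy))

  ∣x∣≤A : ∀ n → M ℕ.≤ n → ∣ x n ∣ ≤ natℚ A
  ∣x∣≤A = proj₂ (proj₂ (bounded x cx))

  ∣y∣≤B : ∀ n → N ℕ.≤ n → ∣ y n ∣ ≤ natℚ B
  ∣y∣≤B = proj₂ (proj₂ (bounded y cy))

  z : ℕ → ℚ
  z n = x n * y n

  estimate : ∀ ε m n → 0ℚ < ε → M ℕ.≤ m → N ℕ.≤ n → ∣ x m - x n ∣ ≤ ε → ∣ y m - y n ∣ ≤ ε →
    ∣ z m - z n ∣ ≤ (natℚ A + natℚ B) * ε
  estimate ε m n 0<ε M≤m N≤n hx hy = ≤-trans (∣∣-product (x m) (y m) (x n) (y n))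
    (≤-eq (+-mono-≤
        (*-mono {∣ x m ∣} {natℚ A} {∣ y m - y n ∣} {ε} (0≤∣p∣ (y m - y n)) (0≤natℚ A) (∣x∣≤A m M≤m) hy)
        (*-mono {∣ x m - x n ∣} {ε} {∣ y n ∣} {natℚ B} (0≤∣p∣ (y n)) (<⇒≤ 0<ε) hx (∣y∣≤B n N≤n)))
      (factor (natℚ A) (natℚ B) ε))

  abstract
    z-cauchy : Cauchy z
    z-cauchy = cauchy-up-to z (natℚ A + natℚ B) (≤-trans (0≤natℚ A) (p≤p+q (natℚ A) (0≤natℚ B))) λ ε 0<ε →
      let P , hx = cx ε 0<ε
          Q , hy = cy ε 0<ε
          L = (P ℕ.⊔ Q) ℕ.⊔ (M ℕ.⊔ N)
      in L , λ m n L≤m L≤n →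
        let PQ≤m = ℕ.m⊔n≤o⇒m≤o (P ℕ.⊔ Q) (M ℕ.⊔ N) L≤m
            PQ≤n = ℕ.m⊔n≤o⇒m≤o (P ℕ.⊔ Q) (M ℕ.⊔ N) L≤n
            MN≤m = ℕ.m⊔n≤o⇒n≤o (P ℕ.⊔ Q) (M ℕ.⊔ N) L≤m
            MN≤n = ℕ.m⊔n≤o⇒n≤o (P ℕ.⊔ Q) (M ℕ.⊔ N) L≤n
        in estimate ε m n 0<ε (ℕ.m⊔n≤o⇒m≤o M N MN≤m) (ℕ.m⊔n≤o⇒n≤o M N MN≤n)
             (hx m n (ℕ.m⊔n≤o⇒m≤o P Q PQ≤m) (ℕ.m⊔n≤o⇒m≤o P Q PQ≤n))
             (hy m n (ℕ.m⊔n≤o⇒n≤o P Q PQ≤m) (ℕ.m⊔n≤o⇒n≤o P Q PQ≤n))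

------------------------------------------------------------------------
-- Real numbers

record ℝ : Set where
  constructor mkℝ
  field
    seq    : ℕ → ℚ
    cauchy : Cauchy seq

open ℝ public

infix 4 _<ℝ_ _≤ℝ_ _≃ℝ_
infixl 6 _+ℝ_ _-ℝ_
infixl 7 _*ℝ_
infix 8 -ℝ_

_<ℝ_ : ℝ → ℝ → Set
x <ℝ y = Σ[ ε ∈ ℚ ] 0ℚ < ε × Σ[ N ∈ ℕ ] ∀ n → N ℕ.≤ n → seq x n + ε ≤ seq y n

_≤ℝ_ : ℝ → ℝ → Set
x ≤ℝ y = ¬ (y <ℝ x)

_≃ℝ_ : ℝ → ℝ → Set
x ≃ℝ y = x ≤ℝ y × y ≤ℝ x

fromℚ : ℚ → ℝ
fromℚ q = mkℝ (λ _ → q) (const-cauchy q)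

0ℝ 1ℝ : ℝ
0ℝ = fromℚ 0ℚ
1ℝ = fromℚ 1ℚ

fromℕ : ℕ → ℝ
fromℕ n = fromℚ (natℚ n)

_+ℝ_ : ℝ → ℝ → ℝ
x +ℝ y = mkℝ (λ n → seq x n + seq y n) (+-cauchy (seq x) (seq y) (cauchy x) (cauchy y))

-ℝ_ : ℝ → ℝ
-ℝ x = mkℝ (λ n → - seq x n) (neg-cauchy (seq x) (cauchy x))

_-ℝ_ : ℝ → ℝ → ℝ
x -ℝ y = x +ℝ -ℝ y

_*ℝ_ : ℝ → ℝ → ℝ
x *ℝ y = mkℝ (λ n → seq x n * seq y n) (Product.z-cauchy (seq x) (seq y) (cauchy x) (cauchy y))

------------------------------------------------------------------------
-- The exponential function

expTerm : ℕ → ℚ → ℚ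
expTerm zero    q = 1ℚ
expTerm (suc k) q = expTerm k q * q * 1/suc k

expSum : ℕ → ℚ → ℚ
expSum zero    q = expTerm zero q
expSum (suc n) q = expSum n q + expTerm (suc n) q

0≤1/suc : ∀ k → 0ℚ ≤ 1/suc k
0≤1/suc k = 0≤frac 1 k

0≤expTerm : ∀ k {q} → 0ℚ ≤ q → 0ℚ ≤ expTerm k q
0≤expTerm zero    0≤q = 0≤natℚ 1
0≤expTerm (suc k) 0≤q = 0≤* (0≤* (0≤expTerm k 0≤q) 0≤q) (0≤1/suc k)

0≤expSum : ∀ k {q} → 0ℚ ≤ q → 0ℚ ≤ expSum k q
0≤expSum zero    0≤q = 0≤natℚ 1
0≤expSum (suc k) 0≤q = ≤-trans (0≤expSum k 0≤q) (p≤p+q _ (0≤expTerm (suc k) 0≤q))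

∣*1/suc∣ : ∀ p k → ∣ p * 1/suc k ∣ ≡ ∣ p ∣ * 1/suc k
∣*1/suc∣ p k = trans (∣p*q∣≡∣p∣*∣q∣ p (1/suc k)) (cong (∣ p ∣ *_) (0≤p⇒∣p∣≡p (0≤1/suc k)))

∣expTerm∣ : ∀ k {q B} → ∣ q ∣ ≤ B → ∣ expTerm k q ∣ ≤ expTerm k B
∣expTerm∣ zero _ = ≤-refl
∣expTerm∣ (suc k) {q} {B} h = eq-≤
  (trans (∣*1/suc∣ (expTerm k q * q) k) (cong (_* 1/suc k) (∣p*q∣≡∣p∣*∣q∣ (expTerm k q) q)))
  (*-monoʳ (0≤1/suc k) (*-mono (0≤∣p∣ q) (0≤expTerm k (≤-trans (0≤∣p∣ q) h)) (∣expTerm∣ k h) h))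

expTerm-lipschitz : ∀ k {p q B} → ∣ p ∣ ≤ B → ∣ q ∣ ≤ B →
  ∣ expTerm (suc k) p - expTerm (suc k) q ∣ ≤ expTerm k B * ∣ p - q ∣
expTerm-lipschitz zero {p} {q} _ _ = ≤-reflexive (trans
  (cong ∣_∣ (solve 2 (λ p q → con 1ℚ :* p :* con 1ℚ :- con 1ℚ :* q :* con 1ℚ := p :- q) refl p q))
  (sym (*-identityˡ ∣ p - q ∣)))
expTerm-lipschitz (suc k) {p} {q} {B} hp hq = eq-≤
  (trans
    (cong ∣_∣ (solve 5 (λ s p t q i → s :* p :* i :- t :* q :* i := (s :* p :- t :* q) :* i) refl
      S p T q (1/suc (suc k))))
    (∣*1/suc∣ (S * p - T * q) (suc k)))
  (≤-eq (*-monoʳ (0≤1/suc (suc k)) (≤-trans (∣∣-product S p T q)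
      (+-mono-≤
        (*-monoʳ (0≤∣p∣ (p - q)) (∣expTerm∣ (suc k) hp))
        (*-mono (0≤∣p∣ q) (0≤* (0≤expTerm k 0≤B) (0≤∣p∣ (p - q))) (expTerm-lipschitz k hp hq) hq))))
    final)
  where
  S = expTerm (suc k) p
  T = expTerm (suc k) q
  0≤B = ≤-trans (0≤∣p∣ p) hp
  E = expTerm k B
  D = ∣ p - q ∣
  i = 1/suc k
  j = 1/suc (suc k)
  c = natℚ (suc k)
  final : (E * B * i * D + E * D * B) * j ≡ E * B * i * D
  final = begin
    (E * B * i * D + E * D * B) * j
      ≡⟨ cong (λ z → (E * B * i * D + z) * j) (sym (trans (cong (E * D * B *_) (suc*1/suc k)) (*-identityʳ (E * D * B)))) ⟩
    (E * B * i * D + E * D * B * (c * i)) * j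
      ≡⟨ solve 6 (λ e b i d c j →
           (e :* b :* i :* d :+ e :* d :* b :* (c :* i)) :* j
           := e :* b :* i :* d :* ((con 1ℚ :+ c) :* j)) refl E B i D c j ⟩
    E * B * i * D * ((1ℚ + c) * j)
      ≡⟨ cong (λ z → E * B * i * D * (z * j)) (sym (natℚ-suc (suc k))) ⟩
    E * B * i * D * (natℚ (suc (suc k)) * j)
      ≡⟨ cong (E * B * i * D *_) (suc*1/suc (suc k)) ⟩
    E * B * i * D * 1ℚ
      ≡⟨ *-identityʳ (E * B * i * D) ⟩
    E * B * i * D ∎
    where open ≡-Reasoning

expSum-lipschitz : ∀ n {p q B} → ∣ p ∣ ≤ B → ∣ q ∣ ≤ B →
  ∣ expSum n p - expSum n q ∣ ≤ expSum n B * ∣ p - q ∣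
expSum-lipschitz zero {p} {q} _ _ = 0≤* (0≤natℚ 1) (0≤∣p∣ (p - q))
expSum-lipschitz (suc n) {p} {q} {B} hp hq = ≤-trans (go n) (*-monoʳ (0≤∣p∣ (p - q))
  (p≤p+q (expSum n B) (0≤expTerm (suc n) 0≤B)))
  where
  0≤B = ≤-trans (0≤∣p∣ p) hp
  go : ∀ n → ∣ expSum (suc n) p - expSum (suc n) q ∣ ≤ expSum n B * ∣ p - q ∣
  split : ∀ n {u v} → ∣ expSum n p - expSum n q ∣ ≤ u → ∣ expTerm (suc n) p - expTerm (suc n) q ∣ ≤ v →
    ∣ expSum (suc n) p - expSum (suc n) q ∣ ≤ u + v
  split n h₁ h₂ = ≤-trans
    (eq-≤ (cong ∣_∣ (solve 4 (λ a b c d → (a :+ b) :- (c :+ d) := (a :- c) :+ (b :- d)) refl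
        (expSum n p) (expTerm (suc n) p) (expSum n q) (expTerm (suc n) q)))
      (∣p+q∣≤∣p∣+∣q∣ (expSum n p - expSum n q) (expTerm (suc n) p - expTerm (suc n) q)))
    (+-mono-≤ h₁ h₂)
  go zero = ≤-eq (split zero {0ℚ} ≤-refl (expTerm-lipschitz zero hp hq)) (+-identityˡ _)
  go (suc n) = ≤-eq (split (suc n) (go n) (expTerm-lipschitz (suc n) hp hq))
    (sym (*-distribʳ-+ ∣ p - q ∣ (expSum n B) (expTerm (suc n) B)))

-- For k ≥ 2B the sum expSum k B + expTerm k B no longer increases.
module Tail (b : ℕ) where
  B = natℚ b
  K = b ℕ.+ b
  0≤B = 0≤natℚ b

  halving : ∀ k → K ℕ.≤ k → expTerm (suc k) B + expTerm (suc k) B ≤ expTerm k B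
  halving k K≤k = eq-≤ (solve 3 (λ t b i → t :* b :* i :+ t :* b :* i := t :* ((b :+ b) :* i)) refl
      (expTerm k B) B (1/suc k))
    (≤-eq (*-monoˡ (0≤expTerm k 0≤B) ratio) (*-identityʳ _))
    where
    ratio : (B + B) * 1/suc k ≤ 1ℚ
    ratio = eq-≤ (trans (*-distribʳ-+ (1/suc k) B B) (cong₂ _+_ (sym (frac≡* b k)) (sym (frac≡* b k))))
      (≤-eq (+-mono-≤ half half) refl)
      where
      half : + b / suc k ≤ + 1 / 2
      half = frac-≤ b k 1 1 (ℕ.≤-trans
        (ℕ.≤-reflexive (trans (ℕ.*-comm b 2) (cong (b ℕ.+_) (ℕ.+-identityʳ b))))
        (ℕ.≤-trans K≤k (ℕ.≤-trans (ℕ.n≤1+n k) (ℕ.≤-reflexive (sym (ℕ.*-identityˡ (suc k)))))))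

  potential : ∀ k d → K ℕ.≤ k →
    expSum (d ℕ.+ k) B + expTerm (d ℕ.+ k) B ≤ expSum k B + expTerm k B
  potential k zero    _   = ≤-refl
  potential k (suc d) K≤k = ≤-trans
    (eq-≤ (+-assoc (expSum (d ℕ.+ k) B) T T)
      (+-monoʳ-≤ (expSum (d ℕ.+ k) B) (halving (d ℕ.+ k) (ℕ.≤-trans K≤k (ℕ.m≤n+m k d)))))
    (potential k d K≤k)
    where T = expTerm (suc (d ℕ.+ k)) B

  M = expSum K B + expTerm K B

  0≤M : 0ℚ ≤ M
  0≤M = ≤-trans (0≤expSum K 0≤B) (p≤p+q _ (0≤expTerm K 0≤B))

  potential-≤M : ∀ n → K ℕ.≤ n → expSum n B + expTerm n B ≤ M
  potential-≤M n K≤n = subst (λ n → expSum n B + expTerm n B ≤ M) (ℕ.m∸n+n≡m K≤n)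
    (potential K (n ℕ.∸ K) ℕ.≤-refl)

  expSum-≤M : ∀ n → K ℕ.≤ n → expSum n B ≤ M
  expSum-≤M n K≤n = ≤-trans (p≤p+q _ (0≤expTerm n 0≤B)) (potential-≤M n K≤n)

  expTerm-≤ : ∀ n → suc K ℕ.≤ n → expTerm n B ≤ M * B * 1/suc (ℕ.pred n)
  expTerm-≤ (suc n) (ℕ.s≤s K≤n) = *-monoʳ (0≤1/suc n) (*-monoʳ 0≤B
    (≤-trans (p≤q+p _ (0≤expSum n 0≤B)) (potential-≤M n K≤n)))

  expSum-tail : ∀ m n → K ℕ.≤ n → n ℕ.≤ m → expSum m B ≤ expSum n B + expTerm n B
  expSum-tail m n K≤n n≤m = ≤-trans (p≤p+q _ (0≤expTerm m 0≤B))
    (subst (λ m → expSum m B + expTerm m B ≤ expSum n B + expTerm n B) (ℕ.m∸n+n≡m n≤m)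
      (potential n (m ℕ.∸ n) K≤n))

expSum-diff : ∀ n d {q B} → ∣ q ∣ ≤ B →
  ∣ expSum (d ℕ.+ n) q - expSum n q ∣ ≤ expSum (d ℕ.+ n) B - expSum n B
expSum-diff n zero {q} {B} _ = ≤-reflexive
  (trans (cong ∣_∣ (+-inverseʳ (expSum n q))) (sym (+-inverseʳ (expSum n B))))
expSum-diff n (suc d) {q} {B} h = ≤-trans
  (eq-≤ (cong ∣_∣ (solve 3 (λ s t u → (s :+ t) :- u := (s :- u) :+ t) refl
          (expSum (d ℕ.+ n) q) (expTerm (suc d ℕ.+ n) q) (expSum n q)))
    (∣p+q∣≤∣p∣+∣q∣ (expSum (d ℕ.+ n) q - expSum n q) (expTerm (suc d ℕ.+ n) q)))
  (≤-eq (+-mono-≤ (expSum-diff n d h) (∣expTerm∣ (suc d ℕ.+ n) h))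
    (solve 3 (λ s t u → (s :- u) :+ t := (s :+ t) :- u) refl
      (expSum (d ℕ.+ n) B) (expTerm (suc d ℕ.+ n) B) (expSum n B)))

by-order : ∀ (y : ℕ → ℚ) {L e} →
  (∀ m n → L ℕ.≤ n → n ℕ.≤ m → ∣ y m - y n ∣ ≤ e) →
  ∀ m n → L ℕ.≤ m → L ℕ.≤ n → ∣ y m - y n ∣ ≤ e
by-order y h m n L≤m L≤n with ℕ.≤-total n m
... | inj₁ n≤m = h m n L≤n n≤m
... | inj₂ m≤n = eq-≤ (∣∣-swap (y m) (y n)) (h n m L≤m m≤n)

module Exp (x : ℝ) where
  b  = proj₁ (bounded (seq x) (cauchy x))
  N₀ = proj₁ (proj₂ (bounded (seq x) (cauchy x)))
  open Tail b

  y : ℕ → ℚ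
  y n = expSum n (seq x n)

  ∣x∣≤B : ∀ n → N₀ ℕ.≤ n → ∣ seq x n ∣ ≤ B
  ∣x∣≤B = proj₂ (proj₂ (bounded (seq x) (cauchy x)))

  rearrange : ∀ ε → M * B * ε + M * ε ≡ (M * B + M) * ε
  rearrange ε = sym (*-distribʳ-+ ε (M * B) M)

  estimate : ∀ ε N₁ N₂ → 0ℚ < ε →
    (∀ m n → N₁ ℕ.≤ m → N₁ ℕ.≤ n → ∣ seq x m - seq x n ∣ ≤ ε) → 1/suc N₂ ≤ ε →
    ∀ m n → N₀ ℕ.≤ n → N₁ ℕ.≤ n → suc N₂ ℕ.≤ n → suc K ℕ.≤ n → n ℕ.≤ m →
    ∣ y m - y n ∣ ≤ (M * B + M) * ε
  estimate ε N₁ N₂ 0<ε hx hε m n N₀≤n N₁≤n N₂<n K<n n≤m =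
    ≤-trans (∣∣-triangle (y m) (expSum n (seq x m)) (y n))
      (≤-eq (+-mono-≤ tail lip) (rearrange ε))
    where
    K≤n  = ℕ.<⇒≤ K<n
    ∣xm∣ = ∣x∣≤B m (ℕ.≤-trans N₀≤n n≤m)
    ∣xn∣ = ∣x∣≤B n N₀≤n
    tail : ∣ expSum m (seq x m) - expSum n (seq x m) ∣ ≤ M * B * ε
    tail = ≤-trans
      (subst (λ k → ∣ expSum k (seq x m) - expSum n (seq x m) ∣ ≤ expSum k B - expSum n B)
        (ℕ.m∸n+n≡m n≤m) (expSum-diff n (m ℕ.∸ n) ∣xm∣))
      (≤-trans (p≤q+r⇒p-q≤r (expSum-tail m n K≤n n≤m))
      (≤-trans (expTerm-≤ n K<n)
      (*-monoˡ (0≤* 0≤M 0≤B) (≤-trans (1/suc-mono (ℕ.pred-mono-≤ N₂<n)) hε))))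
    lip : ∣ expSum n (seq x m) - expSum n (seq x n) ∣ ≤ M * ε
    lip = ≤-trans (expSum-lipschitz n ∣xm∣ ∣xn∣)
      (*-mono (0≤∣p∣ (seq x m - seq x n)) 0≤M (expSum-≤M n K≤n)
        (hx m n (ℕ.≤-trans N₁≤n n≤m) N₁≤n))

  abstract
    y-cauchy : Cauchy y
    y-cauchy = cauchy-up-to y (M * B + M) (≤-trans 0≤M (p≤q+p M (0≤* 0≤M 0≤B))) λ ε 0<ε →
      let N₁ , hx = cauchy x ε 0<ε
          N₂ , hε = 1/suc-small ε 0<ε
          L = (N₀ ℕ.⊔ N₁) ℕ.⊔ (suc N₂ ℕ.⊔ suc K)
      in L , by-order y λ m n L≤n n≤m →
        let N≤n = ℕ.m⊔n≤o⇒m≤o (N₀ ℕ.⊔ N₁) (suc N₂ ℕ.⊔ suc K) L≤n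
            K≤n = ℕ.m⊔n≤o⇒n≤o (N₀ ℕ.⊔ N₁) (suc N₂ ℕ.⊔ suc K) L≤n
        in estimate ε N₁ N₂ 0<ε hx hε m n
             (ℕ.m⊔n≤o⇒m≤o N₀ N₁ N≤n) (ℕ.m⊔n≤o⇒n≤o N₀ N₁ N≤n)
             (ℕ.m⊔n≤o⇒m≤o (suc N₂) (suc K) K≤n) (ℕ.m⊔n≤o⇒n≤o (suc N₂) (suc K) K≤n) n≤m

exp : ℝ → ℝ
exp x = mkℝ (λ n → expSum n (seq x n)) (Exp.y-cauchy x)

------------------------------------------------------------------------
-- Binary logarithms of positive integers

n<2^[1+⌊log₂n⌋] : ∀ n → n ℕ.< 2 ℕ.^ suc ⌊log₂ n ⌋
n<2^[1+⌊log₂n⌋] n = ℕ.≰⇒> λ h → ℕ.1+n≰n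
  (subst (ℕ._≤ ⌊log₂ n ⌋) (⌊log₂[2^n]⌋≡n (suc ⌊log₂ n ⌋)) (⌊log₂⌋-mono-≤ h))

2^⌊log₂n⌋≤n : ∀ n → .{{NonZero n}} → 2 ℕ.^ ⌊log₂ n ⌋ ℕ.≤ n
2^⌊log₂n⌋≤n n = ℕ.<-rec (λ n → .{{NonZero n}} → 2 ℕ.^ ⌊log₂ n ⌋ ℕ.≤ n) step n
  where
  2*⌊n/2⌋≤n : ∀ n → 2 ℕ.* ℕ.⌊ n /2⌋ ℕ.≤ n
  2*⌊n/2⌋≤n n = ℕ.≤-trans
    (ℕ.≤-reflexive (cong (ℕ.⌊ n /2⌋ ℕ.+_) (ℕ.+-identityʳ ℕ.⌊ n /2⌋)))
    (ℕ.≤-trans (ℕ.+-monoʳ-≤ ℕ.⌊ n /2⌋ (ℕ.⌊n/2⌋≤⌈n/2⌉ n)) (ℕ.≤-reflexive (ℕ.⌊n/2⌋+⌈n/2⌉≡n n)))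
  step : ∀ n → (∀ {m} → m ℕ.< n → .{{NonZero m}} → 2 ℕ.^ ⌊log₂ m ⌋ ℕ.≤ m) →
    .{{NonZero n}} → 2 ℕ.^ ⌊log₂ n ⌋ ℕ.≤ n
  step (suc zero)      _   = ℕ.≤-refl
  step n@(suc (suc k)) rec = ℕ.≤-trans (ℕ.≤-reflexive (cong (2 ℕ.^_) log-n))
    (ℕ.≤-trans (ℕ.*-monoʳ-≤ 2 (rec (ℕ.⌊n/2⌋<n (suc k)))) (2*⌊n/2⌋≤n n))
    where
    1≤log : 1 ℕ.≤ ⌊log₂ n ⌋
    1≤log = ⌊log₂⌋-mono-≤ {2} {n} (ℕ.s≤s (ℕ.s≤s ℕ.z≤n))
    log-n : ⌊log₂ n ⌋ ≡ suc ⌊log₂ ℕ.⌊ n /2⌋ ⌋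
    log-n = trans (sym (ℕ.m+[n∸m]≡n 1≤log)) (cong suc (sym (⌊log₂⌊n/2⌋⌋≡⌊log₂n⌋∸1 n)))

module Log (r : ℕ) .{{_ : NonZero r}} where
  -- 2^⌊log₂ x⌋ ≤ x < 2^(1 + ⌊log₂ x⌋) with x = r^(n+1) puts y n below
  -- the logarithm of r by less than 1/(n+1).
  a : ℕ → ℕ
  a n = ⌊log₂ r ℕ.^ suc n ⌋

  y : ℕ → ℚ
  y n = + a n / suc n

  cross : ∀ m n → a m ℕ.* suc n ℕ.≤ suc (a n) ℕ.* suc m
  cross m n = ℕ.<⇒≤ (ℕ.≰⇒> λ h → ℕ.<-irrefl refl (begin-strict
    r ℕ.^ (suc m ℕ.* suc n)            ≡⟨ cong (r ℕ.^_) (ℕ.*-comm (suc m) (suc n)) ⟩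
    r ℕ.^ (suc n ℕ.* suc m)            ≡⟨ sym (ℕ.^-*-assoc r (suc n) (suc m)) ⟩
    (r ℕ.^ suc n) ℕ.^ suc m            <⟨ ℕ.^-monoˡ-< (suc m) (n<2^[1+⌊log₂n⌋] (r ℕ.^ suc n)) ⟩
    (2 ℕ.^ suc (a n)) ℕ.^ suc m        ≡⟨ ℕ.^-*-assoc 2 (suc (a n)) (suc m) ⟩
    2 ℕ.^ (suc (a n) ℕ.* suc m)        ≤⟨ ℕ.^-monoʳ-≤ 2 h ⟩
    2 ℕ.^ (a m ℕ.* suc n)              ≡⟨ sym (ℕ.^-*-assoc 2 (a m) (suc n)) ⟩
    (2 ℕ.^ a m) ℕ.^ suc n              ≤⟨ ℕ.^-monoˡ-≤ (suc n) (2^⌊log₂n⌋≤n (r ℕ.^ suc m) {{ℕ.m^n≢0 r (suc m)}}) ⟩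
    (r ℕ.^ suc m) ℕ.^ suc n            ≡⟨ ℕ.^-*-assoc r (suc m) (suc n) ⟩
    r ℕ.^ (suc m ℕ.* suc n)            ∎))
    where open ℕ.≤-Reasoning

  frac-suc : ∀ c n → + suc c / suc n ≡ + c / suc n + 1/suc n
  frac-suc c n = trans (frac≡* (suc c) n) (trans (cong (_* 1/suc n) (natℚ-suc c))
    (trans (*-distribʳ-+ (1/suc n) 1ℚ (natℚ c))
    (trans (+-comm (1ℚ * 1/suc n) (natℚ c * 1/suc n))
    (cong₂ _+_ (sym (frac≡* c n)) (*-identityˡ (1/suc n))))))

  y-step : ∀ m n → y m ≤ y n + 1/suc n
  y-step m n = subst (y m ≤_) (frac-suc (a n) n) (frac-≤ (a m) m (suc (a n)) n (cross m n))

  y-bound : ∀ N ε m n → 1/suc N ≤ ε → N ℕ.≤ n → y m ≤ y n + ε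
  y-bound N ε m n h N≤n = ≤-trans {y m} {y n + 1/suc n} {y n + ε} (y-step m n)
    (+-monoʳ-≤ (y n) {1/suc n} {ε} (≤-trans {1/suc n} {1/suc N} {ε} (1/suc-mono N≤n) h))

  abstract
    y-cauchy : Cauchy y
    y-cauchy ε 0<ε = let N , h = 1/suc-small ε 0<ε in
      N , λ m n N≤m N≤n → ∣∣-intro {y m} {y n} {ε} (y-bound N ε m n h N≤n) (y-bound N ε n m h N≤m)

log₂ : (r : ℕ) → .{{NonZero r}} → ℝ
log₂ r = mkℝ (Log.y r) (Log.y-cauchy r)

------------------------------------------------------------------------
-- Suprema and infima

-- A set of reals stands for its supremum in the extended reals, so no
-- supremum or infimum has to be constructed. An infimum is the supremum
-- of the lower bounds, and a supremum of suprema is that of the union;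
-- over an empty index set ⨅ is +∞ and ⨆ is -∞.
Sup : Set₁
Sup = ℝ → Set

⨅ : {I : Set} → (I → ℝ) → Sup
⨅ v d = ∀ i → d ≤ℝ v i

⨆ : {I : Set} → (I → Sup) → Sup
⨆ S d = ∃ λ i → S i d

infix 4 _≺_

_≺_ : Sup → ℝ → Set
S ≺ b = ∃ λ c → c <ℝ b × (∀ d → S d → d ≤ℝ c)

------------------------------------------------------------------------
-- Randomness

Σℝ : {n : ℕ} → (Fin n → ℝ) → ℝ
Σℝ = foldr _+ℝ_ 0ℝ

record ProbabilitySpace : Set where
  field
    size   : ℕ
    weight : Fin size → ℝ
    nonneg : ∀ ω → 0ℝ ≤ℝ weight ω
    total  : Σℝ weight ≃ℝ 1ℝ

  Outcome : Set
  Outcome = Fin size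

  𝔼 : (Outcome → ℝ) → ℝ
  𝔼 v = Σℝ λ ω → weight ω *ℝ v ω

open ProbabilitySpace public using (Outcome; 𝔼)

------------------------------------------------------------------------
-- Protocols

-- Conversations with r messages left, where A is what the party about to
-- speak knows, B what the other party knows and O the type of outputs.
-- A message is sent bit by bit and may be empty. When it ends is
-- determined by the bits sent so far, so that both parties know whose
-- turn it is.
data Tree (A B O : Set) : ℕ → Set where
  output : O → Tree A B O 0
  bit    : ∀ {r} → (A → Bool) → (Bool → Tree A B O (suc r)) → Tree A B O (suc r)
  end    : ∀ {r} → Tree B A O r → Tree A B O (suc r)

run : ∀ {A B O r} → Tree A B O r → A → B → O
run (output o) a b = o
run (bit q t)  a b = run (t (q a)) a b
run (end t)    a b = run t b a

bits : ∀ {A B O r} → Tree A B O r → A → B → ℕ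
bits (output o) a b = 0
bits (bit q t)  a b = suc (bits (t (q a)) a b)
bits (end t)    a b = bits t b a

-- As the tree is chosen by the public randomness, the output depends on
-- the transcript and the public randomness only. The three sources of
-- randomness are independent. Finite spaces with arbitrary real weights
-- lose no generality, there being finitely many deterministic strategies
-- of bounded length on finite sets of inputs.
record Protocol (X Y O : Set) (r : ℕ) : Set where
  field
    pub privA privB : ProbabilitySpace
    tree : Outcome pub → Tree (X × Outcome privA) (Y × Outcome privB) O r

  result : X → Y → Outcome pub → Outcome privA → Outcome privB → O
  result x y ω α β = run (tree ω) (x , α) (y , β)

  length : X → Y → Outcome pub → Outcome privA → Outcome privB → ℕ
  length x y ω α β = bits (tree ω) (x , α) (y , β)

  -- The expected value of a function of the output on input (x , y).
  𝔼[_∣_,_] : (O → ℝ) → X → Y → ℝ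
  𝔼[ v ∣ x , y ] = 𝔼 pub λ ω → 𝔼 privA λ α → 𝔼 privB λ β → v (result x y ω α β)

open Protocol public using (length; 𝔼[_∣_,_])

infix 4 ‖_‖≤_

‖_‖≤_ : ∀ {X Y O r} → Protocol X Y O r → ℝ → Set
‖ π ‖≤ C = ∀ x y ω α β → fromℕ (length π x y ω α β) ≤ℝ C

-1^_ : Bool → ℝ
-1^ true  = -ℝ 1ℝ
-1^ false = 1ℝ

indicator : Bool → ℝ
indicator b = if b then 1ℝ else 0ℝ

module _ {X Y : Set} (r : ℕ) (C : ℝ) where

  adv : (X → Y → Bool) → Sup
  adv g = ⨆ {Σ[ π ∈ Protocol X Y Bool r ] ‖ π ‖≤ C} λ (π , _) →
          ⨅ {X × Y} λ (x , y) → 𝔼[_∣_,_] π (λ o → -1^ (o xor g x y)) x y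

  suc-prob : {O : Set} → DecidableEquality O → (X → Y → O) → Sup
  suc-prob {O} _≟_ g = ⨆ {Σ[ π ∈ Protocol X Y O r ] ‖ π ‖≤ C} λ (π , _) →
          ⨅ {X × Y} λ (x , y) → 𝔼[_∣_,_] π (λ o → indicator (does (o ≟ g x y))) x y

infixl 8 _^^_

_^^_ : {X Y : Set} → (X → Y → Bool) → (n : ℕ) → Vec X n → Vec Y n → Vec Bool n
f ^^ n = zipWith f

-- Suppose that π computes f^n too well. By the minimax theorem it suffices
-- to find, for each distribution μ of the inputs of f, a deterministic
-- protocol within the budget C that is right with probability 11/20 (from
-- which the advantage 1/20 > κ follows).
--
-- Fix the coins of π, draw n independent inputs from μ, and let w be their
-- distribution restricted to the inputs on which π is right, of total mass
-- W ≥ (99/100)^2n. Given a coordinate i and the first i entries of x, embed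
-- the input of f as (x_i , y_i), the last entries of y being part of the
-- first message. Both parties then know the conditional distribution under w
-- of each message given what they see, and could run the conversation by
-- drawing each message from the belief of its speaker. The density t_i of
-- this conversation with respect to w has expectation at most 1, and the
-- Markov property of conversations makes the product of all t_i telescope to
-- W. Hence, by the inequality of the means applied to √t_i, the simulation is
-- good on average over i. The density v_i of the conversation drawn from the
-- beliefs of the listeners has a similar product, of about 2^-2T for
-- conversations of T bits, so that most v_i are at least 2^-Λ with Λ = O(T/n).
-- If moreover no t_i is too large, the beliefs of both parties in the actual
-- messages agree up to a factor K = 2^O(Λ). A message can then be sent with
-- O(Λ + log r) bits: common random lists contain few candidates, the speaker
-- announces the first list with a candidate plausible to him, and the
-- listener finds the only candidate in it that is plausible to her, where she
-- multiplies her belief by K.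
module Submission where

open import Defs
open import Data.Bool.Base using (Bool; true; false; if_then_else_; not; _∧_; _∨_; _xor_; T)
import Data.Bool.Properties as Bool
open import Data.Bool.Properties using (_≟_)
open import Data.Empty using (⊥; ⊥-elim)
open import Data.Fin.Base as Fin using (Fin; zero; suc)
import Data.Fin.Properties as Fin
open import Data.Integer.Base as ℤ using (+_)
import Data.Integer.Properties as ℤ
open import Data.List.Base using (List; []; _∷_; _++_; map; cartesianProduct; cartesianProductWith; allFin; upTo; deduplicate)
import Data.List.Base as List
import Data.List.Properties as List
open import Data.List.Membership.Propositional using (_∈_)
import Data.List.Membership.Propositional.Properties as ∈
open import Data.List.Relation.Unary.All using (All; []; _∷_)
import Data.List.Relation.Unary.All as All
open import Data.List.Relation.Unary.AllPairs using ([]; _∷_)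
open import Data.List.Relation.Unary.Any using (here; there)
open import Data.List.Relation.Unary.Unique.Propositional using (Unique)
import Data.List.Relation.Unary.Unique.Propositional.Properties as Unique
import Data.List.Relation.Unary.Unique.DecPropositional.Properties as DecUnique
open import Data.Maybe.Base using (Maybe; just; nothing)
open import Data.Nat.Base as ℕ using (ℕ; zero; suc; NonZero; z≤n; s≤s)
import Data.Nat.Properties as ℕ
import Data.Nat.DivMod as ℕ
import Data.Nat.Solver as ℕ-Solver
open import Data.Nat.Logarithm using (⌊log₂_⌋; ⌊log₂⌋-mono-≤; ⌊log₂[2^n]⌋≡n)
open import Data.Product.Base using (Σ-syntax; ∃; _×_; _,_; proj₁; proj₂)
import Data.Product.Properties as Product
open import Data.Rational.Base as ℚ using (ℚ; 0ℚ; 1ℚ; _+_; _*_; -_; _-_; ∣_∣; _≤_; _<_; _/_; _⊓_)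
open import Data.Rational.Properties hiding (_≟_; _≤?_; _<?_)
import Data.Rational.Properties as ℚ
open import Data.Rational.Solver using (module +-*-Solver)
open import Data.Sum.Base using (_⊎_; inj₁; inj₂)
open import Data.Vec.Base using (Vec; []; _∷_; zipWith; lookup; toList; replicate)
import Data.Vec.Base as Vec
import Data.Vec.Properties as Vec
open import Data.Vec.Properties using (≡-dec)
open import Function.Base using (_∘_; case_of_)
open import Function.Bundles using (_↔_; module Inverse)
open import Relation.Binary.Definitions using (DecidableEquality)
open import Relation.Binary.PropositionalEquality hiding (J)
open import Relation.Nullary.Decidable using (Dec; yes; no; does; dec-true; dec-false; _×-dec_)
open import Relation.Nullary.Negation using (¬_; contradiction)

open +-*-Solver using (solve; _:+_; _:*_; _:-_; :-_; _:=_; con)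

-- Rational arithmetic

-- Two devices keep the argument elementary. First, w stays manageable although it is conditioned on
-- success: the output is a function of the transcript, so on each transcript being right is a
-- condition on every coordinate separately, and the inputs with this transcript form a rectangle.
-- That is why fixing the past of x, the future of y and the transcript leaves the rest of x and the
-- rest of y independent. Second, no entropy or logarithm occurs. Telescoping quotients of weights
-- stand for the chain rule, and the inequality of the means for concavity: the product W of the t_i
-- forces the average of √t_i up to 99/100, and as t_i has mean at most 1, the truncation of t_i at
-- 1 must be large on average. All this is rational arithmetic. The v_i do not telescope by
-- themselves, because the listener to the first message already conditions on y_i and because the
-- boundary terms remain. Further densities of mean at most 1 complete their product to (W / 2^T)².
-- Real numbers enter only at the two ends: the success of π becomes a rational score once its coins
-- are fixed, and exp(-κ n) is compared with a rational power θ^n.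

≤-by : ∀ {p q} d → 0ℚ ≤ d → q ≡ p + d → p ≤ q
≤-by {p} d 0≤d e = ≤-eq (p≤p+q p 0≤d) (sym e)

0≤1 : 0ℚ ≤ 1ℚ
0≤1 = 0≤natℚ 1

0<1 : 0ℚ < 1ℚ
0<1 = ℚ.*<* (ℤ.+<+ (s≤s z≤n))

0≤+ : ∀ {p q} → 0ℚ ≤ p → 0ℚ ≤ q → 0ℚ ≤ p + q
0≤+ {p} 0≤p 0≤q = ≤-trans 0≤p (p≤p+q p 0≤q)

p≤q⇒0≤q-p : ∀ {p q} → p ≤ q → 0ℚ ≤ q - p
p≤q⇒0≤q-p {p} h = eq-≤ (sym (+-inverseʳ p)) (+-monoˡ-≤ (- p) h)

p<q⇒0<q-p : ∀ {p q} → p < q → 0ℚ < q - p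
p<q⇒0<q-p {p} {q} h = subst (_< q - p) (+-inverseʳ p) (+-monoˡ-< (- p) h)

0≤q-p⇒p≤q : ∀ {p q} → 0ℚ ≤ q - p → p ≤ q
0≤q-p⇒p≤q {p} {q} h = ≤-by (q - p) h (solve 2 (λ p q → q := p :+ (q :- p)) refl p q)

0<* : ∀ {p q} → 0ℚ < p → 0ℚ < q → 0ℚ < p * q
0<* {p} {q} 0<p 0<q = positive⁻¹ (p * q) {{pos*pos⇒pos p {{ℚ.positive 0<p}} q {{ℚ.positive 0<q}}}}

*-cancelˡ : ∀ {r p q} → 0ℚ < r → r * p ≤ r * q → p ≤ q
*-cancelˡ {r} 0<r = *-cancelˡ-≤-pos r {{ℚ.positive 0<r}}

*-≢0⇒≡ : ∀ {r p q} → 0ℚ < r → r * p ≡ r * q → p ≡ q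
*-≢0⇒≡ 0<r e = ≤-antisym (*-cancelˡ 0<r (≤-reflexive e)) (*-cancelˡ 0<r (≤-reflexive (sym e)))

0≤sq : ∀ p → 0ℚ ≤ p * p
0≤sq p with ≤-total 0ℚ p
... | inj₁ h = 0≤* h h
... | inj₂ h = ≤-eq (0≤* -p -p) (solve 1 (λ p → (:- p) :* (:- p) := p :* p) refl p)
  where -p = neg-antimono-≤ h

0≤∧≢0⇒0< : ∀ {p} → 0ℚ ≤ p → ¬ p ≡ 0ℚ → 0ℚ < p
0≤∧≢0⇒0< {p} h n with ℚ._<?_ 0ℚ p
... | yes q = q
... | no ¬q = contradiction (≤-antisym (≮⇒≥ ¬q) h) n

*≤1 : ∀ {p q} → 0ℚ ≤ p → p ≤ 1ℚ → 0ℚ ≤ q → q ≤ 1ℚ → p * q ≤ 1ℚ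
*≤1 0≤p p≤1 0≤q q≤1 = *-mono 0≤q 0≤1 p≤1 q≤1

-- Junk value: inv 0 = 0.
inv : ℚ → ℚ
inv p with ℚ._≟_ p 0ℚ
... | yes _ = 0ℚ
... | no ≢0 = ℚ.1/_ p {{ℚ.≢-nonZero ≢0}}

*-inv : ∀ {p} → 0ℚ < p → p * inv p ≡ 1ℚ
*-inv {p} 0<p with ℚ._≟_ p 0ℚ
... | yes refl = contradiction 0<p (<-irrefl refl)
... | no ≢0 = *-inverseʳ p {{ℚ.≢-nonZero ≢0}}

0<inv : ∀ {p} → 0ℚ < p → 0ℚ < inv p
0<inv {p} 0<p with ℚ._≟_ p 0ℚ
... | yes refl = contradiction 0<p (<-irrefl refl)
... | no ≢0 = positive⁻¹ (ℚ.1/_ p {{ℚ.≢-nonZero ≢0}}) {{1/pos⇒pos p {{ℚ.positive 0<p}}}}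

0≤inv : ∀ {p} → 0ℚ ≤ p → 0ℚ ≤ inv p
0≤inv {p} 0≤p with ℚ._≟_ p 0ℚ
... | yes _ = ≤-refl
... | no ≢0 = <⇒≤ (positive⁻¹ (ℚ.1/_ p {{ℚ.≢-nonZero ≢0}})
    {{1/pos⇒pos p {{ℚ.positive (0≤∧≢0⇒0< 0≤p ≢0)}}}})

*-inv-≤1 : ∀ {p} → 0ℚ ≤ p → p * inv p ≤ 1ℚ
*-inv-≤1 {p} 0≤p with ℚ._≟_ p 0ℚ
... | yes _ = eq-≤ (*-zeroʳ p) 0≤1
... | no ≢0 = ≤-reflexive (*-inverseʳ p {{ℚ.≢-nonZero ≢0}})

inv-anti : ∀ {p q} → 0ℚ < p → p ≤ q → inv q ≤ inv p
inv-anti {p} {q} 0<p p≤q = *-cancelˡ 0<p (*-cancelˡ 0<q (≤-by (q - p) (p≤q⇒0≤q-p p≤q)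
  (begin
    q * (p * inv p)                  ≡⟨ cong (q *_) (*-inv 0<p) ⟩
    q * 1ℚ                           ≡⟨ solve 2 (λ p q → q :* con 1ℚ := p :* con 1ℚ :+ (q :- p)) refl p q ⟩
    p * 1ℚ + (q - p)                 ≡⟨ cong (λ z → p * z + (q - p)) (sym (*-inv 0<q)) ⟩
    p * (q * inv q) + (q - p)        ≡⟨ cong (_+ (q - p)) (solve 3 (λ p q i → p :* (q :* i) := q :* (p :* i)) refl p q (inv q)) ⟩
    q * (p * inv q) + (q - p)        ∎)))
  where
  open ≡-Reasoning
  0<q = <-≤-trans 0<p p≤q

infixr 8 _^_

_^_ : ℚ → ℕ → ℚ
p ^ zero  = 1ℚ
p ^ suc n = p * p ^ n

0≤^ : ∀ {p} n → 0ℚ ≤ p → 0ℚ ≤ p ^ n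
0≤^ zero    0≤p = 0≤1
0≤^ (suc n) 0≤p = 0≤* 0≤p (0≤^ n 0≤p)

0<^ : ∀ {p} n → 0ℚ < p → 0ℚ < p ^ n
0<^ zero    0<p = 0<1
0<^ (suc n) 0<p = 0<* 0<p (0<^ n 0<p)

^-+ : ∀ p m n → p ^ (m ℕ.+ n) ≡ p ^ m * p ^ n
^-+ p zero    n = sym (*-identityˡ (p ^ n))
^-+ p (suc m) n = trans (cong (p *_) (^-+ p m n)) (sym (*-assoc p (p ^ m) (p ^ n)))

^-*-distrib : ∀ p q n → (p * q) ^ n ≡ p ^ n * q ^ n
^-*-distrib p q zero    = refl
^-*-distrib p q (suc n) = trans (cong (p * q *_) (^-*-distrib p q n))
  (solve 4 (λ p q a b → p :* q :* (a :* b) := p :* a :* (q :* b)) refl p q (p ^ n) (q ^ n))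

1^ : ∀ n → 1ℚ ^ n ≡ 1ℚ
1^ zero    = refl
1^ (suc n) = trans (*-identityˡ (1ℚ ^ n)) (1^ n)

^-mono : ∀ {p q} n → 0ℚ ≤ p → p ≤ q → p ^ n ≤ q ^ n
^-mono zero    0≤p p≤q = ≤-refl
^-mono (suc n) 0≤p p≤q = *-mono (0≤^ n 0≤p) (≤-trans 0≤p p≤q) p≤q (^-mono n 0≤p p≤q)

1≤^ : ∀ {p} n → 1ℚ ≤ p → 1ℚ ≤ p ^ n
1≤^ n h = eq-≤ (sym (1^ n)) (^-mono n 0≤1 h)

^≤1 : ∀ {p} n → 0ℚ ≤ p → p ≤ 1ℚ → p ^ n ≤ 1ℚ
^≤1 n 0≤p h = ≤-eq (^-mono n 0≤p h) (1^ n)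

^-monoʳ : ∀ {p} {m n} → 1ℚ ≤ p → m ℕ.≤ n → p ^ m ≤ p ^ n
^-monoʳ {p} {m} {n} 1≤p m≤n = subst (λ n → p ^ m ≤ p ^ n) (ℕ.m+[n∸m]≡n m≤n)
  (≤-eq (eq-≤ (sym (*-identityʳ (p ^ m))) (*-monoˡ (0≤^ m (≤-trans 0≤1 1≤p)) (1≤^ (n ℕ.∸ m) 1≤p)))
    (sym (^-+ p m (n ℕ.∸ m))))

natℚ-+ : ∀ m n → natℚ (m ℕ.+ n) ≡ natℚ m + natℚ n
natℚ-+ zero    n = sym (+-identityˡ (natℚ n))
natℚ-+ (suc m) n = trans (natℚ-suc (m ℕ.+ n)) (trans (cong (λ z → 1ℚ + z) (natℚ-+ m n))
  (trans (sym (+-assoc 1ℚ (natℚ m) (natℚ n))) (cong (_+ natℚ n) (sym (natℚ-suc m)))))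

natℚ-* : ∀ m n → natℚ (m ℕ.* n) ≡ natℚ m * natℚ n
natℚ-* zero    n = sym (*-zeroˡ (natℚ n))
natℚ-* (suc m) n = trans (natℚ-+ n (m ℕ.* n)) (trans (cong (λ z → natℚ n + z) (natℚ-* m n))
  (trans (solve 2 (λ m n → n :+ m :* n := (con 1ℚ :+ m) :* n) refl (natℚ m) (natℚ n))
    (cong (_* natℚ n) (sym (natℚ-suc m)))))

natℚ-mono : ∀ {m n} → m ℕ.≤ n → natℚ m ≤ natℚ n
natℚ-mono {m} {n} h = frac-≤ m 0 n 0 (ℕ.*-monoˡ-≤ 1 h)

natℚ-mono-< : ∀ {m n} → m ℕ.< n → natℚ m < natℚ n
natℚ-mono-< {m} {n} h = <-≤-trans (subst₂ _<_ (+-identityˡ (natℚ m)) (sym (natℚ-suc m)) (+-monoˡ-< (natℚ m) 0<1)) (natℚ-mono h)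

natℚ-cancel-≤ : ∀ {m n} → natℚ m ≤ natℚ n → m ℕ.≤ n
natℚ-cancel-≤ {m} {n} h with m ℕ.≤? n
... | yes p = p
... | no ¬p = contradiction (<-≤-trans (natℚ-mono-< (ℕ.≰⇒> ¬p)) h) (<-irrefl refl)

natℚ-cancel-< : ∀ {m n} → natℚ m < natℚ n → m ℕ.< n
natℚ-cancel-< {m} {n} h with m ℕ.<? n
... | yes p = p
... | no ¬p = contradiction (<-≤-trans h (natℚ-mono (ℕ.≮⇒≥ ¬p))) (<-irrefl refl)

natℚ-^ : ∀ m n → natℚ (m ℕ.^ n) ≡ natℚ m ^ n
natℚ-^ m zero    = refl
natℚ-^ m (suc n) = trans (natℚ-* m (m ℕ.^ n)) (cong (natℚ m *_) (natℚ-^ m n))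

2ℚ : ℚ
2ℚ = natℚ 2

0<2 : 0ℚ < 2ℚ
0<2 = natℚ-mono-< {0} {2} (s≤s z≤n)

1≤2 : 1ℚ ≤ 2ℚ
1≤2 = natℚ-mono {1} {2} (s≤s z≤n)

n<2^n : ∀ n → n ℕ.< 2 ℕ.^ n
n<2^n zero    = s≤s z≤n
n<2^n (suc n) = ℕ.≤-trans (s≤s (n<2^n n))
  (ℕ.≤-trans (ℕ.+-monoˡ-≤ (2 ℕ.^ n) (ℕ.m^n>0 2 n)) (ℕ.+-monoʳ-≤ (2 ℕ.^ n) (ℕ.≤-reflexive (sym (ℕ.+-identityʳ (2 ℕ.^ n))))))

floorℕ : ∀ {p} → 0ℚ ≤ p → ∃ λ k → natℚ k ≤ p × p ≤ natℚ (suc k)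
floorℕ {p} 0≤p = search (proj₁ (archimedean p)) (proj₂ (archimedean p))
  where
  search : ∀ n → p ≤ natℚ n → ∃ λ k → natℚ k ≤ p × p ≤ natℚ (suc k)
  search zero    h = 0 , 0≤p , ≤-trans h (natℚ-mono {0} {1} z≤n)
  search (suc n) h with ≤-total p (natℚ n)
  ... | inj₁ p≤n = search n p≤n
  ... | inj₂ n≤p = n , n≤p , h

-- The power function lies above its tangent at x: each step of the induction multiplies by y and
-- leaves a remainder, a nonnegative multiple of (y - x)². Without division it also covers x = 0.
bernoulli : ∀ n {x y} → 0ℚ ≤ x → 0ℚ ≤ y → x ^ suc n + natℚ (suc n) * x ^ n * (y - x) ≤ y ^ suc n
bernoulli zero {x} {y} _ _ = ≤-reflexive (solve 2 (λ x y →
  x :* con 1ℚ :+ con 1ℚ :* con 1ℚ :* (y :- x) := y :* con 1ℚ) refl x y)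
bernoulli (suc n) {x} {y} 0≤x 0≤y = ≤-trans
  (≤-by (natℚ (suc n) * x ^ n * ((y - x) * (y - x))) (0≤* (0≤* (0≤natℚ (suc n)) (0≤^ n 0≤x)) (0≤sq (y - x)))
    (begin
      y * (x * x ^ n + natℚ (suc n) * x ^ n * (y - x))
        ≡⟨ solve 4 (λ x y a n → y :* (x :* a :+ n :* a :* (y :- x)) :=
             (x :* (x :* a) :+ (con 1ℚ :+ n) :* (x :* a) :* (y :- x)) :+ n :* a :* ((y :- x) :* (y :- x))) refl x y (x ^ n) (natℚ (suc n)) ⟩
      (x * (x * x ^ n) + (1ℚ + natℚ (suc n)) * (x * x ^ n) * (y - x)) + natℚ (suc n) * x ^ n * ((y - x) * (y - x))
        ≡⟨ cong (λ z → (x * (x * x ^ n) + z * (x * x ^ n) * (y - x)) + natℚ (suc n) * x ^ n * ((y - x) * (y - x))) (sym (natℚ-suc (suc n))) ⟩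
      (x * (x * x ^ n) + natℚ (suc (suc n)) * (x * x ^ n) * (y - x)) + natℚ (suc n) * x ^ n * ((y - x) * (y - x)) ∎))
  (*-monoˡ 0≤y (bernoulli n 0≤x 0≤y))
  where open ≡-Reasoning

-- Finite sums and products

⟦_⟧ : Bool → ℚ
⟦ true  ⟧ = 1ℚ
⟦ false ⟧ = 0ℚ

0≤⟦⟧ : ∀ b → 0ℚ ≤ ⟦ b ⟧
0≤⟦⟧ true  = 0≤1
0≤⟦⟧ false = ≤-refl

⟦⟧≤1 : ∀ b → ⟦ b ⟧ ≤ 1ℚ
⟦⟧≤1 true  = ≤-refl
⟦⟧≤1 false = 0≤1

⟦∧⟧ : ∀ b c → ⟦ b ∧ c ⟧ ≡ ⟦ b ⟧ * ⟦ c ⟧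
⟦∧⟧ true  c = sym (*-identityˡ ⟦ c ⟧)
⟦∧⟧ false c = sym (*-zeroˡ ⟦ c ⟧)

does-≡ : {A : Set} (_≟_ : DecidableEquality A) (a : A) → does (a ≟ a) ≡ true
does-≡ _≟_ a = dec-true (a ≟ a) refl

does-⇔ : {P Q : Set} (p? : Dec P) (q? : Dec Q) → (P → Q) → (Q → P) → does p? ≡ does q?
does-⇔ (yes p) q? f g = sym (dec-true q? (f p))
does-⇔ (no ¬p) q? f g = sym (dec-false q? (¬p ∘ g))

does-true : {P : Set} (p? : Dec P) → does p? ≡ true → P
does-true (yes p) _ = p

≟-guard : {A : Set} (_≟_ : DecidableEquality A) (f : A → ℚ) (a b : A) →
  ⟦ does (a ≟ b) ⟧ * f a ≡ ⟦ does (a ≟ b) ⟧ * f b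
≟-guard _≟_ f a b with a ≟ b
... | yes refl = refl
... | no _ = trans (*-zeroˡ (f a)) (sym (*-zeroˡ (f b)))

∑ ∏ : {A : Set} → List A → (A → ℚ) → ℚ
∑ []       f = 0ℚ
∑ (x ∷ xs) f = f x + ∑ xs f
∏ []       f = 1ℚ
∏ (x ∷ xs) f = f x * ∏ xs f

module _ {A : Set} where

  ∑-cong : ∀ (xs : List A) {f g} → (∀ a → f a ≡ g a) → ∑ xs f ≡ ∑ xs g
  ∑-cong []       e = refl
  ∑-cong (x ∷ xs) e = cong₂ _+_ (e x) (∑-cong xs e)

  ∑-mono-∈ : ∀ (xs : List A) {f g} → (∀ a → a ∈ xs → f a ≤ g a) → ∑ xs f ≤ ∑ xs g
  ∑-mono-∈ []       h = ≤-refl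
  ∑-mono-∈ (x ∷ xs) h = +-mono-≤ (h x (here refl)) (∑-mono-∈ xs λ a → h a ∘ there)

  ∑-mono : ∀ (xs : List A) {f g} → (∀ a → f a ≤ g a) → ∑ xs f ≤ ∑ xs g
  ∑-mono xs h = ∑-mono-∈ xs λ a _ → h a

  ∑-zero : ∀ (xs : List A) → ∑ xs (λ _ → 0ℚ) ≡ 0ℚ
  ∑-zero []       = refl
  ∑-zero (x ∷ xs) = trans (+-identityˡ _) (∑-zero xs)

  0≤∑ : ∀ (xs : List A) {f} → (∀ a → 0ℚ ≤ f a) → 0ℚ ≤ ∑ xs f
  0≤∑ xs h = eq-≤ (sym (∑-zero xs)) (∑-mono xs h)

  ∑-+ : ∀ (xs : List A) f g → ∑ xs (λ a → f a + g a) ≡ ∑ xs f + ∑ xs g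
  ∑-+ []       f g = refl
  ∑-+ (x ∷ xs) f g = trans (cong (λ z → f x + g x + z) (∑-+ xs f g))
    (solve 4 (λ a b c d → a :+ b :+ (c :+ d) := (a :+ c) :+ (b :+ d)) refl (f x) (g x) (∑ xs f) (∑ xs g))

  ∑-*ˡ : ∀ (xs : List A) c f → ∑ xs (λ a → c * f a) ≡ c * ∑ xs f
  ∑-*ˡ []       c f = sym (*-zeroʳ c)
  ∑-*ˡ (x ∷ xs) c f = trans (cong (λ z → c * f x + z) (∑-*ˡ xs c f)) (sym (*-distribˡ-+ c (f x) (∑ xs f)))

  ∑-*ʳ : ∀ (xs : List A) c f → ∑ xs (λ a → f a * c) ≡ ∑ xs f * c
  ∑-*ʳ xs c f = trans (∑-cong xs λ a → *-comm (f a) c) (trans (∑-*ˡ xs c f) (*-comm c (∑ xs f)))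

  ∑-neg : ∀ (xs : List A) f → ∑ xs (λ a → - f a) ≡ - ∑ xs f
  ∑-neg []       f = refl
  ∑-neg (x ∷ xs) f = trans (cong (λ z → - f x + z) (∑-neg xs f)) (sym (neg-distrib-+ (f x) (∑ xs f)))

  ∑-- : ∀ (xs : List A) f g → ∑ xs (λ a → f a - g a) ≡ ∑ xs f - ∑ xs g
  ∑-- xs f g = trans (∑-+ xs f (λ a → - g a)) (cong (λ z → ∑ xs f + z) (∑-neg xs g))

  ∑-++ : ∀ (xs ys : List A) f → ∑ (xs ++ ys) f ≡ ∑ xs f + ∑ ys f
  ∑-++ []       ys f = sym (+-identityˡ (∑ ys f))
  ∑-++ (x ∷ xs) ys f = trans (cong (λ z → f x + z) (∑-++ xs ys f)) (sym (+-assoc (f x) (∑ xs f) (∑ ys f)))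

  ∑-const : ∀ (xs : List A) c → ∑ xs (λ _ → c) ≡ natℚ (List.length xs) * c
  ∑-const []       c = sym (*-zeroˡ c)
  ∑-const (x ∷ xs) c = trans (cong (λ z → c + z) (∑-const xs c))
    (trans (solve 2 (λ n c → c :+ n :* c := (con 1ℚ :+ n) :* c) refl (natℚ (List.length xs)) c)
      (cong (_* c) (sym (natℚ-suc (List.length xs)))))

  term≤∑ : ∀ {xs : List A} {f a} → (∀ a → 0ℚ ≤ f a) → a ∈ xs → f a ≤ ∑ xs f
  term≤∑ {x ∷ xs} {f} h (here refl) = p≤p+q (f x) (0≤∑ xs h)
  term≤∑ {x ∷ xs} {f} h (there i) = ≤-trans (term≤∑ h i) (p≤q+p (∑ xs f) (h x))

  ∏-cong : ∀ (xs : List A) {f g} → (∀ a → f a ≡ g a) → ∏ xs f ≡ ∏ xs g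
  ∏-cong []       e = refl
  ∏-cong (x ∷ xs) e = cong₂ _*_ (e x) (∏-cong xs e)

  0≤∏ : ∀ (xs : List A) {f} → (∀ a → 0ℚ ≤ f a) → 0ℚ ≤ ∏ xs f
  0≤∏ []       h = 0≤1
  0≤∏ (x ∷ xs) h = 0≤* (h x) (0≤∏ xs h)

  ∏-mono : ∀ (xs : List A) {f g} → (∀ a → 0ℚ ≤ f a) → (∀ a → f a ≤ g a) → ∏ xs f ≤ ∏ xs g
  ∏-mono []       0≤f h = ≤-refl
  ∏-mono (x ∷ xs) 0≤f h = *-mono (0≤∏ xs 0≤f) (≤-trans (0≤f x) (h x)) (h x) (∏-mono xs 0≤f h)

  ∏-* : ∀ (xs : List A) f g → ∏ xs (λ a → f a * g a) ≡ ∏ xs f * ∏ xs g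
  ∏-* []       f g = refl
  ∏-* (x ∷ xs) f g = trans (cong (f x * g x *_) (∏-* xs f g))
    (solve 4 (λ a b c d → a :* b :* (c :* d) := (a :* c) :* (b :* d)) refl (f x) (g x) (∏ xs f) (∏ xs g))

  -- With B the mean of the tail, the head is B + (n + 1)(A - B). So the head times B^n is the value
  -- at A of the tangent to the power n + 1 at B, and `bernoulli` applies.
  am-gm : ∀ (xs : List A) {f} → (∀ a → 0ℚ ≤ f a) → ∀ A → 0ℚ ≤ A →
    ∑ xs f ≡ natℚ (List.length xs) * A → ∏ xs f ≤ A ^ List.length xs
  am-gm []       0≤f A 0≤A e = ≤-refl
  am-gm (x ∷ []) {f} 0≤f A 0≤A e = *-monoʳ 0≤1 (≤-reflexive (trans (sym (+-identityʳ (f x))) (trans e (*-identityˡ A))))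
  am-gm (x ∷ xs@(_ ∷ ys)) {f} 0≤f A 0≤A e = ≤-trans
    (*-monoˡ (0≤f x) (am-gm xs 0≤f B 0≤B eB))
    (≤-trans (≤-reflexive eq) (bernoulli n 0≤B 0≤A))
    where
    m = List.length ys
    n = suc m
    N = natℚ n
    B = ∑ xs f * 1/suc m
    0≤B : 0ℚ ≤ B
    0≤B = 0≤* (0≤∑ xs 0≤f) (0≤1/suc m)
    eB : ∑ xs f ≡ N * B
    eB = sym (trans (solve 3 (λ n s i → n :* (s :* i) := s :* (n :* i)) refl N (∑ xs f) (1/suc m))
      (trans (cong (∑ xs f *_) (suc*1/suc m)) (*-identityʳ (∑ xs f))))
    fx : f x ≡ B + natℚ (suc n) * (A - B)
    fx = trans (solve 2 (λ a s → a := (a :+ s) :- s) refl (f x) (∑ xs f))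
      (trans (cong₂ _-_ (trans e (cong (_* A) (natℚ-suc n))) eB)
      (trans (solve 3 (λ n a b → (con 1ℚ :+ n) :* a :- n :* b := b :+ (con 1ℚ :+ n) :* (a :- b)) refl N A B)
        (cong (λ z → B + z * (A - B)) (sym (natℚ-suc n)))))
    eq : f x * B ^ n ≡ B ^ suc n + natℚ (suc n) * B ^ n * (A - B)
    eq = trans (cong (_* B ^ n) fx)
      (solve 4 (λ b n c a → (b :+ n :* (a :- b)) :* c := b :* c :+ n :* c :* (a :- b)) refl B (natℚ (suc n)) (B ^ n) A)

∑-swap : {A B : Set} (xs : List A) (ys : List B) (f : A → B → ℚ) →
  ∑ xs (λ a → ∑ ys (f a)) ≡ ∑ ys (λ b → ∑ xs λ a → f a b)
∑-swap []       ys f = sym (∑-zero ys)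
∑-swap (x ∷ xs) ys f = trans (cong (λ z → ∑ ys (f x) + z) (∑-swap xs ys f))
  (sym (∑-+ ys (f x) (λ b → ∑ xs λ a → f a b)))

∑-map : {A B : Set} (g : A → B) (xs : List A) (f : B → ℚ) → ∑ (map g xs) f ≡ ∑ xs (f ∘ g)
∑-map g []       f = refl
∑-map g (x ∷ xs) f = cong (λ z → f (g x) + z) (∑-map g xs f)

∑-cartesian : {A B C : Set} (g : A → B → C) (xs : List A) (ys : List B) (f : C → ℚ) →
  ∑ (cartesianProductWith g xs ys) f ≡ ∑ xs λ a → ∑ ys λ b → f (g a b)
∑-cartesian g []       ys f = refl
∑-cartesian g (x ∷ xs) ys f = trans (∑-++ (map (g x) ys) (cartesianProductWith g xs ys) f)
  (cong₂ _+_ (∑-map (g x) ys f) (∑-cartesian g xs ys f))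

module _ {A : Set} (_≟_ : DecidableEquality A) where

  ∑-δ-∉ : ∀ (xs : List A) (f : A → ℚ) b → ¬ b ∈ xs → ∑ xs (λ a → ⟦ does (a ≟ b) ⟧ * f a) ≡ 0ℚ
  ∑-δ-∉ []       f b _ = refl
  ∑-δ-∉ (x ∷ xs) f b b∉ with x ≟ b
  ... | yes refl = contradiction (here refl) b∉
  ... | no _ = trans (cong₂ _+_ (*-zeroˡ (f x)) (∑-δ-∉ xs f b (b∉ ∘ there))) refl

  ∑-δ : ∀ {xs : List A} (f : A → ℚ) b → Unique xs → b ∈ xs → ∑ xs (λ a → ⟦ does (a ≟ b) ⟧ * f a) ≡ f b
  ∑-δ {x ∷ xs} f b (x∉ ∷ u) b∈ with x ≟ b | b∈
  ... | yes refl | _ = trans (cong₂ _+_ (*-identityˡ (f x)) (∑-δ-∉ xs f x λ x∈ → All.lookup x∉ x∈ refl)) (+-identityʳ (f x))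
  ... | no x≢b | here b≡x = contradiction (sym b≡x) x≢b
  ... | no _ | there i = trans (cong₂ _+_ (*-zeroˡ (f x)) (∑-δ f b u i)) (+-identityˡ (f b))

  ∑-δ-≤ : ∀ {xs : List A} (f : A → ℚ) b → Unique xs → 0ℚ ≤ f b → ∑ xs (λ a → ⟦ does (a ≟ b) ⟧ * f a) ≤ f b
  ∑-δ-≤ {[]} f b _ h = h
  ∑-δ-≤ {x ∷ xs} f b (x∉ ∷ u) h with x ≟ b
  ... | yes refl = ≤-reflexive (trans (cong₂ _+_ (*-identityˡ (f x)) (∑-δ-∉ xs f x λ x∈ → All.lookup x∉ x∈ refl)) (+-identityʳ (f x)))
  ... | no _ = eq-≤ (trans (cong (_+ ∑ xs (λ a → ⟦ does (a ≟ b) ⟧ * f a)) (*-zeroˡ (f x))) (+-identityˡ _)) (∑-δ-≤ f b u h)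

-- Some index does at least as well as the average of f / g weighted by g. Indices with g k = 0 must
-- not help the sum of f, for they cannot be returned.
∑-pick : {A : Set} (ks : List A) (f g : A → ℚ) (c : ℚ) →
  (∀ k → 0ℚ ≤ g k) → (∀ k → g k ≡ 0ℚ → f k ≤ 0ℚ) → 0ℚ < ∑ ks g → c * ∑ ks g ≤ ∑ ks f →
  ∃ λ k → 0ℚ < g k × c * g k ≤ f k
∑-pick [] f g c 0≤g f0 0<∑ h = contradiction 0<∑ (<-irrefl refl)
∑-pick (k ∷ ks) f g c 0≤g f0 0<∑ h with ℚ._≟_ (g k) 0ℚ
... | yes gk≡0 = ∑-pick ks f g c 0≤g f0 (subst (0ℚ <_) e 0<∑)
    (≤-trans (≤-reflexive (cong (c *_) (sym e))) (≤-trans h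
      (≤-eq (+-monoˡ-≤ (∑ ks f) (f0 k gk≡0)) (+-identityˡ (∑ ks f)))))
  where
  e : g k + ∑ ks g ≡ ∑ ks g
  e = trans (cong (_+ ∑ ks g) gk≡0) (+-identityˡ (∑ ks g))
... | no gk≢0 with ℚ._≤?_ (c * g k) (f k)
...   | yes p = k , 0≤∧≢0⇒0< (0≤g k) gk≢0 , p
...   | no ¬p with ℚ._≟_ (∑ ks g) 0ℚ
...     | no s≢0 = ∑-pick ks f g c 0≤g f0 (0≤∧≢0⇒0< (0≤∑ ks 0≤g) s≢0)
    (≤-by ((f k + ∑ ks f - c * (g k + ∑ ks g)) + (c * g k - f k))
      (0≤+ (p≤q⇒0≤q-p h) (<⇒≤ (p<q⇒0<q-p (≰⇒> ¬p))))
      (solve 5 (λ c a b s t → t := c :* s :+ ((b :+ t :- c :* (a :+ s)) :+ (c :* a :- b))) refl c (g k) (f k) (∑ ks g) (∑ ks f)))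
...     | yes s≡0 = contradiction (≤-<-trans h (<-≤-trans (+-mono-<-≤ (≰⇒> ¬p) rest≤0)
      (≤-reflexive (trans (+-identityʳ (c * g k)) (cong (c *_) (sym (trans (cong (λ z → g k + z) s≡0) (+-identityʳ (g k)))))))))
      (<-irrefl refl)
  where
  rest≤0 : ∑ ks f ≤ 0ℚ
  rest≤0 = ≤-eq (∑-mono-∈ ks λ a a∈ → f0 a (≤-antisym (≤-eq (term≤∑ 0≤g a∈) s≡0) (0≤g a))) (∑-zero ks)

-- Finite random choices

-- The coins of the constructed simulation, with rational weights. On binary trees, `E` and the
-- choice of an outcome no worse than the mean are plain recursions.
data Dist (Ω : Set) : Set where
  ret : Ω → Dist Ω
  mix : ∀ p → 0ℚ ≤ p → p ≤ 1ℚ → Dist Ω → Dist Ω → Dist Ω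

E : ∀ {Ω} → Dist Ω → (Ω → ℚ) → ℚ
E (ret ω)         φ = φ ω
E (mix p _ _ d e) φ = p * E d φ + (1ℚ - p) * E e φ

infixl 1 _>>=_

_>>=_ : ∀ {Ω Ω′} → Dist Ω → (Ω → Dist Ω′) → Dist Ω′
ret ω         >>= k = k ω
mix p l u d e >>= k = mix p l u (d >>= k) (e >>= k)

E->>= : ∀ {Ω Ω′} (d : Dist Ω) (k : Ω → Dist Ω′) φ → E (d >>= k) φ ≡ E d (λ ω → E (k ω) φ)
E->>= (ret ω)         k φ = refl
E->>= (mix p _ _ d e) k φ = cong₂ (λ a b → p * a + (1ℚ - p) * b) (E->>= d k φ) (E->>= e k φ)

E-cong : ∀ {Ω} (d : Dist Ω) {φ ψ : Ω → ℚ} → (∀ ω → φ ω ≡ ψ ω) → E d φ ≡ E d ψ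
E-cong (ret ω)         h = h ω
E-cong (mix p _ _ d e) h = cong₂ (λ a b → p * a + (1ℚ - p) * b) (E-cong d h) (E-cong e h)

E-mono : ∀ {Ω} (d : Dist Ω) {φ ψ : Ω → ℚ} → (∀ ω → φ ω ≤ ψ ω) → E d φ ≤ E d ψ
E-mono (ret ω)         h = h ω
E-mono (mix p 0≤p p≤1 d e) h = +-mono-≤ (*-monoˡ 0≤p (E-mono d h)) (*-monoˡ (p≤q⇒0≤q-p p≤1) (E-mono e h))

E-const : ∀ {Ω} (d : Dist Ω) c → E d (λ _ → c) ≡ c
E-const (ret ω)         c = refl
E-const (mix p _ _ d e) c = trans (cong₂ (λ a b → p * a + (1ℚ - p) * b) (E-const d c) (E-const e c))
  (solve 2 (λ p c → p :* c :+ (con 1ℚ :- p) :* c := c) refl p c)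

0≤E : ∀ {Ω} (d : Dist Ω) {φ : Ω → ℚ} → (∀ ω → 0ℚ ≤ φ ω) → 0ℚ ≤ E d φ
0≤E d h = eq-≤ (sym (E-const d 0ℚ)) (E-mono d h)

E-+ : ∀ {Ω} (d : Dist Ω) φ ψ → E d (λ ω → φ ω + ψ ω) ≡ E d φ + E d ψ
E-+ (ret ω)         φ ψ = refl
E-+ (mix p _ _ d e) φ ψ = trans (cong₂ (λ a b → p * a + (1ℚ - p) * b) (E-+ d φ ψ) (E-+ e φ ψ))
  (solve 5 (λ p a b c d → p :* (a :+ b) :+ (con 1ℚ :- p) :* (c :+ d) :=
    (p :* a :+ (con 1ℚ :- p) :* c) :+ (p :* b :+ (con 1ℚ :- p) :* d)) refl p (E d φ) (E d ψ) (E e φ) (E e ψ))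

E-*ˡ : ∀ {Ω} (d : Dist Ω) c φ → E d (λ ω → c * φ ω) ≡ c * E d φ
E-*ˡ (ret ω)         c φ = refl
E-*ˡ (mix p _ _ d e) c φ = trans (cong₂ (λ a b → p * a + (1ℚ - p) * b) (E-*ˡ d c φ) (E-*ˡ e c φ))
  (solve 4 (λ p c a b → p :* (c :* a) :+ (con 1ℚ :- p) :* (c :* b) := c :* (p :* a :+ (con 1ℚ :- p) :* b)) refl p c (E d φ) (E e φ))

E-*ʳ : ∀ {Ω} (d : Dist Ω) c φ → E d (λ ω → φ ω * c) ≡ E d φ * c
E-*ʳ d c φ = trans (E-cong d λ ω → *-comm (φ ω) c) (trans (E-*ˡ d c φ) (*-comm c (E d φ)))

E-∑ : ∀ {Ω A} (d : Dist Ω) (xs : List A) (φ : A → Ω → ℚ) → E d (λ ω → ∑ xs λ a → φ a ω) ≡ ∑ xs λ a → E d (φ a)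
E-∑ d []       φ = E-const d 0ℚ
E-∑ d (x ∷ xs) φ = trans (E-+ d (φ x) (λ ω → ∑ xs λ a → φ a ω)) (cong (λ z → E d (φ x) + z) (E-∑ d xs φ))

E-pick : ∀ {Ω} (d : Dist Ω) φ → ∃ λ ω → E d φ ≤ φ ω
E-pick (ret ω) φ = ω , ≤-refl
E-pick (mix p 0≤p p≤1 d e) φ with E-pick d φ | E-pick e φ
... | ω , h | ω′ , h′ with ≤-total (φ ω) (φ ω′)
...   | inj₁ l = ω′ , ≤-eq (+-mono-≤ (*-monoˡ 0≤p (≤-trans h l)) (*-monoˡ (p≤q⇒0≤q-p p≤1) h′))
  (solve 2 (λ p c → p :* c :+ (con 1ℚ :- p) :* c := c) refl p (φ ω′))
...   | inj₂ l = ω , ≤-eq (+-mono-≤ (*-monoˡ 0≤p h) (*-monoˡ (p≤q⇒0≤q-p p≤1) (≤-trans h′ l)))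
  (solve 2 (λ p c → p :* c :+ (con 1ℚ :- p) :* c := c) refl p (φ ω))

glue : ∀ {b} {T : Set} → (Vec Bool b → T) → (Vec Bool b → T) → Vec Bool (suc b) → T
glue F G (false ∷ l) = F l
glue F G (true  ∷ l) = G l

-- One sample for each word l, so that a continuation of the protocol can be drawn for every word
-- that might be sent.
independent : ∀ {T : Set} b → (Vec Bool b → Dist T) → Dist (Vec Bool b → T)
independent zero    D = D [] >>= λ t → ret λ _ → t
independent (suc b) D = independent b (λ l → D (false ∷ l)) >>= λ F →
  independent b (λ l → D (true ∷ l)) >>= λ G → ret (glue F G)

E-glue : ∀ {T : Set} b (D : Vec Bool (suc b) → Dist T) (φ : (Vec Bool (suc b) → T) → ℚ) →
  E (independent (suc b) D) φ ≡
  E (independent b (λ l → D (false ∷ l))) λ F → E (independent b (λ l → D (true ∷ l))) λ G → φ (glue F G)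
E-glue b D φ = trans (E->>= (independent b (λ l → D (false ∷ l))) _ φ)
  (E-cong (independent b (λ l → D (false ∷ l))) λ F → E->>= (independent b (λ l → D (true ∷ l))) _ φ)

E-marginal : ∀ {T : Set} b (D : Vec Bool b → Dist T) l (φ : T → ℚ) → E (independent b D) (λ F → φ (F l)) ≡ E (D l) φ
E-marginal zero    D [] φ = E->>= (D []) _ _
E-marginal (suc b) D (false ∷ l) φ = trans (E-glue b D (λ F → φ (F (false ∷ l))))
  (trans (E-cong (independent b (λ l → D (false ∷ l))) λ F → E-const (independent b (λ l → D (true ∷ l))) (φ (F l)))
    (E-marginal b (λ l → D (false ∷ l)) l φ))
E-marginal (suc b) D (true ∷ l) φ = trans (E-glue b D (λ F → φ (F (true ∷ l))))
  (trans (E-const (independent b (λ l → D (false ∷ l))) _) (E-marginal b (λ l → D (true ∷ l)) l φ))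

-- Sending a message to a receiver who knows its distribution roughly

absent : {U : Set} → Maybe U → ℚ
absent nothing  = 1ℚ
absent (just _) = 0ℚ

present : {U : Set} → (U → Bool) → Maybe U → ℚ
present J nothing  = 0ℚ
present J (just u) = ⟦ J u ⟧

absent≤1 : {U : Set} (m : Maybe U) → absent m ≤ 1ℚ
absent≤1 nothing  = ≤-refl
absent≤1 (just _) = 0≤1

0≤present : {U : Set} (J : U → Bool) (m : Maybe U) → 0ℚ ≤ present J m
0≤present J nothing  = ≤-refl
0≤present J (just u) = 0≤⟦⟧ (J u)

geom : ℚ → ℕ → ℚ
geom ζ b = (1ℚ - ζ) ^ (2 ℕ.^ b)

geom-suc : ∀ ζ b → geom ζ (suc b) ≡ geom ζ b * geom ζ b
geom-suc ζ b = trans (^-+ (1ℚ - ζ) (2 ℕ.^ b) (2 ℕ.^ b ℕ.+ 0))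
  (cong (λ n → geom ζ b * (1ℚ - ζ) ^ n) (ℕ.+-identityʳ (2 ℕ.^ b)))

module _ {U : Set} where

  first : (U → Bool) → List U → Maybe U
  first S []      = nothing
  first S (u ∷ V) = if S u then just u else first S V

  # : (U → Bool) → List U → ℚ
  # S us = ∑ us λ u → ⟦ S u ⟧

  0≤# : ∀ S us → 0ℚ ≤ # S us
  0≤# S us = 0≤∑ us λ u → 0≤⟦⟧ (S u)

  -- The event that V has exactly one element in S, and that this is in J.
  sole : (J S : U → Bool) → List U → ℚ
  sole J S []      = 0ℚ
  sole J S (u ∷ V) = if S u then ⟦ J u ⟧ * absent (first S V) else sole J S V

  module _ (δ : ℚ) (0≤δ : 0ℚ ≤ δ) (δ≤1 : δ ≤ 1ℚ) where

    sublist : List U → Dist (List U)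
    sublist []       = ret []
    sublist (u ∷ us) = sublist us >>= λ V → mix δ 0≤δ δ≤1 (ret (u ∷ V)) (ret V)

    E-sublist : ∀ u us φ → E (sublist (u ∷ us)) φ ≡ δ * E (sublist us) (λ V → φ (u ∷ V)) + (1ℚ - δ) * E (sublist us) φ
    E-sublist u us φ = trans (E->>= (sublist us) _ φ)
      (trans (E-+ (sublist us) (λ V → δ * φ (u ∷ V)) (λ V → (1ℚ - δ) * φ V))
        (cong₂ _+_ (E-*ˡ (sublist us) δ _) (E-*ˡ (sublist us) (1ℚ - δ) φ)))

    0≤1-δ : 0ℚ ≤ 1ℚ - δ
    0≤1-δ = p≤q⇒0≤q-p δ≤1

    -- The union bound, by (1 - δ)(1 - δ s) ≥ 1 - δ (1 + s).
    E-absent : ∀ S us → 1ℚ - δ * # S us ≤ E (sublist us) (λ V → absent (first S V))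
    E-absent S [] = ≤-reflexive (solve 1 (λ d → con 1ℚ :- d :* con 0ℚ := con 1ℚ) refl δ)
    E-absent S (u ∷ us) = ≤-eq (step (S u) refl) (sym (E-sublist u us _))
      where
      d = sublist us
      a = E d (λ V → absent (first S V))
      step : ∀ s → S u ≡ s → 1ℚ - δ * (⟦ S u ⟧ + # S us) ≤ δ * E d (λ V → absent (first S (u ∷ V))) + (1ℚ - δ) * a
      step true e rewrite e | E-const d 0ℚ = ≤-trans
        (≤-by (δ * δ * # S us) (0≤* (0≤* 0≤δ 0≤δ) (0≤# S us))
          (solve 2 (λ d s → d :* con 0ℚ :+ (con 1ℚ :- d) :* (con 1ℚ :- d :* s) :=
            con 1ℚ :- d :* (con 1ℚ :+ s) :+ d :* d :* s) refl δ (# S us)))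
        (+-monoʳ-≤ (δ * 0ℚ) (*-monoˡ 0≤1-δ (E-absent S us)))
      step false e rewrite e = ≤-trans
        (≤-reflexive (solve 2 (λ d s → con 1ℚ :- d :* (con 0ℚ :+ s) := con 1ℚ :- d :* s) refl δ (# S us)))
        (≤-trans (E-absent S us) (≤-reflexive (solve 2 (λ d a → a := d :* a :+ (con 1ℚ :- d) :* a) refl δ a)))

    -- For each u in J, the event that u is drawn and nothing else of S has probability at least δ
    -- (1 - δ s), where s counts S, and these events are disjoint.
    E-sole : ∀ J S us → (∀ u → J u ≡ true → S u ≡ true) →
      δ * # J us * (1ℚ - δ * # S us) ≤ E (sublist us) (sole J S)
    E-sole J S [] _ = ≤-reflexive (solve 1 (λ d → d :* con 0ℚ :* (con 1ℚ :- d :* con 0ℚ) := con 0ℚ) refl δ)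
    E-sole J S (u ∷ us) J⊂S = ≤-eq (step (S u) refl) (sym (E-sublist u us _))
      where
      d = sublist us
      j = # J us
      s = # S us
      J⁻ : S u ≡ false → J u ≡ false
      J⁻ e with J u in eq
      ... | false = refl
      ... | true = trans (sym (J⊂S u eq)) e
      step : ∀ b → S u ≡ b → δ * (⟦ J u ⟧ + j) * (1ℚ - δ * (⟦ S u ⟧ + s)) ≤
        δ * E d (λ V → sole J S (u ∷ V)) + (1ℚ - δ) * E d (sole J S)
      step true e rewrite e | E-*ˡ d ⟦ J u ⟧ (λ V → absent (first S V)) = ≤-trans
        (≤-by (δ * ⟦ J u ⟧ * δ + δ * j * (δ * δ * s))
          (0≤+ (0≤* (0≤* 0≤δ (0≤⟦⟧ (J u))) 0≤δ) (0≤* (0≤* 0≤δ (0≤# J us)) (0≤* (0≤* 0≤δ 0≤δ) (0≤# S us))))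
          (solve 4 (λ d i j s → d :* (i :* (con 1ℚ :- d :* s)) :+ (con 1ℚ :- d) :* (d :* j :* (con 1ℚ :- d :* s)) :=
             d :* (i :+ j) :* (con 1ℚ :- d :* (con 1ℚ :+ s)) :+ (d :* i :* d :+ d :* j :* (d :* d :* s))) refl δ ⟦ J u ⟧ j s))
        (+-mono-≤ (*-monoˡ 0≤δ (*-monoˡ (0≤⟦⟧ (J u)) (E-absent S us))) (*-monoˡ 0≤1-δ (E-sole J S us J⊂S)))
      step false e rewrite e | J⁻ e = ≤-trans
        (≤-reflexive (solve 3 (λ d j s → d :* (con 0ℚ :+ j) :* (con 1ℚ :- d :* (con 0ℚ :+ s)) := d :* j :* (con 1ℚ :- d :* s)) refl δ j s))
        (≤-trans (E-sole J S us J⊂S) (≤-reflexive (solve 2 (λ d a → a := d :* a :+ (con 1ℚ :- d) :* a) refl δ (E d (sole J S)))))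

  -- If the only element of V in G or H lies in J and G, it lies in H too, so both searches stop at
  -- it.
  sole≤ : ∀ (J G H : U → Bool) → (∀ u → J u ≡ true → G u ≡ true → H u ≡ true) → ∀ V →
    sole (λ u → J u ∧ G u) (λ u → G u ∨ H u) V ≤ present J (first G V) * present J (first H V)
  sole≤ J G H h [] = ≤-reflexive (sym (*-zeroˡ 0ℚ))
  sole≤ J G H h (u ∷ V) = step
    where
    null : ∀ m m′ → 0ℚ * absent (first (λ u → G u ∨ H u) V) ≤ present J m * present J m′
    null m m′ = eq-≤ (*-zeroˡ (absent (first (λ u → G u ∨ H u) V))) (0≤* (0≤present J m) (0≤present J m′))
    step : sole (λ u → J u ∧ G u) (λ u → G u ∨ H u) (u ∷ V) ≤ present J (first G (u ∷ V)) * present J (first H (u ∷ V))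
    step with J u in eJ | G u in eG | H u in eH
    ... | true  | true  | true  rewrite eJ = ≤-eq (eq-≤ (*-identityˡ _) (absent≤1 (first (λ u → G u ∨ H u) V))) (sym (*-identityˡ 1ℚ))
    ... | true  | true  | false = contradiction (trans (sym eH) (h u eJ eG)) λ ()
    ... | false | true  | true  = null (just u) (just u)
    ... | false | true  | false = null (just u) (first H V)
    ... | true  | false | true  = null (first G V) (just u)
    ... | false | false | true  = null (first G V) (just u)
    ... | true  | false | false = sole≤ J G H h V
    ... | false | false | false = sole≤ J G H h V

  -- The sender looks for the first of the 2^b lists with an element in G.
  search : ∀ b → (Vec Bool b → List U) → (U → Bool) → Maybe (Vec Bool b × U)
  search zero    K G with first G (K [])
  ... | nothing = nothing
  ... | just u  = just ([] , u)
  search (suc b) K G with search b (λ l → K (false ∷ l)) G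
  ... | just (l , u) = just (false ∷ l , u)
  ... | nothing with search b (λ l → K (true ∷ l)) G
  ...   | just (l , u) = just (true ∷ l , u)
  ...   | nothing = nothing

  -- Worth 1 if both parties end in J, which will be the set of points carrying a given message.
  hit : ∀ b → (Vec Bool b → List U) → (J G H : U → Bool) → ℚ
  hit b K J G H with search b K G
  ... | nothing      = 0ℚ
  ... | just (l , u) = ⟦ J u ⟧ * present J (first H (K l))

  absent-zero : ∀ K G → absent (search zero K G) ≡ absent (first G (K []))
  absent-zero K G with first G (K [])
  ... | nothing = refl
  ... | just _  = refl

  hit-zero : ∀ K J G H → hit zero K J G H ≡ present J (first G (K [])) * present J (first H (K []))
  hit-zero K J G H with first G (K [])
  ... | nothing = sym (*-zeroˡ (present J (first H (K []))))
  ... | just u  = refl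

  absent-suc : ∀ b K G → absent (search (suc b) K G) ≡
    absent (search b (λ l → K (false ∷ l)) G) * absent (search b (λ l → K (true ∷ l)) G)
  absent-suc b K G with search b (λ l → K (false ∷ l)) G
  ... | just _ = sym (*-zeroˡ (absent (search b (λ l → K (true ∷ l)) G)))
  ... | nothing with search b (λ l → K (true ∷ l)) G
  ...   | just _  = refl
  ...   | nothing = refl

  hit-suc : ∀ b K J G H → hit (suc b) K J G H ≡ hit b (λ l → K (false ∷ l)) J G H +
    absent (search b (λ l → K (false ∷ l)) G) * hit b (λ l → K (true ∷ l)) J G H
  hit-suc b K J G H with search b (λ l → K (false ∷ l)) G
  ... | just (l , u) = sym (trans (cong (λ z → ⟦ J u ⟧ * present J (first H (K (false ∷ l))) + z) (*-zeroˡ (hit b (λ l → K (true ∷ l)) J G H))) (+-identityʳ _))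
  ... | nothing with search b (λ l → K (true ∷ l)) G
  ...   | just _  = sym (trans (+-identityˡ _) (*-identityˡ _))
  ...   | nothing = refl

  module _ (d : Dist (List U)) (J G H : U → Bool) (ζ y : ℚ) (0≤ζ : 0ℚ ≤ ζ) (ζ≤1 : ζ ≤ 1ℚ) (0≤y : 0ℚ ≤ y)
    (h-absent : 1ℚ - ζ ≤ E d (λ V → absent (first G V)))
    (h-hit : ζ * y ≤ E d (λ V → present J (first G V) * present J (first H V))) where

    lists : ∀ b → Dist (Vec Bool b → List U)
    lists b = independent b λ _ → d

    0≤geom : ∀ b → 0ℚ ≤ geom ζ b
    0≤geom b = 0≤^ (2 ℕ.^ b) (p≤q⇒0≤q-p ζ≤1)

    E-search : ∀ b → geom ζ b ≤ E (lists b) (λ K → absent (search b K G))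
    E-search zero = ≤-trans (eq-≤ (*-identityʳ (1ℚ - ζ)) h-absent) (≤-reflexive (sym
      (trans (E-cong (lists 0) (λ K → absent-zero K G)) (E-marginal 0 (λ _ → d) [] (λ V → absent (first G V))))))
    E-search (suc b) = ≤-trans (eq-≤ (geom-suc ζ b)
      (*-mono (0≤geom b) (≤-trans (0≤geom b) (E-search b)) (E-search b) (E-search b)))
      (≤-reflexive (sym (trans (E-glue b (λ _ → d) _)
        (trans (E-cong (lists b) λ F → trans (E-cong (lists b) λ F′ → absent-suc b (glue F F′) G)
          (E-*ˡ (lists b) (absent (search b F G)) _))
        (E-*ʳ (lists b) _ _)))))

    -- The right side is at least the geometric sum of (1 - ζ)^j ζ y over 2^b lists. The induction
    -- halves the lists: the second half counts when the first has no candidate. For this reason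
    -- `E-search` bounds the absence of candidates from below.
    E-hit : ∀ b → (1ℚ - geom ζ b) * y ≤ E (lists b) (λ K → hit b K J G H)
    E-hit zero = ≤-trans (≤-trans (≤-reflexive (solve 2 (λ z y →
      (con 1ℚ :- (con 1ℚ :- z) :* con 1ℚ) :* y := z :* y) refl ζ y)) h-hit) (≤-reflexive (sym
      (trans (E-cong (lists 0) (λ K → hit-zero K J G H)) (E-marginal 0 (λ _ → d) [] (λ V → present J (first G V) * present J (first H V))))))
    E-hit (suc b) = ≤-trans (≤-reflexive (trans (cong (λ z → (1ℚ - z) * y) (geom-suc ζ b))
        (solve 2 (λ n y → (con 1ℚ :- n :* n) :* y := (con 1ℚ :- n) :* y :+ n :* ((con 1ℚ :- n) :* y)) refl (geom ζ b) y)))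
      (≤-trans (+-mono-≤ (E-hit b) (*-mono (0≤* 0≤1-n 0≤y) (≤-trans (0≤geom b) (E-search b)) (E-search b) (E-hit b)))
      (≤-reflexive (sym (trans (E-glue b (λ _ → d) _)
        (trans (E-cong (lists b) λ F → trans (E-cong (lists b) λ F′ → hit-suc b (glue F F′) J G H)
          (trans (E-+ (lists b) (λ _ → hit b F J G H) _)
          (cong₂ _+_ (E-const (lists b) (hit b F J G H)) (E-*ˡ (lists b) (absent (search b F G)) _))))
        (trans (E-+ (lists b) (λ F → hit b F J G H) _) (cong (λ z → E (lists b) (λ F → hit b F J G H) + z) (E-*ʳ (lists b) _ _))))))))
      where
      0≤1-n : 0ℚ ≤ 1ℚ - geom ζ b
      0≤1-n = p≤q⇒0≤q-p (^≤1 (2 ℕ.^ b) (p≤q⇒0≤q-p ζ≤1) (≤-by ζ 0≤ζ (solve 1 (λ z → con 1ℚ := (con 1ℚ :- z) :+ z) refl ζ)))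

-- That is (1 - ζ)^N ≤ 1 / (1 + N ζ) for N = 2^b. Squaring passes from N to 2 N, since (1 + x)² ≥ 1
-- + 2 x.
geom-small : ∀ ζ b → 0ℚ ≤ ζ → ζ ≤ 1ℚ → geom ζ b * (1ℚ + natℚ (2 ℕ.^ b) * ζ) ≤ 1ℚ
geom-small ζ zero 0≤ζ ζ≤1 = ≤-by (ζ * ζ) (0≤sq ζ) (solve 1 (λ z →
  con 1ℚ := (con 1ℚ :- z) :* con 1ℚ :* (con 1ℚ :+ con 1ℚ :* z) :+ z :* z) refl ζ)
geom-small ζ (suc b) 0≤ζ ζ≤1 = ≤-trans
  (eq-≤ (cong₂ _*_ (geom-suc ζ b) (cong (λ z → 1ℚ + z * ζ) (natℚ-* 2 (2 ℕ.^ b))))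
    (≤-by (n * n * (N * ζ * (N * ζ))) (0≤* (0≤sq n) (0≤sq (N * ζ)))
      (trans (solve 2 (λ n x → (n :* (con 1ℚ :+ x)) :* (n :* (con 1ℚ :+ x)) := n :* n :* (con 1ℚ :+ con 2ℚ :* x) :+ n :* n :* (x :* x)) refl n (N * ζ))
        (cong (λ z → n * n * (1ℚ + z) + n * n * (N * ζ * (N * ζ))) (sym (*-assoc 2ℚ N ζ))))))
  (*≤1 0≤a a≤1 0≤a a≤1)
  where
  n = geom ζ b
  N = natℚ (2 ℕ.^ b)
  0≤a = 0≤* (0≤^ (2 ℕ.^ b) (p≤q⇒0≤q-p ζ≤1)) (0≤+ 0≤1 (0≤* (0≤natℚ (2 ℕ.^ b)) 0≤ζ))
  a≤1 = geom-small ζ b 0≤ζ ζ≤1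

IsMultiple : ℚ → ℚ → Set
IsMultiple d q = ∃ λ a → d * q ≡ natℚ a

integral-multiple : ∀ q → 0ℚ ≤ q → ∃ λ k → IsMultiple (natℚ (suc k)) q
integral-multiple q@(ℚ.mkℚ (+ n) d _) _ = d , n , trans (cong (natℚ (suc d) *_) (trans (sym (↥p/↧p≡p q)) (frac≡* n d)))
  (trans (solve 3 (λ d n i → d :* (n :* i) := n :* (d :* i)) refl (natℚ (suc d)) (natℚ n) (1/suc d))
    (trans (cong (natℚ n *_) (suc*1/suc d)) (*-identityʳ (natℚ n))))
integral-multiple (ℚ.mkℚ (ℤ.-[1+ _ ]) _ _) (ℚ.*≤* ())

abstract
  -- Makes a probability q the exact fraction of the levels ρ < D that lie below D q, so that
  -- sampling under the graph of a belief needs only finitely many points.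
  common-denominator : (l : List ℚ) → ∃ λ D → 0ℚ < natℚ D × (∀ q → q ∈ l → 0ℚ ≤ q → IsMultiple (natℚ D) q)
  common-denominator [] = 1 , 0<1 , λ _ ()
  common-denominator (p ∷ l) = by-cases (common-denominator l) (ℚ._≤?_ 0ℚ p)
    where
    Result : List ℚ → Set
    Result l = ∃ λ D → 0ℚ < natℚ D × (∀ q → q ∈ l → 0ℚ ≤ q → IsMultiple (natℚ D) q)
    scale : ∀ D k p a → natℚ (suc k) * p ≡ natℚ a → natℚ (suc k ℕ.* D) * p ≡ natℚ (D ℕ.* a)
    scale D k p a e = trans (cong (λ z → z * p) (natℚ-* (suc k) D))
      (trans (solve 3 (λ k d p → k :* d :* p := d :* (k :* p)) refl (natℚ (suc k)) (natℚ D) p)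
        (trans (cong (λ z → natℚ D * z) e) (sym (natℚ-* D a))))
    scale′ : ∀ D k q a → natℚ D * q ≡ natℚ a → natℚ (suc k ℕ.* D) * q ≡ natℚ (suc k ℕ.* a)
    scale′ D k q a e = trans (cong (λ z → z * q) (natℚ-* (suc k) D))
      (trans (*-assoc (natℚ (suc k)) (natℚ D) q) (trans (cong (λ z → natℚ (suc k) * z) e) (sym (natℚ-* (suc k) a))))
    extend : (∃ λ k → IsMultiple (natℚ (suc k)) p) → Result l → Result (p ∷ l)
    extend (k , a , e) (D , 0<D , h) = suc k ℕ.* D , subst (λ z → 0ℚ < z) (sym (natℚ-* (suc k) D)) (0<* (natℚ-mono-< {0} {suc k} (s≤s z≤n)) 0<D) , multiple
      where
      multiple : ∀ q → q ∈ p ∷ l → 0ℚ ≤ q → IsMultiple (natℚ (suc k ℕ.* D)) q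
      multiple q (here refl) _   = D ℕ.* a , scale D k p a e
      multiple q (there i)   0≤q = let a′ , e′ = h q i 0≤q in suc k ℕ.* a′ , scale′ D k q a′ e′
    by-cases : Result l → Dec (0ℚ ≤ p) → Result (p ∷ l)
    by-cases result        (yes 0≤p) = extend (integral-multiple p 0≤p) result
    by-cases (D , 0<D , h) (no ¬0≤p) = D , 0<D , multiple
      where
      multiple : ∀ q → q ∈ p ∷ l → 0ℚ ≤ q → IsMultiple (natℚ D) q
      multiple q (here refl) 0≤q = contradiction 0≤q ¬0≤p
      multiple q (there i)   0≤q = h q i 0≤q

below : ℚ → ℕ → Bool
below q ρ = does (ℚ._<?_ (natℚ ρ) q)

count-below : ∀ D a → # (below (natℚ a)) (List.downFrom D) ≡ natℚ (a ℕ.⊓ D)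
count-below zero    a = cong natℚ (sym (ℕ.⊓-zeroʳ a))
count-below (suc D) a = trans (cong₂ _+_ (cong ⟦_⟧ (does-⇔ (ℚ._<?_ (natℚ D) (natℚ a)) (D ℕ.<? a) (natℚ-cancel-< {D} {a}) (natℚ-mono-< {D} {a}))) (count-below D a))
  (by-cases (D ℕ.<? a))
  where
  by-cases : (d : Dec (D ℕ.< a)) → ⟦ does d ⟧ + natℚ (a ℕ.⊓ D) ≡ natℚ (a ℕ.⊓ suc D)
  by-cases (yes D<a) = trans (cong (λ n → 1ℚ + natℚ n) (ℕ.m≥n⇒m⊓n≡n (ℕ.<⇒≤ D<a))) (trans (sym (natℚ-suc D)) (cong natℚ (sym (ℕ.m≥n⇒m⊓n≡n D<a))))
  by-cases (no D≮a)  = trans (+-identityˡ (natℚ (a ℕ.⊓ D))) (cong natℚ (trans (ℕ.m≤n⇒m⊓n≡m a≤D) (sym (ℕ.m≤n⇒m⊓n≡m (ℕ.m≤n⇒m≤1+n a≤D)))))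
    where a≤D = ℕ.≮⇒≥ D≮a

count-below-≤ : ∀ D {q} → (IsMultiple (natℚ D) q) → # (below (natℚ D * q)) (List.downFrom D) ≤ natℚ D * q
count-below-≤ D {q} (a , e) = subst (λ z → # (below z) (List.downFrom D) ≤ z) (sym e)
  (eq-≤ (count-below D a) (natℚ-mono {a ℕ.⊓ D} {a} (ℕ.m⊓n≤m a D)))

count-below-≡ : ∀ D {q} → q ≤ 1ℚ → (IsMultiple (natℚ D) q) → # (below (natℚ D * q)) (List.downFrom D) ≡ natℚ D * q
count-below-≡ D {q} q≤1 (a , e) = subst (λ z → # (below z) (List.downFrom D) ≡ z) (sym e)
  (trans (count-below D a) (cong natℚ (ℕ.m≤n⇒m⊓n≡m (natℚ-cancel-≤ {a} {D} (eq-≤ (sym e) (≤-eq (*-monoˡ (0≤natℚ D) q≤1) (*-identityʳ (natℚ D))))))))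

⟦∨⟧≤ : ∀ a b → ⟦ a ∨ b ⟧ ≤ ⟦ a ⟧ + ⟦ b ⟧
⟦∨⟧≤ true  b = p≤p+q 1ℚ (0≤⟦⟧ b)
⟦∨⟧≤ false b = ≤-reflexive (sym (+-identityˡ ⟦ b ⟧))

∧⇒∨ : ∀ a b c → a ∧ b ≡ true → b ∨ c ≡ true
∧⇒∨ true true c _ = refl

module Round {A B M : Set} (_≟_ : DecidableEquality M) (m₀ : M)
  {as : List A} {bs : List B} {ms : List M}
  (as-all : ∀ a → a ∈ as) (bs-all : ∀ b → b ∈ bs) (ms-unique : Unique ms)
  (K ζ : ℚ) (b : ℕ) (0≤K : 0ℚ ≤ K) (0≤ζ : 0ℚ ≤ ζ) (ζ≤1 : ζ ≤ 1ℚ) (0≤κ : 0ℚ ≤ 1ℚ - ζ * (1ℚ + K))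
  (p : A → M → ℚ) (q : B → M → ℚ) (0≤p : ∀ a m → 0ℚ ≤ p a m) (0≤q : ∀ b m → 0ℚ ≤ q b m)
  (∑p≤1 : ∀ a → ∑ ms (p a) ≤ 1ℚ) (∑q≤1 : ∀ b → ∑ ms (q b) ≤ 1ℚ)
  where

  values : List ℚ
  values = cartesianProductWith p as ms ++ cartesianProductWith (λ b m → K * q b m) bs ms

  D : ℕ
  D = proj₁ (common-denominator values)

  0<D : 0ℚ < natℚ D
  0<D = proj₁ (proj₂ (common-denominator values))

  pD : ∀ a {m} → m ∈ ms → IsMultiple (natℚ D) (p a m)
  pD a m∈ = proj₂ (proj₂ (common-denominator values)) (p a _) (∈.∈-++⁺ˡ (∈.∈-cartesianProductWith⁺ p (as-all a) m∈)) (0≤p a _)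

  qD : ∀ b {m} → m ∈ ms → IsMultiple (natℚ D) (K * q b m)
  qD b m∈ = proj₂ (proj₂ (common-denominator values)) (K * q b _)
    (∈.∈-++⁺ʳ (cartesianProductWith p as ms) (∈.∈-cartesianProductWith⁺ (λ b m → K * q b m) (bs-all b) m∈)) (0≤* 0≤K (0≤q b _))

  U : Set
  U = M × ℕ

  us : List U
  us = cartesianProduct ms (List.downFrom D)

  -- The points under the graph of the speaker's belief; `H` has those under K times the listener's.
  -- Where p ≤ K q, every candidate of the speaker is plausible to the listener: this is rejection
  -- sampling.
  G : A → U → Bool
  G a (m , ρ) = below (natℚ D * p a m) ρ

  H : B → U → Bool
  H b (m , ρ) = below (natℚ D * (K * q b m)) ρ

  J : M → U → Bool
  J m (m′ , _) = does (m′ ≟ m)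

  -- At this density a list contains on average at most ζ candidates of the speaker and at most ζ K
  -- of the listener.
  δ : ℚ
  δ = ζ * inv (natℚ D)

  0≤δ : 0ℚ ≤ δ
  0≤δ = 0≤* 0≤ζ (0≤inv (<⇒≤ 0<D))

  δD : δ * natℚ D ≡ ζ
  δD = trans (solve 3 (λ z i d → z :* i :* d := z :* (d :* i)) refl ζ (inv (natℚ D)) (natℚ D))
    (trans (cong (ζ *_) (*-inv 0<D)) (*-identityʳ ζ))

  1≤D : 1ℚ ≤ natℚ D
  1≤D = natℚ-mono {1} {D} (natℚ-cancel-< {0} {D} 0<D)

  δ≤1 : δ ≤ 1ℚ
  δ≤1 = ≤-trans (≤-trans (eq-≤ (sym (*-identityʳ δ)) (*-monoˡ 0≤δ 1≤D)) (≤-reflexive δD)) ζ≤1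

  #-rows : ∀ S → # S us ≡ ∑ ms λ m → # (λ ρ → S (m , ρ)) (List.downFrom D)
  #-rows S = ∑-cartesian _,_ ms (List.downFrom D) λ u → ⟦ S u ⟧

  δ#G : ∀ a → δ * # (G a) us ≤ ζ
  δ#G a = ≤-trans (*-monoˡ 0≤δ (≤-trans (≤-reflexive (#-rows (G a)))
    (≤-trans (∑-mono-∈ ms λ m m∈ → count-below-≤ D (pD a m∈))
    (≤-trans (≤-reflexive (∑-*ˡ ms (natℚ D) (p a))) (*-monoˡ (0≤natℚ D) (∑p≤1 a))))))
    (≤-reflexive (trans (cong (δ *_) (*-identityʳ (natℚ D))) δD))

  δ#H : ∀ b → δ * # (H b) us ≤ ζ * K
  δ#H b = ≤-trans (*-monoˡ 0≤δ (≤-trans (≤-reflexive (#-rows (H b)))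
    (≤-trans (∑-mono-∈ ms λ m m∈ → count-below-≤ D (qD b m∈))
    (≤-trans (≤-reflexive (trans (∑-*ˡ ms (natℚ D) (λ m → K * q b m)) (cong (natℚ D *_) (∑-*ˡ ms K (q b)))))
      (*-monoˡ (0≤natℚ D) (*-monoˡ 0≤K (∑q≤1 b)))))))
    (≤-reflexive (trans (solve 3 (λ d D K → d :* (D :* (K :* con 1ℚ)) := d :* D :* K) refl δ (natℚ D) K) (cong (_* K) δD)))

  δ#S : ∀ a b → δ * # (λ u → G a u ∨ H b u) us ≤ ζ * (1ℚ + K)
  δ#S a b = ≤-trans (*-monoˡ 0≤δ (≤-eq (∑-mono us λ u → ⟦∨⟧≤ (G a u) (H b u)) (∑-+ us (λ u → ⟦ G a u ⟧) (λ u → ⟦ H b u ⟧))))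
    (≤-trans (≤-reflexive (*-distribˡ-+ δ (# (G a) us) (# (H b) us))) (≤-eq (+-mono-≤ (δ#G a) (δ#H b))
      (solve 2 (λ z k → z :+ z :* k := z :* (con 1ℚ :+ k)) refl ζ K)))

  p≤1 : ∀ a {m} → m ∈ ms → p a m ≤ 1ℚ
  p≤1 a m∈ = ≤-trans (term≤∑ (0≤p a) m∈) (∑p≤1 a)

  δ#J : ∀ a {m} → m ∈ ms → δ * # (λ u → J m u ∧ G a u) us ≡ ζ * p a m
  δ#J a {m} m∈ = trans (cong (δ *_) (trans (#-rows (λ u → J m u ∧ G a u))
    (trans (∑-cong ms λ m′ → trans (∑-cong (List.downFrom D) λ ρ → ⟦∧⟧ (does (m′ ≟ m)) (G a (m′ , ρ)))
                               (∑-*ˡ (List.downFrom D) ⟦ does (m′ ≟ m) ⟧ (λ ρ → ⟦ G a (m′ , ρ) ⟧)))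
    (trans (∑-δ _≟_ (λ m′ → # (λ ρ → G a (m′ , ρ)) (List.downFrom D)) m ms-unique m∈)
      (count-below-≡ D (p≤1 a m∈) (pD a m∈))))))
    (trans (sym (*-assoc δ (natℚ D) (p a m))) (cong (_* p a m) δD))

  -- Without a candidate an arbitrary word and message are sent. All later estimates bound the
  -- agreement from below, so these defaults do no harm.
  sent : (Vec Bool b → List U) → A → Vec Bool b × M
  sent L a with search b L (G a)
  ... | nothing            = replicate b false , m₀
  ... | just (l , (m , _)) = l , m

  received : (Vec Bool b → List U) → B → Vec Bool b → M
  received L y l with first (H y) (L l)
  ... | nothing      = m₀
  ... | just (m , _) = m

  Code : Set
  Code = (A → Vec Bool b × M) × (B → Vec Bool b → M)

  agree : A → B → M → Code → ℚ
  agree a y m (s , t) = ⟦ does (proj₂ (s a) ≟ m) ⟧ * ⟦ does (t y (proj₁ (s a)) ≟ m) ⟧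

  hit≤agree : ∀ L a y m → hit b L (J m) (G a) (H y) ≤ agree a y m (sent L , received L)
  hit≤agree L a y m with search b L (G a)
  ... | nothing = 0≤* (0≤⟦⟧ (does (m₀ ≟ m))) (0≤⟦⟧ (does (received L y (replicate b false) ≟ m)))
  ... | just (l , (m′ , _)) with first (H y) (L l)
  ...   | nothing      = eq-≤ (*-zeroʳ ⟦ does (m′ ≟ m) ⟧) (0≤* (0≤⟦⟧ (does (m′ ≟ m))) (0≤⟦⟧ (does (m₀ ≟ m))))
  ...   | just (_ , _) = ≤-refl

  code : Dist Code
  code = independent b (λ _ → sublist δ 0≤δ δ≤1 us) >>= λ L → ret (sent L , received L)

  -- A single list yields m with probability at least ζ p(m) (1 - ζ (1 + K)): the first part is for
  -- a point of row m to be drawn, the last factor for the absence of rivals. The 2^b lists then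
  -- raise the factor ζ to 1 - `geom ζ b`.
  E-agree : ∀ a y m → m ∈ ms → p a m ≤ K * q y m →
    (1ℚ - geom ζ b) * (p a m * (1ℚ - ζ * (1ℚ + K))) ≤ E code (agree a y m)
  E-agree a y m m∈ p≤Kq = ≤-trans
    (E-hit (sublist δ 0≤δ δ≤1 us) (J m) (G a) (H y) ζ (p a m * (1ℚ - ζ * (1ℚ + K))) 0≤ζ ζ≤1 (0≤* (0≤p a m) 0≤κ)
      (≤-trans (+-monoʳ-≤ 1ℚ (neg-antimono-≤ (δ#G a))) (E-absent δ 0≤δ δ≤1 (G a) us))
      (≤-trans (≤-reflexive (trans (sym (*-assoc ζ (p a m) _)) (cong (_* (1ℚ - ζ * (1ℚ + K))) (sym (δ#J a m∈)))))
      (≤-trans (*-monoˡ (0≤* 0≤δ (0≤# (λ u → J m u ∧ G a u) us)) (+-monoʳ-≤ 1ℚ (neg-antimono-≤ (δ#S a y))))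
      (≤-trans (E-sole δ 0≤δ δ≤1 (λ u → J m u ∧ G a u) (λ u → G a u ∨ H y u) us J⊂S)
        (E-mono (sublist δ 0≤δ δ≤1 us) (sole≤ (J m) (G a) (H y) J∧G⊂H)))))
      b)
    (≤-trans (E-mono (independent b λ _ → sublist δ 0≤δ δ≤1 us) λ L → hit≤agree L a y m)
      (≤-reflexive (sym (E->>= (independent b λ _ → sublist δ 0≤δ δ≤1 us) _ (agree a y m)))))
    where
    J⊂S : ∀ u → J m u ∧ G a u ≡ true → G a u ∨ H y u ≡ true
    J⊂S u = ∧⇒∨ (J m u) (G a u) (H y u)
    J∧G⊂H : ∀ u → J m u ≡ true → G a u ≡ true → H y u ≡ true
    J∧G⊂H (m′ , ρ) hJ hG = dec-true (ℚ._<?_ (natℚ ρ) (natℚ D * (K * q y m′)))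
      (<-≤-trans (does-true (ℚ._<?_ (natℚ ρ) (natℚ D * p a m′)) hG) (*-monoˡ (0≤natℚ D)
        (subst (λ m → p a m ≤ K * q y m) (sym (does-true (m′ ≟ m) hJ)) p≤Kq)))

  success : ℚ
  success = (1ℚ - geom ζ b) * (1ℚ - ζ * (1ℚ + K))

  ∑agree≤1 : ∀ a y k → ∑ ms (λ m → agree a y m k) ≤ 1ℚ
  ∑agree≤1 a y (s , t) = begin
    ∑ ms (λ m → agree a y m (s , t))      ≤⟨ ∑-mono ms (λ m → *-mono {⟦ does (c ≟ m) ⟧} {⟦ does (m ≟ c) ⟧} {⟦ does (d ≟ m) ⟧} {1ℚ}
                                               (0≤⟦⟧ (does (d ≟ m))) (0≤⟦⟧ (does (m ≟ c))) (flip m) (⟦⟧≤1 (does (d ≟ m)))) ⟩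
    ∑ ms (λ m → ⟦ does (m ≟ c) ⟧ * 1ℚ)    ≤⟨ ∑-δ-≤ _≟_ (λ _ → 1ℚ) c ms-unique 0≤1 ⟩
    1ℚ                                    ∎
    where
    open ≤-Reasoning
    c d : M
    c = proj₂ (s a)
    d = t y (proj₁ (s a))
    flip : ∀ m → ⟦ does (c ≟ m) ⟧ ≤ ⟦ does (m ≟ c) ⟧
    flip m = ≤-reflexive (cong ⟦_⟧ (does-⇔ (c ≟ m) (m ≟ c) sym sym))

  -- Here c m is the value of going on once both parties hold m, and R the value of the round under
  -- a given code. A code agrees on at most one m, so the contributions of all m may be added.
  E-code : ∀ a y (R : Code → ℚ) (c : M → ℚ) → (∀ k → 0ℚ ≤ R k) → (∀ m → 0ℚ ≤ c m) →
    (∀ s t m → proj₂ (s a) ≡ m → t y (proj₁ (s a)) ≡ m → c m ≤ R (s , t)) →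
    success * ∑ ms (λ m → ⟦ does (ℚ._≤?_ (p a m) (K * q y m)) ⟧ * (p a m * c m)) ≤ E code R
  E-code a y R c 0≤R 0≤c c≤R = begin
    success * ∑ ms φ                                 ≡⟨ sym (∑-*ˡ ms success φ) ⟩
    ∑ ms (λ m → success * φ m)                       ≤⟨ ∑-mono-∈ ms term ⟩
    ∑ ms (λ m → E code (λ k → agree a y m k * R k))  ≡⟨ sym (E-∑ code ms λ m k → agree a y m k * R k) ⟩
    E code (λ k → ∑ ms λ m → agree a y m k * R k)    ≤⟨ E-mono code (λ k → ≤-trans
      (≤-reflexive (∑-*ʳ ms (R k) (λ m → agree a y m k)))
      (≤-eq (*-monoʳ (0≤R k) (∑agree≤1 a y k)) (*-identityˡ (R k)))) ⟩
    E code R                                         ∎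
    where
    open ≤-Reasoning
    φ : M → ℚ
    φ m = ⟦ does (ℚ._≤?_ (p a m) (K * q y m)) ⟧ * (p a m * c m)
    pointwise : ∀ m k → agree a y m k * c m ≤ agree a y m k * R k
    pointwise m (s , t) = by-cases (proj₂ (s a) ≟ m) (t y (proj₁ (s a)) ≟ m)
      where
      both : ∀ {x} → x ≡ 0ℚ → x * c m ≤ x * R (s , t)
      both refl = ≤-reflexive (trans (*-zeroˡ (c m)) (sym (*-zeroˡ (R (s , t)))))
      by-cases : (d : Dec (proj₂ (s a) ≡ m)) (e : Dec (t y (proj₁ (s a)) ≡ m)) →
        ⟦ does d ⟧ * ⟦ does e ⟧ * c m ≤ ⟦ does d ⟧ * ⟦ does e ⟧ * R (s , t)
      by-cases (yes e) (yes e′) = *-monoˡ (0≤* 0≤1 0≤1) (c≤R s t m e e′)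
      by-cases (no _)  d        = both (*-zeroˡ ⟦ does d ⟧)
      by-cases (yes _) (no _)   = both (*-zeroʳ 1ℚ)
    0≤agreeR : ∀ m k → 0ℚ ≤ agree a y m k * R k
    0≤agreeR m k@(s , t) = 0≤* (0≤* (0≤⟦⟧ (does (proj₂ (s a) ≟ m))) (0≤⟦⟧ (does (t y (proj₁ (s a)) ≟ m)))) (0≤R k)
    term : ∀ m → m ∈ ms → success * φ m ≤ E code (λ k → agree a y m k * R k)
    term m m∈ = by-cases (ℚ._≤?_ (p a m) (K * q y m))
      where
      rearrange : ∀ g k p c → (g * k) * (1ℚ * (p * c)) ≡ g * (p * k) * c
      rearrange = solve 4 (λ g k p c → (g :* k) :* (con 1ℚ :* (p :* c)) := g :* (p :* k) :* c) refl
      by-cases : (d : Dec (p a m ≤ K * q y m)) → success * (⟦ does d ⟧ * (p a m * c m)) ≤ E code (λ k → agree a y m k * R k)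
      by-cases (no _) = eq-≤ (trans (cong (success *_) (*-zeroˡ (p a m * c m))) (*-zeroʳ success)) (0≤E code (0≤agreeR m))
      by-cases (yes good) = begin
        success * (1ℚ * (p a m * c m))            ≡⟨ rearrange (1ℚ - geom ζ b) (1ℚ - ζ * (1ℚ + K)) (p a m) (c m) ⟩
        (1ℚ - geom ζ b) * (p a m * (1ℚ - ζ * (1ℚ + K))) * c m
                                                  ≤⟨ *-monoʳ (0≤c m) (E-agree a y m m∈ good) ⟩
        E code (agree a y m) * c m                ≡⟨ sym (E-*ʳ code (c m) (agree a y m)) ⟩
        E code (λ k → agree a y m k * c m)        ≤⟨ E-mono code (pointwise m) ⟩
        E code (λ k → agree a y m k * R k)        ∎

-- Simulating a protocol with known message distributions

send : ∀ b {A B O r} → (A → Vec Bool b) → (Vec Bool b → Tree A B O (suc r)) → Tree A B O (suc r)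
send zero    q t = t []
send (suc b) q t = bit (Vec.head ∘ q) λ z → send b (Vec.tail ∘ q) (λ l → t (z ∷ l))

head∷tail : ∀ {A : Set} {n} (v : Vec A (suc n)) → Vec.head v ∷ Vec.tail v ≡ v
head∷tail (x ∷ v) = refl

run-send : ∀ b {A B O r} (q : A → Vec Bool b) (t : Vec Bool b → Tree A B O (suc r)) a c → run (send b q t) a c ≡ run (t (q a)) a c
run-send zero q t a c with q a
... | [] = refl
run-send (suc b) q t a c = trans (run-send b (Vec.tail ∘ q) (λ l → t (Vec.head (q a) ∷ l)) a c)
  (cong (λ v → run (t v) a c) (head∷tail (q a)))

bits-send : ∀ b {A B O r} (q : A → Vec Bool b) (t : Vec Bool b → Tree A B O (suc r)) a c → bits (send b q t) a c ≡ b ℕ.+ bits (t (q a)) a c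
bits-send zero q t a c with q a
... | [] = refl
bits-send (suc b) q t a c = cong suc (trans (bits-send b (Vec.tail ∘ q) (λ l → t (Vec.head (q a) ∷ l)) a c)
  (cong (λ v → b ℕ.+ bits (t v) a c) (head∷tail (q a))))

-- What a party holding an input believes the next message to be, after
-- the messages so far (the most recent one first).
record Party (X M : Set) (ms : List M) : Set where
  field
    inputs     : List X
    all-inputs : ∀ x → x ∈ inputs
    belief     : List M → X → M → ℚ
    0≤belief   : ∀ h x m → 0ℚ ≤ belief h x m
    ∑belief≤1  : ∀ h x → ∑ ms (belief h x) ≤ 1ℚ

open Party

module Walk {M : Set} (ms : List M) (K : ℚ) where

  -- Two beliefs a and b on the next message take turns as the actual one.
  -- α and β collect the probabilities of the path under the actual and
  -- the other beliefs, and g says that they never differed by more than K.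
  walk : ℕ → (a b : List M → M → ℚ) → List M → (α β : ℚ) → Bool → (List M → ℚ → ℚ → Bool → ℚ) → ℚ
  walk zero    a b h α β g F = F h α β g
  walk (suc r) a b h α β g F = ∑ ms λ m →
    walk r b a (m ∷ h) (α * a h m) (β * b h m) (g ∧ does (ℚ._≤?_ (a h m) (K * b h m))) F

  walk-scale : ∀ {F} → (∀ c h α β g → F h (c * α) β g ≡ c * F h α β g) →
    ∀ r a b h c α β g → walk r a b h (c * α) β g F ≡ c * walk r a b h α β g F
  walk-scale lin zero    a b h c α β g = lin c h α β g
  walk-scale {F} lin (suc r) a b h c α β g = trans (∑-cong ms λ m →
    trans (cong (λ z → walk r b a (m ∷ h) z (β * b h m) (g ∧ does (ℚ._≤?_ (a h m) (K * b h m))) F) (*-assoc c α (a h m)))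
      (walk-scale lin r b a (m ∷ h) c (α * a h m) (β * b h m) _))
    (∑-*ˡ ms c _)

  module _ (out : List M → Bool) (z : Bool) where

    outcome : List M → ℚ → ℚ → Bool → ℚ
    outcome h α β g = ⟦ g ⟧ * (⟦ does (out h ≟ z) ⟧ * α)

    outcome-linear : ∀ c h α β g → outcome h (c * α) β g ≡ c * outcome h α β g
    outcome-linear c h α β g = solve 4 (λ g o c α → g :* (o :* (c :* α)) := c :* (g :* (o :* α))) refl ⟦ g ⟧ ⟦ does (out h ≟ z) ⟧ c α

    walk-outcome-false : ∀ r a b h α β → walk r a b h α β false outcome ≡ 0ℚ
    walk-outcome-false zero    a b h α β = *-zeroˡ (⟦ does (out h ≟ z) ⟧ * α)
    walk-outcome-false (suc r) a b h α β = trans (∑-cong ms λ m → walk-outcome-false r b a (m ∷ h) (α * a h m) (β * b h m)) (∑-zero ms)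

    0≤walk-outcome : ∀ r a b → (∀ h m → 0ℚ ≤ a h m) → (∀ h m → 0ℚ ≤ b h m) → ∀ h α β g → 0ℚ ≤ α → 0ℚ ≤ walk r a b h α β g outcome
    0≤walk-outcome zero    a b 0≤a 0≤b h α β g 0≤α = 0≤* (0≤⟦⟧ g) (0≤* (0≤⟦⟧ (does (out h ≟ z))) 0≤α)
    0≤walk-outcome (suc r) a b 0≤a 0≤b h α β g 0≤α = 0≤∑ ms λ m → 0≤walk-outcome r b a 0≤b 0≤a (m ∷ h) (α * a h m) (β * b h m) _ (0≤* 0≤α (0≤a h m))

    walk-outcome-suc : ∀ r a b h β → walk (suc r) a b h 1ℚ β true outcome ≡
      ∑ ms λ m → ⟦ does (ℚ._≤?_ (a h m) (K * b h m)) ⟧ * (a h m * walk r b a (m ∷ h) 1ℚ (β * b h m) true outcome)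
    walk-outcome-suc r a b h β = ∑-cong ms λ m → step m (does (ℚ._≤?_ (a h m) (K * b h m)))
      where
      step : ∀ m g → walk r b a (m ∷ h) (1ℚ * a h m) (β * b h m) g outcome ≡
        ⟦ g ⟧ * (a h m * walk r b a (m ∷ h) 1ℚ (β * b h m) true outcome)
      step m false = trans (walk-outcome-false r b a (m ∷ h) (1ℚ * a h m) (β * b h m)) (sym (*-zeroˡ (a h m * walk r b a (m ∷ h) 1ℚ (β * b h m) true outcome)))
      step m true = trans (cong (λ z → walk r b a (m ∷ h) z (β * b h m) true outcome) (*-comm 1ℚ (a h m)))
        (trans (walk-scale outcome-linear r b a (m ∷ h) (a h m) 1ℚ (β * b h m) true) (sym (*-identityˡ _)))

module Simulation {M : Set} (_≟ₘ_ : DecidableEquality M) (m₀ : M) {ms : List M} (ms-unique : Unique ms)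
  (K ζ : ℚ) (b : ℕ) (0≤K : 0ℚ ≤ K) (0≤ζ : 0ℚ ≤ ζ) (ζ≤1 : ζ ≤ 1ℚ) (0≤κ : 0ℚ ≤ 1ℚ - ζ * (1ℚ + K))
  where

  open Walk ms K

  ρ : ℚ
  ρ = (1ℚ - geom ζ b) * (1ℚ - ζ * (1ℚ + K))

  0≤ρ : 0ℚ ≤ ρ
  0≤ρ = 0≤* (p≤q⇒0≤q-p (^≤1 (2 ℕ.^ b) (p≤q⇒0≤q-p ζ≤1) (≤-by ζ 0≤ζ (solve 1 (λ z → con 1ℚ := (con 1ℚ :- z) :+ z) refl ζ)))) 0≤κ

  module Step {X Y : Set} (P : Party X M ms) (Q : Party Y M ms) (hX : X → List M) (hY : Y → List M) =
    Round _≟ₘ_ m₀ (all-inputs P) (all-inputs Q) ms-unique K ζ b 0≤K 0≤ζ ζ≤1 0≤κ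
      (λ x → belief P (hX x) x) (λ y → belief Q (hY y) y)
      (λ x → 0≤belief P (hX x) x) (λ y → 0≤belief Q (hY y) y)
      (λ x → ∑belief≤1 P (hX x) x) (λ y → ∑belief≤1 Q (hY y) y)

  -- All messages but the last take b bits. The last speaker announces the output instead of a
  -- message, hence the summand 1.
  Bounded : Set → Set → ℕ → Set
  Bounded X Y r = Σ[ t ∈ Tree X Y Bool (suc r) ] ∀ x y → bits t x y ℕ.≤ r ℕ.* b ℕ.+ 1

  module _ {X Y : Set} (out : List M → Bool) (hX : X → List M) (hY : Y → List M) where

    last-message : (X → Vec Bool b × M) × (Y → Vec Bool b → M) → Bounded X Y 0
    last-message (s , _) = bit (λ x → out (proj₂ (s x) ∷ hX x)) (λ z → end (output z)) , λ _ _ → s≤s z≤n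

    prepend : ∀ {r} → (X → Vec Bool b × M) → (Vec Bool b → Bounded Y X r) → Bounded X Y (suc r)
    prepend {r} s F = send b (proj₁ ∘ s) (λ l → end (proj₁ (F l))) , λ x y →
      subst₂ ℕ._≤_ (sym (bits-send b (proj₁ ∘ s) (λ l → end (proj₁ (F l))) x y)) (sym (ℕ.+-assoc b (r ℕ.* b) 1))
        (ℕ.+-monoʳ-≤ b (proj₂ (F (proj₁ (s x))) y x))

  -- hX and hY are the histories as the two parties decoded them, which may differ after a failure.
  -- A continuation is drawn for every word the speaker might send; only one is followed, so its
  -- expectation is a marginal.
  simulate : ∀ r {X Y} → Party X M ms → Party Y M ms → (List M → Bool) → (X → List M) → (Y → List M) → Dist (Bounded X Y r)
  subtree : ∀ r {X Y} → Party X M ms → Party Y M ms → (List M → Bool) → (X → List M) → (Y → List M) →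
    (X → Vec Bool b × M) → (Y → Vec Bool b → M) → Vec Bool b → Dist (Bounded Y X r)

  simulate zero    P Q out hX hY = Step.code P Q hX hY >>= λ c → ret (last-message out hX hY c)
  simulate (suc r) P Q out hX hY = Step.code P Q hX hY >>= λ (s , t) →
    independent b (subtree r P Q out hX hY s t) >>= λ F → ret (prepend out hX hY s F)

  subtree r P Q out hX hY s t l = simulate r Q P out (λ y → t y l ∷ hY y) (λ x → proj₂ (s x) ∷ hX x)

  outputs : ∀ {X Y r} → X → Y → Bool → Bounded X Y r → ℚ
  outputs x y z (t , _) = ⟦ does (run t x y ≟ z) ⟧

  0≤outputs : ∀ {X Y r} (x : X) (y : Y) z (t : Bounded X Y r) → 0ℚ ≤ outputs x y z t
  0≤outputs x y z (t , _) = 0≤⟦⟧ (does (run t x y ≟ z))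

  -- Each round keeps at least the fraction ρ of the paths on which the beliefs agree up to K, by
  -- `E-code` with the rest of the walk as the value of going on. β may be arbitrary because
  -- `outcome` ignores it.
  simulate-outcome : ∀ r {X Y} (P : Party X M ms) (Q : Party Y M ms) out hX hY x y h → hX x ≡ h → hY y ≡ h → ∀ z β →
    ρ ^ suc r * walk (suc r) (λ h → belief P h x) (λ h → belief Q h y) h 1ℚ β true (outcome out z) ≤
    E (simulate r P Q out hX hY) (outputs x y z)
  simulate-outcome r {X} {Y} P Q out hX hY x y h refl eY z β = ≤-trans
    (≤-reflexive (trans (cong (ρ ^ suc r *_) (walk-outcome-suc out z r a b′ h β))
      (trans (solve 3 (λ p q s → (p :* q) :* s := p :* (q :* s)) refl ρ (ρ ^ r) (∑ ms _))
        (cong (ρ *_) (trans (sym (∑-*ˡ ms (ρ ^ r) _)) (∑-cong ms λ m →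
          solve 4 (λ p i a w → p :* (i :* (a :* w)) := i :* (a :* (p :* w))) refl
            (ρ ^ r) ⟦ does (ℚ._≤?_ (a h m) (K * b′ h m)) ⟧ (a h m) (w m)))))))
    (step r refl)
    where
    a : List M → M → ℚ
    a h = belief P h x
    b′ : List M → M → ℚ
    b′ h = belief Q h y
    w : M → ℚ
    w m = walk r b′ a (m ∷ h) 1ℚ (β * b′ h m) true (outcome out z)
    0≤w : ∀ m → 0ℚ ≤ ρ ^ r * w m
    0≤w m = 0≤* (0≤^ r 0≤ρ) (0≤walk-outcome out z r b′ a (λ h → 0≤belief Q h y) (λ h → 0≤belief P h x) (m ∷ h) 1ℚ _ true 0≤1)
    step : ∀ r′ → r ≡ r′ → ρ * ∑ ms (λ m → ⟦ does (ℚ._≤?_ (a h m) (K * b′ h m)) ⟧ * (a h m * (ρ ^ r * w m))) ≤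
      E (simulate r P Q out hX hY) (outputs x y z)
    step zero refl = ≤-trans (subst (λ h′ → ρ * ∑ ms (λ m → ⟦ does (ℚ._≤?_ (a h m) (K * b′ h′ m)) ⟧ * (a h m * (ρ ^ 0 * w m))) ≤
        E (Step.code P Q hX hY) R) eY
        (Step.E-code P Q hX hY x y R (λ m → ρ ^ 0 * w m) (λ k → 0≤outputs x y z (last-message out hX hY k)) 0≤w c≤R))
      (≤-reflexive (sym (E->>= (Step.code P Q hX hY) _ (outputs x y z))))
      where
      R : (X → Vec Bool b × M) × (Y → Vec Bool b → M) → ℚ
      R c = outputs x y z (last-message out hX hY c)
      c≤R : ∀ s t m → proj₂ (s x) ≡ m → t y (proj₁ (s x)) ≡ m → ρ ^ 0 * w m ≤ R (s , t)
      c≤R s t m refl _ = ≤-reflexive (solve 1 (λ d → con 1ℚ :* (con 1ℚ :* (d :* con 1ℚ)) := d) refl _)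
    step (suc r′) refl = ≤-trans (subst (λ h′ → ρ * ∑ ms (λ m → ⟦ does (ℚ._≤?_ (a h m) (K * b′ h′ m)) ⟧ * (a h m * (ρ ^ r * w m))) ≤
        E (Step.code P Q hX hY) R) eY
        (Step.E-code P Q hX hY x y R (λ m → ρ ^ r * w m) (λ (s , t) → 0≤E (D s t (proj₁ (s x))) (0≤outputs y x z)) 0≤w c≤R))
      (≤-reflexive (sym (trans (E->>= (Step.code P Q hX hY) _ (outputs x y z)) (E-cong (Step.code P Q hX hY) λ (s , t) →
        trans (E->>= (independent b (D s t)) _ (outputs x y z))
        (trans (E-cong (independent b (D s t)) λ F → cong (λ o → ⟦ does (o ≟ z) ⟧) (run-send b (proj₁ ∘ s) (λ l → end (proj₁ (F l))) x y))
          (E-marginal b (D s t) (proj₁ (s x)) (outputs y x z)))))))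
      where
      D : (s : X → Vec Bool b × M) (t : Y → Vec Bool b → M) → Vec Bool b → Dist (Bounded Y X r′)
      D s t = subtree r′ P Q out hX hY s t
      R : (X → Vec Bool b × M) × (Y → Vec Bool b → M) → ℚ
      R (s , t) = E (D s t (proj₁ (s x))) (outputs y x z)
      c≤R : ∀ s t m → proj₂ (s x) ≡ m → t y (proj₁ (s x)) ≡ m → ρ ^ r * w m ≤ R (s , t)
      c≤R s t m e e′ = simulate-outcome r′ Q P out (λ y → t y (proj₁ (s x)) ∷ hY y) (λ x → proj₂ (s x) ∷ hX x) y x (m ∷ h)
        (cong₂ _∷_ e′ eY) (cong (_∷ h) e) z (β * b′ h m)

-- Conditional distributions of the messages of a random conversation

does-∷ : {M : Set} (_≟_ : DecidableEquality M) (m m′ : M) (h h′ : List M) →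
  ⟦ does (List.≡-dec _≟_ (m ∷ h) (m′ ∷ h′)) ⟧ ≡ ⟦ does (m ≟ m′) ⟧ * ⟦ does (List.≡-dec _≟_ h h′) ⟧
does-∷ _≟_ m m′ h h′ = ⟦∧⟧ (does (m ≟ m′)) (does (List.≡-dec _≟_ h h′))

module WalkBounds {M : Set} (ms : List M) (K : ℚ) where

  open Walk ms K

  -- Total mass at most 1 rather than 1: conditional beliefs vanish after histories of weight 0.
  Sub : (List M → M → ℚ) → Set
  Sub a = (∀ h m → 0ℚ ≤ a h m) × (∀ h → ∑ ms (a h) ≤ 1ℚ)

  walk-mono : ∀ {F F′} → (∀ h α β g → 0ℚ ≤ α → 0ℚ ≤ β → F h α β g ≤ F′ h α β g) →
    ∀ r {a b} → Sub a → Sub b → ∀ h α β g → 0ℚ ≤ α → 0ℚ ≤ β → walk r a b h α β g F ≤ walk r a b h α β g F′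
  walk-mono le zero    A B h α β g 0≤α 0≤β = le h α β g 0≤α 0≤β
  walk-mono le (suc r) A B h α β g 0≤α 0≤β = ∑-mono ms λ m →
    walk-mono le r B A (m ∷ h) _ _ _ (0≤* 0≤α (proj₁ A h m)) (0≤* 0≤β (proj₁ B h m))

  ∑-scaled : ∀ {a : List M → M → ℚ} h α → Sub a → 0ℚ ≤ α → ∑ ms (λ m → α * a h m) ≤ α
  ∑-scaled {a} h α A 0≤α = ≤-trans (≤-reflexive (∑-*ˡ ms α (a h))) (≤-eq (*-monoˡ 0≤α (proj₂ A h)) (*-identityʳ α))

  walk-α : ∀ r {a b} → Sub a → Sub b → ∀ h α β g → 0ℚ ≤ α → 0ℚ ≤ β → walk r a b h α β g (λ _ α _ _ → α) ≤ α
  walk-α zero    A B h α β g 0≤α 0≤β = ≤-refl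
  walk-α (suc r) {a} {b} A B h α β g 0≤α 0≤β = ≤-trans
    (∑-mono ms λ m → walk-α r B A (m ∷ h) (α * a h m) (β * b h m) _ (0≤* 0≤α (proj₁ A h m)) (0≤* 0≤β (proj₁ B h m)))
    (∑-scaled h α A 0≤α)

  walk-β : ∀ c → 0ℚ ≤ c → ∀ r {a b} → Sub a → Sub b → ∀ h α β g → 0ℚ ≤ α → 0ℚ ≤ β → walk r a b h α β g (λ _ _ β _ → c * β) ≤ c * β
  walk-β c 0≤c zero    A B h α β g 0≤α 0≤β = ≤-refl
  walk-β c 0≤c (suc r) {a} {b} A B h α β g 0≤α 0≤β = ≤-trans
    (∑-mono ms λ m → walk-β c 0≤c r B A (m ∷ h) (α * a h m) (β * b h m) _ (0≤* 0≤α (proj₁ A h m)) (0≤* 0≤β (proj₁ B h m)))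
    (≤-trans (≤-reflexive (∑-*ˡ ms c _)) (*-monoˡ 0≤c (∑-scaled h β B 0≤β)))

  -- On a path that ends with α ≤ c β but has a step of the ratio above K,
  -- β is already too small at the start or α is too large after that step.
  module _ (c λ′ : ℚ) (0≤c : 0ℚ ≤ c) (0≤λ : 0ℚ ≤ λ′) (K≡λ² : K ≡ λ′ * λ′) where

    unreliable : List M → ℚ → ℚ → Bool → ℚ
    unreliable h α β g = ⟦ not g ⟧ * (⟦ does (ℚ._≤?_ α (c * β)) ⟧ * α)

    unreliable≤α : ∀ h α β g → 0ℚ ≤ α → 0ℚ ≤ β → unreliable h α β g ≤ α
    unreliable≤α h α β g 0≤α 0≤β = ≤-eq (*-mono (0≤* (0≤⟦⟧ (does (ℚ._≤?_ α (c * β)))) 0≤α) 0≤1 (⟦⟧≤1 (not g))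
      (≤-eq (*-monoʳ 0≤α (⟦⟧≤1 (does (ℚ._≤?_ α (c * β))))) (*-identityˡ α))) (*-identityˡ α)

    unreliable≤cβ : ∀ h α β g → 0ℚ ≤ α → 0ℚ ≤ β → unreliable h α β g ≤ c * β
    unreliable≤cβ h α β g 0≤α 0≤β = by-cases (ℚ._≤?_ α (c * β))
      where
      by-cases : (d : Dec (α ≤ c * β)) → ⟦ not g ⟧ * (⟦ does d ⟧ * α) ≤ c * β
      by-cases (yes α≤cβ) = ≤-trans (≤-eq (*-mono (0≤* 0≤1 0≤α) 0≤1 (⟦⟧≤1 (not g)) ≤-refl)
        (solve 1 (λ α → con 1ℚ :* (con 1ℚ :* α) := α) refl α)) α≤cβ
      by-cases (no _) = eq-≤ (trans (cong (⟦ not g ⟧ *_) (*-zeroˡ α)) (*-zeroʳ ⟦ not g ⟧)) (0≤* 0≤c 0≤β)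

    walk-unreliable : ∀ r {a b} → Sub a → Sub b → ∀ h α β → 0ℚ ≤ α → 0ℚ ≤ β →
      λ′ * walk r a b h α β true unreliable ≤ c * α + β
    walk-unreliable zero A B h α β 0≤α 0≤β = eq-≤
      (trans (cong (λ′ *_) (*-zeroˡ (⟦ does (ℚ._≤?_ α (c * β)) ⟧ * α))) (*-zeroʳ λ′)) (0≤+ (0≤* 0≤c 0≤α) 0≤β)
    walk-unreliable (suc r) {a} {b} A B h α β 0≤α 0≤β with ≤-total (λ′ * α) β
    ... | inj₁ λα≤β = ≤-trans (*-monoˡ 0≤λ
        (≤-trans (walk-mono unreliable≤α (suc r) A B h α β true 0≤α 0≤β) (walk-α (suc r) A B h α β true 0≤α 0≤β)))
        (≤-trans λα≤β (p≤q+p β (0≤* 0≤c 0≤α)))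
    ... | inj₂ β≤λα = ≤-trans (≤-reflexive (sym (∑-*ˡ ms λ′ _))) (≤-trans (∑-mono ms child)
        (≤-trans (≤-reflexive (trans (∑-+ ms (λ m → c * (α * a h m)) (λ m → β * b h m))
            (cong (_+ ∑ ms (λ m → β * b h m)) (∑-*ˡ ms c (λ m → α * a h m)))))
          (+-mono-≤ (*-monoˡ 0≤c (∑-scaled h α A 0≤α)) (∑-scaled h β B 0≤β))))
      where
      child : ∀ m → λ′ * walk r b a (m ∷ h) (α * a h m) (β * b h m) (does (ℚ._≤?_ (a h m) (K * b h m))) unreliable ≤
        c * (α * a h m) + β * b h m
      child m = by-cases (ℚ._≤?_ (a h m) (K * b h m))
        where
        0≤a = proj₁ A h m
        0≤b = proj₁ B h m
        0≤αa = 0≤* 0≤α 0≤a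
        0≤βb = 0≤* 0≤β 0≤b
        by-cases : (d : Dec (a h m ≤ K * b h m)) →
          λ′ * walk r b a (m ∷ h) (α * a h m) (β * b h m) (does d) unreliable ≤ c * (α * a h m) + β * b h m
        by-cases (yes _) = walk-unreliable r B A (m ∷ h) (α * a h m) (β * b h m) 0≤αa 0≤βb
        -- As β ≤ λ′ α and a ≥ λ′² b, the new β b is at most α a / λ′, and the final mass at most c
        -- times that.
        by-cases (no a≰Kb) = ≤-trans (*-monoˡ 0≤λ
          (≤-trans (walk-mono unreliable≤cβ r B A (m ∷ h) _ _ false 0≤αa 0≤βb) (walk-β c 0≤c r B A (m ∷ h) (α * a h m) (β * b h m) false 0≤αa 0≤βb)))
          (≤-trans (≤-trans
            (≤-reflexive (solve 4 (λ l c β b → l :* (c :* (β :* b)) := c :* (l :* b :* β)) refl λ′ c β (b h m)))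
            (*-monoˡ 0≤c (≤-trans (*-monoˡ (0≤* 0≤λ 0≤b) β≤λα)
              (≤-trans (≤-reflexive (solve 3 (λ l b α → l :* b :* (l :* α) := α :* (l :* l :* b)) refl λ′ (b h m) α))
                (*-monoˡ 0≤α (subst (λ k → k * b h m ≤ a h m) K≡λ² (<⇒≤ (≰⇒> a≰Kb))))))))
            (p≤p+q (c * (α * a h m)) 0≤βb))

module Conversation {Ω M : Set} (_≟ₘ_ : DecidableEquality M) (ωs : List Ω) (msg : ℕ → Ω → M) where

  _≟ₕ_ : DecidableEquality (List M)
  _≟ₕ_ = List.≡-dec _≟ₘ_

  hist : ℕ → Ω → List M
  hist zero    ω = []
  hist (suc j) ω = msg j ω ∷ hist j ω

  at : (Ω → ℚ) → ℕ → List M → ℚ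
  at u n h = ∑ ωs λ ω → u ω * ⟦ does (hist n ω ≟ₕ h) ⟧

  0≤at : ∀ {u} → (∀ ω → 0ℚ ≤ u ω) → ∀ n h → 0ℚ ≤ at u n h
  0≤at 0≤u n h = 0≤∑ ωs λ ω → 0≤* (0≤u ω) (0≤⟦⟧ (does (hist n ω ≟ₕ h)))

  module _ {ms : List M} (ms-unique : Unique ms) where

    ∑-at : ∀ {u} → (∀ ω → 0ℚ ≤ u ω) → ∀ n h → ∑ ms (λ m → at u (suc n) (m ∷ h)) ≤ at u n h
    ∑-at {u} 0≤u n h = ≤-trans (≤-reflexive (∑-swap ms ωs _)) (∑-mono ωs λ ω → ≤-trans
      (≤-reflexive (∑-cong ms λ m → trans (cong (u ω *_) (does-∷ _≟ₘ_ (msg n ω) m (hist n ω) h))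
        (trans (cong (λ d → u ω * (⟦ d ⟧ * ⟦ does (hist n ω ≟ₕ h) ⟧)) (does-⇔ (msg n ω ≟ₘ m) (m ≟ₘ msg n ω) sym sym))
        (solve 3 (λ u d e → u :* (d :* e) := d :* (u :* e)) refl (u ω) ⟦ does (m ≟ₘ msg n ω) ⟧ ⟦ does (hist n ω ≟ₕ h) ⟧))))
      (∑-δ-≤ _≟ₘ_ (λ _ → u ω * ⟦ does (hist n ω ≟ₕ h) ⟧) (msg n ω) ms-unique (0≤* (0≤u ω) (0≤⟦⟧ (does (hist n ω ≟ₕ h))))))

    -- With the junk value 0 after histories of probability 0.
    conditional : (Ω → ℚ) → List M → M → ℚ
    conditional u h m = at u (suc (List.length h)) (m ∷ h) * inv (at u (List.length h) h)

    conditional-sub : ∀ {u K} → (∀ ω → 0ℚ ≤ u ω) → WalkBounds.Sub ms K (conditional u)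
    conditional-sub {u} 0≤u =
      (λ h m → 0≤* (0≤at 0≤u (suc (List.length h)) (m ∷ h)) (0≤inv (0≤at 0≤u (List.length h) h))) ,
      λ h → ≤-trans (≤-reflexive (∑-*ʳ ms (inv (at u (List.length h) h)) _))
        (≤-trans (*-monoʳ (0≤inv (0≤at 0≤u (List.length h) h)) (∑-at 0≤u (List.length h) h)) (*-inv-≤1 (0≤at 0≤u (List.length h) h)))

  module _ (K : ℚ) where

    -- The walk restricted to the single path that ω takes.
    along : ℕ → (a b : List M → M → ℚ) → ℕ → Ω → (α β : ℚ) → Bool → (List M → ℚ → ℚ → Bool → ℚ) → ℚ
    along zero    a b j ω α β g F = F (hist j ω) α β g
    along (suc r) a b j ω α β g F = along r b a (suc j) ω (α * a (hist j ω) (msg j ω)) (β * b (hist j ω) (msg j ω))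
      (g ∧ does (ℚ._≤?_ (a (hist j ω) (msg j ω)) (K * b (hist j ω) (msg j ω)))) F

    module _ {ms : List M} (ms-unique : Unique ms) (ms-all : ∀ j ω → msg j ω ∈ ms) where

      open Walk ms K
      open WalkBounds ms K

      -- Dividing by the weight of the final history makes all ω that share it count once in total,
      -- which turns the sum over ω into a walk over histories. Histories of weight 0 are lost,
      -- hence the inequality.
      ∑-along : ∀ {u F} → (∀ ω → 0ℚ ≤ u ω) → (∀ h α β g → 0ℚ ≤ α → 0ℚ ≤ β → 0ℚ ≤ F h α β g) →
        ∀ r {a b} → Sub a → Sub b → ∀ n j → r ℕ.+ j ≡ n → ∀ h α β g → 0ℚ ≤ α → 0ℚ ≤ β →
        ∑ ωs (λ ω → u ω * (⟦ does (hist j ω ≟ₕ h) ⟧ * (along r a b j ω α β g F * inv (at u n (hist n ω))))) ≤ walk r a b h α β g F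
      ∑-along {u} {F} 0≤u 0≤F zero A B n .n refl h α β g 0≤α 0≤β = begin
        ∑ ωs (λ ω → u ω * (⟦ does (hist n ω ≟ₕ h) ⟧ * (F (hist n ω) α β g * inv (at u n (hist n ω)))))
          ≡⟨ ∑-cong ωs (λ ω → trans (cong (u ω *_) (≟-guard _≟ₕ_ (λ h → F h α β g * inv (at u n h)) (hist n ω) h))
               (sym (*-assoc (u ω) ⟦ does (hist n ω ≟ₕ h) ⟧ (F h α β g * inv (at u n h))))) ⟩
        ∑ ωs (λ ω → u ω * ⟦ does (hist n ω ≟ₕ h) ⟧ * (F h α β g * inv (at u n h)))
          ≡⟨ ∑-*ʳ ωs (F h α β g * inv (at u n h)) (λ ω → u ω * ⟦ does (hist n ω ≟ₕ h) ⟧) ⟩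
        at u n h * (F h α β g * inv (at u n h))
          ≡⟨ rearrange (at u n h) (F h α β g) (inv (at u n h)) ⟩
        F h α β g * (at u n h * inv (at u n h))
          ≤⟨ *-monoˡ (0≤F h α β g 0≤α 0≤β) (*-inv-≤1 (0≤at 0≤u n h)) ⟩
        F h α β g * 1ℚ
          ≡⟨ *-identityʳ (F h α β g) ⟩
        F h α β g ∎
        where
        open ≤-Reasoning
        rearrange : ∀ a f i → a * (f * i) ≡ f * (a * i)
        rearrange = solve 3 (λ a f i → a :* (f :* i) := f :* (a :* i)) refl
      ∑-along {u} {F} 0≤u 0≤F (suc r) {a} {b} A B n j e h α β g 0≤α 0≤β = begin
        ∑ ωs (λ ω → u ω * (⟦ does (hist j ω ≟ₕ h) ⟧ * (along (suc r) a b j ω α β g F * I ω)))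
          ≡⟨ ∑-cong ωs split ⟩
        ∑ ωs (λ ω → ∑ ms λ m → u ω * (⟦ does (hist (suc j) ω ≟ₕ (m ∷ h)) ⟧ * (next h m ω * I ω)))
          ≡⟨ ∑-swap ωs ms _ ⟩
        ∑ ms (λ m → ∑ ωs λ ω → u ω * (⟦ does (hist (suc j) ω ≟ₕ (m ∷ h)) ⟧ * (next h m ω * I ω)))
          ≤⟨ ∑-mono ms (λ m → ∑-along 0≤u 0≤F r B A n (suc j) (trans (ℕ.+-suc r j) e) (m ∷ h) (α * a h m) (β * b h m) _
               (0≤* 0≤α (proj₁ A h m)) (0≤* 0≤β (proj₁ B h m))) ⟩
        walk (suc r) a b h α β g F ∎
        where
        open ≤-Reasoning
        I : Ω → ℚ
        I ω = inv (at u n (hist n ω))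
        next : List M → M → Ω → ℚ
        next h m ω = along r b a (suc j) ω (α * a h m) (β * b h m) (g ∧ does (ℚ._≤?_ (a h m) (K * b h m))) F
        rearrange : ∀ u h m z → u * (h * (m * z)) ≡ m * (u * (h * z))
        rearrange = solve 4 (λ u h m z → u :* (h :* (m :* z)) := m :* (u :* (h :* z))) refl
        split : ∀ ω → u ω * (⟦ does (hist j ω ≟ₕ h) ⟧ * (next (hist j ω) (msg j ω) ω * I ω)) ≡
          ∑ ms λ m → u ω * (⟦ does (hist (suc j) ω ≟ₕ (m ∷ h)) ⟧ * (next h m ω * I ω))
        split ω = trans (cong (u ω *_) (≟-guard _≟ₕ_ (λ h → next h (msg j ω) ω * I ω) (hist j ω) h))
          (trans (sym (∑-δ _≟ₘ_ (λ m → u ω * (⟦ does (hist j ω ≟ₕ h) ⟧ * (next h m ω * I ω))) (msg j ω) ms-unique (ms-all j ω)))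
          (∑-cong ms λ m → trans (sym (rearrange (u ω) ⟦ does (hist j ω ≟ₕ h) ⟧ ⟦ does (m ≟ₘ msg j ω) ⟧ (next h m ω * I ω)))
            (cong (u ω *_) (trans (sym (*-assoc ⟦ does (hist j ω ≟ₕ h) ⟧ ⟦ does (m ≟ₘ msg j ω) ⟧ (next h m ω * I ω)))
              (cong (_* (next h m ω * I ω)) (trans (*-comm ⟦ does (hist j ω ≟ₕ h) ⟧ ⟦ does (m ≟ₘ msg j ω) ⟧)
                (trans (cong (λ d → ⟦ d ⟧ * ⟦ does (hist j ω ≟ₕ h) ⟧) (does-⇔ (m ≟ₘ msg j ω) (msg j ω ≟ₘ m) sym sym))
                  (sym (does-∷ _≟ₘ_ (msg j ω) m (hist j ω) h)))))))))

    -- F is applied only at the end, to arguments that do not depend on F. So different F on one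
    -- path can be compared at one and the same triple.
    along-end : ∀ {a b} → (∀ h m → 0ℚ ≤ a h m) → (∀ h m → 0ℚ ≤ b h m) → ∀ r n j → r ℕ.+ j ≡ n → ∀ ω α β g → 0ℚ ≤ α → 0ℚ ≤ β →
      ∃ λ α′ → ∃ λ β′ → ∃ λ g′ → 0ℚ ≤ α′ × 0ℚ ≤ β′ × (∀ F → along r a b j ω α β g F ≡ F (hist n ω) α′ β′ g′)
    along-end 0≤a 0≤b zero    n .n refl ω α β g 0≤α 0≤β = α , β , g , 0≤α , 0≤β , λ _ → refl
    along-end 0≤a 0≤b (suc r) n j e ω α β g 0≤α 0≤β = along-end 0≤b 0≤a r n (suc j) (trans (ℕ.+-suc r j) e) ω _ _ _
      (0≤* 0≤α (0≤a (hist j ω) (msg j ω))) (0≤* 0≤β (0≤b (hist j ω) (msg j ω)))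

-- A protocol for a single input from a random conversation

record Enumerated (A : Set) : Set where
  field
    dec    : DecidableEquality A
    list   : List A
    unique : Unique list
    all    : ∀ a → a ∈ list

open Enumerated

module Coordinate {Ω M X Y : Set} (eX : Enumerated X) (eY : Enumerated Y)
  (_≟ₘ_ : DecidableEquality M) (m₀ : M) {ms : List M} (ms-unique : Unique ms)
  (ωs : List Ω) (msg : ℕ → Ω → M) (ms-all : ∀ j ω → msg j ω ∈ ms) (x : Ω → X) (y : Ω → Y)
  (w : Ω → ℚ) (0≤w : ∀ ω → 0ℚ ≤ w ω)
  (μ : X → Y → ℚ) (0≤μ : ∀ x y → 0ℚ ≤ μ x y) (∑μ : ∑ (list eX) (λ x → ∑ (list eY) (μ x)) ≡ 1ℚ)
  (f : X → Y → Bool) (out : List M → Bool) (r : ℕ)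
  (K λ′ : ℚ) (0<λ : 0ℚ < λ′) (K≡λ² : K ≡ λ′ * λ′)
  where

  open Conversation _≟ₘ_ ωs msg

  private
    xs = list eX
    ys = list eY

  R : ℕ
  R = suc r

  open Walk ms K
  open WalkBounds ms K

  is-x : X → Ω → ℚ
  is-x x₀ ω = ⟦ does (dec eX (x ω) x₀) ⟧

  is-y : Y → Ω → ℚ
  is-y y₀ ω = ⟦ does (dec eY (y ω) y₀) ⟧

  weight-x : X → Ω → ℚ
  weight-x x₀ ω = w ω * is-x x₀ ω

  weight-y : Y → Ω → ℚ
  weight-y y₀ ω = w ω * is-y y₀ ω

  weight-xy : X → Y → Ω → ℚ
  weight-xy x₀ y₀ ω = w ω * (is-x x₀ ω * is-y y₀ ω)

  0≤weight-x : ∀ x₀ ω → 0ℚ ≤ weight-x x₀ ω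
  0≤weight-x x₀ ω = 0≤* (0≤w ω) (0≤⟦⟧ (does (dec eX (x ω) x₀)))

  0≤weight-y : ∀ y₀ ω → 0ℚ ≤ weight-y y₀ ω
  0≤weight-y y₀ ω = 0≤* (0≤w ω) (0≤⟦⟧ (does (dec eY (y ω) y₀)))

  0≤weight-xy : ∀ x₀ y₀ ω → 0ℚ ≤ weight-xy x₀ y₀ ω
  0≤weight-xy x₀ y₀ ω = 0≤* (0≤w ω) (0≤* (0≤⟦⟧ (does (dec eX (x ω) x₀))) (0≤⟦⟧ (does (dec eY (y ω) y₀))))

  alice : Party X M ms
  alice = record
    { inputs = xs ; all-inputs = all eX ; belief = λ h x₀ → conditional ms-unique (weight-x x₀) h
    ; 0≤belief = λ h x₀ → proj₁ (conditional-sub ms-unique {K = K} (0≤weight-x x₀)) h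
    ; ∑belief≤1 = λ h x₀ → proj₂ (conditional-sub ms-unique {K = K} (0≤weight-x x₀)) h }

  bob : Party Y M ms
  bob = record
    { inputs = ys ; all-inputs = all eY ; belief = λ h y₀ → conditional ms-unique (weight-y y₀) h
    ; 0≤belief = λ h y₀ → proj₁ (conditional-sub ms-unique {K = K} (0≤weight-y y₀)) h
    ; ∑belief≤1 = λ h y₀ → proj₂ (conditional-sub ms-unique {K = K} (0≤weight-y y₀)) h }

  a : X → List M → M → ℚ
  a x₀ h = Party.belief alice h x₀

  b : Y → List M → M → ℚ
  b y₀ h = Party.belief bob h y₀

  sub-a : ∀ x₀ → Sub (a x₀)
  sub-a x₀ = conditional-sub ms-unique {K = K} (0≤weight-x x₀)

  sub-b : ∀ y₀ → Sub (b y₀)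
  sub-b y₀ = conditional-sub ms-unique {K = K} (0≤weight-y y₀)

  Final : Set
  Final = List M → ℚ → ℚ → Bool → ℚ

  path : X → Y → Ω → Final → ℚ
  path x₀ y₀ ω = along K R (a x₀) (b y₀) 0 ω 1ℚ 1ℚ true

  total : X → Y → Final → ℚ
  total x₀ y₀ = walk R (a x₀) (b y₀) [] 1ℚ 1ℚ true

  joint : X → Y → Ω → ℚ
  joint x₀ y₀ ω = at (weight-xy x₀ y₀) R (hist R ω)

  0≤joint : ∀ x₀ y₀ ω → 0ℚ ≤ joint x₀ y₀ ω
  0≤joint x₀ y₀ ω = 0≤at (0≤weight-xy x₀ y₀) R (hist R ω)

  W : ℚ
  W = ∑ ωs w

  0≤W : 0ℚ ≤ W
  0≤W = 0≤∑ ωs 0≤w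

  ∑∑-mono : ∀ {g h : X → Y → ℚ} → (∀ x y → g x y ≤ h x y) → ∑ xs (λ x → ∑ ys (g x)) ≤ ∑ xs λ x → ∑ ys (h x)
  ∑∑-mono le = ∑-mono xs λ x → ∑-mono ys (le x)

  -- The ratio of F on the path of ω to its probability given the inputs.
  ratio : Ω → (X → Y → Final) → ℚ
  ratio ω F = μ (x ω) (y ω) * (path (x ω) (y ω) ω (F (x ω) (y ω)) * inv (joint (x ω) (y ω) ω))

  ∑-ratio : ∀ F → (∀ x y h α β g → 0ℚ ≤ α → 0ℚ ≤ β → 0ℚ ≤ F x y h α β g) →
    ∑ ωs (λ ω → w ω * ratio ω F) ≤ ∑ xs λ x₀ → ∑ ys λ y₀ → μ x₀ y₀ * total x₀ y₀ (F x₀ y₀)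
  ∑-ratio F 0≤F = begin
    ∑ ωs (λ ω → w ω * ratio ω F)
      ≡⟨ ∑-cong ωs split ⟩
    ∑ ωs (λ ω → ∑ xs λ x₀ → ∑ ys λ y₀ → term x₀ y₀ ω)
      ≡⟨ ∑-swap ωs xs (λ ω x₀ → ∑ ys λ y₀ → term x₀ y₀ ω) ⟩
    ∑ xs (λ x₀ → ∑ ωs λ ω → ∑ ys λ y₀ → term x₀ y₀ ω)
      ≡⟨ ∑-cong xs (λ x₀ → ∑-swap ωs ys (λ ω y₀ → term x₀ y₀ ω)) ⟩
    ∑ xs (λ x₀ → ∑ ys λ y₀ → ∑ ωs (term x₀ y₀))
      ≤⟨ ∑∑-mono (λ x₀ y₀ → ≤-trans (≤-reflexive (∑-*ˡ ωs (μ x₀ y₀) (inner x₀ y₀))) (*-monoˡ (0≤μ x₀ y₀) (bound x₀ y₀))) ⟩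
    ∑ xs (λ x₀ → ∑ ys λ y₀ → μ x₀ y₀ * total x₀ y₀ (F x₀ y₀)) ∎
    where
    open ≤-Reasoning
    value : X → Y → Ω → ℚ
    value x₀ y₀ ω = path x₀ y₀ ω (F x₀ y₀) * inv (joint x₀ y₀ ω)
    inner : X → Y → Ω → ℚ
    inner x₀ y₀ ω = weight-xy x₀ y₀ ω * (1ℚ * value x₀ y₀ ω)
    term : X → Y → Ω → ℚ
    term x₀ y₀ ω = μ x₀ y₀ * inner x₀ y₀ ω
    bound : ∀ x₀ y₀ → ∑ ωs (inner x₀ y₀) ≤ total x₀ y₀ (F x₀ y₀)
    bound x₀ y₀ = ∑-along K ms-unique ms-all {F = F x₀ y₀} (0≤weight-xy x₀ y₀) (0≤F x₀ y₀) R (sub-a x₀) (sub-b y₀)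
      R 0 (ℕ.+-identityʳ R) [] 1ℚ 1ℚ true 0≤1 0≤1
    rearrange : ∀ i j w m v → i * (j * (w * (m * v))) ≡ m * (w * (i * j) * (1ℚ * v))
    rearrange = solve 5 (λ i j w m v → i :* (j :* (w :* (m :* v))) := m :* (w :* (i :* j) :* (con 1ℚ :* v))) refl
    split : ∀ ω → w ω * ratio ω F ≡ ∑ xs λ x₀ → ∑ ys λ y₀ → term x₀ y₀ ω
    split ω = trans (sym (∑-δ (dec eX) (λ x₀ → w ω * (μ x₀ (y ω) * value x₀ (y ω) ω)) (x ω) (unique eX) (all eX (x ω))))
      (∑-cong xs λ x₀ → trans (cong (⟦ does (dec eX x₀ (x ω)) ⟧ *_)
          (sym (∑-δ (dec eY) (λ y₀ → w ω * (μ x₀ y₀ * value x₀ y₀ ω)) (y ω) (unique eY) (all eY (y ω)))))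
        (trans (sym (∑-*ˡ ys ⟦ does (dec eX x₀ (x ω)) ⟧ (λ y₀ → ⟦ does (dec eY y₀ (y ω)) ⟧ * (w ω * (μ x₀ y₀ * value x₀ y₀ ω)))))
        (∑-cong ys λ y₀ → trans
          (cong₂ (λ i j → ⟦ i ⟧ * (⟦ j ⟧ * (w ω * (μ x₀ y₀ * value x₀ y₀ ω))))
            (does-⇔ (dec eX x₀ (x ω)) (dec eX (x ω) x₀) sym sym) (does-⇔ (dec eY y₀ (y ω)) (dec eY (y ω) y₀) sym sym))
          (rearrange (is-x x₀ ω) (is-y y₀ ω) (w ω) (μ x₀ y₀) (value x₀ y₀ ω)))))

  forward backward : X → Y → Final
  forward  _ _ _ α _ _ = α
  backward _ _ _ _ β _ = β

  -- The densities with respect to w of the conversation simulated with the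
  -- beliefs of the speakers, and with those of the listeners.
  t v : Ω → ℚ
  t ω = W * ratio ω forward
  v ω = W * ratio ω backward

  average≤ : ∀ (g : X → Y → ℚ) c → 0ℚ ≤ c → (∀ x y → g x y ≤ c) → ∑ xs (λ x → ∑ ys λ y → μ x y * g x y) ≤ c
  average≤ g c 0≤c h = begin
    ∑ xs (λ x → ∑ ys λ y → μ x y * g x y)  ≤⟨ ∑∑-mono (λ x y → *-monoˡ (0≤μ x y) (h x y)) ⟩
    ∑ xs (λ x → ∑ ys λ y → μ x y * c)      ≡⟨ ∑-cong xs (λ x → ∑-*ʳ ys c (μ x)) ⟩
    ∑ xs (λ x → ∑ ys (μ x) * c)            ≡⟨ ∑-*ʳ xs c (λ x → ∑ ys (μ x)) ⟩
    ∑ xs (λ x → ∑ ys (μ x)) * c            ≡⟨ cong (_* c) ∑μ ⟩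
    1ℚ * c                                 ≡⟨ *-identityˡ c ⟩
    c                                      ∎
    where open ≤-Reasoning

  ∑-W : ∀ F → ∑ ωs (λ ω → w ω * (W * ratio ω F)) ≡ W * ∑ ωs (λ ω → w ω * ratio ω F)
  ∑-W F = trans (∑-cong ωs λ ω → solve 3 (λ w W r → w :* (W :* r) := W :* (w :* r)) refl (w ω) W (ratio ω F))
    (∑-*ˡ ωs W (λ ω → w ω * ratio ω F))

  ∑t≤W : ∑ ωs (λ ω → w ω * t ω) ≤ W
  ∑t≤W = ≤-trans (≤-reflexive (∑-W forward)) (≤-eq (*-monoˡ 0≤W (≤-trans
    (∑-ratio forward (λ x y h α β g 0≤α 0≤β → 0≤α))
    (average≤ (λ x y → total x y (forward x y)) 1ℚ 0≤1 λ x y → walk-α R (sub-a x) (sub-b y) [] 1ℚ 1ℚ true 0≤1 0≤1))) (*-identityʳ W))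

  ∑v≤W : ∑ ωs (λ ω → w ω * v ω) ≤ W
  ∑v≤W = ≤-trans (≤-reflexive (∑-W backward)) (≤-eq (*-monoˡ 0≤W (≤-trans
    (∑-ratio backward (λ x y h α β g 0≤α 0≤β → 0≤β))
    (average≤ (λ x y → total x y (backward x y)) 1ℚ 0≤1 λ x y → ≤-trans
      (walk-mono (λ _ _ β _ _ _ → ≤-reflexive (sym (*-identityˡ β))) R (sub-a x) (sub-b y) [] 1ℚ 1ℚ true 0≤1 0≤1)
      (walk-β 1ℚ 0≤1 R (sub-a x) (sub-b y) [] 1ℚ 1ℚ true 0≤1 0≤1)))) (*-identityʳ W))

  module _ (L c e₁ e₂ : ℚ) (0≤L : 0ℚ ≤ L) (0≤c : 0ℚ ≤ c) (0≤e₁ : 0ℚ ≤ e₁) (0≤e₂ : 0ℚ ≤ e₂)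
    (L≤e₁c : L ≤ e₁ * c) (c+1≤e₂λ : c + 1ℚ ≤ e₂ * λ′)
    (correct : ∀ ω → 0ℚ < w ω → out (hist R ω) ≡ f (x ω) (y ω)) where

    bad : Ω → Bool
    bad ω = does (ℚ._<?_ (L * v ω) 1ℚ)

    good-outcome : X → Y → Final
    good-outcome x₀ y₀ = outcome out (f x₀ y₀)

    unreliable′ : X → Y → Final
    unreliable′ _ _ = unreliable c λ′ 0≤c (<⇒≤ 0<λ) K≡λ²

    gain : Ω → ℚ
    gain ω = (1ℚ ⊓ t ω) - ⟦ bad ω ⟧

    -- At the end of the path, t = s α and v = s β. A reliable path is counted by the first term, an
    -- unreliable one with α ≤ c β by the second. Otherwise either v < 1 / L, and subtracting `bad`
    -- leaves at most 0, or e₁ t ≥ e₁ c v ≥ L v ≥ 1. The last two cases are the reason for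
    -- truncating t at 1.
    gain≤ : ∀ ω → 0ℚ < w ω → gain ω ≤ W * ratio ω good-outcome + W * ratio ω unreliable′ + e₁ * t ω
    gain≤ ω 0<w = lemma (along-end K (proj₁ (sub-a (x ω))) (proj₁ (sub-b (y ω))) R R 0 (ℕ.+-identityʳ R) ω 1ℚ 1ℚ true 0≤1 0≤1)
      where
      m i s : ℚ
      m = μ (x ω) (y ω)
      i = inv (joint (x ω) (y ω) ω)
      s = W * (m * i)
      0≤s : 0ℚ ≤ s
      0≤s = 0≤* 0≤W (0≤* (0≤μ (x ω) (y ω)) (0≤inv (0≤joint (x ω) (y ω) ω)))
      rearrange : ∀ W m p i → W * (m * (p * i)) ≡ W * (m * i) * p
      rearrange = solve 4 (λ W m p i → W :* (m :* (p :* i)) := W :* (m :* i) :* p) refl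
      core : ∀ α β g → 0ℚ ≤ α → 0ℚ ≤ β → (q : Dec (α ≤ c * β)) (p : Dec (L * (s * β) < 1ℚ)) →
        (1ℚ ⊓ (s * α)) - ⟦ does p ⟧ ≤ s * (⟦ g ⟧ * (1ℚ * α)) + s * (⟦ not g ⟧ * (⟦ does q ⟧ * α)) + e₁ * (s * α)
      core α β true 0≤α 0≤β q p = ≤-trans (minus (does p)) (≤-trans (p⊓q≤q 1ℚ (s * α))
        (≤-by (e₁ * (s * α)) (0≤* 0≤e₁ (0≤* 0≤s 0≤α)) (solve 4 (λ s α e d →
          s :* (con 1ℚ :* (con 1ℚ :* α)) :+ s :* (con 0ℚ :* (d :* α)) :+ e :* (s :* α) := s :* α :+ e :* (s :* α)) refl s α e₁ ⟦ does q ⟧)))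
        where
        minus : ∀ b → (1ℚ ⊓ (s * α)) - ⟦ b ⟧ ≤ 1ℚ ⊓ (s * α)
        minus b = ≤-by ⟦ b ⟧ (0≤⟦⟧ b) (solve 2 (λ p q → p := (p :- q) :+ q) refl (1ℚ ⊓ (s * α)) ⟦ b ⟧)
      core α β false 0≤α 0≤β (yes _) p = ≤-trans (minus (does p)) (≤-trans (p⊓q≤q 1ℚ (s * α))
        (≤-by (e₁ * (s * α)) (0≤* 0≤e₁ (0≤* 0≤s 0≤α)) (solve 3 (λ s α e →
          s :* (con 0ℚ :* (con 1ℚ :* α)) :+ s :* (con 1ℚ :* (con 1ℚ :* α)) :+ e :* (s :* α) := s :* α :+ e :* (s :* α)) refl s α e₁)))
        where
        minus : ∀ b → (1ℚ ⊓ (s * α)) - ⟦ b ⟧ ≤ 1ℚ ⊓ (s * α)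
        minus b = ≤-by ⟦ b ⟧ (0≤⟦⟧ b) (solve 2 (λ p q → p := (p :- q) :+ q) refl (1ℚ ⊓ (s * α)) ⟦ b ⟧)
      core α β false 0≤α 0≤β (no α≰cβ) (yes _) = ≤-trans (+-monoˡ-≤ (- 1ℚ) (p⊓q≤p 1ℚ (s * α)))
        (≤-by (e₁ * (s * α)) (0≤* 0≤e₁ (0≤* 0≤s 0≤α)) (solve 3 (λ s α e →
          s :* (con 0ℚ :* (con 1ℚ :* α)) :+ s :* (con 1ℚ :* (con 0ℚ :* α)) :+ e :* (s :* α) := (con 1ℚ :- con 1ℚ) :+ e :* (s :* α)) refl s α e₁))
      core α β false 0≤α 0≤β (no α≰cβ) (no ¬bad) = ≤-trans (≤-trans (≤-reflexive (+-identityʳ _)) (p⊓q≤p 1ℚ (s * α)))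
        (≤-trans (≮⇒≥ ¬bad) (≤-trans (*-monoʳ (0≤* 0≤s 0≤β) L≤e₁c)
        (≤-trans (≤-reflexive (solve 4 (λ e c s β → e :* c :* (s :* β) := e :* (s :* (c :* β))) refl e₁ c s β))
        (≤-trans (*-monoˡ 0≤e₁ (*-monoˡ 0≤s (<⇒≤ (≰⇒> α≰cβ))))
        (≤-reflexive (solve 3 (λ s α e → e :* (s :* α) :=
          s :* (con 0ℚ :* (con 1ℚ :* α)) :+ s :* (con 1ℚ :* (con 0ℚ :* α)) :+ e :* (s :* α)) refl s α e₁))))))
      lemma : (∃ λ α → ∃ λ β → ∃ λ g → 0ℚ ≤ α × 0ℚ ≤ β × (∀ F → path (x ω) (y ω) ω F ≡ F (hist R ω) α β g)) →
        gain ω ≤ W * ratio ω good-outcome + W * ratio ω unreliable′ + e₁ * t ω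
      lemma (α , β , g , 0≤α , 0≤β , ends) = subst₂ _≤_ (cong₂ (λ p q → (1ℚ ⊓ p) - ⟦ does (ℚ._<?_ (L * q) 1ℚ) ⟧) eα eβ)
        (cong₂ _+_ (cong₂ _+_ eo eu) (cong (e₁ *_) eα))
        (core α β g 0≤α 0≤β (ℚ._≤?_ α (c * β)) (ℚ._<?_ (L * (s * β)) 1ℚ))
        where
        value : ∀ F → s * F (x ω) (y ω) (hist R ω) α β g ≡ W * ratio ω F
        value F = trans (sym (rearrange W m (F (x ω) (y ω) (hist R ω) α β g) i))
          (cong (λ z → W * (m * (z * i))) (sym (ends (F (x ω) (y ω)))))
        eα : s * α ≡ t ω
        eα = value forward
        eβ : s * β ≡ v ω
        eβ = value backward
        eu : s * (⟦ not g ⟧ * (⟦ does (ℚ._≤?_ α (c * β)) ⟧ * α)) ≡ W * ratio ω unreliable′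
        eu = value unreliable′
        eo : s * (⟦ g ⟧ * (1ℚ * α)) ≡ W * ratio ω good-outcome
        eo = trans (cong (λ d → s * (⟦ g ⟧ * (⟦ d ⟧ * α))) (sym (dec-true (out (hist R ω) ≟ f (x ω) (y ω)) (correct ω 0<w))))
          (value good-outcome)

    total-unreliable : ∑ xs (λ x → ∑ ys λ y → μ x y * total x y (unreliable′ x y)) ≤ e₂
    total-unreliable = average≤ (λ x y → total x y (unreliable′ x y)) e₂ 0≤e₂ λ x y → *-cancelˡ 0<λ
      (≤-trans (walk-unreliable c λ′ 0≤c (<⇒≤ 0<λ) K≡λ² R (sub-a x) (sub-b y) [] 1ℚ 1ℚ 0≤1 0≤1)
      (≤-trans (≤-reflexive (cong (_+ 1ℚ) (*-identityʳ c))) (≤-eq c+1≤e₂λ (*-comm e₂ λ′))))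

    ∑-gain : ∑ ωs (λ ω → w ω * gain ω) - (e₁ + e₂) * W ≤ W * ∑ xs (λ x → ∑ ys λ y → μ x y * total x y (good-outcome x y))
    ∑-gain = p≤q+r⇒p-q≤r (begin
      ∑ ωs (λ ω → w ω * gain ω)
        ≤⟨ ∑-mono ωs (λ ω → pointwise ω (ℚ._≟_ (w ω) 0ℚ)) ⟩
      ∑ ωs (λ ω → w ω * (W * ratio ω good-outcome) + w ω * (W * ratio ω unreliable′) + e₁ * (w ω * t ω))
        ≡⟨ trans (∑-+ ωs (λ ω → w ω * (W * ratio ω good-outcome) + w ω * (W * ratio ω unreliable′)) (λ ω → e₁ * (w ω * t ω)))
             (cong₂ _+_ (trans (∑-+ ωs (λ ω → w ω * (W * ratio ω good-outcome)) (λ ω → w ω * (W * ratio ω unreliable′)))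
               (cong₂ _+_ (∑-W good-outcome) (∑-W unreliable′))) (∑-*ˡ ωs e₁ (λ ω → w ω * t ω))) ⟩
      W * ∑ ωs (λ ω → w ω * ratio ω good-outcome) + W * ∑ ωs (λ ω → w ω * ratio ω unreliable′) + e₁ * ∑ ωs (λ ω → w ω * t ω)
        ≤⟨ +-mono-≤ (+-mono-≤ (*-monoˡ 0≤W (∑-ratio good-outcome λ x y h α β g 0≤α _ → 0≤* (0≤⟦⟧ g) (0≤* (0≤⟦⟧ (does (out h ≟ f x y))) 0≤α)))
             (*-monoˡ 0≤W (≤-trans (∑-ratio unreliable′ λ x y h α β g 0≤α _ → 0≤* (0≤⟦⟧ (not g)) (0≤* (0≤⟦⟧ (does (ℚ._≤?_ α (c * β)))) 0≤α)) total-unreliable)))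
             (*-monoˡ 0≤e₁ ∑t≤W) ⟩
      W * S + W * e₂ + e₁ * W
        ≡⟨ rearrange W S e₁ e₂ ⟩
      (e₁ + e₂) * W + W * S ∎)
      where
      open ≤-Reasoning
      S = ∑ xs (λ x → ∑ ys λ y → μ x y * total x y (good-outcome x y))
      rearrange : ∀ W S e₁ e₂ → W * S + W * e₂ + e₁ * W ≡ (e₁ + e₂) * W + W * S
      rearrange = solve 4 (λ W S a b → W :* S :+ W :* b :+ a :* W := (a :+ b) :* W :+ W :* S) refl
      distribute : ∀ w p q e t → w * (p + q + e * t) ≡ w * p + w * q + e * (w * t)
      distribute = solve 5 (λ w p q e t → w :* (p :+ q :+ e :* t) := w :* p :+ w :* q :+ e :* (w :* t)) refl
      zero-case : ∀ {w} → w ≡ 0ℚ → ∀ z p q e t → w * z ≤ w * p + w * q + e * (w * t)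
      zero-case refl z p q e t = ≤-reflexive (solve 5 (λ z p q e t → con 0ℚ :* z := con 0ℚ :* p :+ con 0ℚ :* q :+ e :* (con 0ℚ :* t)) refl z p q e t)
      pointwise : ∀ ω → Dec (w ω ≡ 0ℚ) → w ω * gain ω ≤
        w ω * (W * ratio ω good-outcome) + w ω * (W * ratio ω unreliable′) + e₁ * (w ω * t ω)
      pointwise ω (yes w≡0) = zero-case w≡0 (gain ω) (W * ratio ω good-outcome) (W * ratio ω unreliable′) e₁ (t ω)
      pointwise ω (no w≢0) = ≤-eq (*-monoˡ (0≤w ω) (gain≤ ω (0≤∧≢0⇒0< (0≤w ω) w≢0)))
        (distribute (w ω) (W * ratio ω good-outcome) (W * ratio ω unreliable′) e₁ (t ω))

    module _ (ζ : ℚ) (b : ℕ) (0≤ζ : 0ℚ ≤ ζ) (ζ≤1 : ζ ≤ 1ℚ) (0≤κ : 0ℚ ≤ 1ℚ - ζ * (1ℚ + K)) where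

      private
        0≤K : 0ℚ ≤ K
        0≤K = ≤-eq (0≤sq λ′) (sym K≡λ²)

      open Simulation _≟ₘ_ m₀ ms-unique K ζ b 0≤K 0≤ζ ζ≤1 0≤κ

      single : Σ[ s ∈ Tree X Y Bool R ] (∀ x y → bits s x y ℕ.≤ r ℕ.* b ℕ.+ 1) ×
        ρ ^ R * (∑ ωs (λ ω → w ω * gain ω) - (e₁ + e₂) * W) ≤ W * ∑ xs (λ x → ∑ ys λ y → μ x y * ⟦ does (run s x y ≟ f x y) ⟧)
      single = proj₁ (proj₁ best) , proj₂ (proj₁ best) , (begin
        ρ ^ R * (∑ ωs (λ ω → w ω * gain ω) - (e₁ + e₂) * W)
          ≤⟨ *-monoˡ (0≤^ R 0≤ρ) ∑-gain ⟩
        ρ ^ R * (W * ∑ xs (λ x → ∑ ys λ y → μ x y * total x y (good-outcome x y)))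
          ≡⟨ swap (ρ ^ R) W (∑ xs (λ x → ∑ ys λ y → μ x y * total x y (good-outcome x y))) ⟩
        W * (ρ ^ R * ∑ xs (λ x → ∑ ys λ y → μ x y * total x y (good-outcome x y)))
          ≡⟨ cong (W *_) (trans (sym (∑-*ˡ xs (ρ ^ R) (λ x → ∑ ys λ y → μ x y * total x y (good-outcome x y))))
               (∑-cong xs λ x → trans (sym (∑-*ˡ ys (ρ ^ R) (λ y → μ x y * total x y (good-outcome x y))))
                 (∑-cong ys λ y → swap (ρ ^ R) (μ x y) (total x y (good-outcome x y))))) ⟩
        W * ∑ xs (λ x → ∑ ys λ y → μ x y * (ρ ^ R * total x y (good-outcome x y)))
          ≤⟨ *-monoˡ 0≤W (∑∑-mono λ x y → *-monoˡ (0≤μ x y)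
               (simulate-outcome r alice bob out (λ _ → []) (λ _ → []) x y [] refl refl (f x y) 1ℚ)) ⟩
        W * ∑ xs (λ x → ∑ ys λ y → μ x y * E d (outputs x y (f x y)))
          ≡⟨ cong (W *_) (sym (trans (E-∑ d xs (λ x s → ∑ ys λ y → μ x y * outputs x y (f x y) s))
               (∑-cong xs λ x → trans (E-∑ d ys (λ y s → μ x y * outputs x y (f x y) s))
                 (∑-cong ys λ y → E-*ˡ d (μ x y) (outputs x y (f x y)))))) ⟩
        W * E d score
          ≤⟨ *-monoˡ 0≤W (proj₂ best) ⟩
        W * score (proj₁ best) ∎)
        where
        open ≤-Reasoning
        d = simulate r alice bob out (λ _ → []) (λ _ → [])
        score : Bounded X Y r → ℚ
        score s = ∑ xs λ x → ∑ ys λ y → μ x y * outputs x y (f x y) s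
        best = E-pick d score
        swap : ∀ p q r → p * (q * r) ≡ q * (p * r)
        swap = solve 3 (λ p q r → p :* (q :* r) := q :* (p :* r)) refl

-- Telescoping products

fins : ∀ n → List (Fin n)
fins zero    = []
fins (suc n) = zero ∷ map suc (fins n)

length-fins : ∀ n → List.length (fins n) ≡ n
length-fins zero    = refl
length-fins (suc n) = cong suc (trans (List.length-map suc (fins n)) (length-fins n))

∏-map : {A B : Set} (g : A → B) (xs : List A) (f : B → ℚ) → ∏ (map g xs) f ≡ ∏ xs (f ∘ g)
∏-map g []       f = refl
∏-map g (x ∷ xs) f = cong (f (g x) *_) (∏-map g xs f)

0<∏ : {A : Set} (xs : List A) {f : A → ℚ} → (∀ a → 0ℚ < f a) → 0ℚ < ∏ xs f
0<∏ []       h = 0<1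
0<∏ (x ∷ xs) h = 0<* (h x) (0<∏ xs h)

-- The hypothesis says t_i = m_i (p_i / p_(i+1)) (q_(i+1) / q_i), written without division.
telescope : ∀ n (t m : Fin n → ℚ) (p q : ℕ → ℚ) → (∀ i → 0ℚ < p i) → (∀ i → 0ℚ < q i) →
  (∀ i → t i * (p (suc (Fin.toℕ i)) * q (Fin.toℕ i)) ≡ m i * (p (Fin.toℕ i) * q (suc (Fin.toℕ i)))) →
  ∏ (fins n) t * (p n * q 0) ≡ ∏ (fins n) m * (p 0 * q n)
telescope zero    t m p q 0<p 0<q e = refl
telescope (suc n) t m p q 0<p 0<q e = *-≢0⇒≡ (0<* (0<p 1) (0<q 1)) (begin
  p 1 * q 1 * (t zero * ∏ (map suc (fins n)) t * (p (suc n) * q 0))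
    ≡⟨ cong (λ z → p 1 * q 1 * (t zero * z * (p (suc n) * q 0))) (∏-map suc (fins n) t) ⟩
  p 1 * q 1 * (t zero * ∏ (fins n) (t ∘ suc) * (p (suc n) * q 0))
    ≡⟨ rearrange (p 1) (q 1) (t zero) (∏ (fins n) (t ∘ suc)) (p (suc n)) (q 0) ⟩
  t zero * (p 1 * q 0) * (∏ (fins n) (t ∘ suc) * (p (suc n) * q 1))
    ≡⟨ cong₂ _*_ (e zero) (telescope n (t ∘ suc) (m ∘ suc) (p ∘ suc) (q ∘ suc) (0<p ∘ suc) (0<q ∘ suc) (e ∘ suc)) ⟩
  m zero * (p 0 * q 1) * (∏ (fins n) (m ∘ suc) * (p 1 * q (suc n)))
    ≡⟨ rearrange′ (p 1) (q 1) (m zero) (∏ (fins n) (m ∘ suc)) (p 0) (q (suc n)) ⟩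
  p 1 * q 1 * (m zero * ∏ (fins n) (m ∘ suc) * (p 0 * q (suc n)))
    ≡⟨ cong (λ z → p 1 * q 1 * (m zero * z * (p 0 * q (suc n)))) (sym (∏-map suc (fins n) m)) ⟩
  p 1 * q 1 * (m zero * ∏ (map suc (fins n)) m * (p 0 * q (suc n))) ∎)
  where
  open ≡-Reasoning
  rearrange : ∀ a b t s c d → a * b * (t * s * (c * d)) ≡ t * (a * d) * (s * (c * b))
  rearrange = solve 6 (λ a b t s c d → a :* b :* (t :* s :* (c :* d)) := t :* (a :* d) :* (s :* (c :* b))) refl
  rearrange′ : ∀ a b t s c d → t * (c * b) * (s * (a * d)) ≡ a * b * (t * s * (c * d))
  rearrange′ = solve 6 (λ a b t s c d → t :* (c :* b) :* (s :* (a :* d)) := a :* b :* (t :* s :* (c :* d))) refl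

-- The product p j · q (j + 1) · p (j + 2) ···, that is, the probability of r messages when p and q
-- are the conditional probabilities of the two parties. With `one` in place of p or q only one
-- party's share is left.
alt : ℕ → (p q : ℕ → ℚ) → ℕ → ℚ
alt zero    p q j = 1ℚ
alt (suc r) p q j = p j * alt r q p (suc j)

one : ℕ → ℚ
one _ = 1ℚ

0<alt : ∀ r {p q} → (∀ j → 0ℚ < p j) → (∀ j → 0ℚ < q j) → ∀ j → 0ℚ < alt r p q j
0<alt zero    0<p 0<q j = 0<1
0<alt (suc r) 0<p 0<q j = 0<* (0<p j) (0<alt r 0<q 0<p (suc j))

alt-split : ∀ r p q j → alt r p q j ≡ alt r p one j * alt r one q j
alt-split zero    p q j = refl
alt-split (suc r) p q j = trans (cong (p j *_) (alt-split r q p (suc j)))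
  (solve 3 (λ a b c → a :* (b :* c) := (a :* c) :* (con 1ℚ :* b)) refl (p j) (alt r q one (suc j)) (alt r one p (suc j)))

alt-cong : ∀ r {p p′ q q′} j → (∀ k → j ℕ.≤ k → p k ≡ p′ k) → (∀ k → j ℕ.≤ k → q k ≡ q′ k) → alt r p q j ≡ alt r p′ q′ j
alt-cong zero    j e e′ = refl
alt-cong (suc r) j e e′ = cong₂ _*_ (e j ℕ.≤-refl) (alt-cong r (suc j) (λ k h → e′ k (ℕ.<⇒≤ h)) (λ k h → e k (ℕ.<⇒≤ h)))

alt-telescope : ∀ r ρ (T : ℕ → ℚ) → (∀ j → ρ j * T j ≡ T (suc j)) → ∀ j → alt r ρ ρ j * T j ≡ T (r ℕ.+ j)
alt-telescope zero    ρ T e j = *-identityˡ (T j)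
alt-telescope (suc r) ρ T e j = trans (solve 3 (λ a b c → a :* b :* c := b :* (a :* c)) refl (ρ j) (alt r ρ ρ (suc j)) (T j))
  (trans (cong (alt r ρ ρ (suc j) *_) (e j)) (trans (alt-telescope r ρ T e (suc j)) (cong T (ℕ.+-suc r j))))

-- Whose turn it is: true for the party sending message 0.
turn : ℕ → Bool
turn zero    = true
turn (suc j) = not (turn j)

alt-ones : ∀ r p τ → (∀ j → turn j ≡ τ → p j ≡ 1ℚ) → ∀ j →
  (turn j ≡ τ → alt r p one j ≡ 1ℚ) × (turn j ≡ not τ → alt r one p j ≡ 1ℚ)
alt-ones zero    p τ h j = (λ _ → refl) , λ _ → refl
alt-ones (suc r) p τ h j =
  (λ e → trans (cong₂ _*_ (h j e) (proj₂ (alt-ones r p τ h (suc j)) (cong not e))) refl) ,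
  (λ e → trans (cong (1ℚ *_) (proj₁ (alt-ones r p τ h (suc j)) (trans (cong not e) (Bool.not-involutive τ)))) refl)

-- Parts of vectors

before after : ∀ {A : Set} {n} → ℕ → Vec A n → List A
before zero    v       = []
before (suc i) []      = []
before (suc i) (a ∷ v) = a ∷ before i v
after zero    v       = toList v
after (suc i) []      = []
after (suc i) (a ∷ v) = after i v

module _ {A : Set} where

  before-suc⁺ : ∀ {n} (i : Fin n) (u v : Vec A n) → before (Fin.toℕ i) u ≡ before (Fin.toℕ i) v → lookup u i ≡ lookup v i →
    before (suc (Fin.toℕ i)) u ≡ before (suc (Fin.toℕ i)) v
  before-suc⁺ zero    (a ∷ u) (b ∷ v) _ e  = cong (_∷ []) e
  before-suc⁺ (suc i) (a ∷ u) (b ∷ v) e e′ = cong₂ _∷_ (List.∷-injectiveˡ e) (before-suc⁺ i u v (List.∷-injectiveʳ e) e′)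

  before-suc⁻ : ∀ {n} (i : Fin n) (u v : Vec A n) → before (suc (Fin.toℕ i)) u ≡ before (suc (Fin.toℕ i)) v →
    before (Fin.toℕ i) u ≡ before (Fin.toℕ i) v × lookup u i ≡ lookup v i
  before-suc⁻ zero    (a ∷ u) (b ∷ v) e = refl , List.∷-injectiveˡ e
  before-suc⁻ (suc i) (a ∷ u) (b ∷ v) e with before-suc⁻ i u v (List.∷-injectiveʳ e)
  ... | e₁ , e₂ = cong₂ _∷_ (List.∷-injectiveˡ e) e₁ , e₂

  after-suc⁺ : ∀ {n} (i : Fin n) (u v : Vec A n) → lookup u i ≡ lookup v i → after (suc (Fin.toℕ i)) u ≡ after (suc (Fin.toℕ i)) v →
    after (Fin.toℕ i) u ≡ after (Fin.toℕ i) v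
  after-suc⁺ zero    (a ∷ u) (b ∷ v) e e′ = cong₂ _∷_ e e′
  after-suc⁺ (suc i) (a ∷ u) (b ∷ v) e e′ = after-suc⁺ i u v e e′

  after-suc⁻ : ∀ {n} (i : Fin n) (u v : Vec A n) → after (Fin.toℕ i) u ≡ after (Fin.toℕ i) v →
    lookup u i ≡ lookup v i × after (suc (Fin.toℕ i)) u ≡ after (suc (Fin.toℕ i)) v
  after-suc⁻ zero    (a ∷ u) (b ∷ v) e = List.∷-injectiveˡ e , List.∷-injectiveʳ e
  after-suc⁻ (suc i) (a ∷ u) (b ∷ v) e = after-suc⁻ i u v e

  before-all : ∀ {n} (u v : Vec A n) → before n u ≡ before n v → u ≡ v
  before-all []      []      e = refl
  before-all (a ∷ u) (b ∷ v) e = cong₂ _∷_ (List.∷-injectiveˡ e) (before-all u v (List.∷-injectiveʳ e))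

  after-zero : ∀ {n} (u v : Vec A n) → after 0 u ≡ after 0 v → u ≡ v
  after-zero []      []      e = refl
  after-zero (a ∷ u) (b ∷ v) e = cong₂ _∷_ (List.∷-injectiveˡ e) (after-zero u v (List.∷-injectiveʳ e))

  after-all : ∀ {n} (u : Vec A n) → after n u ≡ []
  after-all []      = refl
  after-all (a ∷ u) = after-all u

vectors : {A : Set} → List A → ∀ n → List (Vec A n)
vectors as zero    = [] ∷ []
vectors as (suc n) = cartesianProductWith _∷_ as (vectors as n)

∈-vectors : {A : Set} {as : List A} → (∀ a → a ∈ as) → ∀ {n} (v : Vec A n) → v ∈ vectors as n
∈-vectors all []      = here refl
∈-vectors all (a ∷ v) = ∈.∈-cartesianProductWith⁺ _∷_ (all a) (∈-vectors all v)

vectors-unique : {A : Set} {as : List A} → Unique as → ∀ n → Unique (vectors as n)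
vectors-unique u zero    = [] ∷ []
vectors-unique u (suc n) = Unique.cartesianProductWith⁺ _∷_ (λ { refl → refl , refl }) u (vectors-unique u n)

Enumerated-Vec : {A : Set} → Enumerated A → ∀ n → Enumerated (Vec A n)
Enumerated-Vec e n = record
  { dec = ≡-dec (dec e) ; list = vectors (list e) n ; unique = vectors-unique (unique e) n ; all = ∈-vectors (all e) }

Enumerated-× : {A B : Set} → Enumerated A → Enumerated B → Enumerated (A × B)
Enumerated-× e e′ = record
  { dec = Product.≡-dec (dec e) (dec e′) ; list = cartesianProduct (list e) (list e′)
  ; unique = Unique.cartesianProduct⁺ (unique e) (unique e′) ; all = λ (a , b) → ∈.∈-cartesianProduct⁺ (all e a) (all e′ b) }

Enumerated-Bool : Enumerated Bool
Enumerated-Bool = record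
  { dec = _≟_ ; list = false ∷ true ∷ [] ; unique = ((λ ()) ∷ []) ∷ [] ∷ []
  ; all = λ { false → here refl ; true → there (here refl) } }

⨂ : {A B : Set} → ∀ {n} → Vec (A → B → ℚ) n → Vec A n → Vec B n → ℚ
⨂ []      []      []      = 1ℚ
⨂ (p ∷ ps) (x ∷ xs) (y ∷ ys) = p x y * ⨂ ps xs ys

-- Coordinate by coordinate: x and x′ agree before i, y and y′ from i on, so exchanging y with y′ at
-- most permutes the two factors.
⨂-swap : {A B : Set} → ∀ {n} (ps : Vec (A → B → ℚ) n) i x x′ y y′ → before i x ≡ before i x′ → after i y ≡ after i y′ →
  ⨂ ps x y * ⨂ ps x′ y′ ≡ ⨂ ps x y′ * ⨂ ps x′ y
⨂-swap ps zero x x′ y y′ _ e with after-zero y y′ e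
... | refl = refl
⨂-swap [] (suc i) [] [] [] [] e e′ = refl
⨂-swap (p ∷ ps) (suc i) (x ∷ xs) (x′ ∷ xs′) (y ∷ ys) (y′ ∷ ys′) e e′ with List.∷-injectiveˡ e
... | refl = trans (interchange (p x y) (⨂ ps xs ys) (p x y′) (⨂ ps xs′ ys′))
  (trans (cong (p x y * p x y′ *_) (⨂-swap ps i xs xs′ ys ys′ (List.∷-injectiveʳ e) e′))
    (sym (trans (interchange (p x y′) (⨂ ps xs ys′) (p x y) (⨂ ps xs′ ys)) (cong (_* (⨂ ps xs ys′ * ⨂ ps xs′ ys)) (*-comm (p x y′) (p x y))))))
  where
  interchange : ∀ a b c d → (a * b) * (c * d) ≡ (a * c) * (b * d)
  interchange = solve 4 (λ a b c d → (a :* b) :* (c :* d) := (a :* c) :* (b :* d)) refl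

∑-vectors-∏ : {A : Set} (as : List A) (p : A → ℚ) → ∑ as p ≡ 1ℚ → ∀ n → ∑ (vectors as n) (λ v → ∏ (fins n) λ i → p (lookup v i)) ≡ 1ℚ
∑-vectors-∏ as p e zero    = refl
∑-vectors-∏ as p e (suc n) = trans (∑-cartesian _∷_ as (vectors as n) (λ v → ∏ (fins (suc n)) λ i → p (lookup v i)))
  (trans (∑-cong as λ a → trans (∑-cong (vectors as n) λ v → cong (p a *_) (∏-map suc (fins n) λ i → p (lookup (a ∷ v) i)))
    (trans (∑-*ˡ (vectors as n) (p a) (λ v → ∏ (fins n) λ i → p (lookup v i))) (trans (cong (p a *_) (∑-vectors-∏ as p e n)) (*-identityʳ (p a)))))
  e)

∑-product : {A B : Set} (xs : List A) (ys : List B) (f : A → ℚ) (g : B → ℚ) → ∑ xs f * ∑ ys g ≡ ∑ xs λ x → ∑ ys λ y → f x * g y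
∑-product xs ys f g = trans (sym (∑-*ʳ xs (∑ ys g) f)) (∑-cong xs λ x → sym (∑-*ˡ ys (f x) g))

guarded : ∀ b {p q} → (b ≡ true → p ≡ q) → ⟦ b ⟧ * p ≡ ⟦ b ⟧ * q
guarded true  e = cong (1ℚ *_) (e refl)
guarded false {p} {q} e = trans (*-zeroˡ p) (sym (*-zeroˡ q))

module Rectangles {X Y : Set} (xs : List X) (ys : List Y) (φ : X → Y → ℚ) where

  block : (X → Bool) → (Y → Bool) → ℚ
  block P Q = ∑ xs λ x → ⟦ P x ⟧ * ∑ ys λ y → ⟦ Q y ⟧ * φ x y

  -- The exchange law of a matrix of rank one passes from the entries to sums over blocks.
  block-swap : ∀ P P′ Q Q′ → (∀ x x′ y y′ → P x ≡ true → P′ x′ ≡ true → Q y ≡ true → Q′ y′ ≡ true → φ x y * φ x′ y′ ≡ φ x y′ * φ x′ y) →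
    block P Q * block P′ Q′ ≡ block P Q′ * block P′ Q
  block-swap P P′ Q Q′ e = begin
    block P Q * block P′ Q′
      ≡⟨ expand P P′ Q Q′ ⟩
    (∑ xs λ x → ∑ xs λ x′ → ∑ ys λ y → ∑ ys λ y′ → (⟦ P x ⟧ * ⟦ Q y ⟧ * φ x y) * (⟦ P′ x′ ⟧ * ⟦ Q′ y′ ⟧ * φ x′ y′))
      ≡⟨ ∑-cong xs (λ x → ∑-cong xs λ x′ → trans (∑-swap ys ys _) (∑-cong ys λ y′ → ∑-cong ys λ y → term x x′ y y′)) ⟩
    (∑ xs λ x → ∑ xs λ x′ → ∑ ys λ y′ → ∑ ys λ y → (⟦ P x ⟧ * ⟦ Q′ y′ ⟧ * φ x y′) * (⟦ P′ x′ ⟧ * ⟦ Q y ⟧ * φ x′ y))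
      ≡⟨ sym (expand P P′ Q′ Q) ⟩
    block P Q′ * block P′ Q ∎
    where
    open ≡-Reasoning
    inner : X → (Y → Bool) → ℚ
    inner x Q = ∑ ys λ y → ⟦ Q y ⟧ * φ x y
    expand : ∀ P P′ Q Q′ → block P Q * block P′ Q′ ≡
      ∑ xs λ x → ∑ xs λ x′ → ∑ ys λ y → ∑ ys λ y′ → (⟦ P x ⟧ * ⟦ Q y ⟧ * φ x y) * (⟦ P′ x′ ⟧ * ⟦ Q′ y′ ⟧ * φ x′ y′)
    expand P P′ Q Q′ = trans (∑-product xs xs (λ x → ⟦ P x ⟧ * inner x Q) (λ x → ⟦ P′ x ⟧ * inner x Q′))
      (∑-cong xs λ x → ∑-cong xs λ x′ → trans
        (cong₂ _*_ (trans (sym (∑-*ˡ ys ⟦ P x ⟧ (λ y → ⟦ Q y ⟧ * φ x y))) (∑-cong ys λ y → sym (*-assoc ⟦ P x ⟧ ⟦ Q y ⟧ (φ x y))))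
                   (trans (sym (∑-*ˡ ys ⟦ P′ x′ ⟧ (λ y → ⟦ Q′ y ⟧ * φ x′ y))) (∑-cong ys λ y → sym (*-assoc ⟦ P′ x′ ⟧ ⟦ Q′ y ⟧ (φ x′ y)))))
        (∑-product ys ys (λ y → ⟦ P x ⟧ * ⟦ Q y ⟧ * φ x y) (λ y′ → ⟦ P′ x′ ⟧ * ⟦ Q′ y′ ⟧ * φ x′ y′)))
    rearrange : ∀ p q p′ q′ f g → (p * q * f) * (p′ * q′ * g) ≡ p * (p′ * (q * (q′ * (f * g))))
    rearrange = solve 6 (λ p q p′ q′ f g → (p :* q :* f) :* (p′ :* q′ :* g) := p :* (p′ :* (q :* (q′ :* (f :* g))))) refl
    rearrange′ : ∀ p q p′ q′ f g → (p * q′ * f) * (p′ * q * g) ≡ p * (p′ * (q * (q′ * (f * g))))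
    rearrange′ = solve 6 (λ p q p′ q′ f g → (p :* q′ :* f) :* (p′ :* q :* g) := p :* (p′ :* (q :* (q′ :* (f :* g))))) refl
    term : ∀ x x′ y y′ → (⟦ P x ⟧ * ⟦ Q y ⟧ * φ x y) * (⟦ P′ x′ ⟧ * ⟦ Q′ y′ ⟧ * φ x′ y′) ≡
      (⟦ P x ⟧ * ⟦ Q′ y′ ⟧ * φ x y′) * (⟦ P′ x′ ⟧ * ⟦ Q y ⟧ * φ x′ y)
    term x x′ y y′ = trans (rearrange ⟦ P x ⟧ ⟦ Q y ⟧ ⟦ P′ x′ ⟧ ⟦ Q′ y′ ⟧ (φ x y) (φ x′ y′))
      (trans (guarded (P x) λ h₁ → guarded (P′ x′) λ h₂ → guarded (Q y) λ h₃ → guarded (Q′ y′) λ h₄ → e x x′ y y′ h₁ h₂ h₃ h₄)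
        (sym (rearrange′ ⟦ P x ⟧ ⟦ Q y ⟧ ⟦ P′ x′ ⟧ ⟦ Q′ y′ ⟧ (φ x y′) (φ x′ y))))

-- Independent copies

cells : {X Y : Set} → (X → Y → ℚ) → (X → Y → Bool) → ∀ {n} → Vec Bool n → Vec (X → Y → ℚ) n
cells μ f []      = []
cells μ f (b ∷ g) = (λ x y → μ x y * ⟦ does (f x y ≟ b) ⟧) ∷ cells μ f g

0<*⇒0< : ∀ {p q} → 0ℚ ≤ p → 0ℚ ≤ q → 0ℚ < p * q → 0ℚ < p × 0ℚ < q
0<*⇒0< {p} {q} 0≤p 0≤q h =
  0≤∧≢0⇒0< 0≤p (λ { refl → <-irrefl (sym (*-zeroˡ q)) h }) , 0≤∧≢0⇒0< 0≤q (λ { refl → <-irrefl (sym (*-zeroʳ p)) h })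

module _ {X Y : Set} {μ : X → Y → ℚ} (0≤μ : ∀ x y → 0ℚ ≤ μ x y) {f : X → Y → Bool} where

  0≤cells : ∀ {n} (g : Vec Bool n) x y → 0ℚ ≤ ⨂ (cells μ f g) x y
  0≤cells []      []      []      = 0≤1
  0≤cells (b ∷ g) (x ∷ xs) (y ∷ ys) = 0≤* (0≤* (0≤μ x y) (0≤⟦⟧ (does (f x y ≟ b)))) (0≤cells g xs ys)

  cells-support : ∀ {n} (g : Vec Bool n) x y → 0ℚ < ⨂ (cells μ f g) x y →
    (∀ i → lookup g i ≡ f (lookup x i) (lookup y i)) × (∀ i → 0ℚ < μ (lookup x i) (lookup y i)) ×
    ⨂ (cells μ f g) x y ≡ ∏ (fins n) λ i → μ (lookup x i) (lookup y i)
  cells-support [] [] [] _ = (λ ()) , (λ ()) , refl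
  cells-support {suc n} (b ∷ g) (x ∷ xs) (y ∷ ys) h =
    (λ { zero → sym fb ; (suc i) → proj₁ rest i }) , (λ { zero → 0<μ ; (suc i) → proj₁ (proj₂ rest) i }) ,
    cong₂ _*_ (trans (cong (λ d → μ x y * ⟦ d ⟧) (dec-true (f x y ≟ b) fb)) (*-identityʳ (μ x y)))
      (trans (proj₂ (proj₂ rest)) (sym (∏-map suc (fins n) λ i → μ (lookup (x ∷ xs) i) (lookup (y ∷ ys) i))))
    where
    0≤first : 0ℚ ≤ μ x y * ⟦ does (f x y ≟ b) ⟧
    0≤first = 0≤* (0≤μ x y) (0≤⟦⟧ (does (f x y ≟ b)))
    both = 0<*⇒0< 0≤first (0≤cells g xs ys) h
    both′ = 0<*⇒0< (0≤μ x y) (0≤⟦⟧ (does (f x y ≟ b))) (proj₁ both)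
    0<μ = proj₁ both′
    positive : ∀ {b} → 0ℚ < ⟦ b ⟧ → b ≡ true
    positive {true}  _ = refl
    positive {false} h = contradiction h (<-irrefl refl)
    fb : f x y ≡ b
    fb = does-true (f x y ≟ b) (positive (proj₂ both′))
    rest = cells-support g xs ys (proj₂ both)

module _ {Ω M : Set} (_≟ₘ_ : DecidableEquality M) (ωs : List Ω) (msg : ℕ → Ω → M) (K : ℚ) where

  open Conversation _≟ₘ_ ωs msg

  along-forward : ∀ r a b j ω α β g → along K r a b j ω α β g (λ _ α _ _ → α) ≡
    α * alt r (λ k → a (hist k ω) (msg k ω)) (λ k → b (hist k ω) (msg k ω)) j
  along-forward zero    a b j ω α β g = sym (*-identityʳ α)
  along-forward (suc r) a b j ω α β g = trans (along-forward r b a (suc j) ω _ _ _) (*-assoc α (a (hist j ω) (msg j ω)) _)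

  along-backward : ∀ r a b j ω α β g → along K r a b j ω α β g (λ _ _ β _ → β) ≡
    β * alt r (λ k → b (hist k ω) (msg k ω)) (λ k → a (hist k ω) (msg k ω)) j
  along-backward zero    a b j ω α β g = sym (*-identityʳ β)
  along-backward (suc r) a b j ω α β g = trans (along-backward r b a (suc j) ω _ _ _) (*-assoc β (b (hist j ω) (msg j ω)) _)

  length-hist : ∀ j ω → List.length (hist j ω) ≡ j
  length-hist zero    ω = refl
  length-hist (suc j) ω = cong suc (length-hist j ω)

  conditional-hist : ∀ {ms} (u : Unique ms) w j ω →
    conditional u w (hist j ω) (msg j ω) ≡ at w (suc j) (hist (suc j) ω) * inv (at w j (hist j ω))
  conditional-hist u w j ω = cong (λ k → at w (suc k) (hist (suc j) ω) * inv (at w k (hist j ω))) (length-hist j ω)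

-- Weights of the inputs that share given parts

module Marginals {X Y Msg : Set} (eX : Enumerated X) (eY : Enumerated Y) (_≟ₘ_ : DecidableEquality Msg) (n : ℕ)
  (μ : X → Y → ℚ) (0≤μ : ∀ x y → 0ℚ ≤ μ x y) (f : X → Y → Bool)
  (msg : ℕ → Vec X n × Vec Y n → Msg) (r : ℕ) (out : List Msg → Vec Bool n)
  where

  Ω : Set
  Ω = Vec X n × Vec Y n

  eXs : Enumerated (Vec X n)
  eXs = Enumerated-Vec eX n

  eYs : Enumerated (Vec Y n)
  eYs = Enumerated-Vec eY n

  eΩ : Enumerated Ω
  eΩ = Enumerated-× eXs eYs

  ωs : List Ω
  ωs = list eΩ

  open Conversation _≟ₘ_ ωs msg using (hist; _≟ₕ_) public

  R : ℕ
  R = suc r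

  Determined : Set
  Determined = ∀ j ω ω′ → hist j ω ≡ hist j ω′ → (if turn j then proj₁ ω ≡ proj₁ ω′ else proj₂ ω ≡ proj₂ ω′) → msg j ω ≡ msg j ω′

  -- The product weight where the output is right, and 0 elsewhere. Since the output is read off the
  -- history, w is a product over the coordinates on the inputs with a common history.
  w : Ω → ℚ
  w ω@(x , y) = ⨂ (cells μ f (out (hist R ω))) x y

  0≤w : ∀ ω → 0ℚ ≤ w ω
  0≤w ω@(x , y) = 0≤cells 0≤μ (out (hist R ω)) x y

  W : ℚ
  W = ∑ ωs w

  Relation : Set
  Relation = Ω → Ω → Bool

  x≺ y≺ y≽ : ℕ → Relation
  x≺ i (x , _) (x′ , _) = does (List.≡-dec (dec eX) (before i x) (before i x′))
  y≺ i (_ , y) (_ , y′) = does (List.≡-dec (dec eY) (before i y) (before i y′))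
  y≽ i (_ , y) (_ , y′) = does (List.≡-dec (dec eY) (after i y) (after i y′))

  yᵢ : Fin n → Relation
  yᵢ i (_ , y) (_ , y′) = does (dec eY (lookup y i) (lookup y′ i))

  h≈ : ℕ → Relation
  h≈ j ω ω′ = does (hist j ω ≟ₕ hist j ω′)

  infixr 6 _&_

  _&_ : Relation → Relation → Relation
  (e & e′) ω′ ω = e ω′ ω ∧ e′ ω′ ω

  -- The weight of the class of ω. Conditional probabilities under w are quotients of such weights.
  N : Relation → Ω → ℚ
  N e ω = ∑ ωs λ ω′ → w ω′ * ⟦ e ω′ ω ⟧

  N-cong : ∀ e e′ ω → (∀ ω′ → e ω′ ω ≡ e′ ω′ ω) → N e ω ≡ N e′ ω
  N-cong e e′ ω h = ∑-cong ωs λ ω′ → cong (λ b → w ω′ * ⟦ b ⟧) (h ω′)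

  w≤N : ∀ e ω → e ω ω ≡ true → w ω ≤ N e ω
  w≤N e ω h = ≤-trans (≤-reflexive (trans (sym (*-identityʳ (w ω))) (cong (λ b → w ω * ⟦ b ⟧) (sym h))))
    (term≤∑ {f = λ ω′ → w ω′ * ⟦ e ω′ ω ⟧} (λ ω′ → 0≤* (0≤w ω′) (0≤⟦⟧ (e ω′ ω))) (all eΩ ω))

  x≺-refl : ∀ i ω → x≺ i ω ω ≡ true
  x≺-refl i (x , _) = does-≡ (List.≡-dec (dec eX)) (before i x)

  y≺-refl : ∀ i ω → y≺ i ω ω ≡ true
  y≺-refl i (_ , y) = does-≡ (List.≡-dec (dec eY)) (before i y)

  y≽-refl : ∀ i ω → y≽ i ω ω ≡ true
  y≽-refl i (_ , y) = does-≡ (List.≡-dec (dec eY)) (after i y)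

  yᵢ-refl : ∀ i ω → yᵢ i ω ω ≡ true
  yᵢ-refl i (_ , y) = does-≡ (dec eY) (lookup y i)

  h≈-refl : ∀ j ω → h≈ j ω ω ≡ true
  h≈-refl j ω = does-≡ _≟ₕ_ (hist j ω)

  -- `y≽ 0` fixes all of y, so in `V i` only the part of x from i on is free.
  C C′ V : ℕ → Ω → ℚ
  C i  = N (x≺ i)
  C′ i = N (x≺ i & y≺ i)
  V i  = N (x≺ i & y≽ 0 & h≈ R)

  U : ℕ → ℕ → Ω → ℚ
  U j i = N (x≺ i & y≽ i & h≈ j)

  Z B₀ : Fin n → Ω → ℚ
  Z i  = N (x≺ (suc (Fin.toℕ i)) & y≽ (Fin.toℕ i) & h≈ R)
  B₀ i = N (x≺ (Fin.toℕ i) & yᵢ i)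

  module _ (det : Determined) where

    -- A message depends on the history and the speaker's input only, so taking one party's input
    -- from another run with the same history preserves that history.
    rectangle : ∀ j x x′ y y′ {h} → hist j (x , y) ≡ h → hist j (x′ , y′) ≡ h → hist j (x , y′) ≡ h
    rectangle zero    x x′ y y′ e e′ = e
    rectangle (suc j) x x′ y y′ {h} refl e′ = cong₂ _∷_ same-msg same-hist
      where
      same-hist : hist j (x , y′) ≡ hist j (x , y)
      same-hist = rectangle j x x′ y y′ refl (List.∷-injectiveʳ e′)
      same-msg : msg j (x , y′) ≡ msg j (x , y)
      same-msg with turn j | det j (x , y′) (x , y) | det j (x , y′) (x′ , y′)
      ... | true  | d | _ = d same-hist refl
      ... | false | _ | d = trans (d (trans same-hist (sym (List.∷-injectiveʳ e′))) refl) (List.∷-injectiveˡ e′)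

    -- Given the past of x, the future of y and the messages, the rest of y
    -- is independent of the rest of x.
    markov : ∀ i ω → V (suc (Fin.toℕ i)) ω * U R (Fin.toℕ i) ω ≡ Z i ω * V (Fin.toℕ i) ω
    markov i ω = trans (cong₂ _*_ (as-block (suc k) 0) (as-block k k)) (trans
      (block-swap (P (suc k)) (P k) (Q 0) (Q k) swap) (sym (cong₂ _*_ (as-block (suc k) k) (as-block k 0))))
      where
      k = Fin.toℕ i
      h = hist R ω
      g = cells μ f (out h)
      η φ : Vec X n → Vec Y n → ℚ
      η x y = ⟦ does (hist R (x , y) ≟ₕ h) ⟧
      φ x y = w (x , y) * η x y
      φ≡ : ∀ x y → φ x y ≡ ⟦ does (hist R (x , y) ≟ₕ h) ⟧ * ⨂ g x y
      φ≡ x y = trans (*-comm (w (x , y)) _) (≟-guard _≟ₕ_ (λ h → ⨂ (cells μ f (out h)) x y) (hist R (x , y)) h)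
      open Rectangles (list eXs) (list eYs) φ
      P : ℕ → Vec X n → Bool
      P i x = does (List.≡-dec (dec eX) (before i x) (before i (proj₁ ω)))
      Q : ℕ → Vec Y n → Bool
      Q i y = does (List.≡-dec (dec eY) (after i y) (after i (proj₂ ω)))
      rearrange : ∀ w p q h → w * (p * (q * h)) ≡ p * (q * (w * h))
      rearrange = solve 4 (λ w p q h → w :* (p :* (q :* h)) := p :* (q :* (w :* h))) refl
      as-block : ∀ i j → N (x≺ i & y≽ j & h≈ R) ω ≡ block (P i) (Q j)
      as-block i j = trans (∑-cartesian _,_ (list eXs) (list eYs) _) (∑-cong (list eXs) λ x →
        trans (∑-cong (list eYs) λ y → trans (cong (w (x , y) *_) (trans (⟦∧⟧ (P i x) _) (cong (⟦ P i x ⟧ *_) (⟦∧⟧ (Q j y) _))))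
            (rearrange (w (x , y)) ⟦ P i x ⟧ ⟦ Q j y ⟧ ⟦ does (hist R (x , y) ≟ₕ h) ⟧))
          (∑-*ˡ (list eYs) ⟦ P i x ⟧ (λ y → ⟦ Q j y ⟧ * φ x y)))
      hist-swap : ∀ x x′ y y′ → ⟦ does (hist R (x , y) ≟ₕ h) ⟧ * ⟦ does (hist R (x′ , y′) ≟ₕ h) ⟧ ≡
        ⟦ does (hist R (x , y′) ≟ₕ h) ⟧ * ⟦ does (hist R (x′ , y) ≟ₕ h) ⟧
      hist-swap x x′ y y′ = trans (sym (⟦∧⟧ (does (hist R (x , y) ≟ₕ h)) (does (hist R (x′ , y′) ≟ₕ h))))
        (trans (cong ⟦_⟧ (does-⇔ ((hist R (x , y) ≟ₕ h) ×-dec (hist R (x′ , y′) ≟ₕ h)) ((hist R (x , y′) ≟ₕ h) ×-dec (hist R (x′ , y) ≟ₕ h))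
          (λ (a , b) → rectangle R x x′ y y′ a b , rectangle R x′ x y′ y b a)
          (λ (a , b) → rectangle R x x′ y′ y a b , rectangle R x′ x y y′ b a)))
        (⟦∧⟧ (does (hist R (x , y′) ≟ₕ h)) (does (hist R (x′ , y) ≟ₕ h))))
      interchange : ∀ a b c d → (a * b) * (c * d) ≡ (a * c) * (b * d)
      interchange = solve 4 (λ a b c d → (a :* b) :* (c :* d) := (a :* c) :* (b :* d)) refl
      swap : ∀ x x′ y y′ → P (suc k) x ≡ true → P k x′ ≡ true → Q 0 y ≡ true → Q k y′ ≡ true → φ x y * φ x′ y′ ≡ φ x y′ * φ x′ y
      swap x x′ y y′ px px′ qy qy′ = trans (cong₂ _*_ (φ≡ x y) (φ≡ x′ y′)) (trans (interchange (η x y) (⨂ g x y) (η x′ y′) (⨂ g x′ y′))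
        (trans (cong₂ _*_ (hist-swap x x′ y y′) (⨂-swap g k x x′ y y′ ex ey))
        (trans (interchange (η x y′) (η x′ y) (⨂ g x y′) (⨂ g x′ y)) (sym (cong₂ _*_ (φ≡ x y′) (φ≡ x′ y))))))
        where
        ex : before k x ≡ before k x′
        ex = trans (proj₁ (before-suc⁻ i x (proj₁ ω) (does-true (List.≡-dec (dec eX) (before (suc k) x) (before (suc k) (proj₁ ω))) px)))
          (sym (does-true (List.≡-dec (dec eX) (before k x′) (before k (proj₁ ω))) px′))
        ey : after k y ≡ after k y′
        ey = trans (cong (after k) (after-zero y (proj₂ ω) (does-true (List.≡-dec (dec eY) (after 0 y) (after 0 (proj₂ ω))) qy)))
          (sym (does-true (List.≡-dec (dec eY) (after k y′) (after k (proj₂ ω))) qy′))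

-- Densities of the simulated conversations and their products

module Potentials {X Y Msg : Set} (eX : Enumerated X) (eY : Enumerated Y) (_≟ₘ_ : DecidableEquality Msg) (n : ℕ)
  (μ : X → Y → ℚ) (0≤μ : ∀ x y → 0ℚ ≤ μ x y) (f : X → Y → Bool)
  (msg : ℕ → Vec X n × Vec Y n → Msg) (r : ℕ) (out : List Msg → Vec Bool n)
  (det : Marginals.Determined eX eY _≟ₘ_ n μ 0≤μ f msg r out)
  where

  open Marginals eX eY _≟ₘ_ n μ 0≤μ f msg r out

  -- The future of y becomes known with the first message, hence the separate value at 0. For
  -- coordinate i the holder of x_i is given the index i + 1, while `UB`, for the holder of y_i,
  -- uses the index i; this shift makes the densities telescope.
  UX : ℕ → Ω → ℕ → ℚ
  UX i ω zero    = C i ω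
  UX i ω (suc j) = U (suc j) i ω

  UB : Fin n → Ω → ℕ → ℚ
  UB i ω zero    = B₀ i ω
  UB i ω (suc j) = U (suc j) (Fin.toℕ i) ω

  ρˣ : ℕ → Ω → ℕ → ℚ
  ρˣ i ω j = UX i ω (suc j) * inv (UX i ω j)

  ρʸ : Fin n → Ω → ℕ → ℚ
  ρʸ i ω j = UB i ω (suc j) * inv (UB i ω j)

  μᵢ μʸ : Fin n → Ω → ℚ
  μᵢ i (x , y) = μ (lookup x i) (lookup y i)
  μʸ i (x , y) = ∑ (list eX) λ x₀ → μ x₀ (lookup y i)

  -- t and v are densities with respect to w. By the Markov property they
  -- telescope over the coordinates, v up to the densities e, e₁ and e₂.
  fwd bwd t v e : Fin n → Ω → ℚ
  fwd i ω = alt R (ρˣ (suc (Fin.toℕ i)) ω) (ρʸ i ω) 0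
  bwd i ω = alt R (ρʸ i ω) (ρˣ (suc (Fin.toℕ i)) ω) 0
  t i ω = C (Fin.toℕ i) ω * (μᵢ i ω * (fwd i ω * inv (Z i ω)))
  v i ω = C (Fin.toℕ i) ω * (μᵢ i ω * (bwd i ω * inv (Z i ω)))
  e i ω = B₀ i ω * inv (C (Fin.toℕ i) ω) * (μᵢ i ω * inv (μʸ i ω)) * (C′ (Fin.toℕ i) ω * inv (C′ (suc (Fin.toℕ i)) ω))

  -- For ε = 2^-T these are densities of blind guesses: e₁ that of drawing y from its marginals and
  -- a code of the transcript uniformly, e₂ that of drawing the code uniformly given x.
  e₁ e₂ : ℚ → Ω → ℚ
  e₁ ε ω = ε * (W * (∏ (fins n) (λ i → μʸ i ω) * inv (V 0 ω)))
  e₂ ε ω = ε * (C n ω * inv (U R n ω))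

  module _ (ω : Ω) (0<w : 0ℚ < w ω) where

    private
      g = out (hist R ω)
      support = cells-support 0≤μ g (proj₁ ω) (proj₂ ω) 0<w

    0<N : ∀ e → e ω ω ≡ true → 0ℚ < N e ω
    0<N e h = <-≤-trans 0<w (w≤N e ω h)

    0<C : ∀ i → 0ℚ < C i ω
    0<C i = 0<N (x≺ i) (x≺-refl i ω)

    0<C′ : ∀ i → 0ℚ < C′ i ω
    0<C′ i = 0<N (x≺ i & y≺ i) (cong₂ _∧_ (x≺-refl i ω) (y≺-refl i ω))

    0<U : ∀ j i → 0ℚ < U j i ω
    0<U j i = 0<N (x≺ i & y≽ i & h≈ j) (cong₂ _∧_ (x≺-refl i ω) (cong₂ _∧_ (y≽-refl i ω) (h≈-refl j ω)))

    0<V : ∀ i → 0ℚ < V i ω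
    0<V i = 0<N (x≺ i & y≽ 0 & h≈ R) (cong₂ _∧_ (x≺-refl i ω) (cong₂ _∧_ (y≽-refl 0 ω) (h≈-refl R ω)))

    0<Z : ∀ i → 0ℚ < Z i ω
    0<Z i = 0<N (x≺ (suc (Fin.toℕ i)) & y≽ (Fin.toℕ i) & h≈ R)
      (cong₂ _∧_ (x≺-refl (suc (Fin.toℕ i)) ω) (cong₂ _∧_ (y≽-refl (Fin.toℕ i) ω) (h≈-refl R ω)))

    0<B₀ : ∀ i → 0ℚ < B₀ i ω
    0<B₀ i = 0<N (x≺ (Fin.toℕ i) & yᵢ i) (cong₂ _∧_ (x≺-refl (Fin.toℕ i) ω) (yᵢ-refl i ω))

    0<UX : ∀ i j → 0ℚ < UX i ω j
    0<UX i zero    = 0<C i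
    0<UX i (suc j) = 0<U (suc j) i

    0<UB : ∀ i j → 0ℚ < UB i ω j
    0<UB i zero    = 0<B₀ i
    0<UB i (suc j) = 0<U (suc j) (Fin.toℕ i)

    0<ρˣ : ∀ i j → 0ℚ < ρˣ i ω j
    0<ρˣ i j = 0<* (0<UX i (suc j)) (0<inv (0<UX i j))

    0<μᵢ : ∀ i → 0ℚ < μᵢ i ω
    0<μᵢ = proj₁ (proj₂ support)

    0<μʸ : ∀ i → 0ℚ < μʸ i ω
    0<μʸ i = <-≤-trans (0<μᵢ i) (term≤∑ {f = λ x₀ → μ x₀ (lookup (proj₂ ω) i)} (λ x₀ → 0≤μ x₀ _) (all eX (lookup (proj₁ ω) i)))

    w≡∏μ : w ω ≡ ∏ (fins n) λ i → μᵢ i ω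
    w≡∏μ = proj₂ (proj₂ support)

    div-mul : ∀ {q} p → 0ℚ < q → p * inv q * q ≡ p
    div-mul {q} p 0<q = trans (solve 3 (λ p i q → p :* i :* q := p :* (q :* i)) refl p (inv q) q)
      (trans (cong (p *_) (*-inv 0<q)) (*-identityʳ p))

    -- The two parties' shares in the probability of the transcript. Message 0 is the first one, so
    -- its speaker owns the odd share `O`.
    O Ev : ℕ → ℚ
    O i  = alt R (ρˣ i ω) one 0
    Ev i = alt R one (ρˣ i ω) 0

    0<O : ∀ i → 0ℚ < O i
    0<O i = 0<alt R (0<ρˣ i) (λ _ → 0<1) 0

    0<Ev : ∀ i → 0ℚ < Ev i
    0<Ev i = 0<alt R (λ _ → 0<1) (0<ρˣ i) 0

    U-product : ∀ i → C i ω * O i * Ev i ≡ U R i ω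
    U-product i = trans (solve 3 (λ c o e → c :* o :* e := (o :* e) :* c) refl (C i ω) (O i) (Ev i))
      (trans (cong (_* C i ω) (sym (alt-split R (ρˣ i ω) (ρˣ i ω) 0)))
      (trans (alt-telescope R (ρˣ i ω) (UX i ω) (λ j → div-mul (UX i ω (suc j)) (0<UX i j)) 0)
        (cong (UX i ω) (ℕ.+-identityʳ R))))

    -- `ρʸ i` differs from `ρˣ` at the same index only in message 0, which the second party does not
    -- send.
    fwd-product : ∀ i → fwd i ω ≡ O (suc (Fin.toℕ i)) * Ev (Fin.toℕ i)
    fwd-product i = trans (alt-split R (ρˣ (suc (Fin.toℕ i)) ω) (ρʸ i ω) 0)
      (cong (λ z → O (suc (Fin.toℕ i)) * (1ℚ * z)) (alt-cong r 1 (λ { (suc zero) _ → refl ; (suc (suc j)) _ → refl }) (λ _ _ → refl)))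

    -- The listener to message 0 conditions on y_i as well, and thus divides by `B₀` where `ρˣ`
    -- divides by `C`. The density `e` makes up for this mismatch.
    bwd-product : ∀ i → bwd i ω * B₀ i ω ≡ C (Fin.toℕ i) ω * O (Fin.toℕ i) * Ev (suc (Fin.toℕ i))
    bwd-product i = begin
      ρʸ i ω 0 * alt r ρ⁺ (ρʸ i ω) 1 * B₀ i ω           ≡⟨ cong (λ z → ρʸ i ω 0 * z * B₀ i ω) (alt-split r ρ⁺ (ρʸ i ω) 1) ⟩
      ρʸ i ω 0 * (p * alt r one (ρʸ i ω) 1) * B₀ i ω    ≡⟨ cong (λ z → ρʸ i ω 0 * (p * z) * B₀ i ω) (alt-cong r 1 (λ _ _ → refl) (λ { (suc zero) _ → refl ; (suc (suc j)) _ → refl })) ⟩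
      ρʸ i ω 0 * (p * q) * B₀ i ω                       ≡⟨ rearrange (ρʸ i ω 0) p q (B₀ i ω) ⟩
      ρʸ i ω 0 * B₀ i ω * (p * q)                       ≡⟨ cong (_* (p * q)) (trans (div-mul (U 1 k ω) (0<B₀ i)) (sym (div-mul (U 1 k ω) (0<C k)))) ⟩
      ρˣ k ω 0 * C k ω * (p * q)                        ≡⟨ rearrange′ (ρˣ k ω 0) (C k ω) p q ⟩
      C k ω * (ρˣ k ω 0 * q) * (1ℚ * p)                 ∎
      where
      open ≡-Reasoning
      k = Fin.toℕ i
      ρ⁺ = ρˣ (suc k) ω
      p = alt r ρ⁺ one 1
      q = alt r one (ρˣ k ω) 1
      rearrange : ∀ a p q b → a * (p * q) * b ≡ a * b * (p * q)
      rearrange = solve 4 (λ a p q b → a :* (p :* q) :* b := a :* b :* (p :* q)) refl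
      rearrange′ : ∀ a c p q → a * c * (p * q) ≡ c * (a * q) * (1ℚ * p)
      rearrange′ = solve 4 (λ a c p q → a :* c :* (p :* q) := c :* (a :* q) :* (con 1ℚ :* p)) refl

    markov′ : ∀ i → V (suc (Fin.toℕ i)) ω * (C (Fin.toℕ i) ω * O (Fin.toℕ i) * Ev (Fin.toℕ i)) ≡ Z i ω * V (Fin.toℕ i) ω
    markov′ i = trans (cong (V (suc (Fin.toℕ i)) ω *_) (U-product (Fin.toℕ i))) (markov det i ω)

    -- By `markov`, Z i = V (i + 1) · C i · O i · Ev i / V i. Inserted into t_i, this cancels C i
    -- and Ev i.
    t-step : ∀ i → t i ω * (V (suc (Fin.toℕ i)) ω * O (Fin.toℕ i)) ≡ μᵢ i ω * (V (Fin.toℕ i) ω * O (suc (Fin.toℕ i)))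
    t-step i = *-≢0⇒≡ (0<* (0<C k) (0<Ev k)) (begin
      c * Ev k * (c * (m * (fwd i ω * inv z)) * (V (suc k) ω * O k))
        ≡⟨ cong (λ F → c * Ev k * (c * (m * (F * inv z)) * (V (suc k) ω * O k))) (fwd-product i) ⟩
      c * Ev k * (c * (m * (O (suc k) * Ev k * inv z)) * (V (suc k) ω * O k))
        ≡⟨ rearrange c (Ev k) m (O (suc k)) (inv z) (V (suc k) ω) (O k) ⟩
      c * m * (O (suc k) * Ev k) * inv z * (V (suc k) ω * (c * O k * Ev k))
        ≡⟨ cong (c * m * (O (suc k) * Ev k) * inv z *_) (markov′ i) ⟩
      c * m * (O (suc k) * Ev k) * inv z * (z * V k ω)
        ≡⟨ rearrange₂ (c * m * (O (suc k) * Ev k)) (inv z) z (V k ω) ⟩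
      c * m * (O (suc k) * Ev k) * (z * inv z) * V k ω
        ≡⟨ cong (λ u → c * m * (O (suc k) * Ev k) * u * V k ω) (*-inv (0<Z i)) ⟩
      c * m * (O (suc k) * Ev k) * 1ℚ * V k ω
        ≡⟨ rearrange₃ c m (O (suc k)) (Ev k) (V k ω) ⟩
      c * Ev k * (m * (V k ω * O (suc k))) ∎)
      where
      open ≡-Reasoning
      k = Fin.toℕ i
      c = C k ω
      m = μᵢ i ω
      z = Z i ω
      rearrange : ∀ c e m o i v o′ → c * e * (c * (m * (o * e * i)) * (v * o′)) ≡ c * m * (o * e) * i * (v * (c * o′ * e))
      rearrange = solve 7 (λ c e m o i v o′ → c :* e :* (c :* (m :* (o :* e :* i)) :* (v :* o′)) := c :* m :* (o :* e) :* i :* (v :* (c :* o′ :* e))) refl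
      rearrange₂ : ∀ a i z v → a * i * (z * v) ≡ a * (z * i) * v
      rearrange₂ = solve 4 (λ a i z v → a :* i :* (z :* v) := a :* (z :* i) :* v) refl
      rearrange₃ : ∀ c m o e v → c * m * (o * e) * 1ℚ * v ≡ c * e * (m * (v * o))
      rearrange₃ = solve 5 (λ c m o e v → c :* m :* (o :* e) :* con 1ℚ :* v := c :* e :* (m :* (v :* o))) refl

    v-step : ∀ i → v i ω * B₀ i ω * (V (suc (Fin.toℕ i)) ω * Ev (Fin.toℕ i)) ≡ μᵢ i ω * C (Fin.toℕ i) ω * (V (Fin.toℕ i) ω * Ev (suc (Fin.toℕ i)))
    v-step i = *-≢0⇒≡ (0<* (0<C k) (0<O k)) (begin
      c * O k * (c * (m * (bwd i ω * inv z)) * b * (V (suc k) ω * Ev k))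
        ≡⟨ rearrange c (O k) m (bwd i ω) (inv z) b (V (suc k) ω) (Ev k) ⟩
      c * m * (bwd i ω * b) * inv z * (V (suc k) ω * (c * O k * Ev k))
        ≡⟨ cong₂ (λ x y → c * m * x * inv z * y) (bwd-product i) (markov′ i) ⟩
      c * m * (c * O k * Ev (suc k)) * inv z * (z * V k ω)
        ≡⟨ rearrange₂ (c * m * (c * O k * Ev (suc k))) (inv z) z (V k ω) ⟩
      c * m * (c * O k * Ev (suc k)) * (z * inv z) * V k ω
        ≡⟨ cong (λ u → c * m * (c * O k * Ev (suc k)) * u * V k ω) (*-inv (0<Z i)) ⟩
      c * m * (c * O k * Ev (suc k)) * 1ℚ * V k ω
        ≡⟨ rearrange₃ c m (O k) (Ev (suc k)) (V k ω) ⟩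
      c * O k * (m * c * (V k ω * Ev (suc k))) ∎)
      where
      open ≡-Reasoning
      k = Fin.toℕ i
      c = C k ω
      m = μᵢ i ω
      z = Z i ω
      b = B₀ i ω
      rearrange : ∀ c o m f i b v e → c * o * (c * (m * (f * i)) * b * (v * e)) ≡ c * m * (f * b) * i * (v * (c * o * e))
      rearrange = solve 8 (λ c o m f i b v e → c :* o :* (c :* (m :* (f :* i)) :* b :* (v :* e)) := c :* m :* (f :* b) :* i :* (v :* (c :* o :* e))) refl
      rearrange₂ : ∀ a i z v → a * i * (z * v) ≡ a * (z * i) * v
      rearrange₂ = solve 4 (λ a i z v → a :* i :* (z :* v) := a :* (z :* i) :* v) refl
      rearrange₃ : ∀ c m o e v → c * m * (c * o * e) * 1ℚ * v ≡ c * o * (m * c * (v * e))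
      rearrange₃ = solve 5 (λ c m o e v → c :* m :* (c :* o :* e) :* con 1ℚ :* v := c :* o :* (m :* c :* (v :* e))) refl

    e-step : ∀ i → e i ω * (C (Fin.toℕ i) ω * μʸ i ω) * (C′ (suc (Fin.toℕ i)) ω * 1ℚ) ≡ B₀ i ω * μᵢ i ω * (C′ (Fin.toℕ i) ω * 1ℚ)
    e-step i = trans (rearrange (B₀ i ω) (inv (C k ω)) (μᵢ i ω) (inv (μʸ i ω)) (C′ k ω) (inv (C′ (suc k) ω)) (C k ω) (μʸ i ω) (C′ (suc k) ω))
      (trans (cong₂ (λ p q → B₀ i ω * p * (μᵢ i ω * q) * (C′ k ω * (C′ (suc k) ω * inv (C′ (suc k) ω)))) (*-inv (0<C k)) (*-inv (0<μʸ i)))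
      (trans (cong (λ p → B₀ i ω * 1ℚ * (μᵢ i ω * 1ℚ) * (C′ k ω * p)) (*-inv (0<C′ (suc k))))
        (solve 3 (λ b m c → b :* con 1ℚ :* (m :* con 1ℚ) :* (c :* con 1ℚ) := b :* m :* (c :* con 1ℚ)) refl (B₀ i ω) (μᵢ i ω) (C′ k ω))))
      where
      k = Fin.toℕ i
      rearrange : ∀ b i m j c′ k c y d → b * i * (m * j) * (c′ * k) * (c * y) * (d * 1ℚ) ≡ b * (c * i) * (m * (y * j)) * (c′ * (d * k))
      rearrange = solve 9 (λ b i m j c′ k c y d → b :* i :* (m :* j) :* (c′ :* k) :* (c :* y) :* (d :* con 1ℚ) := b :* (c :* i) :* (m :* (y :* j)) :* (c′ :* (d :* k))) refl

    only-ω : ∀ e → e ω ω ≡ true → (∀ ω′ → e ω′ ω ≡ true → ω′ ≡ ω) → N e ω ≡ w ω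
    only-ω e h h′ = trans (∑-cong ωs λ ω′ → trans (*-comm (w ω′) ⟦ e ω′ ω ⟧) (cong (λ b → ⟦ b ⟧ * w ω′) (same ω′ (e ω′ ω) refl)))
      (∑-δ (dec eΩ) w ω (unique eΩ) (all eΩ ω))
      where
      same : ∀ ω′ b → e ω′ ω ≡ b → e ω′ ω ≡ does (dec eΩ ω′ ω)
      same ω′ true  eq = trans eq (sym (dec-true (dec eΩ ω′ ω) (h′ ω′ eq)))
      same ω′ false eq = trans eq (sym (dec-false (dec eΩ ω′ ω) λ { refl → case trans (sym eq) h of λ () }))

    ∧-left : ∀ a {b} → a ∧ b ≡ true → a ≡ true
    ∧-left true _ = refl

    ∧-right : ∀ a {b} → a ∧ b ≡ true → b ≡ true
    ∧-right true e = e

    V-last : V n ω ≡ w ω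
    V-last = only-ω (x≺ n & y≽ 0 & h≈ R) (cong₂ _∧_ (x≺-refl n ω) (cong₂ _∧_ (y≽-refl 0 ω) (h≈-refl R ω)))
      λ ω′@(x , y) h → cong₂ _,_
        (before-all x (proj₁ ω) (does-true (List.≡-dec (dec eX) (before n x) (before n (proj₁ ω))) (∧-left (x≺ n ω′ ω) h)))
        (after-zero y (proj₂ ω) (does-true (List.≡-dec (dec eY) (after 0 y) (after 0 (proj₂ ω))) (∧-left (y≽ 0 ω′ ω) (∧-right (x≺ n ω′ ω) h))))

    C′-last : C′ n ω ≡ w ω
    C′-last = only-ω (x≺ n & y≺ n) (cong₂ _∧_ (x≺-refl n ω) (y≺-refl n ω))
      λ ω′@(x , y) h → cong₂ _,_
        (before-all x (proj₁ ω) (does-true (List.≡-dec (dec eX) (before n x) (before n (proj₁ ω))) (∧-left (x≺ n ω′ ω) h)))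
        (before-all y (proj₂ ω) (does-true (List.≡-dec (dec eY) (before n y) (before n (proj₂ ω))) (∧-right (x≺ n ω′ ω) h)))

    C-zero : C 0 ω ≡ W
    C-zero = ∑-cong ωs λ ω′ → *-identityʳ (w ω′)

    C′-zero : C′ 0 ω ≡ W
    C′-zero = ∑-cong ωs λ ω′ → *-identityʳ (w ω′)

    h≈-suc : ∀ j ω′ → (if turn j then proj₁ ω′ ≡ proj₁ ω else proj₂ ω′ ≡ proj₂ ω) → h≈ (suc j) ω′ ω ≡ h≈ j ω′ ω
    h≈-suc j ω′ s = does-⇔ (hist (suc j) ω′ ≟ₕ hist (suc j) ω) (hist j ω′ ≟ₕ hist j ω) List.∷-injectiveʳ
      (λ same → cong₂ _∷_ (det j ω′ ω same s) same)

    absorb : ∀ a {b c} → (a ≡ true → b ≡ c) → a ∧ b ≡ a ∧ c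
    absorb true  h = h refl
    absorb false h = refl

    -- When all of y is given, the history determines the second party's messages, so each of its
    -- ratios is 1.
    Ev-zero : Ev 0 ≡ 1ℚ
    Ev-zero = proj₂ (alt-ones R (ρˣ 0 ω) false ones 0) refl
      where
      ones : ∀ j → turn j ≡ false → ρˣ 0 ω j ≡ 1ℚ
      ones (suc j) τ = trans (cong (_* inv (U (suc j) 0 ω)) (N-cong (x≺ 0 & y≽ 0 & h≈ (suc (suc j))) (x≺ 0 & y≽ 0 & h≈ (suc j)) ω λ ω′ → absorb (y≽ 0 ω′ ω) λ h → h≈-suc (suc j) ω′
          (subst (λ b → if b then proj₁ ω′ ≡ proj₁ ω else proj₂ ω′ ≡ proj₂ ω) (sym τ)
            (after-zero (proj₂ ω′) (proj₂ ω) (does-true (List.≡-dec (dec eY) (after 0 (proj₂ ω′)) (after 0 (proj₂ ω))) h)))))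
        (*-inv (0<U (suc j) 0))

    -- When all of x is given, the first party's messages are determined. Message 0 is a case of its
    -- own because its ratio also brings in the future of y, which is empty at n.
    O-last : O n ≡ 1ℚ
    O-last = proj₁ (alt-ones R (ρˣ n ω) true ones 0) refl
      where
      same-x : ∀ ω′ → x≺ n ω′ ω ≡ true → proj₁ ω′ ≡ proj₁ ω
      same-x ω′ h = before-all (proj₁ ω′) (proj₁ ω) (does-true (List.≡-dec (dec eX) (before n (proj₁ ω′)) (before n (proj₁ ω))) h)
      ones : ∀ j → turn j ≡ true → ρˣ n ω j ≡ 1ℚ
      ones zero    τ = trans (cong (_* inv (C n ω)) (N-cong (x≺ n & y≽ n & h≈ 1) (x≺ n) ω λ ω′ → trans (absorb (x≺ n ω′ ω) {c = true} λ h → cong₂ _∧_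
          (dec-true (List.≡-dec (dec eY) (after n (proj₂ ω′)) (after n (proj₂ ω))) (trans (after-all (proj₂ ω′)) (sym (after-all (proj₂ ω)))))
          (h≈-suc 0 ω′ (same-x ω′ h))) (Bool.∧-identityʳ (x≺ n ω′ ω))))
        (*-inv (0<C n))
      ones (suc j) τ = trans (cong (_* inv (U (suc j) n ω)) (N-cong (x≺ n & y≽ n & h≈ (suc (suc j))) (x≺ n & y≽ n & h≈ (suc j)) ω λ ω′ → absorb (x≺ n ω′ ω) λ h → cong (y≽ n ω′ ω ∧_) (h≈-suc (suc j) ω′
          (subst (λ b → if b then proj₁ ω′ ≡ proj₁ ω else proj₂ ω′ ≡ proj₂ ω) (sym τ) (same-x ω′ h)))))
        (*-inv (0<U (suc j) n))

    -- The boundary terms cancel: V n is the weight of ω alone, which is the product of the μᵢ, and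
    -- V 0 = C 0 · O 0 · Ev 0 = W · O 0, while O n = 1.
    ∏t : ∏ (fins n) (λ i → t i ω) ≡ W
    ∏t = *-≢0⇒≡ (0<* 0<w (0<O 0)) (begin
      w ω * O 0 * ∏ (fins n) (λ i → t i ω)                ≡⟨ cong (λ z → z * O 0 * ∏ (fins n) (λ i → t i ω)) (sym V-last) ⟩
      V n ω * O 0 * ∏ (fins n) (λ i → t i ω)              ≡⟨ *-comm (V n ω * O 0) (∏ (fins n) (λ i → t i ω)) ⟩
      ∏ (fins n) (λ i → t i ω) * (V n ω * O 0)            ≡⟨ telescope n (λ i → t i ω) (λ i → μᵢ i ω) (λ i → V i ω) O 0<V 0<O t-step ⟩
      ∏ (fins n) (λ i → μᵢ i ω) * (V 0 ω * O n)           ≡⟨ cong₂ (λ p q → p * (V 0 ω * q)) (sym w≡∏μ) O-last ⟩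
      w ω * (U R 0 ω * 1ℚ)                                ≡⟨ cong (λ z → w ω * (z * 1ℚ)) (sym (U-product 0)) ⟩
      w ω * (C 0 ω * O 0 * Ev 0 * 1ℚ)                     ≡⟨ cong₂ (λ p q → w ω * (p * O 0 * q * 1ℚ)) C-zero Ev-zero ⟩
      w ω * (W * O 0 * 1ℚ * 1ℚ)                           ≡⟨ solve 3 (λ w W o → w :* (W :* o :* con 1ℚ :* con 1ℚ) := w :* o :* W) refl (w ω) W (O 0) ⟩
      w ω * O 0 * W                                       ∎)
      where open ≡-Reasoning

    -- Telescoping v leaves V 0 and Ev n, and the products of C and B₀. The product of e trades the
    -- latter for W and the product of the μʸ, and e₁ and e₂ remove V 0 and Ev n at the price of a
    -- factor ε each.
    ∏v∏e : ∀ ε → ∏ (fins n) (λ i → v i ω) * ∏ (fins n) (λ i → e i ω) * (e₁ ε ω * e₂ ε ω) ≡ W * W * (ε * ε)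
    ∏v∏e ε = *-≢0⇒≡ (0<* (0<* 0<PB 0<PC) 0<PY) (begin
      PB * PC * PY * (Pv * Pe * (e₁ ε ω * e₂ ε ω))
        ≡⟨ solve 7 (λ b c y v e p q → b :* c :* y :* (v :* e :* (p :* q)) := (v :* b) :* (e :* (c :* y)) :* (p :* q)) refl PB PC PY Pv Pe (e₁ ε ω) (e₂ ε ω) ⟩
      (Pv * PB) * (Pe * (PC * PY)) * (e₁ ε ω * e₂ ε ω)
        ≡⟨ cong₂ (λ p q → p * q * (e₁ ε ω * e₂ ε ω)) PvPB PePCPY ⟩
      PC * (V 0 ω * Ev n) * (PB * W) * (e₁ ε ω * e₂ ε ω)
        ≡⟨ solve 7 (λ c v e b w p q → c :* (v :* e) :* (b :* w) :* (p :* q) := c :* b :* w :* (p :* v) :* (q :* e)) refl PC (V 0 ω) (Ev n) PB W (e₁ ε ω) (e₂ ε ω) ⟩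
      PC * PB * W * (e₁ ε ω * V 0 ω) * (e₂ ε ω * Ev n)
        ≡⟨ cong₂ (λ p q → PC * PB * W * p * q) e₁V e₂Ev ⟩
      PC * PB * W * (ε * (W * PY)) * ε
        ≡⟨ solve 5 (λ c b w ε y → c :* b :* w :* (ε :* (w :* y)) :* ε := b :* c :* y :* (w :* w :* (ε :* ε))) refl PC PB W ε PY ⟩
      PB * PC * PY * (W * W * (ε * ε)) ∎)
      where
      open ≡-Reasoning
      Pv = ∏ (fins n) (λ i → v i ω)
      Pe = ∏ (fins n) (λ i → e i ω)
      PB = ∏ (fins n) (λ i → B₀ i ω)
      PC = ∏ (fins n) (λ i → C (Fin.toℕ i) ω)
      PY = ∏ (fins n) (λ i → μʸ i ω)
      0<PB = 0<∏ (fins n) 0<B₀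
      0<PC = 0<∏ (fins n) (λ i → 0<C (Fin.toℕ i))
      0<PY = 0<∏ (fins n) 0<μʸ
      PvPB : Pv * PB ≡ PC * (V 0 ω * Ev n)
      PvPB = *-≢0⇒≡ 0<w (begin
        w ω * (Pv * PB)
          ≡⟨ cong₂ _*_ (sym V-last) (sym (∏-* (fins n) (λ i → v i ω) (λ i → B₀ i ω))) ⟩
        V n ω * ∏ (fins n) (λ i → v i ω * B₀ i ω)
          ≡⟨ solve 2 (λ v p → v :* p := p :* (v :* con 1ℚ)) refl (V n ω) _ ⟩
        ∏ (fins n) (λ i → v i ω * B₀ i ω) * (V n ω * 1ℚ)
          ≡⟨ cong (λ z → ∏ (fins n) (λ i → v i ω * B₀ i ω) * (V n ω * z)) (sym Ev-zero) ⟩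
        ∏ (fins n) (λ i → v i ω * B₀ i ω) * (V n ω * Ev 0)
          ≡⟨ telescope n (λ i → v i ω * B₀ i ω) (λ i → μᵢ i ω * C (Fin.toℕ i) ω) (λ i → V i ω) Ev 0<V 0<Ev v-step ⟩
        ∏ (fins n) (λ i → μᵢ i ω * C (Fin.toℕ i) ω) * (V 0 ω * Ev n)
          ≡⟨ cong (_* (V 0 ω * Ev n)) (trans (∏-* (fins n) (λ i → μᵢ i ω) (λ i → C (Fin.toℕ i) ω)) (cong (_* PC) (sym w≡∏μ))) ⟩
        w ω * PC * (V 0 ω * Ev n)
          ≡⟨ *-assoc (w ω) PC (V 0 ω * Ev n) ⟩
        w ω * (PC * (V 0 ω * Ev n)) ∎)
      PePCPY : Pe * (PC * PY) ≡ PB * W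
      PePCPY = *-≢0⇒≡ 0<w (begin
        w ω * (Pe * (PC * PY))
          ≡⟨ cong₂ _*_ (sym C′-last) (cong (Pe *_) (sym (∏-* (fins n) (λ i → C (Fin.toℕ i) ω) (λ i → μʸ i ω)))) ⟩
        C′ n ω * (Pe * ∏ (fins n) (λ i → C (Fin.toℕ i) ω * μʸ i ω))
          ≡⟨ cong (C′ n ω *_) (sym (∏-* (fins n) (λ i → e i ω) (λ i → C (Fin.toℕ i) ω * μʸ i ω))) ⟩
        C′ n ω * ∏ (fins n) (λ i → e i ω * (C (Fin.toℕ i) ω * μʸ i ω))
          ≡⟨ solve 2 (λ v p → v :* p := p :* (v :* con 1ℚ)) refl (C′ n ω) _ ⟩
        ∏ (fins n) (λ i → e i ω * (C (Fin.toℕ i) ω * μʸ i ω)) * (C′ n ω * 1ℚ)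
          ≡⟨ telescope n (λ i → e i ω * (C (Fin.toℕ i) ω * μʸ i ω)) (λ i → B₀ i ω * μᵢ i ω) (λ i → C′ i ω) one 0<C′ (λ _ → 0<1) e-step ⟩
        ∏ (fins n) (λ i → B₀ i ω * μᵢ i ω) * (C′ 0 ω * 1ℚ)
          ≡⟨ cong₂ (λ p q → p * (q * 1ℚ)) (trans (∏-* (fins n) (λ i → B₀ i ω) (λ i → μᵢ i ω)) (cong (PB *_) (sym w≡∏μ))) C′-zero ⟩
        PB * w ω * (W * 1ℚ)
          ≡⟨ solve 3 (λ b w W → b :* w :* (W :* con 1ℚ) := w :* (b :* W)) refl PB (w ω) W ⟩
        w ω * (PB * W) ∎)
      e₁V : e₁ ε ω * V 0 ω ≡ ε * (W * PY)
      e₁V = trans (solve 5 (λ ε W y i v → ε :* (W :* (y :* i)) :* v := ε :* (W :* (y :* i :* v))) refl ε W PY (inv (V 0 ω)) (V 0 ω))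
        (cong (λ z → ε * (W * z)) (div-mul PY (0<V 0)))
      e₂Ev : e₂ ε ω * Ev n ≡ ε
      e₂Ev = *-≢0⇒≡ (0<* (0<C n) (0<O n)) (trans
        (solve 5 (λ c o ε i ev → c :* o :* (ε :* (c :* i) :* ev) := ε :* c :* (i :* (c :* o :* ev))) refl (C n ω) (O n) ε (inv (U R n ω)) (Ev n))
        (trans (cong (λ z → ε * C n ω * (inv (U R n ω) * z)) (U-product n))
        (trans (cong (ε * C n ω *_) (trans (*-comm (inv (U R n ω)) (U R n ω)) (*-inv (0<U R n))))
        (trans (solve 2 (λ c ε → ε :* c :* con 1ℚ := c :* con 1ℚ :* ε) refl (C n ω) ε)
          (cong (λ z → C n ω * z * ε) (sym O-last))))))

-- Summing over ω a function of the class of ω, divided by the weight of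
-- that class, is summing it over the classes.
∑-density : {Ω K : Set} (_≟_ : DecidableEquality K) (ωs : List Ω) (w : Ω → ℚ) → (∀ ω → 0ℚ ≤ w ω) →
  (κ : Ω → K) {ks : List K} → Unique ks → (∀ ω → κ ω ∈ ks) → (F : K → ℚ) → (∀ k → 0ℚ ≤ F k) →
  ∑ ωs (λ ω → w ω * (F (κ ω) * inv (∑ ωs λ ω′ → w ω′ * ⟦ does (κ ω′ ≟ κ ω) ⟧))) ≤ ∑ ks F
∑-density _≟_ ωs w 0≤w κ {ks} u κ∈ F 0≤F = begin
  ∑ ωs (λ ω → w ω * D (κ ω))
    ≡⟨ ∑-cong ωs (λ ω → trans (sym (∑-δ _≟_ (λ k → w ω * D k) (κ ω) u (κ∈ ω))) (∑-cong ks λ k →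
         trans (rearrange ⟦ does (k ≟ κ ω) ⟧ (w ω) (D k)) (cong (λ b → w ω * ⟦ b ⟧ * D k) (does-⇔ (k ≟ κ ω) (κ ω ≟ k) sym sym)))) ⟩
  ∑ ωs (λ ω → ∑ ks λ k → w ω * ⟦ does (κ ω ≟ k) ⟧ * D k)
    ≡⟨ ∑-swap ωs ks (λ ω k → w ω * ⟦ does (κ ω ≟ k) ⟧ * D k) ⟩
  ∑ ks (λ k → ∑ ωs λ ω → w ω * ⟦ does (κ ω ≟ k) ⟧ * D k)
    ≤⟨ ∑-mono ks (λ k → ≤-trans (≤-reflexive (trans (∑-*ʳ ωs (D k) (λ ω → w ω * ⟦ does (κ ω ≟ k) ⟧)) (rearrange₂ (n k) (F k) (inv (n k)))))
         (≤-eq (*-monoˡ (0≤F k) (*-inv-≤1 (0≤n k))) (*-identityʳ (F k)))) ⟩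
  ∑ ks F ∎
  where
  open ≤-Reasoning
  n D : _ → ℚ
  n k = ∑ ωs λ ω′ → w ω′ * ⟦ does (κ ω′ ≟ k) ⟧
  D k = F k * inv (n k)
  0≤n : ∀ k → 0ℚ ≤ n k
  0≤n k = 0≤∑ ωs λ ω′ → 0≤* (0≤w ω′) (0≤⟦⟧ (does (κ ω′ ≟ k)))
  rearrange : ∀ b w d → b * (w * d) ≡ w * b * d
  rearrange = solve 3 (λ b w d → b :* (w :* d) := w :* b :* d) refl
  rearrange₂ : ∀ n f i → n * (f * i) ≡ f * (n * i)
  rearrange₂ = solve 3 (λ n f i → n :* (f :* i) := f :* (n :* i)) refl

∑-classes-≤ : {Ω K : Set} (_≟_ : DecidableEquality K) (ωs : List Ω) (w : Ω → ℚ) → (∀ ω → 0ℚ ≤ w ω) →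
  (κ : Ω → K) {ks : List K} → Unique ks → ∑ ks (λ k → ∑ ωs λ ω → w ω * ⟦ does (κ ω ≟ k) ⟧) ≤ ∑ ωs w
∑-classes-≤ _≟_ ωs w 0≤w κ {ks} u = ≤-trans (≤-reflexive (∑-swap ks ωs (λ k ω → w ω * ⟦ does (κ ω ≟ k) ⟧)))
  (∑-mono ωs λ ω → ≤-trans (≤-reflexive (∑-cong ks λ k → trans (*-comm (w ω) ⟦ does (κ ω ≟ k) ⟧)
      (cong (λ b → ⟦ b ⟧ * w ω) (does-⇔ (κ ω ≟ k) (k ≟ κ ω) sym sym))))
    (∑-δ-≤ _≟_ (λ _ → w ω) (κ ω) u (0≤w ω)))

∑-codes : ∀ T c → ∑ (vectors (list Enumerated-Bool) T) (λ _ → c) ≡ 2ℚ ^ T * c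
∑-codes zero    c = trans (+-identityʳ c) (sym (*-identityˡ c))
∑-codes (suc T) c = trans (∑-cartesian _∷_ (list Enumerated-Bool) (vectors (list Enumerated-Bool) T) (λ _ → c))
  (trans (cong (λ z → z + (z + 0ℚ)) (∑-codes T c))
    (trans (solve 1 (λ z → z :+ (z :+ con 0ℚ) := con 2ℚ :* z) refl (2ℚ ^ T * c)) (sym (*-assoc 2ℚ (2ℚ ^ T) c))))

module Expectations {X Y Msg : Set} (eX : Enumerated X) (eY : Enumerated Y) (_≟ₘ_ : DecidableEquality Msg) (n : ℕ)
  (μ : X → Y → ℚ) (0≤μ : ∀ x y → 0ℚ ≤ μ x y) (∑μ : ∑ (list eX) (λ x → ∑ (list eY) (μ x)) ≡ 1ℚ) (f : X → Y → Bool)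
  (msg : ℕ → Vec X n × Vec Y n → Msg) (r : ℕ) (out : List Msg → Vec Bool n)
  (det : Marginals.Determined eX eY _≟ₘ_ n μ 0≤μ f msg r out)
  where

  open Marginals eX eY _≟ₘ_ n μ 0≤μ f msg r out
  open Potentials eX eY _≟ₘ_ n μ 0≤μ f msg r out det

  _≟ˣ_ : DecidableEquality (List X)
  _≟ˣ_ = List.≡-dec (dec eX)

  _≟ʸ_ : DecidableEquality (List Y)
  _≟ʸ_ = List.≡-dec (dec eY)

  0≤W : 0ℚ ≤ W
  0≤W = 0≤∑ ωs 0≤w

  on-support : ∀ {p q : Ω → ℚ} → (∀ ω → 0ℚ < w ω → p ω ≤ q ω) → ∀ ω → w ω * p ω ≤ w ω * q ω
  on-support {p} {q} h ω = by-cases (ℚ._≟_ (w ω) 0ℚ)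
    where
    by-cases : Dec (w ω ≡ 0ℚ) → w ω * p ω ≤ w ω * q ω
    by-cases (yes w≡0) = ≤-reflexive (trans (cong (_* p ω) w≡0) (trans (*-zeroˡ (p ω)) (sym (trans (cong (_* q ω) w≡0) (*-zeroˡ (q ω))))))
    by-cases (no w≢0) = *-monoˡ (0≤w ω) (h ω (0≤∧≢0⇒0< (0≤w ω) w≢0))

  -- Given both pasts, e is the density of resampling coordinate i: y_i is drawn as under w given
  -- the past of x alone, then x_i from μ given y_i. Accordingly the classes are the pasts together
  -- with the pair of x_i and y_i.
  ∑e≤W : ∀ i → ∑ ωs (λ ω → w ω * e i ω) ≤ W
  ∑e≤W i = begin
    ∑ ωs (λ ω → w ω * e i ω)
      ≡⟨ ∑-cong ωs (λ ω → cong (w ω *_) (trans (rearrange (b (before k (proj₁ ω)) (lookup (proj₂ ω) i) * inv (C k ω)) (μᵢ i ω * inv (μʸ i ω)) (C′ k ω) (inv (C′ (suc k) ω)))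
           (cong₂ (λ z z′ → b (before k (proj₁ ω)) (lookup (proj₂ ω) i) * inv (C k ω) * (μᵢ i ω * inv (μʸ i ω)) * z * inv z′) (C′≡c′ ω) (N-cong (x≺ (suc k) & y≺ (suc k)) (λ ω′ ω → does (κ ω′ ≟ₖ κ ω)) ω λ ω′ → same ω′ ω)))) ⟩
    ∑ ωs (λ ω → w ω * (F (κ ω) * inv (∑ ωs λ ω′ → w ω′ * ⟦ does (κ ω′ ≟ₖ κ ω) ⟧)))
      ≤⟨ ∑-density _≟ₖ_ ωs w 0≤w κ ks-unique κ∈ks F 0≤F ⟩
    ∑ ks F
      ≡⟨ trans (∑-cartesian _,_ ps (cartesianProduct (list eX) (list eY)) F) (∑-cong ps λ p → ∑-cartesian _,_ (list eX) (list eY) (λ xy → F (p , xy))) ⟩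
    ∑ ps (λ p → ∑ (list eX) λ x₀ → ∑ (list eY) λ y₀ → F (p , (x₀ , y₀)))
      ≤⟨ ∑-mono ps (λ p → ≤-trans (≤-reflexive (collect p)) (≤-eq (*-monoʳ (0≤c′ p) (inner≤1 (proj₁ p))) (*-identityˡ (c′ p)))) ⟩
    ∑ ps c′
      ≤⟨ ∑-classes-≤ _≟ₚ_ ωs w 0≤w past (DecUnique.deduplicate-! _≟ₚ_ (map past ωs)) ⟩
    W ∎
    where
    open ≤-Reasoning
    k = Fin.toℕ i
    Past Key : Set
    Past = List X × List Y
    Key = Past × (X × Y)
    _≟ₚ_ : DecidableEquality Past
    _≟ₚ_ = Product.≡-dec _≟ˣ_ _≟ʸ_
    _≟ₖ_ : DecidableEquality Key
    _≟ₖ_ = Product.≡-dec _≟ₚ_ (Product.≡-dec (dec eX) (dec eY))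
    past : Ω → Past
    past (x , y) = before k x , before k y
    κ : Ω → Key
    κ ω@(x , y) = past ω , (lookup x i , lookup y i)
    ps : List Past
    ps = deduplicate _≟ₚ_ (map past ωs)
    ks : List Key
    ks = cartesianProduct ps (cartesianProduct (list eX) (list eY))
    ks-unique : Unique ks
    ks-unique = Unique.cartesianProduct⁺ (DecUnique.deduplicate-! _≟ₚ_ (map past ωs)) (Unique.cartesianProduct⁺ (unique eX) (unique eY))
    κ∈ks : ∀ ω → κ ω ∈ ks
    κ∈ks ω@(x , y) = ∈.∈-cartesianProduct⁺ (∈.∈-deduplicate⁺ _≟ₚ_ (∈.∈-map⁺ past (all eΩ ω))) (∈.∈-cartesianProduct⁺ (all eX (lookup x i)) (all eY (lookup y i)))
    c : List X → ℚ
    c p = ∑ ωs λ ω′ → w ω′ * ⟦ does (before k (proj₁ ω′) ≟ˣ p) ⟧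
    b : List X → Y → ℚ
    b p y₀ = ∑ ωs λ ω′ → w ω′ * ⟦ does (before k (proj₁ ω′) ≟ˣ p) ∧ does (dec eY (lookup (proj₂ ω′) i) y₀) ⟧
    c′ : Past → ℚ
    c′ p = ∑ ωs λ ω′ → w ω′ * ⟦ does (past ω′ ≟ₚ p) ⟧
    μY : Y → ℚ
    μY y₀ = ∑ (list eX) λ x₀ → μ x₀ y₀
    F : Key → ℚ
    F (p , (x₀ , y₀)) = b (proj₁ p) y₀ * inv (c (proj₁ p)) * (μ x₀ y₀ * inv (μY y₀)) * c′ p
    0≤c : ∀ p → 0ℚ ≤ c p
    0≤c p = 0≤∑ ωs λ ω′ → 0≤* (0≤w ω′) (0≤⟦⟧ (does (before k (proj₁ ω′) ≟ˣ p)))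
    0≤b : ∀ p y₀ → 0ℚ ≤ b p y₀
    0≤b p y₀ = 0≤∑ ωs λ ω′ → 0≤* (0≤w ω′) (0≤⟦⟧ (does (before k (proj₁ ω′) ≟ˣ p) ∧ does (dec eY (lookup (proj₂ ω′) i) y₀)))
    0≤c′ : ∀ p → 0ℚ ≤ c′ p
    0≤c′ p = 0≤∑ ωs λ ω′ → 0≤* (0≤w ω′) (0≤⟦⟧ (does (past ω′ ≟ₚ p)))
    0≤μY : ∀ y₀ → 0ℚ ≤ μY y₀
    0≤μY y₀ = 0≤∑ (list eX) λ x₀ → 0≤μ x₀ y₀
    0≤F : ∀ κ → 0ℚ ≤ F κ
    0≤F (p , (x₀ , y₀)) = 0≤* (0≤* (0≤* (0≤b (proj₁ p) y₀) (0≤inv (0≤c (proj₁ p)))) (0≤* (0≤μ x₀ y₀) (0≤inv (0≤μY y₀)))) (0≤c′ p)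
    rearrange : ∀ a m c i → a * m * (c * i) ≡ a * m * c * i
    rearrange = solve 4 (λ a m c i → a :* m :* (c :* i) := a :* m :* c :* i) refl
    same : ∀ ω′ ω → (x≺ (suc k) & y≺ (suc k)) ω′ ω ≡ does (κ ω′ ≟ₖ κ ω)
    same ω′@(x′ , y′) ω@(x , y) = does-⇔ ((before (suc k) x′ ≟ˣ before (suc k) x) ×-dec (before (suc k) y′ ≟ʸ before (suc k) y)) (κ ω′ ≟ₖ κ ω)
      (λ (ex , ey) → let (a , b) = before-suc⁻ i x′ x ex ; (c , d) = before-suc⁻ i y′ y ey in cong₂ _,_ (cong₂ _,_ a c) (cong₂ _,_ b d))
      (λ eq → before-suc⁺ i x′ x (cong (proj₁ ∘ proj₁) eq) (cong (proj₁ ∘ proj₂) eq) ,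
              before-suc⁺ i y′ y (cong (proj₂ ∘ proj₁) eq) (cong (proj₂ ∘ proj₂) eq))
    C′≡c′ : ∀ ω → C′ k ω ≡ c′ (past ω)
    C′≡c′ ω@(x , y) = N-cong (x≺ k & y≺ k) (λ ω′ ω → does (past ω′ ≟ₚ past ω)) ω λ ω′@(x′ , y′) →
      does-⇔ ((before k x′ ≟ˣ before k x) ×-dec (before k y′ ≟ʸ before k y)) (past ω′ ≟ₚ past ω)
        (λ (a , b) → cong₂ _,_ a b) (λ eq → cong proj₁ eq , cong proj₂ eq)
    collect : ∀ p → ∑ (list eX) (λ x₀ → ∑ (list eY) λ y₀ → F (p , (x₀ , y₀))) ≡
      ∑ (list eY) (λ y₀ → b (proj₁ p) y₀ * inv (c (proj₁ p)) * (μY y₀ * inv (μY y₀))) * c′ p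
    collect p = trans (∑-swap (list eX) (list eY) (λ x₀ y₀ → F (p , (x₀ , y₀)))) (trans (∑-cong (list eY) λ y₀ →
        trans (∑-*ʳ (list eX) (c′ p) (λ x₀ → b (proj₁ p) y₀ * inv (c (proj₁ p)) * (μ x₀ y₀ * inv (μY y₀))))
          (cong (_* c′ p) (trans (∑-*ˡ (list eX) (b (proj₁ p) y₀ * inv (c (proj₁ p))) (λ x₀ → μ x₀ y₀ * inv (μY y₀)))
            (cong (b (proj₁ p) y₀ * inv (c (proj₁ p)) *_) (∑-*ʳ (list eX) (inv (μY y₀)) (λ x₀ → μ x₀ y₀))))))
      (∑-*ʳ (list eY) (c′ p) (λ y₀ → b (proj₁ p) y₀ * inv (c (proj₁ p)) * (μY y₀ * inv (μY y₀)))))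
    ∑b≤c : ∀ p → ∑ (list eY) (b p) ≤ c p
    ∑b≤c p = ≤-trans (≤-reflexive (∑-cong (list eY) λ y₀ → ∑-cong ωs λ ω′ →
        trans (cong (w ω′ *_) (⟦∧⟧ (does (before k (proj₁ ω′) ≟ˣ p)) (does (dec eY (lookup (proj₂ ω′) i) y₀)))) (sym (*-assoc (w ω′) _ _))))
      (∑-classes-≤ (dec eY) ωs (λ ω′ → w ω′ * ⟦ does (before k (proj₁ ω′) ≟ˣ p) ⟧)
        (λ ω′ → 0≤* (0≤w ω′) (0≤⟦⟧ (does (before k (proj₁ ω′) ≟ˣ p)))) (λ ω′ → lookup (proj₂ ω′) i) (unique eY))
    inner≤1 : ∀ p → ∑ (list eY) (λ y₀ → b p y₀ * inv (c p) * (μY y₀ * inv (μY y₀))) ≤ 1ℚ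
    inner≤1 p = ≤-trans (∑-mono (list eY) λ y₀ → ≤-eq (*-monoˡ (0≤* (0≤b p y₀) (0≤inv (0≤c p))) (*-inv-≤1 (0≤μY y₀))) (*-identityʳ (b p y₀ * inv (c p))))
      (≤-trans (≤-reflexive (∑-*ʳ (list eY) (inv (c p)) (b p))) (≤-trans (*-monoʳ (0≤inv (0≤c p)) (∑b≤c p)) (*-inv-≤1 (0≤c p))))

  module _ (T : ℕ) (code : Ω → Vec Bool T) (code-inj : ∀ ω ω′ → code ω ≡ code ω′ → hist R ω ≡ hist R ω′) where

    ε : ℚ
    ε = inv (2ℚ ^ T)

    0<2^T : 0ℚ < 2ℚ ^ T
    0<2^T = 0<^ T 0<2

    0≤ε : 0ℚ ≤ ε
    0≤ε = <⇒≤ (0<inv 0<2^T)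

    codes : List (Vec Bool T)
    codes = vectors (list Enumerated-Bool) T

    ε-sum : ∀ {A : Set} (as : List A) (F : A → ℚ) → ∑ (cartesianProduct as codes) (λ (a , _) → ε * F a) ≡ ∑ as F
    ε-sum as F = trans (∑-cartesian _,_ as codes (λ (a , _) → ε * F a)) (∑-cong as λ a → trans (∑-codes T (ε * F a))
      (trans (sym (*-assoc (2ℚ ^ T) ε (F a))) (trans (cong (_* F a) (*-inv 0<2^T)) (*-identityˡ (F a)))))

    -- The classes of equal codes refine those of equal histories.
    density-code : ∀ {A : Set} (eA : Enumerated A) (κ : Ω → A) (F : A → ℚ) → (∀ a → 0ℚ ≤ F a) → (rel : Relation) →
      (∀ ω′ ω → κ ω′ ≡ κ ω → code ω′ ≡ code ω → rel ω′ ω ≡ true) →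
      ∑ ωs (λ ω → w ω * (ε * F (κ ω) * inv (N rel ω))) ≤ ∑ (list eA) F
    density-code eA κ F 0≤F rel fine = ≤-trans
      (∑-mono ωs (on-support λ ω 0<w → *-monoˡ (0≤* 0≤ε (0≤F (κ ω))) (inv-anti (0<Nₖ ω 0<w) (Nₖ≤N ω))))
      (≤-trans (∑-density (dec eK) ωs w 0≤w κ′ (unique eK) (λ ω → all eK (κ′ ω)) (λ (a , _) → ε * F a) (λ (a , _) → 0≤* 0≤ε (0≤F a)))
        (≤-reflexive (ε-sum (list eA) F)))
      where
      eK = Enumerated-× eA (Enumerated-Vec Enumerated-Bool T)
      κ′ : Ω → _ × Vec Bool T
      κ′ ω = κ ω , code ω
      relₖ : Relation
      relₖ ω′ ω = does (dec eK (κ′ ω′) (κ′ ω))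
      0<Nₖ : ∀ ω → 0ℚ < w ω → 0ℚ < N relₖ ω
      0<Nₖ ω 0<w = <-≤-trans 0<w (w≤N relₖ ω (does-≡ (dec eK) (κ′ ω)))
      Nₖ≤N : ∀ ω → N relₖ ω ≤ N rel ω
      Nₖ≤N ω = ∑-mono ωs λ ω′ → *-monoˡ (0≤w ω′) (by-cases ω′ (dec eK (κ′ ω′) (κ′ ω)))
        where
        by-cases : ∀ ω′ → (d : Dec (κ′ ω′ ≡ κ′ ω)) → ⟦ does d ⟧ ≤ ⟦ rel ω′ ω ⟧
        by-cases ω′ (yes eq) = ≤-reflexive (cong ⟦_⟧ (sym (fine ω′ ω (cong proj₁ eq) (cong proj₂ eq))))
        by-cases ω′ (no _) = 0≤⟦⟧ (rel ω′ ω)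

    ∑e₁≤W : ∑ ωs (λ ω → w ω * e₁ ε ω) ≤ W
    ∑e₁≤W = begin
      ∑ ωs (λ ω → w ω * e₁ ε ω)
        ≡⟨ ∑-cong ωs (λ ω → cong (w ω *_) (rearrange ε W (∏ (fins n) λ i → μʸ i ω) (inv (V 0 ω)))) ⟩
      ∑ ωs (λ ω → w ω * (ε * F (proj₂ ω) * inv (V 0 ω)))
        ≤⟨ density-code eYs proj₂ F (λ y → 0≤* 0≤W (0≤∏ (fins n) λ i → 0≤μY (lookup y i))) (x≺ 0 & y≽ 0 & h≈ R)
             (λ { ω′@(x′ , y) ω@(x , y) refl same → cong₂ _∧_ (y≽-refl 0 ω) (dec-true (hist R ω′ ≟ₕ hist R ω) (code-inj ω′ ω same)) }) ⟩
      ∑ (list eYs) F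
        ≡⟨ trans (∑-*ˡ (list eYs) W (λ y → ∏ (fins n) λ i → μY (lookup y i))) (cong (W *_) (∑-vectors-∏ (list eY) μY ∑μY n)) ⟩
      W * 1ℚ
        ≡⟨ *-identityʳ W ⟩
      W ∎
      where
      open ≤-Reasoning
      μY : Y → ℚ
      μY y₀ = ∑ (list eX) λ x₀ → μ x₀ y₀
      0≤μY : ∀ y₀ → 0ℚ ≤ μY y₀
      0≤μY y₀ = 0≤∑ (list eX) λ x₀ → 0≤μ x₀ y₀
      ∑μY : ∑ (list eY) μY ≡ 1ℚ
      ∑μY = trans (sym (∑-swap (list eX) (list eY) μ)) ∑μ
      F : Vec Y n → ℚ
      F y = W * ∏ (fins n) λ i → μY (lookup y i)
      rearrange : ∀ ε W p i → ε * (W * (p * i)) ≡ ε * (W * p) * i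
      rearrange = solve 4 (λ ε W p i → ε :* (W :* (p :* i)) := ε :* (W :* p) :* i) refl

    ∑e₂≤W : ∑ ωs (λ ω → w ω * e₂ ε ω) ≤ W
    ∑e₂≤W = begin
      ∑ ωs (λ ω → w ω * e₂ ε ω)
        ≡⟨ ∑-cong ωs (λ ω → cong (w ω *_) (sym (*-assoc ε (C n ω) (inv (U R n ω))))) ⟩
      ∑ ωs (λ ω → w ω * (ε * F (proj₁ ω) * inv (U R n ω)))
        ≤⟨ density-code eXs proj₁ F (λ x → 0≤∑ ωs λ ω′ → 0≤* (0≤w ω′) (0≤⟦⟧ (does (before n (proj₁ ω′) ≟ˣ before n x)))) (x≺ n & y≽ n & h≈ R)
             (λ { ω′@(x , y′) ω@(x , y) refl same → cong₂ _∧_ (x≺-refl n ω) (cong₂ _∧_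
               (dec-true (after n y′ ≟ʸ after n y) (trans (after-all y′) (sym (after-all y)))) (dec-true (hist R ω′ ≟ₕ hist R ω) (code-inj ω′ ω same))) }) ⟩
      ∑ (list eXs) F
        ≡⟨ ∑-cong (list eXs) (λ x → ∑-cong ωs λ ω′ → cong (λ b → w ω′ * ⟦ b ⟧)
             (does-⇔ (before n (proj₁ ω′) ≟ˣ before n x) (dec eXs (proj₁ ω′) x) (before-all (proj₁ ω′) x) (cong (before n)))) ⟩
      ∑ (list eXs) (λ x → ∑ ωs λ ω′ → w ω′ * ⟦ does (dec eXs (proj₁ ω′) x) ⟧)
        ≤⟨ ∑-classes-≤ (dec eXs) ωs w 0≤w proj₁ (unique eXs) ⟩
      W ∎
      where
      open ≤-Reasoning
      F : Vec X n → ℚ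
      F x = ∑ ωs λ ω′ → w ω′ * ⟦ does (before n (proj₁ ω′) ≟ˣ before n x) ⟧

-- From products to averages

∏≤2^∑ : ∀ {A : Set} (xs : List A) (u : A → ℚ) → (∀ a → 0ℚ ≤ u a) → ∃ λ k → natℚ k ≤ ∑ xs u × ∏ xs u ≤ 2ℚ ^ k
∏≤2^∑ [] u 0≤u = 0 , ≤-refl , ≤-refl
∏≤2^∑ (x ∷ xs) u 0≤u with floorℕ (0≤u x) | ∏≤2^∑ xs u 0≤u
-- u ≤ j + 1 ≤ 2^j for an integer part j of u. This stands for log u ≤ u and keeps the exponents
-- integral.
... | j , j≤u , u≤j+1 | k , k≤∑ , ∏≤ = j ℕ.+ k , eq-≤ (natℚ-+ j k) (+-mono-≤ j≤u k≤∑) ,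
  ≤-eq (*-mono (0≤∏ xs 0≤u) (0≤^ j (<⇒≤ 0<2)) (≤-trans u≤j+1 (≤-eq (natℚ-mono {suc j} {2 ℕ.^ j} (n<2^n j)) (natℚ-^ 2 j))) ∏≤) (sym (^-+ 2ℚ j k))

2^-cancel-≤ : ∀ {a b} → 2ℚ ^ a ≤ 2ℚ ^ b → a ℕ.≤ b
2^-cancel-≤ {a} {b} h with a ℕ.≤? b
... | yes a≤b = a≤b
... | no a≰b = contradiction (<-≤-trans (subst₂ _<_ (*-identityˡ (2ℚ ^ b)) refl
    (*-monoˡ-<-pos (2ℚ ^ b) {{ℚ.positive (0<^ b 0<2)}} (natℚ-mono-< {1} {2} (s≤s (s≤s z≤n)))))
    (≤-trans (^-monoʳ {2ℚ} {suc b} {a} 1≤2 (ℕ.≰⇒> a≰b)) h)) (<-irrefl refl)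

-- A piecewise linear upper bound of the square root, of slope 2/5 from 1 on.
root : ℚ → ℚ
root t = (+ 2 / 5) * (1ℚ + t) + (+ 9 / 40) * (1ℚ ⊓ t)

0≤⊓ : ∀ {t} → 0ℚ ≤ t → 0ℚ ≤ 1ℚ ⊓ t
0≤⊓ 0≤t = ⊓-glb 0≤1 0≤t

0≤root : ∀ {t} → 0ℚ ≤ t → 0ℚ ≤ root t
0≤root 0≤t = 0≤+ (0≤* (0≤frac 2 4) (0≤+ 0≤1 0≤t)) (0≤* (0≤frac 9 39) (0≤⊓ 0≤t))

-- On either side of 1 the coefficients of `root` are 2/5 and 5/8 in some order. Their product is
-- 1/4, so the square of `root` minus t is itself a square.
root² : ∀ {t} → t ≤ root t * root t
root² {t} with ≤-total 1ℚ t
... | inj₁ 1≤t rewrite p≤q⇒p⊓q≡p 1≤t = ≤-by (((+ 5 / 8) - (+ 2 / 5) * t) * ((+ 5 / 8) - (+ 2 / 5) * t)) (0≤sq ((+ 5 / 8) - (+ 2 / 5) * t))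
  (solve 1 (λ t → (con (+ 2 / 5) :* (con 1ℚ :+ t) :+ con (+ 9 / 40) :* con 1ℚ) :* (con (+ 2 / 5) :* (con 1ℚ :+ t) :+ con (+ 9 / 40) :* con 1ℚ) :=
    t :+ (con (+ 5 / 8) :- con (+ 2 / 5) :* t) :* (con (+ 5 / 8) :- con (+ 2 / 5) :* t)) refl t)
... | inj₂ t≤1 rewrite p≥q⇒p⊓q≡q t≤1 = ≤-by (((+ 2 / 5) - (+ 5 / 8) * t) * ((+ 2 / 5) - (+ 5 / 8) * t)) (0≤sq ((+ 2 / 5) - (+ 5 / 8) * t))
  (solve 1 (λ t → (con (+ 2 / 5) :* (con 1ℚ :+ t) :+ con (+ 9 / 40) :* t) :* (con (+ 2 / 5) :* (con 1ℚ :+ t) :+ con (+ 9 / 40) :* t) :=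
    t :+ (con (+ 2 / 5) :- con (+ 5 / 8) :* t) :* (con (+ 2 / 5) :- con (+ 5 / 8) :* t)) refl t)

^-mono-< : ∀ {p q} n → 0ℚ ≤ p → p < q → p ^ suc n < q ^ suc n
^-mono-< {p} {q} n 0≤p p<q = ≤-<-trans (*-monoˡ 0≤p (^-mono n 0≤p (<⇒≤ p<q)))
  (*-monoˡ-<-pos (q ^ n) {{ℚ.positive (0<^ n (≤-<-trans 0≤p p<q))}} p<q)

sqrt-≤ : ∀ {p q} → 0ℚ ≤ q → p * p ≤ q * q → p ≤ q
sqrt-≤ {p} {q} 0≤q h with ℚ._≤?_ p q
... | yes p≤q = p≤q
... | no p≰q = contradiction (<-≤-trans (subst₂ _<_ (cong (q *_) (*-identityʳ q)) (cong (p *_) (*-identityʳ p)) (^-mono-< 1 0≤q (≰⇒> p≰q))) h) (<-irrefl refl)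

-- As t has mean at most 1, the linear part of `root` has mean at most 4/5. The missing 98/100 - 4/5
-- = 9/40 · 4/5 must come from the truncated part.
gain-from-root : ∀ {A : Set} (xs : List A) (w t s : A → ℚ) → (∀ a → 0ℚ ≤ w a) → (∀ a → 0ℚ ≤ s a) → ∑ xs (λ a → w a * t a) ≤ ∑ xs w →
  (+ 98 / 100) * ∑ xs w ≤ ∑ xs (λ a → w a * (root (t a) - s a)) → (+ 4 / 5) * ∑ xs w ≤ ∑ xs (λ a → w a * ((1ℚ ⊓ t a) - s a))
gain-from-root xs w t s 0≤w 0≤s ∑t≤W h = *-cancelˡ {+ 9 / 40} (ℚ.*<* (ℤ.+<+ (s≤s z≤n))) (begin
  (+ 9 / 40) * ((+ 4 / 5) * W)
    ≡⟨ solve 1 (λ w → con (+ 9 / 40) :* (con (+ 4 / 5) :* w) := con (+ 98 / 100) :* w :- con (+ 4 / 5) :* w) refl W ⟩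
  (+ 98 / 100) * W - (+ 4 / 5) * W
    ≤⟨ +-monoˡ-≤ (- ((+ 4 / 5) * W)) h ⟩
  ∑ xs (λ a → w a * (root (t a) - s a)) - (+ 4 / 5) * W
    ≤⟨ +-monoˡ-≤ (- ((+ 4 / 5) * W)) (∑-mono xs λ a → ≤-by (w a * ((+ 31 / 40) * s a)) (0≤* (0≤w a) (0≤* (0≤frac 31 39) (0≤s a)))
         (split (w a) (t a) (1ℚ ⊓ t a) (s a))) ⟩
  ∑ xs (λ a → (+ 2 / 5) * (w a + w a * t a) + (+ 9 / 40) * gain a) - (+ 4 / 5) * W
    ≡⟨ cong (_- (+ 4 / 5) * W) (trans (∑-+ xs (λ a → (+ 2 / 5) * (w a + w a * t a)) (λ a → (+ 9 / 40) * gain a))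
         (cong₂ _+_ (trans (∑-*ˡ xs (+ 2 / 5) (λ a → w a + w a * t a)) (cong ((+ 2 / 5) *_) (∑-+ xs w (λ a → w a * t a))))
           (∑-*ˡ xs (+ 9 / 40) gain))) ⟩
  (+ 2 / 5) * (W + ∑ xs (λ a → w a * t a)) + (+ 9 / 40) * G - (+ 4 / 5) * W
    ≤⟨ +-monoˡ-≤ (- ((+ 4 / 5) * W)) (+-monoˡ-≤ ((+ 9 / 40) * G) (*-monoˡ (0≤frac 2 4) (+-monoʳ-≤ W ∑t≤W))) ⟩
  (+ 2 / 5) * (W + W) + (+ 9 / 40) * G - (+ 4 / 5) * W
    ≡⟨ solve 2 (λ w g → con (+ 2 / 5) :* (w :+ w) :+ con (+ 9 / 40) :* g :- con (+ 4 / 5) :* w := con (+ 9 / 40) :* g) refl W G ⟩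
  (+ 9 / 40) * G ∎)
  where
  open ≤-Reasoning
  W = ∑ xs w
  gain : _ → ℚ
  gain a = w a * ((1ℚ ⊓ t a) - s a)
  G = ∑ xs gain
  split : ∀ w t m s → (+ 2 / 5) * (w + w * t) + (+ 9 / 40) * (w * (m - s)) ≡ w * ((+ 2 / 5) * (1ℚ + t) + (+ 9 / 40) * m - s) + w * ((+ 31 / 40) * s)
  split = solve 4 (λ w t m s → con (+ 2 / 5) :* (w :+ w :* t) :+ con (+ 9 / 40) :* (w :* (m :- s)) :=
    w :* (con (+ 2 / 5) :* (con 1ℚ :+ t) :+ con (+ 9 / 40) :* m :- s) :+ w :* (con (+ 31 / 40) :* s)) refl

module _ {A : Set} (xs : List A) where

  -- The product of the roots has a square of at least W, hence is at least η^n, and by the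
  -- inequality of the means so is the n-th power of their mean.
  ∑-root : ∀ m (t : A → ℚ) (W η : ℚ) → List.length xs ≡ suc m → (∀ a → 0ℚ ≤ t a) → 0ℚ ≤ η → ∏ xs t ≡ W → (η * η) ^ suc m ≤ W →
    natℚ (suc m) * η ≤ ∑ xs (root ∘ t)
  ∑-root m t W η len 0≤t 0≤η e h = ≤-trans (*-monoˡ (0≤natℚ (suc m)) (≮⇒≥ ¬A<η)) (≤-reflexive (sym ∑≡))
    where
    S = ∑ xs (root ∘ t)
    A′ = S * 1/suc m
    0≤A′ : 0ℚ ≤ A′
    0≤A′ = 0≤* (0≤∑ xs λ a → 0≤root (0≤t a)) (0≤1/suc m)
    ∑≡ : S ≡ natℚ (suc m) * A′
    ∑≡ = sym (trans (solve 3 (λ n s i → n :* (s :* i) := s :* (n :* i)) refl (natℚ (suc m)) S (1/suc m))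
      (trans (cong (S *_) (suc*1/suc m)) (*-identityʳ S)))
    P = ∏ xs (root ∘ t)
    P≤ : P ≤ A′ ^ suc m
    P≤ = subst (λ n → P ≤ A′ ^ n) len (am-gm xs (λ a → 0≤root (0≤t a)) A′ 0≤A′ (trans ∑≡ (cong (λ n → natℚ n * A′) (sym len))))
    ηⁿ≤P : η ^ suc m ≤ P
    ηⁿ≤P = sqrt-≤ (0≤∏ xs λ a → 0≤root (0≤t a)) (≤-trans (≤-reflexive (sym (^-*-distrib η η (suc m))))
      (≤-trans h (≤-trans (≤-reflexive (sym e)) (≤-trans (∏-mono xs 0≤t λ a → root²) (≤-reflexive (∏-* xs (root ∘ t) (root ∘ t)))))))
    ¬A<η : ¬ (A′ < η)
    ¬A<η lt = <-irrefl refl (<-≤-trans (^-mono-< m 0≤A′ lt) (≤-trans ηⁿ≤P P≤))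

  -- Where v drops below 2^-Λ, the factor 2^Λ may be gained in the product of 1 + v.
  ∑-small : ∀ (v e : A → ℚ) (e₁ e₂ W : ℚ) (T Λ n : ℕ) → (∀ a → 0ℚ ≤ v a) → (∀ a → 0ℚ ≤ e a) → 0ℚ ≤ e₁ → 0ℚ ≤ e₂ →
    ∏ xs v * ∏ xs e * (e₁ * e₂) ≡ W * W * (inv (2ℚ ^ T) * inv (2ℚ ^ T)) → 1ℚ ≤ 2ℚ ^ n * (W * W) →
    natℚ Λ * ∑ xs (λ a → ⟦ does (ℚ._<?_ (2ℚ ^ Λ * v a) 1ℚ) ⟧) ≤
      natℚ (T ℕ.+ T ℕ.+ n) + (∑ xs (λ a → 1ℚ + v a) + ∑ xs e + (e₁ + e₂))
  ∑-small v e e₁ e₂ W T Λ n 0≤v 0≤e 0≤e₁ 0≤e₂ eq big = begin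
    natℚ Λ * ∑ xs (λ a → ⟦ isSmall a ⟧)
      ≡⟨ cong (natℚ Λ *_) (∑≡count xs) ⟩
    natℚ Λ * natℚ (count xs)
      ≡⟨ sym (natℚ-* Λ (count xs)) ⟩
    natℚ (Λ ℕ.* count xs)
      ≤⟨ natℚ-mono {Λ ℕ.* count xs} {T ℕ.+ T ℕ.+ n ℕ.+ (k ℕ.+ k′ ℕ.+ k″)} (2^-cancel-≤ {Λ ℕ.* count xs} {T ℕ.+ T ℕ.+ n ℕ.+ (k ℕ.+ k′ ℕ.+ k″)} powers) ⟩
    natℚ (T ℕ.+ T ℕ.+ n ℕ.+ (k ℕ.+ k′ ℕ.+ k″))
      ≡⟨ trans (natℚ-+ (T ℕ.+ T ℕ.+ n) (k ℕ.+ k′ ℕ.+ k″)) (cong (λ z → natℚ (T ℕ.+ T ℕ.+ n) + z) (trans (natℚ-+ (k ℕ.+ k′) k″) (cong (_+ natℚ k″) (natℚ-+ k k′)))) ⟩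
    natℚ (T ℕ.+ T ℕ.+ n) + (natℚ k + natℚ k′ + natℚ k″)
      ≤⟨ +-monoʳ-≤ (natℚ (T ℕ.+ T ℕ.+ n)) (+-mono-≤ (+-mono-≤ (proj₁ (proj₂ for-v)) (proj₁ (proj₂ for-e))) (≤-eq (proj₁ (proj₂ for-pair)) (cong (λ z → e₁ + z) (+-identityʳ e₂)))) ⟩
    natℚ (T ℕ.+ T ℕ.+ n) + (∑ xs (λ a → 1ℚ + v a) + ∑ xs e + (e₁ + e₂)) ∎
    where
    open ≤-Reasoning
    pair : Bool → ℚ
    pair true  = e₁
    pair false = e₂
    0≤pair : ∀ b → 0ℚ ≤ pair b
    0≤pair true  = 0≤e₁
    0≤pair false = 0≤e₂
    for-v = ∏≤2^∑ xs (λ a → 1ℚ + v a) λ a → 0≤+ 0≤1 (0≤v a)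
    for-e = ∏≤2^∑ xs e 0≤e
    for-pair = ∏≤2^∑ (true ∷ false ∷ []) pair 0≤pair
    k k′ k″ : ℕ
    k  = proj₁ for-v
    k′ = proj₁ for-e
    k″ = proj₁ for-pair
    L = 2ℚ ^ Λ
    isSmall : A → Bool
    isSmall a = does (ℚ._<?_ (L * v a) 1ℚ)
    toNat : Bool → ℕ
    toNat true  = 1
    toNat false = 0
    count : List A → ℕ
    count []       = 0
    count (x ∷ xs) = toNat (isSmall x) ℕ.+ count xs
    toNat-⟦⟧ : ∀ b → ⟦ b ⟧ ≡ natℚ (toNat b)
    toNat-⟦⟧ true  = refl
    toNat-⟦⟧ false = refl
    ∑≡count : ∀ xs → ∑ xs (λ a → ⟦ isSmall a ⟧) ≡ natℚ (count xs)
    ∑≡count []       = refl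
    ∑≡count (x ∷ xs) = trans (cong₂ _+_ (toNat-⟦⟧ (isSmall x)) (∑≡count xs)) (sym (natℚ-+ (toNat (isSmall x)) (count xs)))
    factor′ : A → ℚ
    factor′ a = 2ℚ ^ (Λ ℕ.* toNat (isSmall a))
    ∏factor : ∀ xs → ∏ xs factor′ ≡ 2ℚ ^ (Λ ℕ.* count xs)
    ∏factor []       = cong (2ℚ ^_) (sym (ℕ.*-zeroʳ Λ))
    ∏factor (x ∷ xs) = trans (cong (factor′ x *_) (∏factor xs)) (trans (sym (^-+ 2ℚ (Λ ℕ.* toNat (isSmall x)) (Λ ℕ.* count xs)))
      (cong (2ℚ ^_) (sym (ℕ.*-distribˡ-+ Λ (toNat (isSmall x)) (count xs)))))
    factor≤ : ∀ a → factor′ a * v a ≤ 1ℚ + v a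
    factor≤ a = by-cases (ℚ._<?_ (L * v a) 1ℚ)
      where
      by-cases : (d : Dec (L * v a < 1ℚ)) → 2ℚ ^ (Λ ℕ.* toNat (does d)) * v a ≤ 1ℚ + v a
      by-cases (yes small) = ≤-trans (≤-reflexive (cong (λ m → 2ℚ ^ m * v a) (ℕ.*-identityʳ Λ))) (≤-trans (<⇒≤ small) (p≤p+q 1ℚ (0≤v a)))
      by-cases (no _) = ≤-trans (≤-reflexive (trans (cong (λ m → 2ℚ ^ m * v a) (ℕ.*-zeroʳ Λ)) (*-identityˡ (v a)))) (p≤q+p (v a) 0≤1)
    0≤2^ : ∀ m → 0ℚ ≤ 2ℚ ^ m
    0≤2^ m = 0≤^ m (<⇒≤ 0<2)
    ∏fv≤ : ∏ xs (λ a → factor′ a * v a) ≤ 2ℚ ^ k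
    ∏fv≤ = ≤-trans (∏-mono xs (λ a → 0≤* (0≤2^ (Λ ℕ.* toNat (isSmall a))) (0≤v a)) factor≤) (proj₂ (proj₂ for-v))
    D = 2ℚ ^ (Λ ℕ.* count xs)
    i = inv (2ℚ ^ T)
    cancelT : 2ℚ ^ T * i ≡ 1ℚ
    cancelT = *-inv (0<^ T 0<2)
    rearrange : ∀ a b c w i → c * (w * w * (i * i)) * (a * a * b) ≡ c * (b * (w * w)) * (a * i * (a * i))
    rearrange = solve 5 (λ a b c w i → c :* (w :* w :* (i :* i)) :* (a :* a :* b) := c :* (b :* (w :* w)) :* (a :* i :* (a :* i))) refl
    product≤ : D * (∏ xs v * ∏ xs e * (e₁ * e₂)) ≤ 2ℚ ^ (k ℕ.+ k′ ℕ.+ k″)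
    product≤ = begin
      D * (∏ xs v * ∏ xs e * (e₁ * e₂))
        ≡⟨ cong (_* (∏ xs v * ∏ xs e * (e₁ * e₂))) (sym (∏factor xs)) ⟩
      ∏ xs factor′ * (∏ xs v * ∏ xs e * (e₁ * e₂))
        ≡⟨ solve 4 (λ f v e p → f :* (v :* e :* p) := f :* v :* e :* p) refl (∏ xs factor′) (∏ xs v) (∏ xs e) (e₁ * e₂) ⟩
      ∏ xs factor′ * ∏ xs v * ∏ xs e * (e₁ * e₂)
        ≡⟨ cong₂ (λ a b → a * ∏ xs e * b) (sym (∏-* xs factor′ v)) (cong (e₁ *_) (sym (*-identityʳ e₂))) ⟩
      ∏ xs (λ a → factor′ a * v a) * ∏ xs e * (e₁ * (e₂ * 1ℚ))
        ≤⟨ *-mono (0≤* 0≤e₁ (0≤* 0≤e₂ 0≤1)) (0≤* (0≤2^ k) (0≤2^ k′)) (*-mono (0≤∏ xs 0≤e) (0≤2^ k) ∏fv≤ (proj₂ (proj₂ for-e))) (proj₂ (proj₂ for-pair)) ⟩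
      2ℚ ^ k * 2ℚ ^ k′ * 2ℚ ^ k″
        ≡⟨ sym (trans (^-+ 2ℚ (k ℕ.+ k′) k″) (cong (_* 2ℚ ^ k″) (^-+ 2ℚ k k′))) ⟩
      2ℚ ^ (k ℕ.+ k′ ℕ.+ k″) ∎
    powers : 2ℚ ^ (Λ ℕ.* count xs) ≤ 2ℚ ^ (T ℕ.+ T ℕ.+ n ℕ.+ (k ℕ.+ k′ ℕ.+ k″))
    powers = begin
      D
        ≡⟨ sym (*-identityʳ D) ⟩
      D * 1ℚ
        ≤⟨ *-monoˡ (0≤2^ (Λ ℕ.* count xs)) big ⟩
      D * (2ℚ ^ n * (W * W))
        ≡⟨ sym (trans (cong (λ z → D * (2ℚ ^ n * (W * W)) * (z * z)) cancelT) (*-identityʳ (D * (2ℚ ^ n * (W * W))))) ⟩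
      D * (2ℚ ^ n * (W * W)) * (2ℚ ^ T * i * (2ℚ ^ T * i))
        ≡⟨ sym (rearrange (2ℚ ^ T) (2ℚ ^ n) D W i) ⟩
      D * (W * W * (i * i)) * (2ℚ ^ T * 2ℚ ^ T * 2ℚ ^ n)
        ≡⟨ cong₂ (λ a b → D * a * b) (sym eq) (sym (trans (^-+ 2ℚ (T ℕ.+ T) n) (cong (_* 2ℚ ^ n) (^-+ 2ℚ T T)))) ⟩
      D * (∏ xs v * ∏ xs e * (e₁ * e₂)) * 2ℚ ^ (T ℕ.+ T ℕ.+ n)
        ≤⟨ *-monoʳ (0≤2^ (T ℕ.+ T ℕ.+ n)) product≤ ⟩
      2ℚ ^ (k ℕ.+ k′ ℕ.+ k″) * 2ℚ ^ (T ℕ.+ T ℕ.+ n)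
        ≡⟨ trans (*-comm (2ℚ ^ (k ℕ.+ k′ ℕ.+ k″)) (2ℚ ^ (T ℕ.+ T ℕ.+ n))) (sym (^-+ 2ℚ (T ℕ.+ T ℕ.+ n) (k ℕ.+ k′ ℕ.+ k″))) ⟩
      2ℚ ^ (T ℕ.+ T ℕ.+ n ℕ.+ (k ℕ.+ k′ ℕ.+ k″)) ∎

-- One coordinate of the conversation

module Choice {X Y Msg : Set} (eX : Enumerated X) (eY : Enumerated Y) (_≟ₘ_ : DecidableEquality Msg) (m₀ : Msg) (n : ℕ)
  (μ : X → Y → ℚ) (0≤μ : ∀ x y → 0ℚ ≤ μ x y) (∑μ : ∑ (list eX) (λ x → ∑ (list eY) (μ x)) ≡ 1ℚ) (f : X → Y → Bool)
  (msg : ℕ → Vec X n × Vec Y n → Msg) {msgs : List Msg} (msgs-all : ∀ j ω → msg j ω ∈ msgs) (r : ℕ) (out : List Msg → Vec Bool n)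
  (det : Marginals.Determined eX eY _≟ₘ_ n μ 0≤μ f msg r out)
  (K λ′ : ℚ) (0<λ : 0ℚ < λ′) (K≡λ² : K ≡ λ′ * λ′)
  where

  open Marginals eX eY _≟ₘ_ n μ 0≤μ f msg r out
  open Potentials eX eY _≟ₘ_ n μ 0≤μ f msg r out det
  open Expectations eX eY _≟ₘ_ n μ 0≤μ ∑μ f msg r out det

  -- For coordinate i, the first i entries of x are fixed, and each message
  -- comes with the last entries of y.
  M : Set
  M = List Y × Msg

  _≟ᴹ_ : DecidableEquality M
  _≟ᴹ_ = Product.≡-dec _≟ʸ_ _≟ₘ_

  future : Fin n → Ω → List Y
  future i ω = after (suc (Fin.toℕ i)) (proj₂ ω)

  msgᵢ : Fin n → ℕ → Ω → M
  msgᵢ i j ω = future i ω , msg j ω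

  all-msgᵢ : Fin n → List M
  all-msgᵢ i = deduplicate _≟ᴹ_ (cartesianProduct (map (future i) ωs) msgs)

  past : Fin n → Ω → List X
  past i ω = before (Fin.toℕ i) (proj₁ ω)

  pasts : Fin n → List (List X)
  pasts i = deduplicate _≟ˣ_ (map (past i) ωs)

  wᵢ : Fin n → List X → Ω → ℚ
  wᵢ i c ω = w ω * ⟦ does (past i ω ≟ˣ c) ⟧

  0≤wᵢ : ∀ i c ω → 0ℚ ≤ wᵢ i c ω
  0≤wᵢ i c ω = 0≤* (0≤w ω) (0≤⟦⟧ (does (past i ω ≟ˣ c)))

  outᵢ : Fin n → List M → Bool
  outᵢ i h = lookup (out (map proj₂ h)) i

  module At (i : Fin n) (c : List X) = Coordinate eX eY _≟ᴹ_ ([] , m₀) {all-msgᵢ i}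
    (DecUnique.deduplicate-! _≟ᴹ_ (cartesianProduct (map (future i) ωs) msgs)) ωs (msgᵢ i)
    (λ j ω → ∈.∈-deduplicate⁺ _≟ᴹ_ (∈.∈-cartesianProduct⁺ (∈.∈-map⁺ (future i) (all eΩ ω)) (msgs-all j ω)))
    (λ ω → lookup (proj₁ ω) i) (λ ω → lookup (proj₂ ω) i) (wᵢ i c) (0≤wᵢ i c) μ 0≤μ ∑μ f (outᵢ i) r K λ′ 0<λ K≡λ²

  module Convᵢ (i : Fin n) = Conversation _≟ᴹ_ ωs (msgᵢ i)

  histᵢ≡ : ∀ i j ω → Convᵢ.hist i j ω ≡ map (future i ω ,_) (hist j ω)
  histᵢ≡ i zero    ω = refl
  histᵢ≡ i (suc j) ω = cong (msgᵢ i j ω ∷_) (histᵢ≡ i j ω)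

  map-proj₂-histᵢ : ∀ i j ω → map proj₂ (Convᵢ.hist i j ω) ≡ hist j ω
  map-proj₂-histᵢ i zero    ω = refl
  map-proj₂-histᵢ i (suc j) ω = cong (msg j ω ∷_) (map-proj₂-histᵢ i j ω)

  histᵢ⁻ : ∀ i j ω′ ω → Convᵢ.hist i (suc j) ω′ ≡ Convᵢ.hist i (suc j) ω → future i ω′ ≡ future i ω × hist (suc j) ω′ ≡ hist (suc j) ω
  histᵢ⁻ i j ω′ ω e = cong proj₁ (List.∷-injectiveˡ e) ,
    trans (sym (map-proj₂-histᵢ i (suc j) ω′)) (trans (cong (map proj₂) e) (map-proj₂-histᵢ i (suc j) ω))

  histᵢ⁺ : ∀ i j ω′ ω → future i ω′ ≡ future i ω → hist j ω′ ≡ hist j ω → Convᵢ.hist i j ω′ ≡ Convᵢ.hist i j ω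
  histᵢ⁺ i j ω′ ω e e′ = trans (histᵢ≡ i j ω′) (trans (cong₂ (λ y h → map (y ,_) h) e e′) (sym (histᵢ≡ i j ω)))

  two : ∀ {P Q S : Set} (p : Dec P) (q : Dec Q) (s : Dec S) w → (P → Q → S) → (S → P × Q) →
    w * ⟦ does p ⟧ * ⟦ does q ⟧ ≡ w * ⟦ does s ⟧
  two p q s w to from = trans (*-assoc w ⟦ does p ⟧ ⟦ does q ⟧) (cong (w *_) (trans (sym (⟦∧⟧ (does p) (does q)))
    (cong ⟦_⟧ (does-⇔ (p ×-dec q) s (λ (a , b) → to a b) from))))

  module _ (i : Fin n) (ω : Ω) where

    private
      k = Fin.toℕ i
      c = past i ω
      x = proj₁ ω
      y = proj₂ ω
      xᵢ≡ : (ω′ : Ω) → Dec (lookup (proj₁ ω′) i ≡ lookup x i)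
      xᵢ≡ ω′ = dec eX (lookup (proj₁ ω′) i) (lookup x i)
      yᵢ≡ : (ω′ : Ω) → Dec (lookup (proj₂ ω′) i ≡ lookup y i)
      yᵢ≡ ω′ = dec eY (lookup (proj₂ ω′) i) (lookup y i)
      before≡ : ∀ j (ω′ : Ω) → Dec (before j (proj₁ ω′) ≡ before j x)
      before≡ j ω′ = before j (proj₁ ω′) ≟ˣ before j x
      after≡ : ∀ j (ω′ : Ω) → Dec (after j (proj₂ ω′) ≡ after j y)
      after≡ j ω′ = after j (proj₂ ω′) ≟ʸ after j y

      _≟ᴴ_ : DecidableEquality (List M)
      _≟ᴴ_ = List.≡-dec _≟ᴹ_

    open Convᵢ i using (at) renaming (hist to histᵢ)

    -- Within the past c, fixing x_i amounts to fixing x up to and including i, and a nonempty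
    -- history of the coordinate is an actual history together with the future of y. Thus the
    -- beliefs of `Coordinate` are the ratios of `Potentials`.
    at-x : ∀ j → at (At.weight-x i c (lookup x i)) j (histᵢ j ω) ≡ UX (suc k) ω j
    at-x zero = ∑-cong ωs λ ω′ → trans (*-identityʳ (wᵢ i c ω′ * ⟦ does (xᵢ≡ ω′) ⟧))
      (two (before≡ k ω′) (xᵢ≡ ω′) (before≡ (suc k) ω′) (w ω′) (before-suc⁺ i (proj₁ ω′) x) (before-suc⁻ i (proj₁ ω′) x))
    at-x (suc j) = ∑-cong ωs λ ω′ → trans
      (cong (_* ⟦ does (histᵢ (suc j) ω′ ≟ᴴ histᵢ (suc j) ω) ⟧)
        (two (before≡ k ω′) (xᵢ≡ ω′) (before≡ (suc k) ω′) (w ω′) (before-suc⁺ i (proj₁ ω′) x) (before-suc⁻ i (proj₁ ω′) x)))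
      (two (before≡ (suc k) ω′) (histᵢ (suc j) ω′ ≟ᴴ histᵢ (suc j) ω)
        (before≡ (suc k) ω′ ×-dec (after≡ (suc k) ω′ ×-dec (hist (suc j) ω′ ≟ₕ hist (suc j) ω))) (w ω′)
        (λ a b → a , histᵢ⁻ i j ω′ ω b) (λ (a , b , c) → a , histᵢ⁺ i (suc j) ω′ ω b c))

    at-y : ∀ j → at (At.weight-y i c (lookup y i)) j (histᵢ j ω) ≡ UB i ω j
    at-y zero = ∑-cong ωs λ ω′ → trans (*-identityʳ (wᵢ i c ω′ * ⟦ does (yᵢ≡ ω′) ⟧))
      (two (before≡ k ω′) (yᵢ≡ ω′) (before≡ k ω′ ×-dec yᵢ≡ ω′) (w ω′) _,_ (λ z → z))
    at-y (suc j) = ∑-cong ωs λ ω′ → trans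
      (cong (_* ⟦ does (histᵢ (suc j) ω′ ≟ᴴ histᵢ (suc j) ω) ⟧)
        (two (before≡ k ω′) (yᵢ≡ ω′) (before≡ k ω′ ×-dec yᵢ≡ ω′) (w ω′) _,_ (λ z → z)))
      (two (before≡ k ω′ ×-dec yᵢ≡ ω′) (histᵢ (suc j) ω′ ≟ᴴ histᵢ (suc j) ω)
        (before≡ k ω′ ×-dec (after≡ k ω′ ×-dec (hist (suc j) ω′ ≟ₕ hist (suc j) ω))) (w ω′)
        (λ (a , e) b → let (e′ , h) = histᵢ⁻ i j ω′ ω b in a , after-suc⁺ i (proj₂ ω′) y e e′ , h)
        (λ (a , b , h) → let (e , e′) = after-suc⁻ i (proj₂ ω′) y b in (a , e) , histᵢ⁺ i (suc j) ω′ ω e′ h))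

    at-xy : At.joint i c (lookup x i) (lookup y i) ω ≡ Z i ω
    at-xy = ∑-cong ωs λ ω′ → trans
      (cong (_* ⟦ does (histᵢ R ω′ ≟ᴴ histᵢ R ω) ⟧) (trans (cong (wᵢ i c ω′ *_) (sym (⟦∧⟧ (does (xᵢ≡ ω′)) (does (yᵢ≡ ω′)))))
        (two (before≡ k ω′) (xᵢ≡ ω′ ×-dec yᵢ≡ ω′) (before≡ (suc k) ω′ ×-dec yᵢ≡ ω′) (w ω′)
          (λ a (b , e) → before-suc⁺ i (proj₁ ω′) x a b , e)
          (λ (a , e) → let (a′ , b) = before-suc⁻ i (proj₁ ω′) x a in a′ , b , e))))
      (two (before≡ (suc k) ω′ ×-dec yᵢ≡ ω′) (histᵢ R ω′ ≟ᴴ histᵢ R ω)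
        (before≡ (suc k) ω′ ×-dec (after≡ k ω′ ×-dec (hist R ω′ ≟ₕ hist R ω))) (w ω′)
        (λ (a , e) b → let (e′ , h) = histᵢ⁻ i r ω′ ω b in a , after-suc⁺ i (proj₂ ω′) y e e′ , h)
        (λ (a , b , h) → let (e , e′) = after-suc⁻ i (proj₂ ω′) y b in (a , e) , histᵢ⁺ i R ω′ ω e′ h))

    private
      unique-msgᵢ = DecUnique.deduplicate-! _≟ᴹ_ (cartesianProduct (map (future i) ωs) msgs)

    belief-x : ∀ j → At.a i c (lookup x i) (histᵢ j ω) (msgᵢ i j ω) ≡ ρˣ (suc k) ω j
    belief-x j = trans (conditional-hist _≟ᴹ_ ωs (msgᵢ i) K unique-msgᵢ (At.weight-x i c (lookup x i)) j ω)
      (cong₂ (λ p q → p * inv q) (at-x (suc j)) (at-x j))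

    belief-y : ∀ j → At.b i c (lookup y i) (histᵢ j ω) (msgᵢ i j ω) ≡ ρʸ i ω j
    belief-y j = trans (conditional-hist _≟ᴹ_ ωs (msgᵢ i) K unique-msgᵢ (At.weight-y i c (lookup y i)) j ω)
      (cong₂ (λ p q → p * inv q) (at-y (suc j)) (at-y j))

    At-t : At.t i c ω ≡ t i ω
    At-t = cong₂ (λ p q → C k ω * (μᵢ i ω * (p * inv q)))
      (trans (along-forward _≟ᴹ_ ωs (msgᵢ i) K R (At.a i c (lookup x i)) (At.b i c (lookup y i)) 0 ω 1ℚ 1ℚ true)
        (trans (*-identityˡ _) (alt-cong R 0 (λ j _ → belief-x j) (λ j _ → belief-y j)))) at-xy

    At-v : At.v i c ω ≡ v i ω
    At-v = cong₂ (λ p q → C k ω * (μᵢ i ω * (p * inv q)))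
      (trans (along-backward _≟ᴹ_ ωs (msgᵢ i) K R (At.a i c (lookup x i)) (At.b i c (lookup y i)) 0 ω 1ℚ 1ℚ true)
        (trans (*-identityˡ _) (alt-cong R 0 (λ j _ → belief-y j) (λ j _ → belief-x j)))) at-xy

  ∑-pasts : ∀ i (G : List X → Ω → ℚ) → ∑ ωs (λ ω → w ω * G (past i ω) ω) ≡ ∑ (pasts i) λ c → ∑ ωs λ ω → wᵢ i c ω * G c ω
  ∑-pasts i G = trans (∑-cong ωs λ ω → trans
      (sym (∑-δ _≟ˣ_ (λ c → w ω * G c ω) (past i ω) (DecUnique.deduplicate-! _≟ˣ_ (map (past i) ωs)) (∈.∈-deduplicate⁺ _≟ˣ_ (∈.∈-map⁺ (past i) (all eΩ ω)))))
      (∑-cong (pasts i) λ c → trans (cong (λ b → ⟦ b ⟧ * (w ω * G c ω)) (does-⇔ (c ≟ˣ past i ω) (past i ω ≟ˣ c) sym sym))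
        (rearrange ⟦ does (past i ω ≟ˣ c) ⟧ (w ω) (G c ω))))
    (∑-swap ωs (pasts i) (λ ω c → wᵢ i c ω * G c ω))
    where
    rearrange : ∀ b w g → b * (w * g) ≡ w * b * g
    rearrange = solve 3 (λ b w g → b :* (w :* g) := w :* b :* g) refl

  ∑W≡W : ∀ i → ∑ (pasts i) (At.W i) ≡ W
  ∑W≡W i = trans (∑-cong (pasts i) λ c → ∑-cong ωs λ ω → sym (*-identityʳ (wᵢ i c ω)))
    (trans (sym (∑-pasts i λ _ _ → 1ℚ)) (∑-cong ωs λ ω → *-identityʳ (w ω)))

  ∑v≤W : ∀ i → ∑ ωs (λ ω → w ω * v i ω) ≤ W
  ∑v≤W i = ≤-trans (≤-reflexive (trans (∑-cong ωs λ ω → cong (w ω *_) (sym (At-v i ω))) (∑-pasts i (At.v i))))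
    (≤-trans (∑-mono (pasts i) λ c → At.∑v≤W i c) (≤-reflexive (∑W≡W i)))

-- Closed inequalities are settled by evaluation, the implicit argument then being of the unit type.
≤-dec : ∀ {p q} → {h : T (does (ℚ._≤?_ p q))} → p ≤ q
≤-dec {p} {q} {h} = does-true (ℚ._≤?_ p q) (T⇒≡ h)
  where
  T⇒≡ : ∀ {b} → T b → b ≡ true
  T⇒≡ {true} _ = refl

-- A good coordinate and a good past

module Selection {X Y Msg : Set} (eX : Enumerated X) (eY : Enumerated Y) (_≟ₘ_ : DecidableEquality Msg) (m₀ : Msg) (n : ℕ)
  (μ : X → Y → ℚ) (0≤μ : ∀ x y → 0ℚ ≤ μ x y) (∑μ : ∑ (list eX) (λ x → ∑ (list eY) (μ x)) ≡ 1ℚ) (f : X → Y → Bool)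
  (msg : ℕ → Vec X n × Vec Y n → Msg) {msgs : List Msg} (msgs-all : ∀ j ω → msg j ω ∈ msgs) (r : ℕ) (out : List Msg → Vec Bool n)
  (det : Marginals.Determined eX eY _≟ₘ_ n μ 0≤μ f msg r out)
  (Λ : ℕ)
  where

  -- Two factors of 2^6: L / c = 1/64 is the loss from densities t that are too large compared with
  -- v, and (c + 1) / λ′ ≤ 1/32 that from unreliable messages.
  L c λ′ K : ℚ
  L  = 2ℚ ^ Λ
  c  = 2ℚ ^ (6 ℕ.+ Λ)
  λ′ = 2ℚ ^ (12 ℕ.+ Λ)
  K  = λ′ * λ′

  0<λ : 0ℚ < λ′
  0<λ = 0<^ (12 ℕ.+ Λ) 0<2

  0≤L : 0ℚ ≤ L
  0≤L = 0≤^ Λ (<⇒≤ 0<2)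

  0≤c : 0ℚ ≤ c
  0≤c = 0≤^ (6 ℕ.+ Λ) (<⇒≤ 0<2)

  open Marginals eX eY _≟ₘ_ n μ 0≤μ f msg r out
  open Potentials eX eY _≟ₘ_ n μ 0≤μ f msg r out det
  open Expectations eX eY _≟ₘ_ n μ 0≤μ ∑μ f msg r out det
  open Choice eX eY _≟ₘ_ m₀ n μ 0≤μ ∑μ f msg msgs-all r out det K λ′ 0<λ refl

  η : ℚ
  η = + 99 / 100

  small : ℚ → ℚ
  small p = ⟦ does (ℚ._<?_ (L * p) 1ℚ) ⟧

  0≤small : ∀ p → 0ℚ ≤ small p
  0≤small p = 0≤⟦⟧ (does (ℚ._<?_ (L * p) 1ℚ))

  module _ (T : ℕ) (code : Ω → Vec Bool T) (code-inj : ∀ ω ω′ → code ω ≡ code ω′ → hist R ω ≡ hist R ω′)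
    (m : ℕ) (n≡1+m : n ≡ suc m) (likely : (η * η) ^ n ≤ W) (many : 100 ℕ.* (T ℕ.+ T ℕ.+ 6 ℕ.* n) ℕ.≤ Λ ℕ.* n) where

    private
      N′ : ℚ
      N′ = natℚ n
      is : List (Fin n)
      is = fins n

    0<N′ : 0ℚ < N′
    0<N′ = subst (λ n → 0ℚ < natℚ n) (sym n≡1+m) (natℚ-mono-< {0} {suc m} (s≤s z≤n))

    0<W : 0ℚ < W
    0<W = <-≤-trans (0<^ n (0<* {η} {η} 0<η 0<η)) likely
      where
      0<η : 0ℚ < η
      0<η = ℚ.*<* (ℤ.+<+ (s≤s z≤n))

    module _ (ω : Ω) (0<w : 0ℚ < w ω) where

      0<ρʸ : ∀ i j → 0ℚ < ρʸ i ω j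
      0<ρʸ i j = 0<* (0<UB ω 0<w i (suc j)) (0<inv (0<UB ω 0<w i j))

      0≤density : ∀ i p → 0ℚ < p → 0ℚ ≤ C (Fin.toℕ i) ω * (μᵢ i ω * (p * inv (Z i ω)))
      0≤density i p 0<p = <⇒≤ (0<* (0<C ω 0<w (Fin.toℕ i)) (0<* (0<μᵢ ω 0<w i) (0<* 0<p (0<inv (0<Z ω 0<w i)))))

      0≤t : ∀ i → 0ℚ ≤ t i ω
      0≤t i = 0≤density i (fwd i ω) (0<alt R (0<ρˣ ω 0<w (suc (Fin.toℕ i))) (0<ρʸ i) 0)

      0≤v : ∀ i → 0ℚ ≤ v i ω
      0≤v i = 0≤density i (bwd i ω) (0<alt R (0<ρʸ i) (0<ρˣ ω 0<w (suc (Fin.toℕ i))) 0)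

      0≤e : ∀ i → 0ℚ ≤ e i ω
      0≤e i = <⇒≤ (0<* (0<* (0<* (0<B₀ ω 0<w i) (0<inv (0<C ω 0<w (Fin.toℕ i)))) (0<* (0<μᵢ ω 0<w i) (0<inv (0<μʸ ω 0<w i))))
        (0<* (0<C′ ω 0<w (Fin.toℕ i)) (0<inv (0<C′ ω 0<w (suc (Fin.toℕ i))))))

      0≤e₁ : 0ℚ ≤ e₁ (ε T code code-inj) ω
      0≤e₁ = 0≤* (0≤ε T code code-inj) (0≤* 0≤W (<⇒≤ (0<* (0<∏ is (0<μʸ ω 0<w)) (0<inv (0<V ω 0<w 0)))))

      0≤e₂ : 0ℚ ≤ e₂ (ε T code code-inj) ω
      0≤e₂ = 0≤* (0≤ε T code code-inj) (<⇒≤ (0<* (0<C ω 0<w n) (0<inv (0<U ω 0<w R n))))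

      close : N′ * η ≤ ∑ is λ i → root (t i ω)
      close = subst (λ n′ → natℚ n′ * η ≤ ∑ is λ i → root (t i ω)) (sym n≡1+m)
        (∑-root is m (λ i → t i ω) W η (trans (length-fins n) n≡1+m) 0≤t (≤-dec {0ℚ} {η}) (∏t ω 0<w)
          (subst (λ n′ → (η * η) ^ n′ ≤ W) n≡1+m likely))

      few : natℚ Λ * ∑ is (λ i → small (v i ω)) ≤
        natℚ (T ℕ.+ T ℕ.+ n) + (∑ is (λ i → 1ℚ + v i ω) + ∑ is (λ i → e i ω) + (e₁ (ε T code code-inj) ω + e₂ (ε T code code-inj) ω))
      few = ∑-small is (λ i → v i ω) (λ i → e i ω) (e₁ (ε T code code-inj) ω) (e₂ (ε T code code-inj) ω) W T Λ n 0≤v 0≤e 0≤e₁ 0≤e₂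
        (∏v∏e ω 0<w (ε T code code-inj))
        -- 2 η⁴ ≥ 1 gives 2^n W² ≥ 1.
        (≤-trans (1≤^ n (≤-dec {1ℚ} {2ℚ * (η * η * (η * η))}))
          (≤-trans (≤-reflexive (trans (^-*-distrib 2ℚ (η * η * (η * η)) n) (cong (2ℚ ^ n *_) (^-*-distrib (η * η) (η * η) n))))
            (*-monoˡ (0≤^ n (<⇒≤ 0<2)) (*-mono (0≤^ n 0≤η²) 0≤W likely likely))))
        where
        0≤η² : 0ℚ ≤ η * η
        0≤η² = ≤-dec {0ℚ} {η * η}

    S : Fin n → ℚ
    S i = ∑ ωs λ ω → w ω * root (t i ω)

    B : Fin n → ℚ
    B i = ∑ ωs λ ω → w ω * small (v i ω)

    exchange : ∀ (p : Fin n → Ω → ℚ) → ∑ is (λ i → ∑ ωs λ ω → w ω * p i ω) ≡ ∑ ωs λ ω → w ω * ∑ is λ i → p i ω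
    exchange p = trans (∑-swap is ωs (λ i ω → w ω * p i ω)) (∑-cong ωs λ ω → ∑-*ˡ is (w ω) (λ i → p i ω))

    ∑-is : ∀ (p : Fin n → ℚ) q → (∀ i → p i ≤ q) → ∑ is p ≤ N′ * q
    ∑-is p q h = ≤-trans (∑-mono is h) (≤-reflexive (trans (∑-const is q) (cong (λ n → natℚ n * q) (length-fins n))))

    ∑S : N′ * η * W ≤ ∑ is S
    ∑S = ≤-trans (≤-reflexive (trans (*-comm (N′ * η) W) (sym (∑-*ʳ ωs (N′ * η) w))))
      (≤-trans (∑-mono ωs (on-support close)) (≤-reflexive (sym (exchange λ i ω → root (t i ω)))))

    -- Every density involved has mean at most 1 under w. The 6 n consists of n for 2^n W² ≥ 1, n
    -- each for the summands 1, v and e, and 2 ≤ 2 n for e₁ and e₂.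
    ∑B : natℚ Λ * ∑ is B ≤ natℚ (T ℕ.+ T ℕ.+ 6 ℕ.* n) * W
    ∑B = begin
      natℚ Λ * ∑ is B
        ≡⟨ trans (cong (natℚ Λ *_) (exchange λ i ω → small (v i ω))) (trans (sym (∑-*ˡ ωs (natℚ Λ) (λ ω → w ω * ∑ is λ i → small (v i ω))))
             (∑-cong ωs λ ω → solve 3 (λ l w s → l :* (w :* s) := w :* (l :* s)) refl (natℚ Λ) (w ω) (∑ is λ i → small (v i ω)))) ⟩
      ∑ ωs (λ ω → w ω * (natℚ Λ * ∑ is λ i → small (v i ω)))
        ≤⟨ ∑-mono ωs (on-support few) ⟩
      ∑ ωs (λ ω → w ω * (a + (∑ is (λ i → 1ℚ + v i ω) + ∑ is (λ i → e i ω) + (e₁ ε′ ω + e₂ ε′ ω))))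
        ≡⟨ ∑-cong ωs (λ ω → trans (cong (λ z → w ω * (a + (z + ∑ is (λ i → e i ω) + (e₁ ε′ ω + e₂ ε′ ω))))
               (trans (∑-+ is (λ _ → 1ℚ) (λ i → v i ω)) (cong (_+ ∑ is (λ i → v i ω)) (trans (∑-const is 1ℚ) (trans (cong (λ n → natℚ n * 1ℚ) (length-fins n)) (*-identityʳ N′))))))
             (rearrange (w ω) a N′ (∑ is (λ i → v i ω)) (∑ is (λ i → e i ω)) (e₁ ε′ ω) (e₂ ε′ ω))) ⟩
      ∑ ωs (λ ω → w ω * (a + N′) + w ω * ∑ is (λ i → v i ω) + w ω * ∑ is (λ i → e i ω) + (w ω * e₁ ε′ ω + w ω * e₂ ε′ ω))
        ≡⟨ trans (∑-+ ωs (λ ω → w ω * (a + N′) + w ω * ∑ is (λ i → v i ω) + w ω * ∑ is (λ i → e i ω)) (λ ω → w ω * e₁ ε′ ω + w ω * e₂ ε′ ω))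
             (cong₂ _+_ (trans (∑-+ ωs (λ ω → w ω * (a + N′) + w ω * ∑ is (λ i → v i ω)) (λ ω → w ω * ∑ is (λ i → e i ω)))
                 (cong₂ _+_ (trans (∑-+ ωs (λ ω → w ω * (a + N′)) (λ ω → w ω * ∑ is (λ i → v i ω)))
                     (cong₂ _+_ (∑-*ʳ ωs (a + N′) w) (sym (exchange v)))) (sym (exchange e))))
               (∑-+ ωs (λ ω → w ω * e₁ ε′ ω) (λ ω → w ω * e₂ ε′ ω))) ⟩
      W * (a + N′) + ∑ is (λ i → ∑ ωs λ ω → w ω * v i ω) + ∑ is (λ i → ∑ ωs λ ω → w ω * e i ω) + (∑ ωs (λ ω → w ω * e₁ ε′ ω) + ∑ ωs (λ ω → w ω * e₂ ε′ ω))
        ≤⟨ +-mono-≤ (+-mono-≤ (+-monoʳ-≤ (W * (a + N′)) (∑-is _ W ∑v≤W)) (∑-is _ W ∑e≤W)) (+-mono-≤ (∑e₁≤W T code code-inj) (∑e₂≤W T code code-inj)) ⟩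
      W * (a + N′) + N′ * W + N′ * W + (W + W)
        ≡⟨ solve 3 (λ W a n → W :* (a :+ n) :+ n :* W :+ n :* W :+ (W :+ W) := (a :+ (n :+ (n :+ (n :+ (con 1ℚ :+ con 1ℚ))))) :* W) refl W a N′ ⟩
      (a + (N′ + (N′ + (N′ + (1ℚ + 1ℚ))))) * W
        ≤⟨ *-monoʳ 0≤W (+-monoʳ-≤ a (+-monoʳ-≤ N′ (+-monoʳ-≤ N′ (+-monoʳ-≤ N′ (+-mono-≤ 1≤N′ 1≤N′))))) ⟩
      (a + (N′ + (N′ + (N′ + (N′ + N′))))) * W
        ≡⟨ cong (_* W) (sym total) ⟩
      natℚ (T ℕ.+ T ℕ.+ 6 ℕ.* n) * W ∎
      where
      open ≤-Reasoning
      a = natℚ (T ℕ.+ T ℕ.+ n)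
      ε′ = ε T code code-inj
      1≤N′ : 1ℚ ≤ N′
      1≤N′ = natℚ-mono {1} {n} (subst (1 ℕ.≤_) (sym n≡1+m) (s≤s z≤n))
      rearrange : ∀ w a n p q r s → w * (a + (n + p + q + (r + s))) ≡ w * (a + n) + w * p + w * q + (w * r + w * s)
      rearrange = solve 7 (λ w a n p q r s → w :* (a :+ (n :+ p :+ q :+ (r :+ s))) := w :* (a :+ n) :+ w :* p :+ w :* q :+ (w :* r :+ w :* s)) refl
      total : natℚ (T ℕ.+ T ℕ.+ 6 ℕ.* n) ≡ a + (N′ + (N′ + (N′ + (N′ + N′))))
      total = trans (natℚ-+ (T ℕ.+ T) (6 ℕ.* n)) (trans (cong (λ z → natℚ (T ℕ.+ T) + z) (natℚ-* 6 n))
        (trans (solve 2 (λ t n → t :+ con (natℚ 6) :* n := (t :+ n) :+ (n :+ (n :+ (n :+ (n :+ n))))) refl (natℚ (T ℕ.+ T)) N′)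
          (cong (_+ (N′ + (N′ + (N′ + (N′ + N′))))) (sym (natℚ-+ (T ℕ.+ T) n)))))

    ∑B≤ : natℚ 100 * ∑ is B ≤ N′ * W
    ∑B≤ = *-cancelˡ 0<Λ (begin
      natℚ Λ * (natℚ 100 * ∑ is B)                          ≡⟨ solve 3 (λ l h b → l :* (h :* b) := h :* (l :* b)) refl (natℚ Λ) (natℚ 100) (∑ is B) ⟩
      natℚ 100 * (natℚ Λ * ∑ is B)                          ≤⟨ *-monoˡ (0≤natℚ 100) ∑B ⟩
      natℚ 100 * (natℚ (T ℕ.+ T ℕ.+ 6 ℕ.* n) * W)           ≡⟨ sym (*-assoc (natℚ 100) (natℚ (T ℕ.+ T ℕ.+ 6 ℕ.* n)) W) ⟩
      natℚ 100 * natℚ (T ℕ.+ T ℕ.+ 6 ℕ.* n) * W             ≤⟨ *-monoʳ 0≤W (subst₂ _≤_ (natℚ-* 100 (T ℕ.+ T ℕ.+ 6 ℕ.* n)) (natℚ-* Λ n)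
                                                               (natℚ-mono {100 ℕ.* (T ℕ.+ T ℕ.+ 6 ℕ.* n)} {Λ ℕ.* n} many)) ⟩
      natℚ Λ * N′ * W                                       ≡⟨ *-assoc (natℚ Λ) N′ W ⟩
      natℚ Λ * (N′ * W)                                     ∎)
      where
      open ≤-Reasoning
      0<Λ : 0ℚ < natℚ Λ
      0<Λ = natℚ-mono-< {0} {Λ} (ℕ.n≢0⇒n>0 λ { refl → impossible n n≡1+m many })
        where
        impossible : ∀ n → n ≡ suc m → ¬ 100 ℕ.* (T ℕ.+ T ℕ.+ 6 ℕ.* n) ℕ.≤ 0
        impossible .(suc m) refl h = ℕ.<-irrefl refl (ℕ.≤-trans (ℕ.≤-trans (s≤s z≤n)
          (ℕ.≤-trans (ℕ.m≤n+m (6 ℕ.* suc m) (T ℕ.+ T)) (ℕ.m≤n*m (T ℕ.+ T ℕ.+ 6 ℕ.* suc m) 100))) h)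

    value : Fin n → ℚ
    value i = ∑ ωs λ ω → w ω * (root (t i ω) - small (v i ω))

    value≡ : ∀ i → value i ≡ S i - B i
    value≡ i = trans (∑-cong ωs λ ω → solve 3 (λ w p q → w :* (p :- q) := w :* p :- w :* q) refl (w ω) (root (t i ω)) (small (v i ω)))
      (∑-- ωs (λ ω → w ω * root (t i ω)) (λ ω → w ω * small (v i ω)))

    -- Averaged over the coordinates, the roots give 99/100 and the small v take away 1/100.
    best-i : ∃ λ i → (+ 98 / 100) * W ≤ value i
    best-i = let (i , _ , h) = ∑-pick is value (λ _ → W) (+ 98 / 100) (λ _ → 0≤W) (λ i W≡0 → contradiction 0<W (<-irrefl (sym W≡0)))
                  (subst (0ℚ <_) (sym ∑W) (0<* 0<N′ 0<W)) total in i , h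
      where
      open ≤-Reasoning
      ∑W : ∑ is (λ _ → W) ≡ N′ * W
      ∑W = trans (∑-const is W) (cong (λ n → natℚ n * W) (length-fins n))
      total : (+ 98 / 100) * ∑ is (λ _ → W) ≤ ∑ is value
      total = begin
        (+ 98 / 100) * ∑ is (λ _ → W)           ≡⟨ cong ((+ 98 / 100) *_) ∑W ⟩
        (+ 98 / 100) * (N′ * W)                 ≡⟨ solve 2 (λ n W → con (+ 98 / 100) :* (n :* W) := n :* con η :* W :- con (+ 1 / 100) :* (n :* W)) refl N′ W ⟩
        N′ * η * W - (+ 1 / 100) * (N′ * W)     ≤⟨ +-mono-≤ ∑S (neg-antimono-≤ (*-monoˡ (0≤frac 1 99) ∑B≤)) ⟩
        ∑ is S - (+ 1 / 100) * (natℚ 100 * ∑ is B) ≡⟨ cong (λ z → ∑ is S - z) (solve 1 (λ b → con (+ 1 / 100) :* (con (natℚ 100) :* b) := b) refl (∑ is B)) ⟩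
        ∑ is S - ∑ is B                         ≡⟨ sym (trans (∑-cong is value≡) (∑-- is S B)) ⟩
        ∑ is value                              ∎

    module _ (ζ : ℚ) (b : ℕ) (0≤ζ : 0ℚ ≤ ζ) (ζ≤1 : ζ ≤ 1ℚ) (0≤κ : 0ℚ ≤ 1ℚ - ζ * (1ℚ + K))
      (reliable : + 9 / 10 ≤ ((1ℚ - geom ζ b) * (1ℚ - ζ * (1ℚ + K))) ^ R) where

      private
        value-at : Fin n → List X → ℚ
        value-at i c = ∑ ωs λ ω → wᵢ i c ω * (root (At.t i c ω) - small (At.v i c ω))

        best-c : ∀ i → (+ 98 / 100) * W ≤ value i → ∃ λ p → 0ℚ < At.W i p × (+ 98 / 100) * At.W i p ≤ value-at i p
        best-c i large = ∑-pick (pasts i) (value-at i) (At.W i) (+ 98 / 100) (At.0≤W i) empty (subst (0ℚ <_) (sym (∑W≡W i)) 0<W)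
          (≤-trans (≤-reflexive (cong ((+ 98 / 100) *_) (∑W≡W i))) (≤-trans large (≤-reflexive
            (trans (∑-cong ωs λ ω → cong (w ω *_) (cong₂ (λ p q → root p - small q) (sym (At-t i ω)) (sym (At-v i ω))))
              (∑-pasts i λ c ω → root (At.t i c ω) - small (At.v i c ω))))))
          where
          empty : ∀ c → At.W i c ≡ 0ℚ → value-at i c ≤ 0ℚ
          empty c W≡0 = ≤-reflexive (trans (∑-cong ωs λ ω → trans (cong (_* (root (At.t i c ω) - small (At.v i c ω))) (zero-weight ω)) (*-zeroˡ (root (At.t i c ω) - small (At.v i c ω)))) (∑-zero ωs))
            where
            zero-weight : ∀ ω → wᵢ i c ω ≡ 0ℚ
            zero-weight ω = ≤-antisym (≤-trans (term≤∑ {f = wᵢ i c} (0≤wᵢ i c) (all eΩ ω)) (≤-reflexive W≡0)) (0≤wᵢ i c ω)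

      module _ (i : Fin n) (p : List X) (0<Wᵢ : 0ℚ < At.W i p) (large : (+ 98 / 100) * At.W i p ≤ value-at i p) where

        correct : ∀ ω → 0ℚ < wᵢ i p ω → outᵢ i (Convᵢ.hist i R ω) ≡ f (lookup (proj₁ ω) i) (lookup (proj₂ ω) i)
        correct ω 0<wᵢ = trans (cong (λ h → lookup (out h) i) (map-proj₂-histᵢ i R ω))
          (proj₁ (cells-support 0≤μ (out (hist R ω)) (proj₁ ω) (proj₂ ω) (proj₁ (0<*⇒0< (0≤w ω) (0≤⟦⟧ (does (past i ω ≟ˣ p))) 0<wᵢ))) i)

        L≤ : L ≤ (+ 1 / 64) * c
        L≤ = ≤-reflexive (sym (trans (cong ((+ 1 / 64) *_) (^-+ 2ℚ 6 Λ)) (solve 1 (λ l → con (+ 1 / 64) :* (con (2ℚ ^ 6) :* l) := l) refl L)))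

        c+1≤ : c + 1ℚ ≤ (+ 1 / 32) * λ′
        c+1≤ = ≤-trans (+-monoʳ-≤ c (1≤^ (6 ℕ.+ Λ) 1≤2)) (≤-reflexive (trans (cong (λ z → z + z) (^-+ 2ℚ 6 Λ))
          (trans (solve 1 (λ l → con (2ℚ ^ 6) :* l :+ con (2ℚ ^ 6) :* l := con (+ 1 / 32) :* (con (2ℚ ^ 12) :* l)) refl L)
            (cong ((+ 1 / 32) *_) (sym (^-+ 2ℚ 12 Λ))))))

        gain : Ω → ℚ
        gain ω = (1ℚ ⊓ At.t i p ω) - small (At.v i p ω)

        ∑gain : (+ 4 / 5) * At.W i p ≤ ∑ ωs λ ω → wᵢ i p ω * gain ω
        ∑gain = gain-from-root ωs (wᵢ i p) (At.t i p) (small ∘ At.v i p) (0≤wᵢ i p) (λ ω → 0≤small (At.v i p ω)) (At.∑t≤W i p) large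

        success : Σ[ s ∈ Tree X Y Bool R ] (∀ x y → bits s x y ℕ.≤ r ℕ.* b ℕ.+ 1) ×
          + 11 / 20 ≤ ∑ (list eX) λ x → ∑ (list eY) λ y → μ x y * ⟦ does (run s x y ≟ f x y) ⟧
        success = proj₁ single , proj₁ (proj₂ single) , *-cancelˡ 0<Wᵢ (begin
          -- 9/10 · (4/5 - 1/64 - 1/32) exceeds 11/20 by 409/3200.
          Wᵢ * (+ 11 / 20)
            ≤⟨ ≤-by ((+ 409 / 3200) * Wᵢ) (0≤* (0≤frac 409 3199) (<⇒≤ 0<Wᵢ))
                 (solve 1 (λ w → con (+ 9 / 10) :* (con (+ 4 / 5) :* w :- (con (+ 1 / 64) :+ con (+ 1 / 32)) :* w) := w :* con (+ 11 / 20) :+ con (+ 409 / 3200) :* w) refl Wᵢ) ⟩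
          (+ 9 / 10) * ((+ 4 / 5) * Wᵢ - (+ 1 / 64 + + 1 / 32) * Wᵢ)
            ≤⟨ *-mono (≤-trans (0≤* {+ 241 / 320} (0≤frac 241 319) (<⇒≤ 0<Wᵢ))
                   (≤-reflexive (solve 1 (λ w → con (+ 241 / 320) :* w := con (+ 4 / 5) :* w :- (con (+ 1 / 64) :+ con (+ 1 / 32)) :* w) refl Wᵢ)))
                 (≤-trans (0≤frac 9 9) reliable) reliable (+-monoˡ-≤ (- ((+ 1 / 64 + + 1 / 32) * Wᵢ)) ∑gain) ⟩
          ((1ℚ - geom ζ b) * (1ℚ - ζ * (1ℚ + K))) ^ R * (∑ ωs (λ ω → wᵢ i p ω * gain ω) - (+ 1 / 64 + + 1 / 32) * Wᵢ)
            ≤⟨ proj₂ (proj₂ single) ⟩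
          Wᵢ * ∑ (list eX) (λ x → ∑ (list eY) λ y → μ x y * ⟦ does (run (proj₁ single) x y ≟ f x y) ⟧) ∎)
          where
          open ≤-Reasoning
          Wᵢ = At.W i p
          single = At.single i p L c (+ 1 / 64) (+ 1 / 32) 0≤L 0≤c (0≤frac 1 63) (0≤frac 1 31) L≤ c+1≤ correct ζ b 0≤ζ ζ≤1 0≤κ

      one-of-many : Σ[ s ∈ Tree X Y Bool R ] (∀ x y → bits s x y ℕ.≤ r ℕ.* b ℕ.+ 1) ×
        + 11 / 20 ≤ ∑ (list eX) λ x → ∑ (list eY) λ y → μ x y * ⟦ does (run s x y ≟ f x y) ⟧
      one-of-many = let (i , large) = best-i ; (p , 0<Wᵢ , largeᵢ) = best-c i large in success i p 0<Wᵢ largeᵢ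

-- Transcripts

message : ∀ {A B O r} → Tree A B O (suc r) → A → List Bool
message (bit q t) a = q a ∷ message (t (q a)) a
message (end t)   a = []

next : ∀ {A B O r} → Tree A B O (suc r) → A → Tree B A O r
next (bit q t) a = next (t (q a)) a
next (end t)   a = t

messages : ∀ {A B O r} → Tree A B O r → A → B → ℕ → List Bool
messages {r = zero}  t a b j       = []
messages {r = suc r} t a b zero    = message t a
messages {r = suc r} t a b (suc j) = messages (next t a) b a j

-- Reads a message without the speaker's input. A message that stops too early is continued by
-- `false`, which never happens to an actual one.
replay-message : ∀ {A B O r} → Tree A B O (suc r) → List Bool → Tree B A O r
replay-message (bit q t) []      = replay-message (t false) []
replay-message (bit q t) (z ∷ m) = replay-message (t z) m
replay-message (end t)   m       = t

replay : ∀ {A B O r} → Tree A B O r → List (List Bool) → O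
replay {r = zero}  (output o) ms       = o
replay {r = suc r} t          []       = replay (replay-message t []) []
replay {r = suc r} t          (m ∷ ms) = replay (replay-message t m) ms

replay-message-next : ∀ {A B O r} (t : Tree A B O (suc r)) a → replay-message t (message t a) ≡ next t a
replay-message-next (bit q t) a = replay-message-next (t (q a)) a
replay-message-next (end t)   a = refl

run-next : ∀ {A B O r} (t : Tree A B O (suc r)) a b → run t a b ≡ run (next t a) b a
run-next (bit q t) a b = run-next (t (q a)) a b
run-next (end t)   a b = refl

replay-messages : ∀ {A B O r} (t : Tree A B O r) a b → replay t (List.applyUpTo (messages t a b) r) ≡ run t a b
replay-messages {r = zero}  (output o) a b = refl
replay-messages {r = suc r} t a b = trans (cong (λ s → replay s (List.applyUpTo (messages (next t a) b a) r)) (replay-message-next t a))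
  (trans (replay-messages (next t a) b a) (sym (run-next t a b)))

next-cong : ∀ {A B O r} (t : Tree A B O (suc r)) a a′ → message t a ≡ message t a′ → next t a ≡ next t a′
next-cong t a a′ e = trans (sym (replay-message-next t a)) (trans (cong (replay-message t) e) (replay-message-next t a′))

messages-determined : ∀ {A B O r} (t : Tree A B O r) j a b a′ b′ → (∀ k → k ℕ.< j → messages t a b k ≡ messages t a′ b′ k) →
  (if turn j then a ≡ a′ else b ≡ b′) → messages t a b j ≡ messages t a′ b′ j
messages-determined {r = zero}  t j       a b a′ b′ h s = refl
messages-determined {r = suc r} t zero    a b a′ b′ h s = cong (message t) s
messages-determined {r = suc r} t (suc j) a b a′ b′ h s = trans (messages-determined (next t a) j b a b′ a′
    (λ k k<j → trans (h (suc k) (s≤s k<j)) (cong (λ u → messages u b′ a′ k) (sym same-next))) (switch (turn j) s))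
  (cong (λ u → messages u b′ a′ j) same-next)
  where
  same-next : next t a ≡ next t a′
  same-next = next-cong t a a′ (h 0 (s≤s z≤n))
  switch : ∀ τ → (if not τ then a ≡ a′ else b ≡ b′) → if τ then b ≡ b′ else a ≡ a′
  switch true  e = e
  switch false e = e

messages-late : ∀ {A B O r} (t : Tree A B O r) a b j → r ℕ.≤ j → messages t a b j ≡ []
messages-late {r = zero}  t a b j       _         = refl
messages-late {r = suc r} t a b (suc j) (s≤s r≤j) = messages-late (next t a) b a j r≤j

padded : ∀ {A B O r} T → Tree A B O r → A → B → Vec Bool T
padded T       (output o) a b = replicate T false
padded zero    (bit q t)  a b = []
padded (suc T) (bit q t)  a b = q a ∷ padded T (t (q a)) a b
padded T       (end t)    a b = padded T t b a

padded-messages : ∀ {A B O r} T (t : Tree A B O r) a b a′ b′ → bits t a b ℕ.≤ T → bits t a′ b′ ℕ.≤ T →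
  padded T t a b ≡ padded T t a′ b′ → ∀ k → messages t a b k ≡ messages t a′ b′ k
padded-messages T (output o) a b a′ b′ h h′ e k = refl
padded-messages (suc T) (bit q t) a b a′ b′ (s≤s h) (s≤s h′) e = λ where
    zero    → cong₂ _∷_ same (rest zero)
    (suc k) → rest (suc k)
  where
  same : q a ≡ q a′
  same = cong Vec.head e
  rest : ∀ k → messages (t (q a)) a b k ≡ messages (t (q a′)) a′ b′ k
  rest k = trans (padded-messages T (t (q a)) a b a′ b′ h (subst (λ z → bits (t z) a′ b′ ℕ.≤ T) (sym same) h′)
      (trans (cong Vec.tail e) (cong (λ z → padded T (t z) a′ b′) (sym same))) k)
    (cong (λ z → messages (t z) a′ b′ k) same)
padded-messages T (end t) a b a′ b′ h h′ e zero    = refl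
padded-messages T (end t) a b a′ b′ h h′ e (suc k) = padded-messages T t b a b′ a′ h h′ e k

⨂-cells : ∀ {X Y : Set} (μ : X → Y → ℚ) f {n} (g : Vec Bool n) x y →
  ⨂ (cells μ f g) x y ≡ ⨂ (replicate n μ) x y * ⟦ does (≡-dec _≟_ g (zipWith f x y)) ⟧
⨂-cells μ f []      []      []      = refl
⨂-cells μ f {suc n} (b ∷ g) (x ∷ xs) (y ∷ ys) = trans
  (cong₂ (λ d z → μ x y * ⟦ d ⟧ * z) (does-⇔ (f x y ≟ b) (b ≟ f x y) sym sym) (⨂-cells μ f g xs ys))
  (trans (solve 4 (λ m d p e → m :* d :* (p :* e) := m :* p :* (d :* e)) refl (μ x y) ⟦ does (b ≟ f x y) ⟧ (⨂ (replicate n μ) xs ys) ⟦ does (≡-dec _≟_ g (zipWith f xs ys)) ⟧)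
    (cong (μ x y * ⨂ (replicate n μ) xs ys *_) (sym (⟦∧⟧ (does (b ≟ f x y)) (does (≡-dec _≟_ g (zipWith f xs ys)))))))

score : ∀ {X Y O : Set} {r} → Enumerated X → Enumerated Y → (X → Y → ℚ) → DecidableEquality O → (X → Y → O) → Tree X Y O r → ℚ
score eX eY μ _≟ₒ_ f t = ∑ (list eX) λ x → ∑ (list eY) λ y → μ x y * ⟦ does (run t x y ≟ₒ f x y) ⟧

module _ {X Y : Set} (eX : Enumerated X) (eY : Enumerated Y)
  (μ : X → Y → ℚ) (0≤μ : ∀ x y → 0ℚ ≤ μ x y) (∑μ : ∑ (list eX) (λ x → ∑ (list eY) (μ x)) ≡ 1ℚ) (f : X → Y → Bool) where

  product-to-single : ∀ m r (t : Tree (Vec X (suc m)) (Vec Y (suc m)) (Vec Bool (suc m)) (suc r)) T → (∀ x y → bits t x y ℕ.≤ T) →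
    ((+ 99 / 100) * (+ 99 / 100)) ^ suc m ≤ score (Enumerated-Vec eX (suc m)) (Enumerated-Vec eY (suc m)) (⨂ (replicate (suc m) μ)) (≡-dec _≟_) (zipWith f) t →
    ∀ Λ → 100 ℕ.* (T ℕ.+ T ℕ.+ 6 ℕ.* suc m) ℕ.≤ Λ ℕ.* suc m →
    ∀ ζ b → 0ℚ ≤ ζ → ζ ≤ 1ℚ → 0ℚ ≤ 1ℚ - ζ * (1ℚ + 2ℚ ^ (12 ℕ.+ Λ) * 2ℚ ^ (12 ℕ.+ Λ)) →
    + 9 / 10 ≤ ((1ℚ - geom ζ b) * (1ℚ - ζ * (1ℚ + 2ℚ ^ (12 ℕ.+ Λ) * 2ℚ ^ (12 ℕ.+ Λ)))) ^ suc r →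
    Σ[ s ∈ Tree X Y Bool (suc r) ] (∀ x y → bits s x y ℕ.≤ r ℕ.* b ℕ.+ 1) × + 11 / 20 ≤ score eX eY μ _≟_ f s
  product-to-single m r t T bits≤T likely Λ many ζ b 0≤ζ ζ≤1 0≤κ reliable =
    Selection.one-of-many eX eY (List.≡-dec _≟_) [] n μ 0≤μ ∑μ f msg msg∈ r out det Λ
      T (λ (x , y) → padded T t x y)
      (λ (x , y) (x′ , y′) e → hist-cong R (x , y) (x′ , y′) λ k _ → padded-messages T t x y x′ y′ (bits≤T x y) (bits≤T x′ y′) e k)
      m refl (≤-trans likely (≤-reflexive (sym W≡))) many ζ b 0≤ζ ζ≤1 0≤κ reliable
    where
    n R : ℕ
    n = suc m
    R = suc r
    Ω : Set
    Ω = Vec X n × Vec Y n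
    ωs : List Ω
    ωs = list (Enumerated-× (Enumerated-Vec eX n) (Enumerated-Vec eY n))
    all-ωs : ∀ ω → ω ∈ ωs
    all-ωs = all (Enumerated-× (Enumerated-Vec eX n) (Enumerated-Vec eY n))
    msg : ℕ → Ω → List Bool
    msg j (x , y) = messages t x y j
    msgs : List (List Bool)
    msgs = [] ∷ cartesianProductWith msg (upTo R) ωs
    msg∈ : ∀ j ω → msg j ω ∈ msgs
    msg∈ j ω@(x , y) = by-cases (j ℕ.<? R)
      where
      by-cases : Dec (j ℕ.< R) → msg j ω ∈ msgs
      by-cases (yes j<R) = there (∈.∈-cartesianProductWith⁺ msg (∈.∈-upTo⁺ j<R) (all-ωs ω))
      by-cases (no j≮R)  = here (messages-late t x y j (ℕ.≮⇒≥ j≮R))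
    out : List (List Bool) → Vec Bool n
    out h = replay t (List.reverse h)
    open Conversation (List.≡-dec _≟_) ωs msg using (hist)
    hist-applyDownFrom : ∀ j ω → hist j ω ≡ List.applyDownFrom (λ k → msg k ω) j
    hist-applyDownFrom zero    ω = refl
    hist-applyDownFrom (suc j) ω = cong (msg j ω ∷_) (hist-applyDownFrom j ω)
    out-hist : ∀ x y → out (hist R (x , y)) ≡ run t x y
    out-hist x y = trans (cong (replay t) (trans (cong List.reverse (hist-applyDownFrom R (x , y))) (List.reverse-applyDownFrom (messages t x y) R)))
      (replay-messages t x y)
    hist-cong : ∀ j ω ω′ → (∀ k → k ℕ.< j → msg k ω ≡ msg k ω′) → hist j ω ≡ hist j ω′
    hist-cong zero    ω ω′ h = refl
    hist-cong (suc j) ω ω′ h = cong₂ _∷_ (h j ℕ.≤-refl) (hist-cong j ω ω′ λ k k<j → h k (ℕ.m≤n⇒m≤1+n k<j))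
    hist⁻ : ∀ j ω ω′ → hist j ω ≡ hist j ω′ → ∀ k → k ℕ.< j → msg k ω ≡ msg k ω′
    hist⁻ (suc j) ω ω′ e k (s≤s k≤j) = by-cases (ℕ.m≤n⇒m<n∨m≡n k≤j)
      where
      by-cases : k ℕ.< j ⊎ k ≡ j → msg k ω ≡ msg k ω′
      by-cases (inj₁ k<j)  = hist⁻ j ω ω′ (List.∷-injectiveʳ e) k k<j
      by-cases (inj₂ refl) = List.∷-injectiveˡ e
    det : ∀ j (ω ω′ : Ω) → hist j ω ≡ hist j ω′ → (if turn j then proj₁ ω ≡ proj₁ ω′ else proj₂ ω ≡ proj₂ ω′) → msg j ω ≡ msg j ω′
    det j ω@(x , y) ω′@(x′ , y′) e s = messages-determined t j x y x′ y′ (hist⁻ j ω ω′ e) s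
    W≡ : Marginals.W eX eY (List.≡-dec _≟_) n μ 0≤μ f msg r out ≡ score (Enumerated-Vec eX n) (Enumerated-Vec eY n) (⨂ (replicate n μ)) (≡-dec _≟_) (zipWith f) t
    W≡ = trans (∑-cartesian _,_ (vectors (list eX) n) (vectors (list eY) n) _) (∑-cong (vectors (list eX) n) λ x → ∑-cong (vectors (list eY) n) λ y →
      trans (cong (λ g → ⨂ (cells μ f g) x y) (out-hist x y)) (⨂-cells μ f (run t x y) x y))

-- Protocols of few bits

-- Communication is replaced by guessing the transcript: there are at most 2^T, each with one
-- output, and o is the best of these outputs. P keeps the inputs compatible with the bits guessed
-- so far.
guess-transcript : ∀ {A B O r} (as : List A) (bs : List B) (o₀ : O) T (t : Tree A B O r) (P : A → B → Bool) (u : A → B → O → ℚ) →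
  (∀ a b o → 0ℚ ≤ u a b o) → (∀ a b → P a b ≡ true → bits t a b ℕ.≤ T) →
  ∃ λ o → ∑ as (λ a → ∑ bs λ b → ⟦ P a b ⟧ * u a b (run t a b)) ≤ 2ℚ ^ T * ∑ as (λ a → ∑ bs λ b → u a b o)
guess-transcript as bs o₀ T (output o) P u 0≤u h = o , ≤-trans
  (∑-mono as λ a → ∑-mono bs λ b → ≤-eq (*-monoʳ (0≤u a b o) (⟦⟧≤1 (P a b))) (*-identityˡ (u a b o)))
  (eq-≤ (sym (*-identityˡ _)) (*-monoʳ (0≤∑ as λ a → 0≤∑ bs λ b → 0≤u a b o) (1≤^ T 1≤2)))
guess-transcript as bs o₀ zero (bit q t) P u 0≤u h = o₀ , ≤-trans
  (≤-reflexive (trans (∑-cong as λ a → trans (∑-cong bs λ b → null a b (P a b) refl) (∑-zero bs)) (∑-zero as)))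
  (0≤* 0≤1 (0≤∑ as λ a → 0≤∑ bs λ b → 0≤u a b o₀))
  where
  null : ∀ a b p → P a b ≡ p → ⟦ P a b ⟧ * u a b (run (t (q a)) a b) ≡ 0ℚ
  null a b true  e = contradiction (h a b e) λ ()
  null a b false e = trans (cong (λ p → ⟦ p ⟧ * u a b (run (t (q a)) a b)) e) (*-zeroˡ (u a b (run (t (q a)) a b)))
guess-transcript as bs o₀ (suc T) (bit q t) P u 0≤u h = choose (guess true) (guess false)
  where
  side : Bool → _ → _ → Bool
  side z a b = P a b ∧ does (q a ≟ z)
  part : Bool → ℚ
  part z = ∑ as (λ a → ∑ bs λ b → ⟦ side z a b ⟧ * u a b (run (t z) a b))
  total : _ → ℚ
  total o = ∑ as (λ a → ∑ bs λ b → u a b o)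
  guess : ∀ z → ∃ λ o → part z ≤ 2ℚ ^ T * total o
  guess z = guess-transcript as bs o₀ T (t z) (side z) u 0≤u λ a b e → ok a b (P a b) (q a ≟ z) refl e
    where
    ok : ∀ a b p (d : Dec (q a ≡ z)) → P a b ≡ p → p ∧ does d ≡ true → bits (t z) a b ℕ.≤ T
    ok a b true (yes e) eP _ = subst (λ z → bits (t z) a b ℕ.≤ T) e (ℕ.≤-pred (h a b eP))
  split : ∀ a b → ⟦ P a b ⟧ * u a b (run (t (q a)) a b) ≡ ⟦ side true a b ⟧ * u a b (run (t true) a b) + ⟦ side false a b ⟧ * u a b (run (t false) a b)
  split a b = by-cases (P a b) (q a)
    where
    by-cases : ∀ p z → ⟦ p ⟧ * u a b (run (t z) a b) ≡ ⟦ p ∧ does (z ≟ true) ⟧ * u a b (run (t true) a b) + ⟦ p ∧ does (z ≟ false) ⟧ * u a b (run (t false) a b)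
    by-cases true  true  = solve 2 (λ x y → con 1ℚ :* x := con 1ℚ :* x :+ con 0ℚ :* y) refl (u a b (run (t true) a b)) (u a b (run (t false) a b))
    by-cases true  false = solve 2 (λ x y → con 1ℚ :* y := con 0ℚ :* x :+ con 1ℚ :* y) refl (u a b (run (t true) a b)) (u a b (run (t false) a b))
    by-cases false true  = solve 2 (λ x y → con 0ℚ :* x := con 0ℚ :* x :+ con 0ℚ :* y) refl (u a b (run (t true) a b)) (u a b (run (t false) a b))
    by-cases false false = solve 2 (λ x y → con 0ℚ :* y := con 0ℚ :* x :+ con 0ℚ :* y) refl (u a b (run (t true) a b)) (u a b (run (t false) a b))
  sum≡ : ∑ as (λ a → ∑ bs λ b → ⟦ P a b ⟧ * u a b (run (t (q a)) a b)) ≡ part true + part false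
  sum≡ = trans (∑-cong as λ a → trans (∑-cong bs (split a)) (∑-+ bs _ _)) (∑-+ as _ _)
  twice : ∀ x → 2ℚ ^ T * x + 2ℚ ^ T * x ≡ 2ℚ ^ suc T * x
  twice x = solve 2 (λ p x → p :* x :+ p :* x := con 2ℚ :* p :* x) refl (2ℚ ^ T) x
  0≤2^T : 0ℚ ≤ 2ℚ ^ T
  0≤2^T = 0≤^ T (<⇒≤ 0<2)
  choose : (∃ λ o → part true ≤ 2ℚ ^ T * total o) → (∃ λ o → part false ≤ 2ℚ ^ T * total o) →
    ∃ λ o → ∑ as (λ a → ∑ bs λ b → ⟦ P a b ⟧ * u a b (run (t (q a)) a b)) ≤ 2ℚ ^ suc T * total o
  choose (o , le) (o′ , le′) = by-cases (≤-total (total o) (total o′))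
    where
    by-cases : total o ≤ total o′ ⊎ total o′ ≤ total o → ∃ λ o → ∑ as (λ a → ∑ bs λ b → ⟦ P a b ⟧ * u a b (run (t (q a)) a b)) ≤ 2ℚ ^ suc T * total o
    by-cases (inj₁ o≤o′) = o′ , ≤-trans (≤-reflexive sum≡) (≤-eq (+-mono-≤ (≤-trans le (*-monoˡ 0≤2^T o≤o′)) le′) (twice (total o′)))
    by-cases (inj₂ o′≤o) = o , ≤-trans (≤-reflexive sum≡) (≤-eq (+-mono-≤ le (≤-trans le′ (*-monoˡ 0≤2^T o′≤o))) (twice (total o)))
guess-transcript as bs o₀ T (end t) P u 0≤u h with guess-transcript bs as o₀ T t (λ b a → P a b) (λ b a → u a b) (λ b a → 0≤u a b) (λ b a → h a b)
... | o , le = o , ≤-trans (≤-reflexive (∑-swap as bs _)) (≤-trans le (≤-reflexive (cong (2ℚ ^ T *_) (∑-swap bs as (λ b a → u a b o)))))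

∑-⨂ : {X Y : Set} (xs : List X) (ys : List Y) → ∀ {n} (ps : Vec (X → Y → ℚ) n) →
  ∑ (vectors xs n) (λ x → ∑ (vectors ys n) λ y → ⨂ ps x y) ≡ ∏ (fins n) λ i → ∑ xs λ x → ∑ ys λ y → lookup ps i x y
∑-⨂ xs ys [] = refl
∑-⨂ xs ys {suc n} (p ∷ ps) = begin
  ∑ (vectors xs (suc n)) (λ x → ∑ (vectors ys (suc n)) λ y → ⨂ (p ∷ ps) x y)
    ≡⟨ trans (∑-cartesian _∷_ xs (vectors xs n) _) (∑-cong xs λ x → ∑-cong (vectors xs n) λ v → ∑-cartesian _∷_ ys (vectors ys n) _) ⟩
  ∑ xs (λ x → ∑ (vectors xs n) λ v → ∑ ys λ y → ∑ (vectors ys n) λ v′ → p x y * ⨂ ps v v′)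
    ≡⟨ ∑-cong xs (λ x → trans (∑-swap (vectors xs n) ys _) (∑-cong ys λ y → trans (∑-cong (vectors xs n) λ v → ∑-*ˡ (vectors ys n) (p x y) (⨂ ps v))
         (∑-*ˡ (vectors xs n) (p x y) (λ v → ∑ (vectors ys n) (⨂ ps v))))) ⟩
  ∑ xs (λ x → ∑ ys λ y → p x y * S)
    ≡⟨ trans (∑-cong xs λ x → ∑-*ʳ ys S (p x)) (∑-*ʳ xs S (λ x → ∑ ys (p x))) ⟩
  ∑ xs (λ x → ∑ ys (p x)) * S
    ≡⟨ cong (∑ xs (λ x → ∑ ys (p x)) *_) (trans (∑-⨂ xs ys ps) (sym (∏-map suc (fins n) λ i → ∑ xs λ x → ∑ ys λ y → lookup (p ∷ ps) i x y))) ⟩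
  ∏ (fins (suc n)) (λ i → ∑ xs λ x → ∑ ys λ y → lookup (p ∷ ps) i x y) ∎
  where
  open ≡-Reasoning
  S = ∑ (vectors xs n) (λ v → ∑ (vectors ys n) λ v′ → ⨂ ps v v′)

module _ {X Y : Set} (eX : Enumerated X) (eY : Enumerated Y) (μ : X → Y → ℚ) (0≤μ : ∀ x y → 0ℚ ≤ μ x y) (f : X → Y → Bool) where

  constant-score : Bool → ℚ
  constant-score z = ∑ (list eX) λ x → ∑ (list eY) λ y → μ x y * ⟦ does (f x y ≟ z) ⟧

  lookup-cells : ∀ {n} (g : Vec Bool n) i → lookup (cells μ f g) i ≡ λ x y → μ x y * ⟦ does (f x y ≟ lookup g i) ⟧
  lookup-cells (b ∷ g) zero    = refl
  lookup-cells (b ∷ g) (suc i) = lookup-cells g i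

  ∑-cells : ∀ {n} (g : Vec Bool n) → ∑ (vectors (list eX) n) (λ x → ∑ (vectors (list eY) n) λ y → ⨂ (cells μ f g) x y) ≡
    ∏ (fins n) λ i → constant-score (lookup g i)
  ∑-cells {n} g = trans (∑-⨂ (list eX) (list eY) (cells μ f g))
    (∏-cong (fins n) λ i → cong (λ p → ∑ (list eX) λ x → ∑ (list eY) λ y → p x y) (lookup-cells g i))

  0≤constant-score : ∀ z → 0ℚ ≤ constant-score z
  0≤constant-score z = 0≤∑ (list eX) λ x → 0≤∑ (list eY) λ y → 0≤* (0≤μ x y) (0≤⟦⟧ (does (f x y ≟ z)))

  -- If both constants were right with probability below 11/20, any fixed output vector would be
  -- right with probability at most (11/20)^n, and guessing T bits with 2 T ≤ n gains at most
  -- 2^(n/2). But θ² > 2 (11/20)².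
  product-to-constant : ∀ {r} m (t : Tree (Vec X (suc m)) (Vec Y (suc m)) (Vec Bool (suc m)) r) T → (∀ x y → bits t x y ℕ.≤ T) → T ℕ.+ T ℕ.≤ suc m →
    ((+ 99 / 100) * (+ 99 / 100)) ^ suc m ≤ score (Enumerated-Vec eX (suc m)) (Enumerated-Vec eY (suc m)) (⨂ (replicate (suc m) μ)) (≡-dec _≟_) (zipWith f) t →
    ∃ λ z → + 11 / 20 ≤ constant-score z
  product-to-constant m t T bits≤T 2T≤n likely = decide (ℚ._≤?_ (+ 11 / 20) (constant-score true)) (ℚ._≤?_ (+ 11 / 20) (constant-score false))
    where
    n = suc m
    exs = Enumerated-Vec eX n
    eys = Enumerated-Vec eY n
    u : Vec X n → Vec Y n → Vec Bool n → ℚ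
    u x y g = ⨂ (cells μ f g) x y
    guess = guess-transcript (list exs) (list eys) (replicate n false) T t (λ _ _ → true) u (λ x y g → 0≤cells 0≤μ g x y) (λ x y _ → bits≤T x y)
    θ : ℚ
    θ = (+ 99 / 100) * (+ 99 / 100)
    bound : ∀ q → 0ℚ ≤ q → (∀ z → constant-score z ≤ q) → θ ^ n ≤ 2ℚ ^ T * q ^ n
    bound q 0≤q h = ≤-trans likely (≤-trans (≤-reflexive (∑-cong (list exs) λ x → ∑-cong (list eys) λ y →
        trans (sym (⨂-cells μ f (run t x y) x y)) (sym (*-identityˡ _))))
      (≤-trans (proj₂ guess) (*-monoˡ (0≤^ T (<⇒≤ 0<2)) (≤-trans (≤-reflexive (∑-cells (proj₁ guess)))
        (≤-trans (∏-mono (fins n) (λ i → 0≤constant-score (lookup (proj₁ guess) i)) (λ i → h (lookup (proj₁ guess) i)))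
          (≤-reflexive (∏-const n)))))))
      where
      ∏-const : ∀ n → ∏ (fins n) (λ _ → q) ≡ q ^ n
      ∏-const zero    = refl
      ∏-const (suc n) = cong (q *_) (trans (∏-map suc (fins n) (λ _ → q)) (∏-const n))
    q : ℚ
    q = + 11 / 20
    contra : (∀ z → constant-score z ≤ q) → ⊥
    contra h = <-irrefl refl (<-≤-trans (^-mono-< {2ℚ * (q * q)} {θ * θ} m (≤-dec {0ℚ} {2ℚ * (q * q)}) (does-true (ℚ._<?_ (2ℚ * (q * q)) (θ * θ)) refl)) (begin
      (θ * θ) ^ n                                ≡⟨ ^-*-distrib θ θ n ⟩
      θ ^ n * θ ^ n                              ≤⟨ *-mono (0≤^ n (≤-dec {0ℚ} {θ})) (0≤* (0≤^ T (<⇒≤ 0<2)) (0≤^ n (≤-dec {0ℚ} {q}))) (bound q (≤-dec {0ℚ} {q}) h) (bound q (≤-dec {0ℚ} {q}) h) ⟩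
      2ℚ ^ T * q ^ n * (2ℚ ^ T * q ^ n)          ≡⟨ solve 2 (λ a b → a :* b :* (a :* b) := a :* a :* (b :* b)) refl (2ℚ ^ T) (q ^ n) ⟩
      2ℚ ^ T * 2ℚ ^ T * (q ^ n * q ^ n)          ≡⟨ cong₂ _*_ (sym (^-+ 2ℚ T T)) (sym (^-*-distrib q q n)) ⟩
      2ℚ ^ (T ℕ.+ T) * (q * q) ^ n               ≤⟨ *-monoʳ (0≤^ n (≤-dec {0ℚ} {q * q})) (^-monoʳ 1≤2 2T≤n) ⟩
      2ℚ ^ n * (q * q) ^ n                       ≡⟨ sym (^-*-distrib 2ℚ (q * q) n) ⟩
      (2ℚ * (q * q)) ^ n                         ∎))
      where open ≤-Reasoning
    decide : Dec (q ≤ constant-score true) → Dec (q ≤ constant-score false) → ∃ λ z → q ≤ constant-score z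
    decide (yes h) _       = true , h
    decide (no _)  (yes h) = false , h
    decide (no h)  (no h′) = ⊥-elim (contra λ { true → <⇒≤ (≰⇒> h) ; false → <⇒≤ (≰⇒> h′) })

-- The minimax theorem

-- Approachability: always answer the distribution of the inputs on which
-- the strategies so far do too badly. Then the sum of the squared
-- deficits grows at most linearly.
module Minimax {A P : Set} (eP : Enumerated P) (c : A → P → Bool) (a₀ : A)
  (answer : ∀ (μ : P → ℚ) → (∀ p → 0ℚ ≤ μ p) → ∑ (list eP) μ ≡ 1ℚ → ∃ λ a → + 11 / 20 ≤ ∑ (list eP) λ p → μ p * ⟦ c a p ⟧)
  where

  private
    ps = list eP

  loss : A → P → ℚ
  loss a p = + 11 / 20 - ⟦ c a p ⟧

  deficit : List A → P → ℚ
  deficit as p = ∑ as λ a → loss a p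

  pos : ℚ → ℚ
  pos d = 0ℚ ℚ.⊔ d

  0≤pos : ∀ d → 0ℚ ≤ pos d
  0≤pos d = p≤p⊔q 0ℚ d

  potential : List A → ℚ
  potential as = ∑ ps λ p → pos (deficit as p) * pos (deficit as p)

  respond : ∀ (ν : P → ℚ) → (∀ p → 0ℚ ≤ ν p) → ∃ λ a → ∑ ps (λ p → ν p * loss a p) ≤ 0ℚ
  respond ν 0≤ν = by-cases (ℚ._≟_ (∑ ps ν) 0ℚ)
    where
    S = ∑ ps ν
    0≤S = 0≤∑ ps 0≤ν
    by-cases : Dec (S ≡ 0ℚ) → ∃ λ a → ∑ ps (λ p → ν p * loss a p) ≤ 0ℚ
    by-cases (yes S≡0) = a₀ , ≤-reflexive (trans (∑-cong ps λ p → trans (cong (_* loss a₀ p) (zero-ν p)) (*-zeroˡ (loss a₀ p))) (∑-zero ps))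
      where
      zero-ν : ∀ p → ν p ≡ 0ℚ
      zero-ν p = ≤-antisym (≤-trans (term≤∑ 0≤ν (all eP p)) (≤-reflexive S≡0)) (0≤ν p)
    by-cases (no S≢0) = a , (begin
      ∑ ps (λ p → ν p * loss a p)
        ≡⟨ ∑-cong ps (λ p → solve 2 (λ n b → n :* (con (+ 11 / 20) :- b) := con (+ 11 / 20) :* n :- n :* b) refl (ν p) ⟦ c a p ⟧) ⟩
      ∑ ps (λ p → (+ 11 / 20) * ν p - ν p * ⟦ c a p ⟧)
        ≡⟨ trans (∑-- ps (λ p → (+ 11 / 20) * ν p) (λ p → ν p * ⟦ c a p ⟧)) (cong (_- ∑ ps (λ p → ν p * ⟦ c a p ⟧)) (∑-*ˡ ps (+ 11 / 20) ν)) ⟩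
      (+ 11 / 20) * S - ∑ ps (λ p → ν p * ⟦ c a p ⟧)
        ≤⟨ +-monoʳ-≤ ((+ 11 / 20) * S) (neg-antimono-≤ enough) ⟩
      (+ 11 / 20) * S - (+ 11 / 20) * S
        ≡⟨ +-inverseʳ ((+ 11 / 20) * S) ⟩
      0ℚ ∎)
      where
      open ≤-Reasoning
      0<S = 0≤∧≢0⇒0< 0≤S S≢0
      found = answer (λ p → ν p * inv S) (λ p → 0≤* (0≤ν p) (0≤inv 0≤S)) (trans (∑-*ʳ ps (inv S) ν) (*-inv 0<S))
      a = proj₁ found
      enough : (+ 11 / 20) * S ≤ ∑ ps (λ p → ν p * ⟦ c a p ⟧)
      enough = ≤-trans (*-monoʳ 0≤S (proj₂ found)) (≤-reflexive (trans (cong (_* S) (trans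
          (∑-cong ps λ p → solve 3 (λ n i b → n :* i :* b := n :* b :* i) refl (ν p) (inv S) ⟦ c a p ⟧)
          (∑-*ʳ ps (inv S) (λ p → ν p * ⟦ c a p ⟧))))
        (trans (*-assoc (∑ ps (λ p → ν p * ⟦ c a p ⟧)) (inv S) S)
          (trans (cong (∑ ps (λ p → ν p * ⟦ c a p ⟧) *_) (trans (*-comm (inv S) S) (*-inv 0<S))) (*-identityʳ _)))))

  loss²≤1 : ∀ a p → loss a p * loss a p ≤ 1ℚ
  loss²≤1 a p = by-cases (c a p)
    where
    by-cases : ∀ b → (+ 11 / 20 - ⟦ b ⟧) * (+ 11 / 20 - ⟦ b ⟧) ≤ 1ℚ
    by-cases true  = ≤-dec
    by-cases false = ≤-dec

  pos-step : ∀ d l → pos (l + d) * pos (l + d) ≤ (pos d + l) * (pos d + l)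
  pos-step d l with ≤-total 0ℚ (l + d)
  ... | inj₁ h rewrite p≤q⇒p⊔q≡q h = *-mono h (≤-trans h le) le le
    where
    le : l + d ≤ pos d + l
    le = ≤-trans (≤-reflexive (+-comm l d)) (+-monoˡ-≤ l (p≤q⊔p 0ℚ d))
  ... | inj₂ h rewrite p≥q⇒p⊔q≡p h = eq-≤ (*-zeroˡ 0ℚ) (0≤sq (pos d + l))

  play : ∀ N → ∃ λ as → List.length as ≡ N × potential as ≤ natℚ N * natℚ (List.length ps)
  play zero = [] , refl , ≤-reflexive (trans (∑-zero ps) (sym (*-zeroˡ (natℚ (List.length ps)))))
  play (suc N) = (a ∷ as) , cong suc len , (begin
    potential (a ∷ as)
      ≤⟨ ∑-mono ps (λ p → ≤-trans (pos-step (deficit as p) (loss a p)) (≤-trans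
           (≤-reflexive (solve 2 (λ d l → (d :+ l) :* (d :+ l) := d :* d :+ con 2ℚ :* (d :* l) :+ l :* l) refl (pos (deficit as p)) (loss a p)))
           (+-monoʳ-≤ (pos (deficit as p) * pos (deficit as p) + 2ℚ * (pos (deficit as p) * loss a p)) (loss²≤1 a p)))) ⟩
    ∑ ps (λ p → pos (deficit as p) * pos (deficit as p) + 2ℚ * (pos (deficit as p) * loss a p) + 1ℚ)
      ≡⟨ trans (∑-+ ps (λ p → pos (deficit as p) * pos (deficit as p) + 2ℚ * (pos (deficit as p) * loss a p)) (λ _ → 1ℚ))
           (cong₂ _+_ (trans (∑-+ ps (λ p → pos (deficit as p) * pos (deficit as p)) (λ p → 2ℚ * (pos (deficit as p) * loss a p)))
             (cong (λ z → potential as + z) (∑-*ˡ ps 2ℚ (λ p → pos (deficit as p) * loss a p)))) (∑-const ps 1ℚ)) ⟩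
    potential as + 2ℚ * ∑ ps (λ p → pos (deficit as p) * loss a p) + n * 1ℚ
      ≤⟨ +-monoˡ-≤ (n * 1ℚ) (+-mono-≤ bound (*-monoˡ (<⇒≤ 0<2) (proj₂ reply))) ⟩
    natℚ N * n + 2ℚ * 0ℚ + n * 1ℚ
      ≡⟨ trans (solve 2 (λ N n → N :* n :+ con 2ℚ :* con 0ℚ :+ n :* con 1ℚ := (con 1ℚ :+ N) :* n) refl (natℚ N) n) (cong (_* n) (sym (natℚ-suc N))) ⟩
    natℚ (suc N) * n ∎)
    where
    open ≤-Reasoning
    n = natℚ (List.length ps)
    as = proj₁ (play N)
    len = proj₁ (proj₂ (play N))
    bound = proj₂ (proj₂ (play N))
    reply = respond (λ p → pos (deficit as p)) (λ p → 0≤pos (deficit as p))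
    a = proj₁ reply

  mixture : ∃ λ m → ∃ λ as → List.length as ≡ suc m × (∀ p → (+ 21 / 40) * natℚ (suc m) ≤ ∑ as λ a → ⟦ c a p ⟧)
  mixture = m , as , len , λ p → ≤-by ((+ 1 / 40) * N - deficit as p) (p≤q⇒0≤q-p (≤-trans (p≤q⊔p 0ℚ (deficit as p)) (small p)))
    (trans (solve 2 (λ N s → s := con (+ 21 / 40) :* N :+ (con (+ 1 / 40) :* N :- (N :* con (+ 11 / 20) :- s))) refl N (∑ as λ a → ⟦ c a p ⟧))
      (cong (λ z → (+ 21 / 40) * N + ((+ 1 / 40) * N - z)) (sym (deficit≡ p))))
    where
    -- After N ≥ 1600 |ps| moves every deficit is at most √(N |ps|) ≤ N / 40, and 11/20 - 1/40 =
    -- 21/40.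
    m = 1600 ℕ.* List.length ps
    N = natℚ (suc m)
    as = proj₁ (play (suc m))
    len = proj₁ (proj₂ (play (suc m)))
    deficit≡ : ∀ p → deficit as p ≡ N * (+ 11 / 20) - ∑ as (λ a → ⟦ c a p ⟧)
    deficit≡ p = trans (∑-- as (λ _ → + 11 / 20) (λ a → ⟦ c a p ⟧)) (cong (_- ∑ as (λ a → ⟦ c a p ⟧))
      (trans (∑-const as (+ 11 / 20)) (cong (λ n → natℚ n * (+ 11 / 20)) len)))
    small : ∀ p → pos (deficit as p) ≤ (+ 1 / 40) * N
    small p = sqrt-≤ (0≤* (0≤frac 1 39) (0≤natℚ (suc m))) (begin
      pos (deficit as p) * pos (deficit as p)
        ≤⟨ term≤∑ {f = λ p → pos (deficit as p) * pos (deficit as p)} (λ p → 0≤sq (pos (deficit as p))) (all eP p) ⟩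
      potential as
        ≤⟨ proj₂ (proj₂ (play (suc m))) ⟩
      N * natℚ (List.length ps)
        ≡⟨ solve 2 (λ N n → N :* n := con (+ 1 / 1600) :* (N :* (con (natℚ 1600) :* n))) refl N (natℚ (List.length ps)) ⟩
      (+ 1 / 1600) * (N * (natℚ 1600 * natℚ (List.length ps)))
        ≤⟨ *-monoˡ (0≤frac 1 1599) (*-monoˡ (0≤natℚ (suc m)) (≤-trans (≤-reflexive (sym (natℚ-* 1600 (List.length ps)))) (natℚ-mono {m} {suc m} (ℕ.n≤1+n m)))) ⟩
      (+ 1 / 1600) * (N * N)
        ≡⟨ solve 1 (λ N → con (+ 1 / 1600) :* (N :* N) := con (+ 1 / 40) :* N :* (con (+ 1 / 40) :* N)) refl N ⟩
      (+ 1 / 40) * N * ((+ 1 / 40) * N) ∎)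
      where open ≤-Reasoning

-- Comparing sequences in the limit

infix 4 _≲_

-- For real numbers equivalent to `_≤ℝ_`, which is a negation; in this positive form inequalities
-- can be added and scaled.
_≲_ : (x y : ℕ → ℚ) → Set
x ≲ y = ∀ ε → 0ℚ < ε → ∃ λ N → ∀ n → N ℕ.≤ n → x n ≤ y n + ε

half : ℚ → ℚ
half ε = (+ 1 / 2) * ε

0<half : ∀ {ε} → 0ℚ < ε → 0ℚ < half ε
0<half = 0<* {+ 1 / 2} (ℚ.*<* (ℤ.+<+ (s≤s z≤n)))

half+half : ∀ ε → half ε + half ε ≡ ε
half+half = solve 1 (λ ε → con (+ 1 / 2) :* ε :+ con (+ 1 / 2) :* ε := ε) refl

≲-everywhere : ∀ {x y} → (∀ n → x n ≤ y n) → x ≲ y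
≲-everywhere {x} {y} h ε 0<ε = 0 , λ n _ → ≤-trans (h n) (p≤p+q (y n) (<⇒≤ 0<ε))

≲-trans : ∀ {x y z} → x ≲ y → y ≲ z → x ≲ z
≲-trans {x} {y} {z} p q ε 0<ε =
  let M , hp = p (half ε) (0<half 0<ε) ; N , hq = q (half ε) (0<half 0<ε)
  in M ℕ.⊔ N , λ n h → ≤-trans (hp n (ℕ.m⊔n≤o⇒m≤o M N h)) (≤-eq (+-monoˡ-≤ (half ε) (hq n (ℕ.m⊔n≤o⇒n≤o M N h)))
    (trans (+-assoc (z n) (half ε) (half ε)) (cong (λ e → z n + e) (half+half ε))))

≲-+ : ∀ {x y u v} → x ≲ y → u ≲ v → (λ n → x n + u n) ≲ (λ n → y n + v n)
≲-+ {x} {y} {u} {v} p q ε 0<ε =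
  let M , hp = p (half ε) (0<half 0<ε) ; N , hq = q (half ε) (0<half 0<ε)
  in M ℕ.⊔ N , λ n h → ≤-trans (+-mono-≤ (hp n (ℕ.m⊔n≤o⇒m≤o M N h)) (hq n (ℕ.m⊔n≤o⇒n≤o M N h)))
    (≤-reflexive (trans (solve 3 (λ a b e → (a :+ e) :+ (b :+ e) := (a :+ b) :+ (e :+ e)) refl (y n) (v n) (half ε)) (cong (λ e → y n + v n + e) (half+half ε))))

≲-*ˡ : ∀ {x y} c → 0ℚ < c → x ≲ y → (λ n → c * x n) ≲ (λ n → c * y n)
≲-*ˡ {x} {y} c 0<c p ε 0<ε =
  let N , h = p (ε * inv c) (0<* 0<ε (0<inv 0<c))
  in N , λ n N≤n → ≤-trans (*-monoˡ (<⇒≤ 0<c) (h n N≤n)) (≤-reflexive (trans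
    (solve 4 (λ c y e i → c :* (y :+ e :* i) := c :* y :+ e :* (c :* i)) refl c (y n) ε (inv c))
    (trans (cong (λ z → c * y n + ε * z) (*-inv 0<c)) (cong (λ z → c * y n + z) (*-identityʳ ε)))))

-- Eventually w and x are at least -δ and at most A and B. Only mixed signs make the product
-- negative, and then it is at least -A δ or -B δ.
≲-* : ∀ {w x} → Cauchy w → Cauchy x → (λ _ → 0ℚ) ≲ w → (λ _ → 0ℚ) ≲ x → (λ _ → 0ℚ) ≲ (λ n → w n * x n)
≲-* {w} {x} cw cx 0≲w 0≲x ε 0<ε =
  let A , N₁ , hA = bounded w cw ; B , N₂ , hB = bounded x cx
      D = natℚ A + natℚ B + 1ℚ
      0<D : 0ℚ < D
      0<D = <-≤-trans 0<1 (p≤q+p 1ℚ (0≤+ (0≤natℚ A) (0≤natℚ B)))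
      δ = ε * inv D
      0<δ = 0<* 0<ε (0<inv 0<D)
      N₃ , hw = 0≲w δ 0<δ ; N₄ , hx = 0≲x δ 0<δ
  in (N₁ ℕ.⊔ N₂) ℕ.⊔ (N₃ ℕ.⊔ N₄) , λ n h →
    let h₁₂ = ℕ.m⊔n≤o⇒m≤o (N₁ ℕ.⊔ N₂) (N₃ ℕ.⊔ N₄) h ; h₃₄ = ℕ.m⊔n≤o⇒n≤o (N₁ ℕ.⊔ N₂) (N₃ ℕ.⊔ N₄) h
    in core (w n) (x n) (natℚ A) (natℚ B) D δ refl (trans (*-assoc ε (inv D) D) (trans (cong (ε *_) (trans (*-comm (inv D) D) (*-inv 0<D))) (*-identityʳ ε)))
      (<⇒≤ 0<δ) (≤-trans (p≤∣p∣ (w n)) (hA n (ℕ.m⊔n≤o⇒m≤o N₁ N₂ h₁₂))) (≤-trans (p≤∣p∣ (x n)) (hB n (ℕ.m⊔n≤o⇒n≤o N₁ N₂ h₁₂)))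
      (0≤natℚ A) (0≤natℚ B) (hw n (ℕ.m⊔n≤o⇒m≤o N₃ N₄ h₃₄)) (hx n (ℕ.m⊔n≤o⇒n≤o N₃ N₄ h₃₄))
  where
  neg-case : ∀ w x A δ → w ≤ A → 0ℚ ≤ A → 0ℚ ≤ δ → 0ℚ ≤ w → x ≤ 0ℚ → 0ℚ ≤ x + δ → 0ℚ ≤ w * x + A * δ
  neg-case w x A δ w≤A 0≤A 0≤δ 0≤w x≤0 0≤x+δ = ≤-trans (0≤+ (0≤* 0≤w 0≤x+δ) (0≤* (p≤q⇒0≤q-p w≤A) 0≤δ))
    (≤-reflexive (solve 4 (λ w x a d → w :* (x :+ d) :+ (a :- w) :* d := w :* x :+ a :* d) refl w x A δ))
  core : ∀ w x A B D δ → D ≡ A + B + 1ℚ → δ * D ≡ ε → 0ℚ ≤ δ → w ≤ A → x ≤ B → 0ℚ ≤ A → 0ℚ ≤ B → 0ℚ ≤ w + δ → 0ℚ ≤ x + δ → 0ℚ ≤ w * x + ε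
  core w x A B D δ D≡ δD≡ 0≤δ w≤A x≤B 0≤A 0≤B hw hx = ≤-trans (main (≤-total 0ℚ w) (≤-total 0ℚ x)) (≤-reflexive (cong (λ z → w * x + z) (trans
      (solve 3 (λ a b d → a :* d :+ b :* d :+ d := d :* (a :+ b :+ con 1ℚ)) refl A B δ) (trans (cong (δ *_) (sym D≡)) δD≡))))
    where
    grow : ∀ {p q} → 0ℚ ≤ w * x + p → p + q ≡ A * δ + B * δ + δ → 0ℚ ≤ q → 0ℚ ≤ w * x + (A * δ + B * δ + δ)
    grow {p} {q} h e 0≤q = ≤-trans (0≤+ h 0≤q) (≤-reflexive (trans (+-assoc (w * x) p q) (cong (λ z → w * x + z) e)))
    main : 0ℚ ≤ w ⊎ w ≤ 0ℚ → 0ℚ ≤ x ⊎ x ≤ 0ℚ → 0ℚ ≤ w * x + (A * δ + B * δ + δ)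
    main (inj₁ 0≤w) (inj₁ 0≤x) = 0≤+ (0≤* 0≤w 0≤x) (0≤+ (0≤+ (0≤* 0≤A 0≤δ) (0≤* 0≤B 0≤δ)) 0≤δ)
    main (inj₁ 0≤w) (inj₂ x≤0) = grow {A * δ} {B * δ + δ} (neg-case w x A δ w≤A 0≤A 0≤δ 0≤w x≤0 hx)
      (sym (+-assoc (A * δ) (B * δ) δ)) (0≤+ (0≤* 0≤B 0≤δ) 0≤δ)
    main (inj₂ w≤0) (inj₁ 0≤x) = grow {B * δ} {A * δ + δ} (≤-trans (neg-case x w B δ x≤B 0≤B 0≤δ 0≤x w≤0 hw) (≤-reflexive (cong (_+ B * δ) (*-comm x w))))
      (solve 3 (λ a b d → b :+ (a :+ d) := a :+ b :+ d) refl (A * δ) (B * δ) δ) (0≤+ (0≤* 0≤A 0≤δ) 0≤δ)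
    main (inj₂ w≤0) (inj₂ x≤0) = 0≤+ (≤-eq (0≤* (neg-antimono-≤ w≤0) (neg-antimono-≤ x≤0)) (solve 2 (λ w x → (:- w) :* (:- x) := w :* x) refl w x))
      (0≤+ (0≤+ (0≤* 0≤A 0≤δ) (0≤* 0≤B 0≤δ)) 0≤δ)

-- Once both sequences have settled to within ε / 8, comparing two rationals at the one index L
-- decides: either the bound holds from L on, or x exceeds y by ε / 4 from L on, which x ≤ y
-- forbids.
≤ℝ⇒≲ : ∀ {x y} → x ≤ℝ y → seq x ≲ seq y
≤ℝ⇒≲ {x} {y} x≤y ε 0<ε =
  let δ = (+ 1 / 8) * ε
      0<δ : 0ℚ < δ
      0<δ = 0<* {+ 1 / 8} (ℚ.*<* (ℤ.+<+ (s≤s z≤n))) 0<ε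
      M , hx = cauchy x δ 0<δ ; N , hy = cauchy y δ 0<δ
      L = M ℕ.⊔ N
      near-x : ∀ m n → L ℕ.≤ m → L ℕ.≤ n → seq x m ≤ seq x n + δ
      near-x m n p q = close (seq x m) (seq x n) δ (hx m n (ℕ.m⊔n≤o⇒m≤o M N p) (ℕ.m⊔n≤o⇒m≤o M N q))
      near-y : ∀ m n → L ℕ.≤ m → L ℕ.≤ n → seq y m ≤ seq y n + δ
      near-y m n p q = close (seq y m) (seq y n) δ (hy m n (ℕ.m⊔n≤o⇒n≤o M N p) (ℕ.m⊔n≤o⇒n≤o M N q))
  in decide (ℚ._≤?_ (seq x L) (seq y L + (+ 1 / 2) * ε)) L δ refl 0<δ near-x near-y
  where
  close : ∀ p q δ → ∣ p - q ∣ ≤ δ → p ≤ q + δ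
  close p q δ h = ≤-trans (≤-reflexive (solve 2 (λ p q → p := q :+ (p :- q)) refl p q)) (+-monoʳ-≤ q (≤-trans (p≤∣p∣ (p - q)) h))
  decide : ∀ {L} → Dec (seq x L ≤ seq y L + (+ 1 / 2) * ε) → ∀ L′ δ → δ ≡ (+ 1 / 8) * ε → 0ℚ < δ →
    (∀ m n → L ℕ.≤ m → L ℕ.≤ n → seq x m ≤ seq x n + δ) → (∀ m n → L ℕ.≤ m → L ℕ.≤ n → seq y m ≤ seq y n + δ) →
    ∃ λ N → ∀ n → N ℕ.≤ n → seq x n ≤ seq y n + ε
  decide {L} (yes le) _ .((+ 1 / 8) * ε) refl 0<δ hx hy = L , λ n h → ≤-trans (hx n L h ℕ.≤-refl)
    (≤-trans (+-monoˡ-≤ ((+ 1 / 8) * ε) (≤-trans le (+-monoˡ-≤ ((+ 1 / 2) * ε) (hy L n ℕ.≤-refl h))))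
      (≤-by ((+ 1 / 4) * ε) (0≤* (0≤frac 1 3) (<⇒≤ 0<ε)) (solve 2 (λ y e → y :+ e :=
        ((y :+ con (+ 1 / 8) :* e) :+ con (+ 1 / 2) :* e) :+ con (+ 1 / 8) :* e :+ con (+ 1 / 4) :* e) refl (seq y n) ε)))
  decide {L} (no gt) _ .((+ 1 / 8) * ε) refl 0<δ hx hy = ⊥-elim (x≤y ((+ 1 / 4) * ε , 0<* {+ 1 / 4} (ℚ.*<* (ℤ.+<+ (s≤s z≤n))) 0<ε , L , λ n h →
    +-cancel ((+ 1 / 8) * ε) (≤-trans (≤-reflexive (solve 2 (λ y e → y :+ con (+ 1 / 4) :* e :+ con (+ 1 / 8) :* e := y :+ con (+ 3 / 8) :* e) refl (seq y n) ε))
      (≤-trans (+-monoˡ-≤ ((+ 3 / 8) * ε) (hy n L h ℕ.≤-refl)) (≤-trans (≤-reflexive (solve 2 (λ y e → y :+ con (+ 1 / 8) :* e :+ con (+ 3 / 8) :* e := y :+ con (+ 1 / 2) :* e) refl (seq y L) ε))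
        (≤-trans (<⇒≤ (≰⇒> gt)) (hx L n ℕ.≤-refl h)))))))
    where
    +-cancel : ∀ {p q} r → p + r ≤ q + r → p ≤ q
    +-cancel {p} {q} r h = 0≤q-p⇒p≤q (≤-trans (p≤q⇒0≤q-p h) (≤-reflexive (solve 3 (λ p q r → q :+ r :- (p :+ r) := q :- p) refl p q r)))

≲⇒≤ℝ : ∀ {x y} → seq x ≲ seq y → x ≤ℝ y
≲⇒≤ℝ {x} {y} h (ε , 0<ε , N , gap) =
  let M , le = h (half ε) (0<half 0<ε)
      n = M ℕ.⊔ N
  in <-irrefl refl (<-≤-trans (subst (λ e → seq y n + half ε < seq y n + e) (half+half ε)
       (subst (_< seq y n + (half ε + half ε)) (cong (λ z → seq y n + z) (+-identityʳ (half ε))) (+-monoʳ-< (seq y n) (+-monoʳ-< (half ε) (0<half 0<ε)))))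
     (≤-trans (gap n (ℕ.m≤n⊔m M N)) (le n (ℕ.m≤m⊔n M N))))

<ℝ⇒≲ : ∀ {x y} → x <ℝ y → seq x ≲ seq y
<ℝ⇒≲ {x} {y} (ε , 0<ε , N , gap) δ 0<δ = N , λ n h → ≤-trans (p≤p+q (seq x n) (<⇒≤ 0<ε)) (≤-trans (gap n h) (p≤p+q (seq y n) (<⇒≤ 0<δ)))

-- The exponential function

sumTo : ℕ → (ℕ → ℚ) → ℚ
sumTo zero    f = f 0
sumTo (suc N) f = sumTo N f + f (suc N)

conv : ℕ → (f g : ℕ → ℚ) → ℚ
conv zero    f g = f 0 * g 0
conv (suc k) f g = f 0 * g (suc k) + conv k (f ∘ suc) g

-- The Cauchy product summed over the triangle i + j ≤ N, to be compared with the square i, j ≤ N.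
tri : ℕ → (f g : ℕ → ℚ) → ℚ
tri N f g = sumTo N λ k → conv k f g

tri-suc : ∀ N f g → tri (suc N) f g ≡ f 0 * sumTo (suc N) g + tri N (f ∘ suc) g
tri-suc zero    f g = solve 4 (λ a b c d → a :* b :+ (a :* c :+ d) := a :* (b :+ c) :+ d) refl (f 0) (g 0) (g 1) (f 1 * g 0)
tri-suc (suc N) f g = trans (cong (_+ conv (suc (suc N)) f g) (tri-suc N f g))
  (solve 5 (λ a s t c d → (a :* s :+ t) :+ (a :* c :+ d) := a :* (s :+ c) :+ (t :+ d)) refl
    (f 0) (sumTo (suc N) g) (tri N (f ∘ suc) g) (g (suc (suc N))) (conv (suc N) (f ∘ suc) g))

sumTo-suc : ∀ N f → sumTo (suc N) f ≡ f 0 + sumTo N (f ∘ suc)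
sumTo-suc zero    f = refl
sumTo-suc (suc N) f = trans (cong (_+ f (suc (suc N))) (sumTo-suc N f)) (+-assoc (f 0) (sumTo N (f ∘ suc)) (f (suc (suc N))))

0≤sumTo : ∀ N {f} → (∀ i → 0ℚ ≤ f i) → 0ℚ ≤ sumTo N f
0≤sumTo zero    0≤f = 0≤f 0
0≤sumTo (suc N) 0≤f = 0≤+ (0≤sumTo N 0≤f) (0≤f (suc N))

0≤conv : ∀ k {f g} → (∀ i → 0ℚ ≤ f i) → (∀ i → 0ℚ ≤ g i) → 0ℚ ≤ conv k f g
0≤conv zero    0≤f 0≤g = 0≤* (0≤f 0) (0≤g 0)
0≤conv (suc k) 0≤f 0≤g = 0≤+ (0≤* (0≤f 0) (0≤g (suc k))) (0≤conv k (0≤f ∘ suc) 0≤g)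

sumTo-mono : ∀ {M N f} → (∀ i → 0ℚ ≤ f i) → M ℕ.≤ N → sumTo M f ≤ sumTo N f
sumTo-mono {M} {N} {f} 0≤f M≤N = subst (λ N → sumTo M f ≤ sumTo N f) (ℕ.m∸n+n≡m M≤N) (grow (N ℕ.∸ M))
  where
  grow : ∀ d → sumTo M f ≤ sumTo (d ℕ.+ M) f
  grow zero    = ≤-refl
  grow (suc d) = ≤-trans (grow d) (p≤p+q (sumTo (d ℕ.+ M) f) (0≤f (suc d ℕ.+ M)))

tri≤product : ∀ N {f g} → (∀ i → 0ℚ ≤ f i) → (∀ i → 0ℚ ≤ g i) → tri N f g ≤ sumTo N f * sumTo N g
tri≤product zero    0≤f 0≤g = ≤-refl
tri≤product (suc N) {f} {g} 0≤f 0≤g = begin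
  tri (suc N) f g
    ≡⟨ tri-suc N f g ⟩
  f 0 * sumTo (suc N) g + tri N (f ∘ suc) g
    ≤⟨ +-monoʳ-≤ (f 0 * sumTo (suc N) g) (≤-trans (tri≤product N (0≤f ∘ suc) 0≤g)
         (*-monoˡ (0≤sumTo N (0≤f ∘ suc)) (sumTo-mono 0≤g (ℕ.n≤1+n N)))) ⟩
  f 0 * sumTo (suc N) g + sumTo N (f ∘ suc) * sumTo (suc N) g
    ≡⟨ trans (sym (*-distribʳ-+ (sumTo (suc N) g) (f 0) (sumTo N (f ∘ suc)))) (cong (_* sumTo (suc N) g) (sym (sumTo-suc N f))) ⟩
  sumTo (suc N) f * sumTo (suc N) g ∎
  where open ≤-Reasoning

product≤tri : ∀ M N {f g} → (∀ i → 0ℚ ≤ f i) → (∀ i → 0ℚ ≤ g i) → sumTo M f * sumTo N g ≤ tri (M ℕ.+ N) f g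
product≤tri zero zero    0≤f 0≤g = ≤-refl
product≤tri zero (suc N) {f} {g} 0≤f 0≤g = ≤-trans (p≤p+q (f 0 * sumTo (suc N) g) (0≤sumTo N λ k → 0≤conv k (0≤f ∘ suc) 0≤g))
  (≤-reflexive (sym (tri-suc N f g)))
product≤tri (suc M) N {f} {g} 0≤f 0≤g = begin
  sumTo (suc M) f * sumTo N g
    ≡⟨ trans (cong (_* sumTo N g) (sumTo-suc M f)) (*-distribʳ-+ (sumTo N g) (f 0) (sumTo M (f ∘ suc))) ⟩
  f 0 * sumTo N g + sumTo M (f ∘ suc) * sumTo N g
    ≤⟨ +-mono-≤ (*-monoˡ (0≤f 0) (sumTo-mono 0≤g (ℕ.m≤n+m N (suc M)))) (product≤tri M N (0≤f ∘ suc) 0≤g) ⟩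
  f 0 * sumTo (suc (M ℕ.+ N)) g + tri (M ℕ.+ N) (f ∘ suc) g
    ≡⟨ sym (tri-suc (M ℕ.+ N) f g) ⟩
  tri (suc M ℕ.+ N) f g ∎
  where open ≤-Reasoning

-- The difference consists of the products in the square but outside the triangle, and these are
-- dominated term by term.
product-tri : ∀ N {f g F G} → (∀ i → ∣ f i ∣ ≤ F i) → (∀ i → ∣ g i ∣ ≤ G i) →
  ∣ sumTo N f * sumTo N g - tri N f g ∣ ≤ sumTo N F * sumTo N G - tri N F G
product-tri zero {f} {g} {F} {G} _ _ = ≤-reflexive (trans (cong ∣_∣ (+-inverseʳ (f 0 * g 0))) (sym (+-inverseʳ (F 0 * G 0))))
product-tri (suc N) {f} {g} {F} {G} hf hg = begin
  ∣ sumTo (suc N) f * sumTo (suc N) g - tri (suc N) f g ∣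
    ≡⟨ cong ∣_∣ (expand f g) ⟩
  ∣ (S * sumTo N g - tri N (f ∘ suc) g) + S * g (suc N) ∣
    ≤⟨ ∣p+q∣≤∣p∣+∣q∣ (S * sumTo N g - tri N (f ∘ suc) g) (S * g (suc N)) ⟩
  ∣ S * sumTo N g - tri N (f ∘ suc) g ∣ + ∣ S * g (suc N) ∣
    ≤⟨ +-mono-≤ (product-tri N (hf ∘ suc) hg) (eq-≤ (∣p*q∣≡∣p∣*∣q∣ S (g (suc N)))
         (*-mono (0≤∣p∣ (g (suc N))) (≤-trans (0≤∣p∣ S) (∣sumTo∣ N (hf ∘ suc))) (∣sumTo∣ N (hf ∘ suc)) (hg (suc N)))) ⟩
  (sumTo N (F ∘ suc) * sumTo N G - tri N (F ∘ suc) G) + sumTo N (F ∘ suc) * G (suc N)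
    ≡⟨ sym (expand F G) ⟩
  sumTo (suc N) F * sumTo (suc N) G - tri (suc N) F G ∎
  where
  open ≤-Reasoning
  S = sumTo N (f ∘ suc)
  ∣sumTo∣ : ∀ N {f F : ℕ → ℚ} → (∀ i → ∣ f i ∣ ≤ F i) → ∣ sumTo N f ∣ ≤ sumTo N F
  ∣sumTo∣ zero    h = h 0
  ∣sumTo∣ (suc N) {f} h = ≤-trans (∣p+q∣≤∣p∣+∣q∣ (sumTo N f) (f (suc N))) (+-mono-≤ (∣sumTo∣ N h) (h (suc N)))
  expand : ∀ f g → sumTo (suc N) f * sumTo (suc N) g - tri (suc N) f g ≡
    (sumTo N (f ∘ suc) * sumTo N g - tri N (f ∘ suc) g) + sumTo N (f ∘ suc) * g (suc N)
  expand f g = trans (cong₂ (λ s t → s * sumTo (suc N) g - t) (sumTo-suc N f) (tri-suc N f g))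
    (solve 5 (λ a s h c t → (a :+ s) :* (h :+ c) :- (a :* (h :+ c) :+ t) := (s :* h :- t) :+ s :* c) refl
      (f 0) (sumTo N (f ∘ suc)) (sumTo N g) (g (suc N)) (tri N (f ∘ suc) g))

conv-cong : ∀ k {f f′ g g′} → (∀ i → f i ≡ f′ i) → (∀ i → g i ≡ g′ i) → conv k f g ≡ conv k f′ g′
conv-cong zero    e e′ = cong₂ _*_ (e 0) (e′ 0)
conv-cong (suc k) e e′ = cong₂ _+_ (cong₂ _*_ (e 0) (e′ (suc k))) (conv-cong k (e ∘ suc) e′)

conv-*ˡ : ∀ k c f g → conv k (λ i → c * f i) g ≡ c * conv k f g
conv-*ˡ zero    c f g = *-assoc c (f 0) (g 0)
conv-*ˡ (suc k) c f g = trans (cong₂ _+_ (*-assoc c (f 0) (g (suc k))) (conv-*ˡ k c (f ∘ suc) g))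
  (sym (*-distribˡ-+ c (f 0 * g (suc k)) (conv k (f ∘ suc) g)))

conv-*ʳ : ∀ k c f g → conv k f (λ i → c * g i) ≡ c * conv k f g
conv-*ʳ zero    c f g = solve 3 (λ c a b → a :* (c :* b) := c :* (a :* b)) refl c (f 0) (g 0)
conv-*ʳ (suc k) c f g = trans (cong₂ _+_ (solve 3 (λ c a b → a :* (c :* b) := c :* (a :* b)) refl c (f 0) (g (suc k))) (conv-*ʳ k c (f ∘ suc) g))
  (sym (*-distribˡ-+ c (f 0 * g (suc k)) (conv k (f ∘ suc) g)))

conv-last : ∀ k f g → conv (suc k) f g ≡ conv k f (g ∘ suc) + f (suc k) * g 0
conv-last zero    f g = refl
conv-last (suc k) f g = trans (cong (λ z → f 0 * g (suc (suc k)) + z) (conv-last k (f ∘ suc) g))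
  (sym (+-assoc (f 0 * g (suc (suc k))) (conv k (f ∘ suc) (g ∘ suc)) (f (suc (suc k)) * g 0)))

-- Multiplying the k-th coefficient by k is differentiation, and this is Leibniz's rule. The shift s
-- is for the induction, which moves on to the tail of f.
conv-weight : ∀ k s f g → natℚ (s ℕ.+ k) * conv k f g ≡ conv k (λ i → natℚ (s ℕ.+ i) * f i) g + conv k f (λ i → natℚ i * g i)
conv-weight zero s f g = solve 3 (λ s a b → s :* (a :* b) := s :* a :* b :+ a :* (con 0ℚ :* b)) refl (natℚ (s ℕ.+ 0)) (f 0) (g 0)
conv-weight (suc k) s f g = trans (*-distribˡ-+ (natℚ (s ℕ.+ suc k)) (f 0 * g (suc k)) (conv k (f ∘ suc) g))
  (trans (cong₂ _+_ (cong (_* (f 0 * g (suc k))) (trans (natℚ-+ s (suc k)) (cong (_+ natℚ (suc k)) (cong natℚ (sym (ℕ.+-identityʳ s))))))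
    (trans (cong (λ m → natℚ m * conv k (f ∘ suc) g) (ℕ.+-suc s k)) (trans (conv-weight k (suc s) (f ∘ suc) g)
      (cong (_+ conv k (f ∘ suc) (λ i → natℚ i * g i)) (conv-cong k {g = g} (λ i → cong (λ m → natℚ m * f (suc i)) (sym (ℕ.+-suc s i))) (λ _ → refl))))))
  (solve 6 (λ s k a b x y → (s :+ k) :* (a :* b) :+ (x :+ y) := (s :* a :* b :+ x) :+ (a :* (k :* b) :+ y)) refl
    (natℚ (s ℕ.+ 0)) (natℚ (suc k)) (f 0) (g (suc k)) (conv k (λ i → natℚ (s ℕ.+ suc i) * f (suc i)) g) (conv k (f ∘ suc) (λ i → natℚ i * g i))))

term : ℚ → ℕ → ℚ
term q k = expTerm k q

term-suc : ∀ q k → natℚ (suc k) * term q (suc k) ≡ q * term q k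
term-suc q k = trans (solve 4 (λ n t q i → n :* (t :* q :* i) := q :* t :* (n :* i)) refl (natℚ (suc k)) (term q k) q (1/suc k))
  (trans (cong (q * term q k *_) (suc*1/suc k)) (*-identityʳ (q * term q k)))

-- The coefficients of exp obey (k + 1) t_(k+1) = q t_k. By Leibniz's rule the Cauchy product obeys
-- the same recursion with p + q, which spares the binomial theorem.
term-+ : ∀ k p q → term (p + q) k ≡ conv k (term p) (term q)
term-+ zero    p q = refl
term-+ (suc k) p q = *-≢0⇒≡ {natℚ (suc k)} (natℚ-mono-< {0} {suc k} (s≤s z≤n)) (begin
  natℚ (suc k) * term (p + q) (suc k)
    ≡⟨ term-suc (p + q) k ⟩
  (p + q) * term (p + q) k
    ≡⟨ cong ((p + q) *_) (term-+ k p q) ⟩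
  (p + q) * conv k (term p) (term q)
    ≡⟨ *-distribʳ-+ (conv k (term p) (term q)) p q ⟩
  p * conv k (term p) (term q) + q * conv k (term p) (term q)
    ≡⟨ sym (cong₂ _+_ (first-part) (second-part)) ⟩
  conv (suc k) (λ i → natℚ (0 ℕ.+ i) * term p i) (term q) + conv (suc k) (term p) (λ i → natℚ i * term q i)
    ≡⟨ sym (conv-weight (suc k) 0 (term p) (term q)) ⟩
  natℚ (suc k) * conv (suc k) (term p) (term q) ∎)
  where
  open ≡-Reasoning
  first-part : conv (suc k) (λ i → natℚ i * term p i) (term q) ≡ p * conv k (term p) (term q)
  first-part = trans (cong₂ _+_ (*-zeroˡ (term q (suc k))) (trans (conv-cong k {g = term q} (term-suc p) (λ _ → refl)) (conv-*ˡ k p (term p) (term q))))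
    (+-identityˡ (p * conv k (term p) (term q)))
  second-part : conv (suc k) (term p) (λ i → natℚ i * term q i) ≡ q * conv k (term p) (term q)
  second-part = trans (conv-last k (term p) (λ i → natℚ i * term q i)) (trans (cong₂ _+_
      (trans (conv-cong k {f = term p} (λ _ → refl) (term-suc q)) (conv-*ʳ k q (term p) (term q))) (*-zeroʳ (term p (suc k))))
    (+-identityʳ (q * conv k (term p) (term q))))

expSum≡sumTo : ∀ N q → expSum N q ≡ sumTo N (term q)
expSum≡sumTo zero    q = refl
expSum≡sumTo (suc N) q = cong (_+ term q (suc N)) (expSum≡sumTo N q)

expSum-+ : ∀ N p q → expSum N (p + q) ≡ tri N (term p) (term q)
expSum-+ N p q = trans (expSum≡sumTo N (p + q)) (go N)
  where
  go : ∀ N → sumTo N (term (p + q)) ≡ tri N (term p) (term q)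
  go zero    = refl
  go (suc N) = cong₂ _+_ (go N) (term-+ (suc N) p q)

expSum-+-≤ : ∀ N {p q} → 0ℚ ≤ p → 0ℚ ≤ q → expSum N (p + q) ≤ expSum N p * expSum N q
expSum-+-≤ N {p} {q} 0≤p 0≤q = eq-≤ (expSum-+ N p q) (≤-eq (tri≤product N (λ i → 0≤expTerm i 0≤p) (λ i → 0≤expTerm i 0≤q))
  (sym (cong₂ _*_ (expSum≡sumTo N p) (expSum≡sumTo N q))))

expSum-0 : ∀ N → expSum N 0ℚ ≡ 1ℚ
expSum-0 zero    = refl
expSum-0 (suc N) = trans (cong₂ _+_ (expSum-0 N) (trans (cong (_* 1/suc N) (*-zeroʳ (expTerm N 0ℚ))) (*-zeroˡ (1/suc N)))) (+-identityʳ 1ℚ)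

-- Comparison with the geometric series, the k-th term being at most h^k.
expSum-geometric : ∀ N {h} → 0ℚ ≤ h → h ≤ 1ℚ → expSum N h * (1ℚ - h) ≤ 1ℚ
expSum-geometric N {h} 0≤h h≤1 = ≤-trans (sharp N) (≤-by (h ^ suc N) (0≤^ (suc N) 0≤h) (solve 1 (λ x → con 1ℚ := (con 1ℚ :- x) :+ x) refl (h ^ suc N)))
  where
  1/suc≤1 : ∀ k → 1/suc k ≤ 1ℚ
  1/suc≤1 k = 1/suc-mono {0} {k} z≤n
  term≤^ : ∀ k → expTerm k h ≤ h ^ k
  term≤^ zero    = ≤-refl
  term≤^ (suc k) = ≤-trans (*-monoˡ (0≤* (0≤expTerm k 0≤h) 0≤h) (1/suc≤1 k))
    (≤-trans (≤-reflexive (*-identityʳ (expTerm k h * h))) (≤-eq (*-monoʳ 0≤h (term≤^ k)) (*-comm (h ^ k) h)))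
  sharp : ∀ N → expSum N h * (1ℚ - h) ≤ 1ℚ - h ^ suc N
  sharp zero    = ≤-reflexive (solve 1 (λ h → con 1ℚ :* (con 1ℚ :- h) := con 1ℚ :- h :* con 1ℚ) refl h)
  sharp (suc N) = ≤-trans (≤-reflexive (*-distribʳ-+ (1ℚ - h) (expSum N h) (expTerm (suc N) h)))
    (≤-trans (+-mono-≤ (sharp N) (*-monoʳ (p≤q⇒0≤q-p h≤1) (term≤^ (suc N))))
      (≤-reflexive (solve 2 (λ x h → (con 1ℚ :- x) :+ x :* (con 1ℚ :- h) := con 1ℚ :- h :* x) refl (h ^ suc N) h)))

expSum-multiple : ∀ N {h} → 0ℚ ≤ h → h ≤ 1ℚ → ∀ n → expSum N (natℚ n * h) * (1ℚ - h) ^ n ≤ 1ℚ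
expSum-multiple N {h} 0≤h h≤1 zero = ≤-reflexive (trans (*-identityʳ _) (trans (cong (expSum N) (*-zeroˡ h)) (expSum-0 N)))
expSum-multiple N {h} 0≤h h≤1 (suc n) = begin
  expSum N (natℚ (suc n) * h) * (1ℚ - h) ^ suc n
    ≡⟨ cong (λ z → expSum N z * (1ℚ - h) ^ suc n) (trans (cong (_* h) (natℚ-suc n)) (solve 2 (λ n h → (con 1ℚ :+ n) :* h := h :+ n :* h) refl (natℚ n) h)) ⟩
  expSum N (h + natℚ n * h) * (1ℚ - h) ^ suc n
    ≤⟨ *-monoʳ (0≤^ (suc n) 0≤1-h) (expSum-+-≤ N 0≤h (0≤* (0≤natℚ n) 0≤h)) ⟩
  expSum N h * expSum N (natℚ n * h) * ((1ℚ - h) * (1ℚ - h) ^ n)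
    ≡⟨ solve 4 (λ a b c d → a :* b :* (c :* d) := (a :* c) :* (b :* d)) refl (expSum N h) (expSum N (natℚ n * h)) (1ℚ - h) ((1ℚ - h) ^ n) ⟩
  expSum N h * (1ℚ - h) * (expSum N (natℚ n * h) * (1ℚ - h) ^ n)
    ≤⟨ *≤1 (0≤* (0≤expSum N 0≤h) 0≤1-h) (expSum-geometric N 0≤h h≤1) (0≤* (0≤expSum N (0≤* (0≤natℚ n) 0≤h)) (0≤^ n 0≤1-h)) (expSum-multiple N 0≤h h≤1 n) ⟩
  1ℚ ∎
  where
  open ≤-Reasoning
  0≤1-h = p≤q⇒0≤q-p h≤1

-- exp(-q) exp(q) is exp(0) up to the products outside the triangle. In absolute value these belong
-- to the part of the series of exp(2 q) between N and 2 N, which is small by the Cauchy property.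
expSum-inverse : ∀ q → 0ℚ ≤ q → ∀ δ → 0ℚ < δ → ∃ λ N₀ → ∀ N → N₀ ℕ.≤ N → 1ℚ - δ ≤ expSum N (- q) * expSum N q
expSum-inverse q 0≤q δ 0<δ = N₀ , λ N N₀≤N → lower (begin
  ∣ expSum N (- q) * expSum N q - 1ℚ ∣
    ≡⟨ cong₂ (λ p r → ∣ p - r ∣) (cong₂ _*_ (expSum≡sumTo N (- q)) (expSum≡sumTo N q))
         (trans (sym (expSum-0 N)) (trans (cong (expSum N) (sym (+-inverseˡ q))) (expSum-+ N (- q) q))) ⟩
  ∣ sumTo N (term (- q)) * sumTo N (term q) - tri N (term (- q)) (term q) ∣
    ≤⟨ product-tri N (λ i → ∣expTerm∣ i (≤-reflexive (trans (∣-p∣≡∣p∣ q) (0≤p⇒∣p∣≡p 0≤q)))) (λ i → ∣expTerm∣ i (≤-reflexive (0≤p⇒∣p∣≡p 0≤q))) ⟩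
  sumTo N (term q) * sumTo N (term q) - tri N (term q) (term q)
    ≤⟨ +-monoˡ-≤ (- tri N (term q) (term q)) (product≤tri N N (λ i → 0≤expTerm i 0≤q) (λ i → 0≤expTerm i 0≤q)) ⟩
  tri (N ℕ.+ N) (term q) (term q) - tri N (term q) (term q)
    ≡⟨ sym (cong₂ _-_ (expSum-+ (N ℕ.+ N) q q) (expSum-+ N q q)) ⟩
  expSum (N ℕ.+ N) (q + q) - expSum N (q + q)
    ≤⟨ ≤-trans (p≤∣p∣ _) (close (N ℕ.+ N) N (ℕ.≤-trans N₀≤N (ℕ.m≤m+n N N)) N₀≤N) ⟩
  δ ∎)
  where
  open ≤-Reasoning
  tail = cauchy (exp (fromℚ (q + q))) δ 0<δ
  N₀ = proj₁ tail
  close : ∀ m n → N₀ ℕ.≤ m → N₀ ℕ.≤ n → ∣ expSum m (q + q) - expSum n (q + q) ∣ ≤ δ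
  close = proj₂ tail
  lower : ∀ {p} → ∣ p - 1ℚ ∣ ≤ δ → 1ℚ - δ ≤ p
  lower {p} h = ≤-by (δ - (1ℚ - p)) (p≤q⇒0≤q-p (≤-trans (p≤∣p∣ (1ℚ - p)) (eq-≤ (∣∣-swap 1ℚ p) h)))
    (solve 2 (λ d p → p := (con 1ℚ :- d) :+ (d :- (con 1ℚ :- p))) refl δ p)

-- θ < 1 - h ≤ exp(-h) leaves the gap (1 - h)^n - θ^n. Half of it is the margin of the strict
-- inequality, the other half absorbs the error of `expSum-inverse`.
exp-lower : ∀ m (h θ : ℚ) → 0ℚ ≤ h → h ≤ 1ℚ → 0ℚ ≤ θ → θ < 1ℚ - h → fromℚ (θ ^ suc m) <ℝ exp (-ℝ (fromℚ h *ℝ fromℕ (suc m)))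
exp-lower m h θ 0≤h h≤1 0≤θ θ<1-h = ε , 0<ε , proj₁ inverse , λ N N₀≤N → bound N (proj₂ inverse N N₀≤N)
  where
  n = suc m
  u = (1ℚ - h) ^ n
  v = θ ^ n
  ε = half (u - v)
  0<ε : 0ℚ < ε
  0<ε = 0<half (p<q⇒0<q-p (^-mono-< m 0≤θ θ<1-h))
  0≤u : 0ℚ ≤ u
  0≤u = 0≤^ n (p≤q⇒0≤q-p h≤1)
  u≤1 : u ≤ 1ℚ
  u≤1 = ^≤1 n (p≤q⇒0≤q-p h≤1) (≤-by h 0≤h (solve 1 (λ h → con 1ℚ := (con 1ℚ :- h) :+ h) refl h))
  q = natℚ n * h
  0≤q = 0≤* (0≤natℚ n) 0≤h
  inverse = expSum-inverse q 0≤q ε 0<ε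
  bound : ∀ N → 1ℚ - ε ≤ expSum N (- q) * expSum N q → v + ε ≤ expSum N (- (h * natℚ n))
  bound N le = subst (λ z → v + ε ≤ expSum N (- z)) (*-comm (natℚ n) h) (begin
    v + ε
      ≡⟨ trans (cong (λ z → z + ε) (solve 2 (λ u v → v := u :- (u :- v)) refl u v)) (cong (λ z → u - z + ε) (sym (half+half (u - v)))) ⟩
    u - (ε + ε) + ε
      ≡⟨ solve 2 (λ u e → u :- (e :+ e) :+ e := u :- e :* con 1ℚ) refl u ε ⟩
    u - ε * 1ℚ
      ≤⟨ +-monoʳ-≤ u (neg-antimono-≤ (*-monoˡ (<⇒≤ 0<ε) u≤1)) ⟩
    u - ε * u
      ≡⟨ solve 2 (λ u e → u :- e :* u := (con 1ℚ :- e) :* u) refl u ε ⟩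
    (1ℚ - ε) * u
      ≤⟨ *-monoʳ 0≤u le ⟩
    A * B * u
      ≡⟨ *-assoc A B u ⟩
    A * (B * u)
      ≤⟨ *-monoˡ 0≤A (expSum-multiple N 0≤h h≤1 n) ⟩
    A * 1ℚ
      ≡⟨ *-identityʳ A ⟩
    A ∎)
    where
    open ≤-Reasoning
    A = expSum N (- q)
    B = expSum N q
    0≤1-ε : 0ℚ ≤ 1ℚ - ε
    0≤1-ε = p≤q⇒0≤q-p (≤-trans (*-monoˡ (0≤frac 1 1) (≤-by {u - v} {u} v (0≤^ n 0≤θ) (solve 2 (λ u v → u := (u :- v) :+ v) refl u v)))
      (≤-trans (*-monoˡ (0≤frac 1 1) u≤1) (≤-dec {(+ 1 / 2) * 1ℚ} {1ℚ})))
    0<B : 0ℚ < B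
    0<B = <-≤-trans 0<1 (1≤expSum N)
      where
      1≤expSum : ∀ N → 1ℚ ≤ expSum N q
      1≤expSum zero    = ≤-refl
      1≤expSum (suc N) = ≤-trans (1≤expSum N) (p≤p+q (expSum N q) (0≤expTerm (suc N) 0≤q))
    0≤A : 0ℚ ≤ A
    0≤A = *-cancelˡ 0<B (≤-trans (≤-reflexive (*-zeroʳ B)) (≤-trans (≤-trans 0≤1-ε le) (≤-reflexive (*-comm A B))))

-- Randomized protocols

seq-Σℝ : ∀ {n} (v : Fin n → ℝ) k → seq (Σℝ v) k ≡ ∑ (fins n) λ i → seq (v i) k
seq-Σℝ {zero}  v k = refl
seq-Σℝ {suc n} v k = cong (λ z → seq (v zero) k + z) (trans (seq-Σℝ (v ∘ suc) k) (sym (∑-map suc (fins n) λ i → seq (v i) k)))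

≲-∑ : ∀ {A : Set} (xs : List A) {z : A → ℕ → ℚ} → (∀ a → (λ _ → 0ℚ) ≲ z a) → (λ _ → 0ℚ) ≲ (λ k → ∑ xs λ a → z a k)
≲-∑ []       h = ≲-everywhere λ _ → ≤-refl
≲-∑ (x ∷ xs) {z} h ε 0<ε =
  let N , le = ≲-+ {λ _ → 0ℚ} {z x} {λ _ → 0ℚ} {λ k → ∑ xs λ a → z a k} (h x) (≲-∑ xs h) ε 0<ε
  in N , λ n N≤n → eq-≤ (sym (+-identityˡ 0ℚ)) (le n N≤n)

module _ (P : ProbabilitySpace) where

  open ProbabilitySpace P using (size; weight; nonneg; total)

  seq-𝔼 : ∀ (v : Outcome P → ℝ) k → seq (𝔼 P v) k ≡ ∑ (fins size) λ ω → seq (weight ω) k * seq (v ω) k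
  seq-𝔼 v = seq-Σℝ (λ ω → weight ω *ℝ v ω)

  𝔼-≲ : ∀ (v : Outcome P → ℝ) c → 0ℚ < c → (∀ ω → seq (v ω) ≲ (λ _ → c)) → seq (𝔼 P v) ≲ (λ _ → c)
  𝔼-≲ v c 0<c h = ≲-trans {seq (𝔼 P v)} {λ k → c * seq (Σℝ weight) k} {λ _ → c}
    (λ ε 0<ε → let N , le = slack ε 0<ε in N , λ k N≤k → move k ε (le k N≤k))
    (≲-trans {λ k → c * seq (Σℝ weight) k} {λ _ → c * 1ℚ} {λ _ → c} (≲-*ˡ {seq (Σℝ weight)} {λ _ → 1ℚ} c 0<c (≤ℝ⇒≲ {Σℝ weight} {1ℝ} (proj₁ total)))
      (≲-everywhere λ _ → ≤-reflexive (*-identityʳ c)))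
    where
    w : Outcome P → ℕ → ℚ
    w ω = seq (weight ω)
    gap : Outcome P → ℕ → ℚ
    gap ω k = c - seq (v ω) k
    slack : (λ _ → 0ℚ) ≲ (λ k → ∑ (fins size) λ ω → w ω k * gap ω k)
    slack = ≲-∑ (fins size) λ ω → ≲-* {w ω} {gap ω} (cauchy (weight ω)) (+-cauchy (λ _ → c) (λ k → - seq (v ω) k) (const-cauchy c) (neg-cauchy (seq (v ω)) (cauchy (v ω))))
      (≤ℝ⇒≲ {0ℝ} {weight ω} (nonneg ω)) λ ε 0<ε → let N , le = h ω ε 0<ε in N , λ k N≤k →
        ≤-trans (p≤q⇒0≤q-p (le k N≤k)) (≤-reflexive (solve 3 (λ c e v → c :+ e :- v := (c :- v) :+ e) refl c ε (seq (v ω) k)))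
    move : ∀ k ε → 0ℚ ≤ ∑ (fins size) (λ ω → w ω k * gap ω k) + ε → seq (𝔼 P v) k ≤ c * seq (Σℝ weight) k + ε
    move k ε le = ≤-by (∑ (fins size) (λ ω → w ω k * gap ω k) + ε) le (trans
      (cong (_+ ε) (trans (cong (c *_) (seq-Σℝ weight k)) (trans (sym (∑-*ˡ (fins size) c (λ ω → w ω k)))
        (trans (∑-cong (fins size) λ ω → solve 3 (λ c w v → c :* w := w :* v :+ w :* (c :- v)) refl c (w ω k) (seq (v ω) k))
          (trans (∑-+ (fins size) (λ ω → w ω k * seq (v ω) k) (λ ω → w ω k * gap ω k)) (cong (_+ ∑ (fins size) (λ ω → w ω k * gap ω k)) (sym (seq-𝔼 v k))))))))
      (+-assoc (seq (𝔼 P v) k) (∑ (fins size) (λ ω → w ω k * gap ω k)) ε))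

  𝔼-linear : ∀ {A : Set} (xs : List A) (μ : A → ℚ) (v : A → Outcome P → ℝ) (V : Outcome P → ℝ) k →
    (∀ ω → seq (V ω) k ≡ ∑ xs λ a → μ a * seq (v a ω) k) → seq (𝔼 P V) k ≡ ∑ xs λ a → μ a * seq (𝔼 P (v a)) k
  𝔼-linear xs μ v V k e = begin
    seq (𝔼 P V) k
      ≡⟨ seq-𝔼 V k ⟩
    ∑ (fins size) (λ ω → w ω * seq (V ω) k)
      ≡⟨ ∑-cong (fins size) (λ ω → trans (cong (w ω *_) (e ω)) (trans (sym (∑-*ˡ xs (w ω) (λ a → μ a * seq (v a ω) k)))
           (∑-cong xs λ a → solve 3 (λ w m v → w :* (m :* v) := m :* (w :* v)) refl (w ω) (μ a) (seq (v a ω) k)))) ⟩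
    ∑ (fins size) (λ ω → ∑ xs λ a → μ a * (w ω * seq (v a ω) k))
      ≡⟨ ∑-swap (fins size) xs (λ ω a → μ a * (w ω * seq (v a ω) k)) ⟩
    ∑ xs (λ a → ∑ (fins size) λ ω → μ a * (w ω * seq (v a ω) k))
      ≡⟨ ∑-cong xs (λ a → trans (∑-*ˡ (fins size) (μ a) (λ ω → w ω * seq (v a ω) k)) (cong (μ a *_) (sym (seq-𝔼 (v a) k)))) ⟩
    ∑ xs (λ a → μ a * seq (𝔼 P (v a)) k) ∎
    where
    open ≡-Reasoning
    w : Outcome P → ℚ
    w ω = seq (weight ω) k

map-inputs : ∀ {A B A′ B′ O r} → (A → A′) → (B → B′) → Tree A′ B′ O r → Tree A B O r
map-inputs f g (output o) = output o
map-inputs f g (bit q t)  = bit (q ∘ f) λ z → map-inputs f g (t z)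
map-inputs f g (end t)    = end (map-inputs g f t)

run-map-inputs : ∀ {A B A′ B′ O r} (f : A → A′) (g : B → B′) (t : Tree A′ B′ O r) a b → run (map-inputs f g t) a b ≡ run t (f a) (g b)
run-map-inputs f g (output o) a b = refl
run-map-inputs f g (bit q t)  a b = run-map-inputs f g (t (q (f a))) a b
run-map-inputs f g (end t)    a b = run-map-inputs g f t b a

bits-map-inputs : ∀ {A B A′ B′ O r} (f : A → A′) (g : B → B′) (t : Tree A′ B′ O r) a b → bits (map-inputs f g t) a b ≡ bits t (f a) (g b)
bits-map-inputs f g (output o) a b = refl
bits-map-inputs f g (bit q t)  a b = cong suc (bits-map-inputs f g (t (q (f a))) a b)
bits-map-inputs f g (end t)    a b = bits-map-inputs g f t b a

seq-indicator : ∀ b k → seq (indicator b) k ≡ ⟦ b ⟧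
seq-indicator true  k = refl
seq-indicator false k = refl

module _ {X Y O : Set} {r : ℕ} (eX : Enumerated X) (eY : Enumerated Y) (_≟ₒ_ : DecidableEquality O) (g : X → Y → O)
  (π : Protocol X Y O r) (c : ℚ) (0<c : 0ℚ < c) (d : ℝ) (c<d : fromℚ c <ℝ d)
  (d≤ : ∀ x y → d ≤ℝ 𝔼[_∣_,_] π (λ o → indicator (does (o ≟ₒ g x y))) x y)
  (μ : X → Y → ℚ) (0≤μ : ∀ x y → 0ℚ ≤ μ x y) (∑μ : ∑ (list eX) (λ x → ∑ (list eY) (μ x)) ≡ 1ℚ) where

  open Protocol π using (pub; privA; privB; tree)

  fix-randomness : Outcome pub → Outcome privA → Outcome privB → Tree X Y O r
  fix-randomness ω α β = map-inputs (_, α) (_, β) (tree ω)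

  private
    ps = list (Enumerated-× eX eY)

    value : Outcome pub → Outcome privA → Outcome privB → ℚ
    value ω α β = score eX eY μ _≟ₒ_ g (fix-randomness ω α β)

    correct : X × Y → Outcome pub → Outcome privA → Outcome privB → ℝ
    correct (x , y) ω α β = indicator (does (Protocol.result π x y ω α β ≟ₒ g x y))

    μ′ : X × Y → ℚ
    μ′ (x , y) = μ x y

    expected : X × Y → ℝ
    expected p = 𝔼 pub λ ω → 𝔼 privA λ α → 𝔼 privB λ β → correct p ω α β

    average : ℝ
    average = 𝔼 pub λ ω → 𝔼 privA λ α → 𝔼 privB λ β → fromℚ (value ω α β)

    average≡ : ∀ k → seq average k ≡ ∑ ps λ p → μ′ p * seq (expected p) k
    average≡ k = 𝔼-linear pub ps μ′ _ _ k λ ω → 𝔼-linear privA ps μ′ _ _ k λ α → 𝔼-linear privB ps μ′ _ _ k λ β →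
      sym (trans (∑-cartesian _,_ (list eX) (list eY) (λ p → μ′ p * seq (correct p ω α β) k)) (∑-cong (list eX) λ x → ∑-cong (list eY) λ y →
        cong (μ x y *_) (trans (seq-indicator (does (Protocol.result π x y ω α β ≟ₒ g x y)) k) (cong (λ o → ⟦ does (o ≟ₒ g x y) ⟧) (sym (run-map-inputs (_, α) (_, β) (tree ω) x y))))))

    d≲average : seq d ≲ seq average
    d≲average ε 0<ε = let N , le = slack ε 0<ε in N , λ k N≤k → move k (le k N≤k)
      where
      gap : X × Y → ℕ → ℚ
      gap p k = seq (expected p) k - seq d k
      0≲gap : ∀ p → (λ _ → 0ℚ) ≲ gap p
      0≲gap p@(x , y) ε 0<ε = let N , le = ≤ℝ⇒≲ {d} {expected p} (d≤ x y) ε 0<ε in N , λ k N≤k → ≤-trans (p≤q⇒0≤q-p (le k N≤k))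
        (≤-reflexive (solve 3 (λ v e d → v :+ e :- d := (v :- d) :+ e) refl (seq (expected p) k) ε (seq d k)))
      slack : (λ _ → 0ℚ) ≲ (λ k → ∑ ps λ p → μ′ p * gap p k)
      slack = ≲-∑ ps λ p → ≲-* {λ _ → μ′ p} {gap p} (const-cauchy (μ′ p))
        (+-cauchy (seq (expected p)) (λ k → - seq d k) (cauchy (expected p)) (neg-cauchy (seq d) (cauchy d)))
        (≲-everywhere λ _ → 0≤μ (proj₁ p) (proj₂ p)) (0≲gap p)
      move : ∀ k {ε} → 0ℚ ≤ ∑ ps (λ p → μ′ p * gap p k) + ε → seq d k ≤ seq average k + ε
      move k {ε} le = ≤-by (∑ ps (λ p → μ′ p * gap p k) + ε) le (trans (cong (_+ ε) (trans (average≡ k)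
        (trans (∑-cong ps λ p → solve 3 (λ m v d → m :* v := m :* d :+ m :* (v :- d)) refl (μ′ p) (seq (expected p) k) (seq d k))
          (trans (∑-+ ps (λ p → μ′ p * seq d k) (λ p → μ′ p * gap p k)) (cong (_+ ∑ ps (λ p → μ′ p * gap p k))
            (trans (∑-*ʳ ps (seq d k) μ′) (trans (cong (_* seq d k) (trans (∑-cartesian _,_ (list eX) (list eY) μ′) ∑μ)) (*-identityˡ (seq d k)))))))))
        (+-assoc (seq d k) (∑ ps (λ p → μ′ p * gap p k)) ε))

  -- Scores are rational, so a search through the finitely many coins decides whether c is attained.
  -- If it were not, the average score would be at most c, although it is at least d > c.
  derandomize : ∃ λ ω → ∃ λ α → ∃ λ β → c ≤ score eX eY μ _≟ₒ_ g (fix-randomness ω α β)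
  derandomize = by-cases (Fin.any? λ ω → Fin.any? λ α → Fin.any? λ β → ℚ._≤?_ c (value ω α β))
    where
    by-cases : Dec (∃ λ ω → ∃ λ α → ∃ λ β → c ≤ value ω α β) → ∃ λ ω → ∃ λ α → ∃ λ β → c ≤ value ω α β
    by-cases (yes found) = found
    by-cases (no none) = ⊥-elim (≲⇒≤ℝ {d} {fromℚ c} (≲-trans {seq d} {seq average} {λ _ → c} d≲average
      (𝔼-≲ pub _ c 0<c λ ω → 𝔼-≲ privA _ c 0<c λ α → 𝔼-≲ privB _ c 0<c λ β →
        ≲-everywhere λ _ → <⇒≤ (≰⇒> λ le → none (ω , α , β , le)))) c<d)

trivial : ProbabilitySpace
trivial = record
  { size = 1 ; weight = λ _ → 1ℝ ; nonneg = λ _ → ≲⇒≤ℝ {0ℝ} {1ℝ} (≲-everywhere λ _ → 0≤1)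
  ; total = ≲⇒≤ℝ {Σℝ {1} λ _ → 1ℝ} {1ℝ} (≲-everywhere λ _ → ≤-reflexive (+-identityʳ 1ℚ)) , ≲⇒≤ℝ {1ℝ} {Σℝ {1} λ _ → 1ℝ} (≲-everywhere λ _ → ≤-reflexive (sym (+-identityʳ 1ℚ))) }

∑-lookup : ∀ {A : Set} (as : List A) (f : A → ℚ) → ∑ (fins (List.length as)) (λ i → f (List.lookup as i)) ≡ ∑ as f
∑-lookup []       f = refl
∑-lookup (a ∷ as) f = cong (λ z → f a + z) (trans (∑-map suc (fins (List.length as)) λ i → f (List.lookup (a ∷ as) i)) (∑-lookup as f))

module _ {X Y : Set} {r : ℕ} (m : ℕ) (ts : List (Tree X Y Bool r)) (len : List.length ts ≡ suc m) where

  uniform : ProbabilitySpace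
  uniform = record
    { size = List.length ts ; weight = λ _ → fromℚ (1/suc m) ; nonneg = λ _ → ≲⇒≤ℝ {0ℝ} {fromℚ (1/suc m)} (≲-everywhere λ _ → 0≤1/suc m)
    ; total = ≲⇒≤ℝ {Σℝ w} {1ℝ} (≲-everywhere λ k → ≤-reflexive (sum k)) , ≲⇒≤ℝ {1ℝ} {Σℝ w} (≲-everywhere λ k → ≤-reflexive (sym (sum k))) }
    where
    w : Fin (List.length ts) → ℝ
    w _ = fromℚ (1/suc m)
    sum : ∀ k → seq (Σℝ w) k ≡ 1ℚ
    sum k = trans (seq-Σℝ w k) (trans (∑-const (fins (List.length ts)) (1/suc m))
      (trans (cong (λ n → natℚ n * 1/suc m) (trans (length-fins (List.length ts)) len)) (suc*1/suc m)))

  mixed : Protocol X Y Bool r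
  mixed = record { pub = uniform ; privA = trivial ; privB = trivial ; tree = λ ω → map-inputs proj₁ proj₁ (List.lookup ts ω) }

  -- The advantage is twice the probability of success minus 1, and 2 · 21/40 - 1 = 1/20.
  mixed-advantage : ∀ (f : X → Y → Bool) x y → (+ 21 / 40) * natℚ (suc m) ≤ ∑ ts (λ t → ⟦ does (run t x y ≟ f x y) ⟧) →
    fromℚ (+ 1 / 20) ≤ℝ 𝔼[_∣_,_] mixed (λ o → -1^ (o xor f x y)) x y
  mixed-advantage f x y h = ≲⇒≤ℝ {fromℚ (+ 1 / 20)} {𝔼[_∣_,_] mixed (λ o → -1^ (o xor f x y)) x y} (≲-everywhere λ k → ≤-trans
    (≤-trans (≤-reflexive (sym twice)) (+-monoˡ-≤ (- 1ℚ) (*-monoˡ (<⇒≤ 0<2) (*-monoˡ (0≤1/suc m) h)))) (≤-reflexive (sym (value k))))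
    where
    s : Tree X Y Bool r → ℚ
    s t = ⟦ does (run t x y ≟ f x y) ⟧
    twice : 2ℚ * (1/suc m * ((+ 21 / 40) * natℚ (suc m))) - 1ℚ ≡ + 1 / 20
    twice = trans (cong (_- 1ℚ) (solve 2 (λ i n → con 2ℚ :* (i :* (con (+ 21 / 40) :* n)) := con (+ 21 / 20) :* (n :* i)) refl (1/suc m) (natℚ (suc m))))
      (cong (λ z → (+ 21 / 20) * z - 1ℚ) (suc*1/suc m))
    sign : ∀ o b k → seq (-1^ (o xor b)) k ≡ 2ℚ * ⟦ does (o ≟ b) ⟧ - 1ℚ
    sign true  true  k = refl
    sign true  false k = refl
    sign false true  k = refl
    sign false false k = refl
    only : ∀ (v : Fin 1 → ℝ) k → seq (𝔼 trivial v) k ≡ seq (v zero) k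
    only v k = trans (seq-𝔼 trivial v k) (trans (+-identityʳ (1ℚ * seq (v zero) k)) (*-identityˡ (seq (v zero) k)))
    value : ∀ k → seq (𝔼[_∣_,_] mixed (λ o → -1^ (o xor f x y)) x y) k ≡ 2ℚ * (1/suc m * ∑ ts s) - 1ℚ
    value k = begin
      seq (𝔼[_∣_,_] mixed (λ o → -1^ (o xor f x y)) x y) k
        ≡⟨ seq-𝔼 uniform (λ ω → 𝔼 trivial λ α → 𝔼 trivial λ β → -1^ (o ω α β xor f x y)) k ⟩
      ∑ is (λ ω → 1/suc m * seq (𝔼 trivial λ α → 𝔼 trivial λ β → -1^ (o ω α β xor f x y)) k)
        ≡⟨ ∑-cong is (λ ω → trans (cong (1/suc m *_) (trans (only (λ α → 𝔼 trivial λ β → -1^ (o ω α β xor f x y)) k)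
             (trans (only (λ β → -1^ (o ω zero β xor f x y)) k) (trans (sign (o ω zero zero) (f x y) k)
               (cong (λ o → 2ℚ * ⟦ does (o ≟ f x y) ⟧ - 1ℚ) (run-map-inputs proj₁ proj₁ (List.lookup ts ω) (x , zero) (y , zero)))))))
             (rearrange (1/suc m) (s (List.lookup ts ω)))) ⟩
      ∑ is (λ ω → 2ℚ * (1/suc m * s (List.lookup ts ω)) - 1/suc m)
        ≡⟨ ∑-- is (λ ω → 2ℚ * (1/suc m * s (List.lookup ts ω))) (λ _ → 1/suc m) ⟩
      ∑ is (λ ω → 2ℚ * (1/suc m * s (List.lookup ts ω))) - ∑ is (λ _ → 1/suc m)
        ≡⟨ cong₂ _-_ (trans (∑-lookup ts (λ t → 2ℚ * (1/suc m * s t))) (trans (∑-*ˡ ts 2ℚ (λ t → 1/suc m * s t)) (cong (2ℚ *_) (∑-*ˡ ts (1/suc m) s))))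
             (trans (∑-const is (1/suc m)) (trans (cong (λ n → natℚ n * 1/suc m) (trans (length-fins (List.length ts)) len)) (suc*1/suc m))) ⟩
      2ℚ * (1/suc m * ∑ ts s) - 1ℚ ∎
      where
      open ≡-Reasoning
      is = fins (List.length ts)
      o : Fin (List.length ts) → Fin 1 → Fin 1 → Bool
      o ω α β = run (map-inputs proj₁ proj₁ (List.lookup ts ω)) (x , α) (y , β)
      rearrange : ∀ i b → i * (2ℚ * b - 1ℚ) ≡ 2ℚ * (i * b) - i
      rearrange = solve 2 (λ i b → i :* (con 2ℚ :* b :- con 1ℚ) := con 2ℚ :* (i :* b) :- i) refl

-- Choice of the parameters

-- The exponents are variables, lest their powers of 2 be unfolded.
module Parameters (r′ Λ ℓ a k s b : ℕ) (R<2^[1+ℓ] : suc r′ ℕ.< 2 ℕ.^ suc ℓ)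
  (a≡ : a ≡ 8 ℕ.+ ℓ) (k≡ : k ≡ 24 ℕ.+ (Λ ℕ.+ Λ)) (s≡ : s ≡ suc k ℕ.+ a) (b≡ : b ≡ s ℕ.+ a) where

  R : ℕ
  R = suc r′

  -- x bounds both losses of a round: no candidate in any list, and a rival candidate. The choice of
  -- s gives ζ (1 + K) ≤ x, that of b = s + a gives 2^b ζ = 2^a, and a = 8 + ℓ gives R x ≤ 2 / 2^8.
  x ζ K : ℚ
  x = inv (2ℚ ^ a)
  ζ = inv (2ℚ ^ s)
  K = 2ℚ ^ (12 ℕ.+ Λ) * 2ℚ ^ (12 ℕ.+ Λ)

  0<2^ : ∀ k → 0ℚ < 2ℚ ^ k
  0<2^ k = 0<^ k 0<2

  inv≤1 : ∀ k → inv (2ℚ ^ k) ≤ 1ℚ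
  inv≤1 k = *-cancelˡ (0<2^ k) (≤-trans (≤-reflexive (*-inv (0<2^ k))) (≤-trans (1≤^ k 1≤2) (≤-reflexive (sym (*-identityʳ (2ℚ ^ k))))))

  0≤ζ : 0ℚ ≤ ζ
  0≤ζ = <⇒≤ (0<inv (0<2^ s))

  0≤x : 0ℚ ≤ x
  0≤x = <⇒≤ (0<inv (0<2^ a))

  K≡ : K ≡ 2ℚ ^ k
  K≡ = trans (sym (^-+ 2ℚ (12 ℕ.+ Λ) (12 ℕ.+ Λ))) (cong (2ℚ ^_) (trans (solveℕ 1 (λ l → conℕ 12 :+ℕ l :+ℕ (conℕ 12 :+ℕ l) :=ℕ conℕ 24 :+ℕ (l :+ℕ l)) refl Λ) (sym k≡)))
    where open ℕ-Solver.+-*-Solver using () renaming (solve to solveℕ; _:+_ to _:+ℕ_; _:=_ to _:=ℕ_; con to conℕ)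

  ζ[1+K]≤x : ζ * (1ℚ + K) ≤ x
  ζ[1+K]≤x = *-cancelˡ (0<2^ a) (begin
    2ℚ ^ a * (ζ * (1ℚ + K))                              ≤⟨ *-monoˡ (<⇒≤ (0<2^ a)) (*-monoˡ 0≤ζ 1+K≤) ⟩
    2ℚ ^ a * (ζ * 2ℚ ^ (suc k))               ≡⟨ solve 3 (λ p z q → p :* (z :* q) := (q :* p) :* z) refl (2ℚ ^ a) ζ (2ℚ ^ (suc k)) ⟩
    2ℚ ^ (suc k) * 2ℚ ^ a * ζ                 ≡⟨ cong (_* ζ) (trans (sym (^-+ 2ℚ (suc k) a)) (cong (2ℚ ^_) (sym s≡))) ⟩
    2ℚ ^ s * ζ                                           ≡⟨ trans (*-inv (0<2^ s)) (sym (*-inv (0<2^ a))) ⟩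
    2ℚ ^ a * x                                           ∎)
    where
    open ≤-Reasoning
    1+K≤ : 1ℚ + K ≤ 2ℚ ^ (suc k)
    1+K≤ = begin
      1ℚ + K                           ≡⟨ cong (λ z → 1ℚ + z) K≡ ⟩
      1ℚ + 2ℚ ^ k     ≤⟨ +-monoˡ-≤ (2ℚ ^ k) (1≤^ k 1≤2) ⟩
      2ℚ ^ k + 2ℚ ^ k ≡⟨ solve 1 (λ p → p :+ p := con 2ℚ :* p) refl (2ℚ ^ k) ⟩
      2ℚ ^ (suc k)          ∎

  0≤κ : 0ℚ ≤ 1ℚ - ζ * (1ℚ + K)
  0≤κ = p≤q⇒0≤q-p (≤-trans ζ[1+K]≤x (inv≤1 a))

  geom≤x : geom ζ b ≤ x
  geom≤x = *-cancelˡ (0<2^ a) (begin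
    2ℚ ^ a * geom ζ b                          ≤⟨ *-monoʳ (0≤^ (2 ℕ.^ b) (p≤q⇒0≤q-p (inv≤1 s))) (p≤q+p (2ℚ ^ a) 0≤1) ⟩
    (1ℚ + 2ℚ ^ a) * geom ζ b                   ≡⟨ *-comm (1ℚ + 2ℚ ^ a) (geom ζ b) ⟩
    geom ζ b * (1ℚ + 2ℚ ^ a)                   ≡⟨ cong (λ z → geom ζ b * (1ℚ + z)) (sym 2^bζ) ⟩
    geom ζ b * (1ℚ + natℚ (2 ℕ.^ b) * ζ)       ≤⟨ geom-small ζ b 0≤ζ (inv≤1 s) ⟩
    1ℚ                                         ≡⟨ sym (*-inv (0<2^ a)) ⟩
    2ℚ ^ a * x                                 ∎)
    where
    open ≤-Reasoning
    2^bζ : natℚ (2 ℕ.^ b) * ζ ≡ 2ℚ ^ a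
    2^bζ = trans (cong (_* ζ) (trans (natℚ-^ 2 b) (trans (cong (2ℚ ^_) b≡) (^-+ 2ℚ s a)))) (trans (solve 3 (λ s a z → s :* a :* z := s :* z :* a) refl (2ℚ ^ s) (2ℚ ^ a) ζ)
      (trans (cong (_* 2ℚ ^ a) (*-inv (0<2^ s))) (*-identityˡ (2ℚ ^ a))))

  reliable : + 9 / 10 ≤ ((1ℚ - geom ζ b) * (1ℚ - ζ * (1ℚ + K))) ^ R
  reliable = begin
    + 9 / 10                                              ≤⟨ ≤-dec {+ 9 / 10} {1ℚ - 2ℚ * (2ℚ * inv (2ℚ ^ 8))} ⟩
    1ℚ - 2ℚ * (2ℚ * inv (2ℚ ^ 8))                         ≤⟨ +-monoʳ-≤ 1ℚ (neg-antimono-≤ (*-monoˡ (<⇒≤ 0<2) Rx)) ⟩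
    1ℚ - 2ℚ * (natℚ R * x)                                ≡⟨ solve 2 (λ n x → con 1ℚ :- con 2ℚ :* (n :* x) := con 1ℚ :+ n :* con 1ℚ :* ((con 1ℚ :- con 2ℚ :* x) :- con 1ℚ)) refl (natℚ R) x ⟩
    1ℚ + natℚ R * 1ℚ * ((1ℚ - 2ℚ * x) - 1ℚ)               ≡⟨ cong₂ (λ p q → p + natℚ R * q * ((1ℚ - 2ℚ * x) - 1ℚ)) (sym (1^ R)) (sym (1^ r′)) ⟩
    1ℚ ^ R + natℚ R * 1ℚ ^ r′ * ((1ℚ - 2ℚ * x) - 1ℚ)      ≤⟨ bernoulli r′ 0≤1 0≤1-2x ⟩
    (1ℚ - 2ℚ * x) ^ R                                     ≤⟨ ^-mono R 0≤1-2x (≤-trans (≤-by (x * x) (0≤sq x)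
                                                               (solve 1 (λ x → (con 1ℚ :- x) :* (con 1ℚ :- x) := (con 1ℚ :- con 2ℚ :* x) :+ x :* x) refl x))
                                                               (*-mono 0≤1-x (≤-trans 0≤1-x 1-x≤g) 1-x≤g (+-monoʳ-≤ 1ℚ (neg-antimono-≤ ζ[1+K]≤x)))) ⟩
    ((1ℚ - geom ζ b) * (1ℚ - ζ * (1ℚ + K))) ^ R           ∎
    where
    open ≤-Reasoning
    0≤1-x : 0ℚ ≤ 1ℚ - x
    0≤1-x = p≤q⇒0≤q-p (inv≤1 a)
    1-x≤g : 1ℚ - x ≤ 1ℚ - geom ζ b
    1-x≤g = +-monoʳ-≤ 1ℚ (neg-antimono-≤ geom≤x)
    x≡ : 2ℚ ^ ℓ * x ≡ inv (2ℚ ^ 8)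
    x≡ = *-≢0⇒≡ (0<2^ 8) (trans (sym (*-assoc (2ℚ ^ 8) (2ℚ ^ ℓ) x)) (trans (cong (_* x) (trans (sym (^-+ 2ℚ 8 ℓ)) (cong (2ℚ ^_) (sym a≡)))) (trans (*-inv (0<2^ a)) (sym (*-inv (0<2^ 8))))))
    Rx : natℚ R * x ≤ 2ℚ * inv (2ℚ ^ 8)
    Rx = ≤-trans (*-monoʳ 0≤x (≤-eq (natℚ-mono {R} {2 ℕ.^ suc ℓ} (ℕ.<⇒≤ R<2^[1+ℓ])) (natℚ-^ 2 (suc ℓ))))
      (≤-reflexive (trans (*-assoc 2ℚ (2ℚ ^ ℓ) x) (cong (2ℚ *_) x≡)))
    0≤1-2x : 0ℚ ≤ 1ℚ - 2ℚ * x
    0≤1-2x = p≤q⇒0≤q-p (≤-trans (*-monoˡ (<⇒≤ 0<2) (inv-anti (0<2^ 1) (^-monoʳ {2ℚ} {1} {a} 1≤2 (subst (1 ℕ.≤_) (sym a≡) (s≤s z≤n))))) (≤-dec {2ℚ * inv (2ℚ ^ 1)} {1ℚ}))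

  result : ∃ λ ζ → ∃ λ b → 0ℚ ≤ ζ × ζ ≤ 1ℚ × 0ℚ ≤ 1ℚ - ζ * (1ℚ + 2ℚ ^ (12 ℕ.+ Λ) * 2ℚ ^ (12 ℕ.+ Λ)) ×
    + 9 / 10 ≤ ((1ℚ - geom ζ b) * (1ℚ - ζ * (1ℚ + 2ℚ ^ (12 ℕ.+ Λ) * 2ℚ ^ (12 ℕ.+ Λ)))) ^ suc r′ × b ≡ 41 ℕ.+ 2 ℕ.* ℓ ℕ.+ 2 ℕ.* Λ
  result = ζ , b , 0≤ζ , inv≤1 s , 0≤κ , reliable , trans b≡ (trans (cong₂ ℕ._+_ (trans s≡ (cong₂ (λ k a → suc k ℕ.+ a) k≡ a≡)) a≡)
    (solveℕ 2 (λ Λ l → conℕ 25 :+ℕ (Λ :+ℕ Λ) :+ℕ (conℕ 8 :+ℕ l) :+ℕ (conℕ 8 :+ℕ l) :=ℕ conℕ 41 :+ℕ conℕ 2 :*ℕ l :+ℕ conℕ 2 :*ℕ Λ) refl Λ ℓ))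
    where open ℕ-Solver.+-*-Solver using () renaming (solve to solveℕ; _:+_ to _:+ℕ_; _:*_ to _:*ℕ_; _:=_ to _:=ℕ_; con to conℕ)

abstract

  parameters : ∀ r′ Λ → ∃ λ ζ → ∃ λ b → 0ℚ ≤ ζ × ζ ≤ 1ℚ × 0ℚ ≤ 1ℚ - ζ * (1ℚ + 2ℚ ^ (12 ℕ.+ Λ) * 2ℚ ^ (12 ℕ.+ Λ)) ×
    + 9 / 10 ≤ ((1ℚ - geom ζ b) * (1ℚ - ζ * (1ℚ + 2ℚ ^ (12 ℕ.+ Λ) * 2ℚ ^ (12 ℕ.+ Λ)))) ^ suc r′ × b ≡ 41 ℕ.+ 2 ℕ.* ⌊log₂ suc r′ ⌋ ℕ.+ 2 ℕ.* Λ
  parameters r′ Λ = Parameters.result r′ Λ ⌊log₂ suc r′ ⌋ (8 ℕ.+ ⌊log₂ suc r′ ⌋) (24 ℕ.+ (Λ ℕ.+ Λ))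
    (suc (24 ℕ.+ (Λ ℕ.+ Λ)) ℕ.+ (8 ℕ.+ ⌊log₂ suc r′ ⌋)) (suc (24 ℕ.+ (Λ ℕ.+ Λ)) ℕ.+ (8 ℕ.+ ⌊log₂ suc r′ ⌋) ℕ.+ (8 ℕ.+ ⌊log₂ suc r′ ⌋))
    (n<2^[1+⌊log₂n⌋] (suc r′)) refl refl refl refl

-- 25 b = 41025 + 50 ℓ + 10000 q. The last term is at most G + 2. As ℓ ≥ 1, the other two plus 4 are
-- at most 70000 ℓ, hence at most G + 2. So 25 b ≤ 2 G.
round-fits : ∀ G q Λ ℓ b → 10000 ℕ.* q ℕ.≤ 2 ℕ.+ G → 70000 ℕ.* ℓ ℕ.≤ 2 ℕ.+ G → 1 ℕ.≤ ℓ →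
  Λ ≡ 100 ℕ.* (suc q ℕ.+ suc q ℕ.+ 6) → b ≡ 41 ℕ.+ 2 ℕ.* ℓ ℕ.+ 2 ℕ.* Λ → b ℕ.≤ G
round-fits G q Λ ℓ b hq hℓ 1≤ℓ Λ≡ b≡ = natℚ-cancel-≤ {b} {G} (*-cancelˡ {natℚ 25} (natℚ-mono-< {0} {25} (s≤s z≤n))
  (core (natℚ ℓ) (natℚ q) (natℚ G) (natℚ Λ) (natℚ b)
    (natℚ-mono {1} {ℓ} 1≤ℓ) (≤-trans (eq-≤ (sym (natℚ-* 10000 q)) (natℚ-mono {10000 ℕ.* q} {2 ℕ.+ G} hq)) (≤-reflexive (natℚ-+ 2 G)))
    (≤-trans (eq-≤ (sym (natℚ-* 70000 ℓ)) (natℚ-mono {70000 ℕ.* ℓ} {2 ℕ.+ G} hℓ)) (≤-reflexive (natℚ-+ 2 G))) (0≤natℚ ℓ) (0≤natℚ G)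
    (trans (cong natℚ Λ≡) (trans (natℚ-* 100 (suc q ℕ.+ suc q ℕ.+ 6)) (cong (natℚ 100 *_) (trans (natℚ-+ (suc q ℕ.+ suc q) 6)
      (cong (_+ natℚ 6) (trans (natℚ-+ (suc q) (suc q)) (cong₂ _+_ (natℚ-suc q) (natℚ-suc q))))))))
    (trans (cong natℚ b≡) (trans (natℚ-+ (41 ℕ.+ 2 ℕ.* ℓ) (2 ℕ.* Λ)) (cong₂ _+_ (trans (natℚ-+ 41 (2 ℕ.* ℓ)) (cong (λ z → natℚ 41 + z) (natℚ-* 2 ℓ))) (natℚ-* 2 Λ))))))
  where
  core : ∀ L Q g Λ b → 1ℚ ≤ L → natℚ 10000 * Q ≤ 2ℚ + g → natℚ 70000 * L ≤ 2ℚ + g → 0ℚ ≤ L → 0ℚ ≤ g →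
    Λ ≡ natℚ 100 * (1ℚ + Q + (1ℚ + Q) + natℚ 6) → b ≡ natℚ 41 + natℚ 2 * L + natℚ 2 * Λ → natℚ 25 * b ≤ natℚ 25 * g
  core L Q g Λ b 1≤L hQ hL 0≤L 0≤g refl refl = ≤-by
    (natℚ 41029 * (L - 1ℚ) + (2ℚ + g - natℚ 10000 * Q) + (2ℚ + g - natℚ 70000 * L) + natℚ 28921 * L + natℚ 23 * g)
    (0≤+ (0≤+ (0≤+ (0≤+ (0≤* (0≤natℚ 41029) (p≤q⇒0≤q-p 1≤L)) (p≤q⇒0≤q-p hQ)) (p≤q⇒0≤q-p hL)) (0≤* (0≤natℚ 28921) 0≤L)) (0≤* (0≤natℚ 23) 0≤g))
    (solve 3 (λ l q g → con (natℚ 25) :* g :=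
      con (natℚ 25) :* (con (natℚ 41) :+ con (natℚ 2) :* l :+ con (natℚ 2) :* (con (natℚ 100) :* (con 1ℚ :+ q :+ (con 1ℚ :+ q) :+ con (natℚ 6)))) :+
      (con (natℚ 41029) :* (l :- con 1ℚ) :+ (con 2ℚ :+ g :- con (natℚ 10000) :* q) :+ (con 2ℚ :+ g :- con (natℚ 70000) :* l) :+ con (natℚ 28921) :* l :+ con (natℚ 23) :* g)) refl L Q g)

-- The direct product theorem

≲-const : ∀ {p q : ℚ} → (λ _ → p) ≲ (λ _ → q) → p ≤ q
≲-const {p} {q} h with ℚ._≤?_ p q
... | yes p≤q = p≤q
... | no p≰q = contradiction (q<p⇒ (p<q⇒0<q-p (≰⇒> p≰q))) (≲⇒≤ℝ {fromℚ p} {fromℚ q} h)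
  where
  q<p⇒ : 0ℚ < p - q → fromℚ q <ℝ fromℚ p
  q<p⇒ 0<p-q = p - q , 0<p-q , 0 , λ _ _ → ≤-reflexive (solve 2 (λ p q → q :+ (p :- q) := p) refl p q)

module _ {A : Set} {a : ℕ} (iso : A ↔ Fin a) where

  open Inverse iso using (to; from; strictlyInverseˡ; strictlyInverseʳ)

  to-injective : ∀ {x y} → to x ≡ to y → x ≡ y
  to-injective {x} {y} e = trans (sym (strictlyInverseʳ x)) (trans (cong from e) (strictlyInverseʳ y))

  from-injective : ∀ {i j} → from i ≡ from j → i ≡ j
  from-injective {i} {j} e = trans (sym (strictlyInverseˡ i)) (trans (cong to e) (strictlyInverseˡ j))

  finite : Enumerated A
  finite = record
    { dec = λ x y → Dec-map (to x Fin.≟ to y) ; list = map from (allFin a) ; unique = Unique.map⁺ from-injective (Unique.allFin⁺ a)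
    ; all = λ x → subst (_∈ map from (allFin a)) (strictlyInverseʳ x) (∈.∈-map⁺ from (∈.∈-allFin (to x))) }
    where
    Dec-map : ∀ {x y} → Dec (to x ≡ to y) → Dec (x ≡ y)
    Dec-map (yes e) = yes (to-injective e)
    Dec-map (no ¬e) = no (¬e ∘ cong to)

silent : ∀ {A B} r → Tree A B Bool r
silent zero    = output false
silent (suc r) = end (silent r)

bits-silent : ∀ {A B} r (a : A) (b : B) → bits (silent r) a b ≡ 0
bits-silent zero    a b = refl
bits-silent (suc r) a b = bits-silent r b a

-- π spends about q = κ₀ C / r bits per coordinate. With Λ about 200 q, a message of the simulation
-- takes about 400 q bits, and C / r are available; the factor 10000 leaves room for the constants.
κ₀ : ℚ
κ₀ = + 1 / 10000

θ : ℚ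
θ = (+ 99 / 100) * (+ 99 / 100)

0<θ : 0ℚ < θ
0<θ = does-true (ℚ._<?_ 0ℚ θ) refl

module _ {X Y : Set} (eX : Enumerated X) (eY : Enumerated Y) (f : X → Y → Bool) (r : ℕ) (C : ℝ) (adv≺κ : adv r C f ≺ fromℚ κ₀) where

  -- By the minimax theorem a uniform mixture of such trees would be right with probability 21/40 on
  -- every input. It costs at most c ≤ C bits, and its advantage 1/20 exceeds κ₀.
  no-trees : ∀ c → fromℕ c ≤ℝ C →
    ¬ (∀ μ → (∀ x y → 0ℚ ≤ μ x y) → ∑ (list eX) (λ x → ∑ (list eY) (μ x)) ≡ 1ℚ →
       Σ[ s ∈ Tree X Y Bool r ] (∀ x y → bits s x y ℕ.≤ c) × + 11 / 20 ≤ score eX eY μ _≟_ f s)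
  no-trees c c≤C answer = contradiction (≲-const {+ 1 / 20} {κ₀} (≲-trans {λ _ → + 1 / 20} {seq (proj₁ adv≺κ)} {λ _ → κ₀}
      (≤ℝ⇒≲ {fromℚ (+ 1 / 20)} {proj₁ adv≺κ} (proj₂ (proj₂ adv≺κ) (fromℚ (+ 1 / 20)) member))
      (<ℝ⇒≲ {proj₁ adv≺κ} {fromℚ κ₀} (proj₁ (proj₂ adv≺κ)))))
    (λ le → <-irrefl refl (<-≤-trans (does-true (ℚ._<?_ κ₀ (+ 1 / 20)) refl) le))
    where
    A : Set
    A = Σ[ s ∈ Tree X Y Bool r ] ∀ x y → bits s x y ℕ.≤ c
    correct : A → X × Y → Bool
    correct (s , _) (x , y) = does (run s x y ≟ f x y)
    answer′ : ∀ (μ : X × Y → ℚ) → (∀ p → 0ℚ ≤ μ p) → ∑ (list (Enumerated-× eX eY)) μ ≡ 1ℚ →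
      ∃ λ a → + 11 / 20 ≤ ∑ (list (Enumerated-× eX eY)) λ p → μ p * ⟦ correct a p ⟧
    answer′ μ 0≤μ ∑μ =
      let (s , small , good) = answer (λ x y → μ (x , y)) (λ x y → 0≤μ (x , y)) (trans (sym (∑-cartesian _,_ (list eX) (list eY) μ)) ∑μ)
      in (s , small) , ≤-trans good (≤-reflexive (sym (∑-cartesian _,_ (list eX) (list eY) (λ p → μ p * ⟦ correct (s , small) p ⟧))))
    a₀ : A
    a₀ = silent r , λ x y → ℕ.≤-trans (ℕ.≤-reflexive (bits-silent r x y)) z≤n
    mixture = Minimax.mixture (Enumerated-× eX eY) correct a₀ answer′
    m = proj₁ mixture
    as = proj₁ (proj₂ mixture)
    ts : List (Tree X Y Bool r)
    ts = map proj₁ as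
    len : List.length ts ≡ suc m
    len = trans (List.length-map proj₁ as) (proj₁ (proj₂ (proj₂ mixture)))
    short : ∀ (as : List A) → All (λ t → ∀ x y → bits t x y ℕ.≤ c) (map proj₁ as)
    short []             = []
    short ((_ , h) ∷ as) = h ∷ short as
    member : adv r C f (fromℚ (+ 1 / 20))
    member = (mixed m ts len , λ x y ω α β → ≲⇒≤ℝ {fromℕ (length (mixed m ts len) x y ω α β)} {C} (≲-trans {λ _ → natℚ (length (mixed m ts len) x y ω α β)} {λ _ → natℚ c} {seq C}
        (≲-everywhere λ _ → natℚ-mono {length (mixed m ts len) x y ω α β} {c} (ℕ.≤-trans
          (ℕ.≤-reflexive (bits-map-inputs proj₁ proj₁ (List.lookup ts ω) (x , α) (y , β))) (All.lookup (short as) (∈.∈-lookup ω) x y)))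
        (≤ℝ⇒≲ {fromℕ c} {C} c≤C))) ,
      λ (x , y) → mixed-advantage m ts len f x y (≤-trans (proj₂ (proj₂ (proj₂ mixture)) (x , y))
        (≤-reflexive (sym (∑-map proj₁ as λ t → ⟦ does (run t x y ≟ f x y) ⟧))))

∑-product-distribution : {X Y : Set} (eX : Enumerated X) (eY : Enumerated Y) (μ : X → Y → ℚ) → ∑ (list eX) (λ x → ∑ (list eY) (μ x)) ≡ 1ℚ →
  ∀ n → ∑ (vectors (list eX) n) (λ x → ∑ (vectors (list eY) n) λ y → ⨂ (replicate n μ) x y) ≡ 1ℚ
∑-product-distribution eX eY μ ∑μ n = trans (∑-⨂ (list eX) (list eY) (replicate n μ))
  (trans (∏-cong (fins n) λ i → trans (cong (λ p → ∑ (list eX) λ x → ∑ (list eY) λ y → p x y) (Vec.lookup-replicate i μ)) ∑μ) (∏-ones (fins n)))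
  where
  ∏-ones : {A : Set} (xs : List A) → ∏ xs (λ _ → 1ℚ) ≡ 1ℚ
  ∏-ones []       = refl
  ∏-ones (x ∷ xs) = trans (*-identityˡ _) (∏-ones xs)

0≤⨂ : {X Y : Set} {μ : X → Y → ℚ} → (∀ x y → 0ℚ ≤ μ x y) → ∀ {n} (x : Vec X n) (y : Vec Y n) → 0ℚ ≤ ⨂ (replicate n μ) x y
0≤⨂ 0≤μ []      []      = 0≤1
0≤⨂ 0≤μ (x ∷ xs) (y ∷ ys) = 0≤* (0≤μ x y) (0≤⨂ 0≤μ xs ys)

division : ∀ G → ∃ λ q → 10000 ℕ.* q ℕ.≤ G × G ℕ.≤ 10000 ℕ.* suc q
division G = q , ℕ.≤-trans (ℕ.≤-reflexive (ℕ.*-comm 10000 q)) (ℕ.m/n*n≤m G 10000) ,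
  ℕ.≤-trans (ℕ.≤-reflexive (ℕ.m≡m%n+[m/n]*n G 10000)) (ℕ.≤-trans (ℕ.+-monoˡ-≤ (q ℕ.* 10000) (ℕ.<⇒≤ (ℕ.m%n<n G 10000)))
    (ℕ.≤-reflexive (ℕ.*-comm (suc q) 10000)))
  where
  q = G ℕ./ 10000

module _ {X Y : Set} (eX : Enumerated X) (eY : Enumerated Y) (f : X → Y → Bool) (m r′ : ℕ) (C : ℝ)
  (h7 : fromℕ 7 *ℝ (fromℕ (suc r′) *ℝ log₂ (suc r′)) <ℝ fromℚ κ₀ *ℝ C) (adv≺κ : adv (suc r′) C f ≺ fromℚ κ₀)
  (π : Protocol (Vec X (suc m)) (Vec Y (suc m)) (Vec Bool (suc m)) (suc r′))
  (π-short : ‖ π ‖≤ (fromℚ κ₀ *ℝ C *ℝ fromℚ (+ 1 / suc r′) -ℝ log₂ (suc r′)) *ℝ fromℕ (suc m))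
  (d : ℝ) (θ<d : fromℚ (θ ^ suc m) <ℝ d)
  (d≤ : ∀ x y → d ≤ℝ 𝔼[_∣_,_] π (λ o → indicator (does (≡-dec _≟_ o ((f ^^ suc m) x y)))) x y) where

  private
    n r : ℕ
    n = suc m
    r = suc r′

    log : ℕ → ℚ
    log = seq (log₂ r)

    0<κ₀ : 0ℚ < κ₀
    0<κ₀ = does-true (ℚ._<?_ 0ℚ κ₀) refl

    ℓ : ℕ
    ℓ = ⌊log₂ r ⌋

    -- True of each approximation separately, since 2^ℓ ≤ r may be raised to the power k + 1.
    ℓ≤log : ∀ k → natℚ ℓ ≤ log k
    ℓ≤log k = frac-≤ ℓ 0 ⌊log₂ r ℕ.^ suc k ⌋ k (ℕ.≤-trans
      (subst (ℕ._≤ ⌊log₂ r ℕ.^ suc k ⌋) (⌊log₂[2^n]⌋≡n (ℓ ℕ.* suc k)) (⌊log₂⌋-mono-≤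
        (ℕ.≤-trans (ℕ.≤-reflexive (sym (ℕ.^-*-assoc 2 ℓ (suc k)))) (ℕ.^-monoˡ-≤ (suc k) (2^⌊log₂n⌋≤n r)))))
      (ℕ.≤-reflexive (sym (ℕ.*-identityʳ ⌊log₂ r ℕ.^ suc k ⌋))))

    rℓ≲C : (λ _ → natℚ 70000 * (natℚ r * natℚ ℓ)) ≲ seq C
    rℓ≲C = ≲-trans {λ _ → natℚ 70000 * (natℚ r * natℚ ℓ)} {λ k → natℚ 10000 * (κ₀ * seq C k)} {seq C}
      (≲-trans {λ _ → natℚ 70000 * (natℚ r * natℚ ℓ)} {λ k → natℚ 10000 * (natℚ 7 * (natℚ r * log k))} {λ k → natℚ 10000 * (κ₀ * seq C k)}
        (≲-everywhere λ k → ≤-trans (≤-reflexive (solve 1 (λ z → con (natℚ 70000) :* z := con (natℚ 10000) :* (con (natℚ 7) :* z)) refl (natℚ r * natℚ ℓ)))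
          (*-monoˡ (0≤natℚ 10000) (*-monoˡ (0≤natℚ 7) (*-monoˡ (0≤natℚ r) (ℓ≤log k)))))
        (≲-*ˡ {λ k → natℚ 7 * (natℚ r * log k)} {λ k → κ₀ * seq C k} (natℚ 10000) (natℚ-mono-< {0} {10000} (s≤s z≤n))
          (<ℝ⇒≲ {fromℕ 7 *ℝ (fromℕ r *ℝ log₂ r)} {fromℚ κ₀ *ℝ C} h7)))
      (≲-everywhere λ k → ≤-reflexive (solve 1 (λ z → con (natℚ 10000) :* (con κ₀ :* z) := z) refl (seq C k)))

    0≲C : (λ _ → 0ℚ) ≲ seq C
    0≲C = ≲-trans {λ _ → 0ℚ} {λ _ → natℚ 70000 * (natℚ r * natℚ ℓ)} {seq C}
      (≲-everywhere λ _ → 0≤* (0≤natℚ 70000) (0≤* (0≤natℚ r) (0≤natℚ ℓ))) rℓ≲C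

    -- log r is nonnegative, so π has at most κ₀ C n / r bits. The bound B for C makes this a
    -- comparison of rationals.
    budget : ∀ B → seq C ≲ (λ _ → B) → ∀ x y ω α β → natℚ (length π x y ω α β) ≤ κ₀ * (natℚ n * (1/suc r′ * B))
    budget B C≲B x y ω α β = ≲-const (≲-trans {λ _ → natℚ (length π x y ω α β)} {seq limit} {λ _ → κ₀ * (natℚ n * (1/suc r′ * B))}
      (≤ℝ⇒≲ {fromℕ (length π x y ω α β)} {limit} (π-short x y ω α β))
      (≲-trans {seq limit} {λ k → factor′ * seq C k} {λ _ → κ₀ * (natℚ n * (1/suc r′ * B))}
        (≲-everywhere λ k → ≤-by (log k * natℚ n) (0≤* (≤-trans (0≤natℚ ℓ) (ℓ≤log k)) (0≤natℚ n))
          (solve 5 (λ κ c i l n → κ :* (n :* i) :* c := (κ :* c :* i :- l) :* n :+ l :* n) refl κ₀ (seq C k) (1/suc r′) (log k) (natℚ n)))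
        (≲-trans {λ k → factor′ * seq C k} {λ _ → factor′ * B} {λ _ → κ₀ * (natℚ n * (1/suc r′ * B))}
          (≲-*ˡ {seq C} {λ _ → B} factor′ 0<factor C≲B)
          (≲-everywhere λ _ → ≤-reflexive (solve 4 (λ κ n i b → κ :* (n :* i) :* b := κ :* (n :* (i :* b))) refl κ₀ (natℚ n) (1/suc r′) B)))))
      where
      limit = (fromℚ κ₀ *ℝ C *ℝ fromℚ (1/suc r′) -ℝ log₂ r) *ℝ fromℕ n
      factor′ = κ₀ * (natℚ n * 1/suc r′)
      0<factor : 0ℚ < factor′
      0<factor = 0<* 0<κ₀ (0<* (natℚ-mono-< {0} {n} (s≤s z≤n)) (positive⁻¹ (1/suc r′) {{normalize-pos 1 (suc r′)}}))

    fixed : ∀ μ → (∀ x y → 0ℚ ≤ μ x y) → ∑ (list eX) (λ x → ∑ (list eY) (μ x)) ≡ 1ℚ → ∀ T → (∀ x y ω α β → length π x y ω α β ℕ.≤ T) →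
      Σ[ t ∈ Tree (Vec X n) (Vec Y n) (Vec Bool n) r ] (∀ x y → bits t x y ℕ.≤ T) ×
        θ ^ n ≤ score (Enumerated-Vec eX n) (Enumerated-Vec eY n) (⨂ (replicate n μ)) (≡-dec _≟_) (zipWith f) t
    fixed μ 0≤μ ∑μ T h =
      let (ω , α , β , good) = derandomize (Enumerated-Vec eX n) (Enumerated-Vec eY n) (≡-dec _≟_) (zipWith f) π (θ ^ n) (0<^ n 0<θ) d θ<d d≤
                                 (⨂ (replicate n μ)) (0≤⨂ 0≤μ) (∑-product-distribution eX eY μ ∑μ n)
      in map-inputs (_, α) (_, β) (Protocol.tree π ω) ,
         (λ x y → ℕ.≤-trans (ℕ.≤-reflexive (bits-map-inputs (_, α) (_, β) (Protocol.tree π ω) x y)) (h x y ω α β)) , good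

    -- Then C < 1 allows no communication at all, but π exchanges at most n / 2 bits,
    -- and guessing them turns π into a constant answer in each coordinate.
    C≮1 : r′ ≡ 0 → ¬ C <ℝ 1ℝ
    C≮1 refl C<1 = no-trees eX eY f r C adv≺κ 0 (≲⇒≤ℝ {fromℕ 0} {C} 0≲C) λ μ 0≤μ ∑μ →
      let (t , t-short , good) = fixed μ 0≤μ ∑μ ℕ.⌊ n /2⌋ few
          (z , better) = product-to-constant eX eY μ 0≤μ f m t ℕ.⌊ n /2⌋ t-short
            (ℕ.≤-trans (ℕ.+-monoʳ-≤ ℕ.⌊ n /2⌋ (ℕ.⌊n/2⌋≤⌈n/2⌉ n)) (ℕ.≤-reflexive (ℕ.⌊n/2⌋+⌈n/2⌉≡n n))) good
      in end (output z) , (λ _ _ → z≤n) , ≤-trans better (≤-reflexive (∑-cong (list eX) λ x → ∑-cong (list eY) λ y →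
           cong (λ b → μ x y * ⟦ b ⟧) (does-⇔ (f x y ≟ z) (z ≟ f x y) sym sym)))
      where
      few : ∀ x y ω α β → length π x y ω α β ℕ.≤ ℕ.⌊ n /2⌋
      few x y ω α β = ℕ.≤-trans (ℕ.≤-reflexive (ℕ.n≡⌊n+n/2⌋ L)) (ℕ.⌊n/2⌋-mono (natℚ-cancel-≤ {L ℕ.+ L} {n} (≤-trans (≤-reflexive (natℚ-+ L L))
        (≤-trans (+-mono-≤ L≤ L≤) (≤-by ((+ 9998 / 10000) * natℚ n) (0≤* (0≤frac 9998 9999) (0≤natℚ n))
          (solve 1 (λ n → n := (con κ₀ :* (n :* (con 1ℚ :* con 1ℚ)) :+ con κ₀ :* (n :* (con 1ℚ :* con 1ℚ))) :+ con (+ 9998 / 10000) :* n) refl (natℚ n)))))))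
        where
        L = length π x y ω α β
        L≤ : natℚ L ≤ κ₀ * (natℚ n * (1ℚ * 1ℚ))
        L≤ = budget 1ℚ (<ℝ⇒≲ {C} {1ℝ} C<1) x y ω α β

    -- The integer part of a real number is not computable. Approximating C to 1/4 and rounding the
    -- quotient by r brackets C between G r and (G + 2) r, where one of the two extra r pays for the
    -- error of 1/2.
    approximate : (λ _ → 1ℚ) ≲ seq C → ∃ λ G → (λ _ → natℚ (G ℕ.* r)) ≲ seq C × seq C ≲ (λ _ → natℚ ((2 ℕ.+ G) ℕ.* r))
    approximate 1≲C = G , ≲-trans {λ _ → natℚ (G ℕ.* r)} {λ _ → c - + 1 / 4} {seq C} (≲-everywhere λ _ → lower) c≲C ,
      ≲-trans {seq C} {λ _ → c + + 1 / 4} {λ _ → natℚ ((2 ℕ.+ G) ℕ.* r)} C≲c (≲-everywhere λ _ → upper)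
      where
      limit = cauchy C (+ 1 / 4) (does-true (ℚ._<?_ 0ℚ (+ 1 / 4)) refl)
      N = proj₁ limit
      c = seq C N
      c≲C : (λ _ → c - + 1 / 4) ≲ seq C
      c≲C ε 0<ε = N , λ k N≤k → ≤-trans (p≤q+r⇒p-q≤r {c} {+ 1 / 4} {seq C k} (≤-trans (≤-reflexive (solve 2 (λ c k → c := (c :- k) :+ k) refl c (seq C k)))
        (+-monoˡ-≤ (seq C k) (≤-trans (p≤∣p∣ (c - seq C k)) (proj₂ limit N k ℕ.≤-refl N≤k))))) (p≤p+q (seq C k) (<⇒≤ 0<ε))
      C≲c : seq C ≲ (λ _ → c + + 1 / 4)
      C≲c ε 0<ε = N , λ k N≤k → ≤-trans (≤-trans (≤-reflexive (solve 2 (λ c k → k := c :+ (k :- c)) refl c (seq C k)))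
        (+-monoʳ-≤ c (≤-trans (p≤∣p∣ (seq C k - c)) (proj₂ limit k N N≤k ℕ.≤-refl)))) (p≤p+q (c + + 1 / 4) (<⇒≤ 0<ε))
      1≤c+¼ : 1ℚ ≤ c + + 1 / 4
      1≤c+¼ = ≲-const (≲-trans {λ _ → 1ℚ} {seq C} {λ _ → c + + 1 / 4} 1≲C C≲c)
      0≤c-¼ : 0ℚ ≤ c - + 1 / 4
      0≤c-¼ = ≤-trans (0≤+ (p≤q⇒0≤q-p 1≤c+¼) (0≤frac 1 1)) (≤-reflexive (solve 1 (λ c → (c :+ con (+ 1 / 4) :- con 1ℚ) :+ con (+ 1 / 2) := c :- con (+ 1 / 4)) refl c))
      quotient = floorℕ (0≤* 0≤c-¼ (0≤1/suc r′))
      G = proj₁ quotient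
      multiply : ∀ z → z * 1/suc r′ * natℚ r ≡ z
      multiply z = trans (solve 3 (λ z i r → z :* i :* r := z :* (r :* i)) refl z (1/suc r′) (natℚ r)) (trans (cong (z *_) (suc*1/suc r′)) (*-identityʳ z))
      lower : natℚ (G ℕ.* r) ≤ c - + 1 / 4
      lower = ≤-trans (≤-reflexive (natℚ-* G r)) (≤-trans (*-monoʳ (0≤natℚ r) (proj₁ (proj₂ quotient))) (≤-reflexive (multiply (c - + 1 / 4))))
      upper : c + + 1 / 4 ≤ natℚ ((2 ℕ.+ G) ℕ.* r)
      upper = ≤-trans (≤-reflexive (solve 1 (λ c → c :+ con (+ 1 / 4) := (c :- con (+ 1 / 4)) :+ con (+ 1 / 2)) refl c))
        (≤-trans (+-mono-≤ (≤-trans (≤-reflexive (sym (multiply (c - + 1 / 4)))) (*-monoʳ (0≤natℚ r) (proj₂ (proj₂ quotient))))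
          (≤-trans (≤-dec {+ 1 / 2} {1ℚ}) (natℚ-mono {1} {r} (s≤s z≤n))))
        (≤-reflexive (sym (trans (natℚ-* (2 ℕ.+ G) r) (trans (cong (_* natℚ r) (natℚ-suc (suc G)))
          (solve 2 (λ g r → (con 1ℚ :+ g) :* r := g :* r :+ r) refl (natℚ (suc G)) (natℚ r)))))))

    C≱1 : ¬ (λ _ → 1ℚ) ≲ seq C
    C≱1 1≲C = no-trees eX eY f r C adv≺κ c c≤C λ μ 0≤μ ∑μ →
      let (t , t-short , good) = fixed μ 0≤μ ∑μ L few
          (ζ , b , 0≤ζ , ζ≤1 , 0≤κ , reliable , _) = params
      in product-to-single eX eY μ 0≤μ ∑μ f m r′ t L t-short good Λ many ζ b 0≤ζ ζ≤1 0≤κ reliable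
      where
      approx = approximate 1≲C
      G = proj₁ approx
      div = division (2 ℕ.+ G)
      q L Λ : ℕ
      q = proj₁ div
      L = suc q ℕ.* n
      Λ = 100 ℕ.* (suc q ℕ.+ suc q ℕ.+ 6)
      params = parameters r′ Λ
      c : ℕ
      c = r′ ℕ.* proj₁ (proj₂ params) ℕ.+ 1
      many : 100 ℕ.* (L ℕ.+ L ℕ.+ 6 ℕ.* n) ℕ.≤ Λ ℕ.* n
      many = ℕ.≤-reflexive (trans (cong (100 ℕ.*_) (trans (cong (ℕ._+ 6 ℕ.* n) (sym (ℕ.*-distribʳ-+ n (suc q) (suc q)))) (sym (ℕ.*-distribʳ-+ n (suc q ℕ.+ suc q) 6))))
        (sym (ℕ.*-assoc 100 (suc q ℕ.+ suc q ℕ.+ 6) n)))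
      few : ∀ x y ω α β → length π x y ω α β ℕ.≤ L
      few x y ω α β = natℚ-cancel-≤ {length π x y ω α β} {L} (≤-trans (budget (natℚ ((2 ℕ.+ G) ℕ.* r)) (proj₂ (proj₂ approx)) x y ω α β)
        (≤-trans (≤-reflexive (cong (λ z → κ₀ * (natℚ n * z)) (trans (cong (1/suc r′ *_) (natℚ-* (2 ℕ.+ G) r))
            (trans (solve 3 (λ i g r → i :* (g :* r) := g :* (r :* i)) refl (1/suc r′) (natℚ (2 ℕ.+ G)) (natℚ r))
              (trans (cong (natℚ (2 ℕ.+ G) *_) (suc*1/suc r′)) (*-identityʳ (natℚ (2 ℕ.+ G))))))))
        (≤-trans (*-monoˡ (<⇒≤ 0<κ₀) (*-monoˡ (0≤natℚ n) (≤-eq (natℚ-mono {2 ℕ.+ G} {10000 ℕ.* suc q} (proj₂ (proj₂ div))) (natℚ-* 10000 (suc q)))))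
          (≤-reflexive (trans (solve 2 (λ n q → con κ₀ :* (n :* (con (natℚ 10000) :* q)) := q :* n) refl (natℚ n) (natℚ (suc q))) (sym (natℚ-* (suc q) n)))))))
      c≤C : fromℕ c ≤ℝ C
      c≤C = ≲⇒≤ℝ {fromℕ c} {C} (by-rounds r′ refl)
        where
        by-rounds : ∀ r″ → r″ ≡ r′ → (λ _ → natℚ (r″ ℕ.* proj₁ (proj₂ params) ℕ.+ 1)) ≲ seq C
        -- With one round the simulation sends the output bit only.
        by-rounds zero    e = 1≲C
        -- r′ b + 1 ≤ r′ G + G = G r, the output bit being charged to the last round.
        by-rounds (suc k) e = ≲-trans {λ _ → natℚ (suc k ℕ.* b ℕ.+ 1)} {λ _ → natℚ (G ℕ.* r)} {seq C}
          (≲-everywhere λ _ → natℚ-mono {suc k ℕ.* b ℕ.+ 1} {G ℕ.* r} (ℕ.≤-trans (ℕ.+-mono-≤ (ℕ.*-monoʳ-≤ (suc k) b≤G) 1≤G)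
            (ℕ.≤-reflexive (trans (cong (λ z → z ℕ.* G ℕ.+ G) e) (trans (ℕ.+-comm (r′ ℕ.* G) G) (ℕ.*-comm r G))))))
          (proj₁ (proj₂ approx))
          where
          b = proj₁ (proj₂ params)
          b≡ = proj₂ (proj₂ (proj₂ (proj₂ (proj₂ (proj₂ params)))))
          1≤ℓ : 1 ℕ.≤ ℓ
          1≤ℓ = ⌊log₂⌋-mono-≤ {2} {r} (s≤s (subst (1 ℕ.≤_) e (s≤s z≤n)))
          ℓ≤ : 70000 ℕ.* ℓ ℕ.≤ 2 ℕ.+ G
          ℓ≤ = natℚ-cancel-≤ {70000 ℕ.* ℓ} {2 ℕ.+ G} (*-cancelˡ {natℚ r} (natℚ-mono-< {0} {r} (s≤s z≤n)) (≤-trans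
            (≤-reflexive (trans (cong (natℚ r *_) (natℚ-* 70000 ℓ)) (solve 2 (λ r l → r :* (con (natℚ 70000) :* l) := con (natℚ 70000) :* (r :* l)) refl (natℚ r) (natℚ ℓ))))
            (≤-trans (≲-const (≲-trans {λ _ → natℚ 70000 * (natℚ r * natℚ ℓ)} {seq C} {λ _ → natℚ ((2 ℕ.+ G) ℕ.* r)} rℓ≲C (proj₂ (proj₂ approx))))
              (≤-reflexive (trans (natℚ-* (2 ℕ.+ G) r) (*-comm (natℚ (2 ℕ.+ G)) (natℚ r)))))))
          b≤G : b ℕ.≤ G
          b≤G = round-fits G q Λ ℓ b (proj₁ (proj₂ div)) ℓ≤ 1≤ℓ refl b≡
          1≤G : 1 ℕ.≤ G
          1≤G = ℕ.≤-trans (subst (1 ℕ.≤_) (sym b≡) (s≤s z≤n)) b≤G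

  impossible : ⊥
  impossible = by-rounds r′ refl
    where
    by-rounds : ∀ k → k ≡ r′ → ⊥
    -- `_≤ℝ_` being a negation, `C≮1` is already 1 ≤ C, without any decision about the real number
    -- C.
    by-rounds zero e = C≱1 (≤ℝ⇒≲ {1ℝ} {C} (C≮1 (sym e)))
    -- From two rounds on, ℓ ≥ 1, and the lower bound for C gives C ≥ 70000 r ℓ ≥ 1.
    by-rounds (suc k) e = C≱1 (≲-trans {λ _ → 1ℚ} {λ _ → natℚ 70000 * (natℚ r * natℚ ℓ)} {seq C}
      (≲-everywhere λ _ → ≤-trans (≤-dec {1ℚ} {natℚ 70000 * (1ℚ * 1ℚ)}) (*-monoˡ (0≤natℚ 70000)
        (*-mono {1ℚ} {natℚ r} {1ℚ} {natℚ ℓ} 0≤1 (0≤natℚ r) (natℚ-mono {1} {r} (s≤s z≤n))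
          (natℚ-mono {1} {ℓ} (⌊log₂⌋-mono-≤ {2} {r} (s≤s (subst (1 ℕ.≤_) e (s≤s z≤n)))))))) rℓ≲C)

corollary18 :
    ∃ λ (κ : ℝ) → 0ℝ <ℝ κ ×
      ((X Y : Set) (a b : ℕ) → X ↔ Fin a → Y ↔ Fin b →
       (f : X → Y → Bool) (n r : ℕ) .{{_ : NonZero n}} .{{_ : NonZero r}} (C : ℝ) →
       fromℕ 7 *ℝ (fromℕ r *ℝ log₂ r) <ℝ κ *ℝ C →
       adv r C f ≺ κ →
       suc-prob r ((κ *ℝ C *ℝ fromℚ (+ 1 / r) -ℝ log₂ r) *ℝ fromℕ n) (≡-dec _≟_) (f ^^ n)
         ≺ exp (-ℝ (κ *ℝ fromℕ n)))
corollary18 = fromℚ κ₀ , (κ₀ , does-true (ℚ._<?_ 0ℚ κ₀) refl , 0 , λ _ _ → ≤-reflexive (+-identityˡ κ₀)) , λ where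
  X Y a b X↔ Y↔ f zero    r {{n≢0}} C h7 adv≺κ → contradiction (ℕ.>-nonZero⁻¹ 0 {{n≢0}}) λ ()
  X Y a b X↔ Y↔ f (suc m) zero {{_}} {{r≢0}} C h7 adv≺κ → contradiction (ℕ.>-nonZero⁻¹ 0 {{r≢0}}) λ ()
  X Y a b X↔ Y↔ f (suc m) (suc r′) C h7 adv≺κ →
    -- θ^n separates the two sides: no protocol exceeds it, and θ < 1 - κ₀ ≤ exp(-κ₀).
    fromℚ (θ ^ suc m) ,
    exp-lower m κ₀ θ (≤-dec {0ℚ} {κ₀}) (≤-dec {κ₀} {1ℚ}) (<⇒≤ 0<θ) (does-true (ℚ._<?_ θ (1ℚ - κ₀)) refl) ,
    λ d ((π , π-short) , d≤) θ<d → impossible (finite X↔) (finite Y↔) f m r′ C h7 adv≺κ π π-short d θ<d λ x y → d≤ (x , y)
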